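{- The systems $\mathbf{TTL}$ and $\mathbf{ITTL}$ are decidable: there is an algorithm which, given a classical (respectively, intuitionistic) tensor sequent, decides whether it is derivable in $\mathbf{TTL}$ (respectively, in $\mathbf{ITTL}$).
   Context: Classical tensor language. Fix an infinite set $\mathit{Ind}$ of indices and a set $\mathit{Lit}_+$ of positive literals, each $p\in\mathit{Lit}_+$ having a valency $v(p)\in\mathbb N^2$. Put $\mathit{Lit}_-=\{\overline p\mid p\in\mathit{Lit}_+\}$, $\overline{\overline p}=p$, $\mathit{Lit}=\mathit{Lit}_+\cup\mathit{Lit}_-$, $\mathit{Prop}=\mathit{Lit}\cup\{\mathbf 1,\bot\}$, with $v(\overline p)=(m,n)$ if $v(p)=(n,m)$, $v(\mathbf 1)=v(\bot)=(1,1)$, $\overline{\mathbf 1}=\bot$, $\overline{\bot}=\mathbf 1$. Atomic formulas are the expressions $p^{i_1\ldots i_m}_{j_1\ldots j_n}$ with $p\in\mathit{Prop}$, $v(p)=(m,n)$ and pairwise distinct indices. (Classical tensor) formulas are built from atomic ones by the binary connectives $\otimes,\wp$, subject to the condition that any index has at most one upper and at most one lower occurrence in the formula. Duality: $\overline{p^{i_1\ldots i_m}_{j_1\ldots j_n}}=\overline p^{\,j_n\ldots j_1}_{\,i_m\ldots i_1}$, $\overline{A\otimes B}=\overline B\wp\overline A$, $\overline{A\wp B}=\overline B\otimes\overline A$. An index of a formula is free if it occurs exactly once, otherwise bound. $FI^\bullet(A)$, $FI_\bullet(A)$ are the sets of free upper, respectively lower, indices of $A$. $A^{[i/j]}$ (respectively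 $A_{[i/j]}$) is $A$ with $i$ substituted for the free upper (respectively lower) occurrence of $j$; it is implicitly assumed that $i$ does not occur in $A$. A (classical tensor) context is a finite unordered multiset $\Gamma$ of formulas such that $FI^\bullet(A)\cap FI^\bullet(B)=FI_\bullet(A)\cap FI_\bullet(B)=\emptyset$ for any two distinct occurrences $A,B$ in $\Gamma$; $FI^\bullet(\Gamma)$, $FI_\bullet(\Gamma)$ are the unions over formulas of $\Gamma$. A (classical tensor) sequent is $\vdash\Gamma$ where $\Gamma$ is a context with $FI^\bullet(\Gamma)=FI_\bullet(\Gamma)$. Rules of $\mathbf{TTL}$ (all expressions are required to be well-formed sequents): (Id) $\vdash\overline A,A$ for $A$ atomic; (Cut) from $\vdash\Gamma,A$ and $\vdash\overline A,\Delta$ infer $\vdash\Gamma,\Delta$; ($\otimes$) from $\vdash\Gamma,A$ and $\vdash B,\Delta$ infer $\vdash\Gamma,A\otimes B,\Delta$; ($\wp$) from $\vdash\Gamma,A,B$ infer $\vdash\Gamma,A\wp B$; ($\bot^\to$) from $\vdash\Gamma,A$ with $j\in FI^\bullet(A)$ infer $\vdash\Gamma,\bot^j_i,A^{[i/j]}$; ($\bot_\leftarrow$) from $\vdash\Gamma,A,\bot^j_i$ with $j\in FI_\bullet(A)$ infer $\vdash\Gamma,A_{[i/j]}$; in the last two rules $i\notin FI^\bullet(A)\cup FI_\bullet(A)$. Intuitionistic tensor language over a set $\mathit{Lit}$ of literals with valencies. Formulas are built from atomic formulas $p^{i_1\ldots i_m}_{j_1\ldots j_n}$, $p\in\mathit{Lit}\cup\{\mathbf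 1\}$, $v(p)=(m,n)$, $v(\mathbf 1)=(1,1)$ (indices pairwise distinct), by $\otimes$ and $\multimap$. Polarity of index occurrences: in atomic formulas upper indices have upper polarity and lower indices lower polarity; $\otimes$ preserves polarities; in $A\multimap B$ polarities of occurrences in $B$ are preserved and those in $A$ are reversed. A formula must have at most one upper polarity and at most one lower polarity occurrence of any index. An index of an intuitionistic formula is free if it occurs exactly once, otherwise bound; $FI^\bullet(A)$, $FI_\bullet(A)$ are the sets of free indices of $A$ whose occurrence has upper, respectively lower, polarity; $A^{[i/j]}$ (respectively $A_{[i/j]}$) is $A$ with $i$ substituted for the free upper polarity (respectively lower polarity) occurrence of $j$, where it is implicitly assumed that $i$ does not occur in $A$. Intuitionistic contexts are finite multisets $\Gamma$ of intuitionistic formulas such that $FI^\bullet(A)\cap FI^\bullet(B)=FI_\bullet(A)\cap FI_\bullet(B)=\emptyset$ for any two distinct occurrences $A,B$ in $\Gamma$; $FI^\bullet(\Gamma)$, $FI_\bullet(\Gamma)$ are the unions over formulas of $\Gamma$. An intuitionistic sequent is $\Gamma\vdash A$ with $FI^\bullet(\Gamma)\cap FI_\bullet(A)=FI_\bullet(\Gamma)\cap FI^\bullet(A)=\emptyset$ and $FI^\bullet(\Gamma)\cup FI_\bullet(A)=FI_\bullet(\Gamma)\cup FI^\bullet(A)$. Rules of $\mathbf{ITTL}$ (all expressions are required to be well-formed sequents): (Id) $A\vdash A$ for $A$ atomic; (Cut) from $\Gamma\vdash A$ and $A,\Delta\vdash B$ infer $\Gamma,\Delta\vdash B$; (L$\multimap$)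 from $\Gamma\vdash A$ and $B,\Delta\vdash C$ infer $\Gamma,A\multimap B,\Delta\vdash C$; (R$\multimap$) from $\Gamma,A\vdash B$ infer $\Gamma\vdash A\multimap B$; (L$\otimes$) from $\Gamma,A,B\vdash C$ infer $\Gamma,A\otimes B\vdash C$; (R$\otimes$) from $\Gamma\vdash A$ and $\Delta\vdash B$ infer $\Gamma,\Delta\vdash A\otimes B$; (L$1_\to$) from $\Gamma,A\vdash B$, $j\in FI_\bullet(A)$, infer $\Gamma,A_{[i/j]},\mathbf 1^i_j\vdash B$; (R$1^\to$) from $\Gamma\vdash A$, $j\in FI^\bullet(A)$, infer $\mathbf 1^i_j,\Gamma\vdash A^{[i/j]}$; (L$1^\leftarrow$) from $\Gamma,\mathbf 1^i_j,A\vdash B$, $j\in FI^\bullet(A)$, infer $\Gamma,A^{[i/j]}\vdash B$; (R$1_\leftarrow$) from $\Gamma,\mathbf 1^i_j\vdash A$, $j\in FI_\bullet(A)$, infer $\Gamma\vdash A_{[i/j]}$; in the last four rules $i\notin FI^\bullet(A)\cup FI_\bullet(A)$. -}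

module Defs where

open import Data.Bool using (if_then_else_)
open import Data.List using (List; []; _∷_; _++_; [_]; filter; length)
open import Data.List.Membership.Propositional using (_∈_; _∉_)
open import Data.List.Relation.Binary.Permutation.Propositional using (_↭_)
open import Data.List.Relation.Unary.All using (All)
open import Data.List.Relation.Unary.AllPairs using (AllPairs)
open import Data.List.Relation.Unary.Any using (Any)
open import Data.List.Relation.Unary.Unique.Propositional using (Unique)
open import Data.Nat using (ℕ)
open import Data.Product using (_×_; _,_; proj₁; proj₂; swap)
open import Data.Vec as Vec using (Vec; toList; reverse)
open import Function.Bundles using (_↣_)
open import Level using (0ℓ)
open import Relation.Binary.Definitions using (DecidableEquality)
open import Relation.Binary.PropositionalEquality using (_≡_)
open import Relation.Nullary using (does)
open import Relation.Unary using (Pred; Empty; _∩_; _∪_; _≐_)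

-- The field Lit plays the role of the positive literals Lit₊ in the classical
-- language and of all literals in the intuitionistic one.  Decidable equality
-- of indices and of literals is what it means for the symbols to be available
-- to an algorithm at all (⊢ p̄ , q is derivable for atoms with the same
-- indices only if p and q are the same literal).
record Vocabulary : Set₁ where
  field
    Ind      : Set
    _≟ᵢ_     : DecidableEquality Ind
    infinite : ℕ ↣ Ind
    Lit      : Set
    _≟ₗ_     : DecidableEquality Lit
    valency  : Lit → ℕ × ℕ

-- The notions that depend only on the list of upper (polarity) and the list of
-- lower (polarity) index occurrences of an expression.
module Indexed {Ind Expr : Set} (_≟ᵢ_ : DecidableEquality Ind)
               (upper lower : Expr → List Ind)
               (AtomsDistinct : Expr → Set) where

  occurrences : Expr → List Ind
  occurrences A = upper A ++ lower A

  IsFormula : Expr → Set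
  IsFormula A = AtomsDistinct A × Unique (upper A) × Unique (lower A)

  Free : Expr → Pred Ind 0ℓ
  Free A i = length (filter (i ≟ᵢ_) (occurrences A)) ≡ 1

  FI↑ FI↓ : Expr → Pred Ind 0ℓ
  FI↑ A i = Free A i × i ∈ upper A
  FI↓ A i = Free A i × i ∈ lower A

  FI↑* FI↓* : List Expr → Pred Ind 0ℓ
  FI↑* Γ i = Any (λ A → FI↑ A i) Γ
  FI↓* Γ i = Any (λ A → FI↓ A i) Γ

  Compatible : Expr → Expr → Set
  Compatible A B = Empty (FI↑ A ∩ FI↑ B) × Empty (FI↓ A ∩ FI↓ B)

  -- AllPairs ranges over pairs of distinct positions, that is, over pairs of
  -- distinct occurrences in the multiset.
  IsContext : List Expr → Set
  IsContext Γ = All IsFormula Γ × AllPairs Compatible Γ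

  -- i replaces every occurrence of j; when j is free there is only one.
  replace : Ind → Ind → Ind → Ind
  replace i j k = if does (k ≟ᵢ j) then i else k

-- In both calculi multisets are lists with an exchange rule, every rule
-- requires its conclusion to be a well-formed sequent, and the convention that
-- i does not occur in A whenever A [ i / j ] is written appears as the premise
-- i ∉ occurrences A.  This premise subsumes the side condition that i is not a
-- free index of A.

module TTL (V : Vocabulary) where
  open Vocabulary V

  data Symbol : Set where
    pos neg : Lit → Symbol
    𝟏 ⊥     : Symbol

  v : Symbol → ℕ × ℕ
  v (pos p) = valency p
  v (neg p) = swap (valency p)
  v 𝟏       = 1 , 1
  v ⊥       = 1 , 1

  infixr 7 _⊗_
  infixr 6 _⅋_

  -- Expressions; the condition on index occurrences is IsFormula.
  -- atom p us ls has the upper indices us and the lower indices ls.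
  data Expr : Set where
    atom : (p : Symbol) → Vec Ind (proj₁ (v p)) → Vec Ind (proj₂ (v p)) → Expr
    _⊗_  : Expr → Expr → Expr
    _⅋_  : Expr → Expr → Expr

  upper lower : Expr → List Ind
  upper (atom p us ls) = toList us
  upper (A ⊗ B)        = upper A ++ upper B
  upper (A ⅋ B)        = upper A ++ upper B
  lower (atom p us ls) = toList ls
  lower (A ⊗ B)        = lower A ++ lower B
  lower (A ⅋ B)        = lower A ++ lower B

  AtomsDistinct : Expr → Set
  AtomsDistinct (atom p us ls) = Unique (toList us ++ toList ls)
  AtomsDistinct (A ⊗ B)        = AtomsDistinct A × AtomsDistinct B
  AtomsDistinct (A ⅋ B)        = AtomsDistinct A × AtomsDistinct B

  open Indexed _≟ᵢ_ upper lower AtomsDistinct public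

  IsSequent : List Expr → Set
  IsSequent Γ = IsContext Γ × FI↑* Γ ≐ FI↓* Γ

  dual : Expr → Expr
  dual (atom (pos p) us ls) = atom (neg p) (reverse ls) (reverse us)
  dual (atom (neg p) us ls) = atom (pos p) (reverse ls) (reverse us)
  dual (atom 𝟏 us ls)       = atom ⊥ (reverse ls) (reverse us)
  dual (atom ⊥ us ls)       = atom 𝟏 (reverse ls) (reverse us)
  dual (A ⊗ B)              = dual B ⅋ dual A
  dual (A ⅋ B)              = dual B ⊗ dual A

  infix 8 _[_/_]↑ _[_/_]↓

  _[_/_]↑ _[_/_]↓ : Expr → Ind → Ind → Expr
  atom p us ls [ i / j ]↑ = atom p (Vec.map (replace i j) us) ls
  (A ⊗ B)      [ i / j ]↑ = A [ i / j ]↑ ⊗ B [ i / j ]↑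
  (A ⅋ B)      [ i / j ]↑ = A [ i / j ]↑ ⅋ B [ i / j ]↑
  atom p us ls [ i / j ]↓ = atom p us (Vec.map (replace i j) ls)
  (A ⊗ B)      [ i / j ]↓ = A [ i / j ]↓ ⊗ B [ i / j ]↓
  (A ⅋ B)      [ i / j ]↓ = A [ i / j ]↓ ⅋ B [ i / j ]↓

  -- ⊥⟨ j / i ⟩ has the upper index j and the lower index i.
  ⊥⟨_/_⟩ : Ind → Ind → Expr
  ⊥⟨ j / i ⟩ = atom ⊥ (Vec.[ j ]) (Vec.[ i ])

  infix 3 ⊢_

  data ⊢_ : List Expr → Set where
    exchange : ∀ {Γ Δ} → Γ ↭ Δ → ⊢ Γ → ⊢ Δ

    id  : ∀ p us ls → let A = atom p us ls in
          IsSequent (dual A ∷ A ∷ []) →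
          ⊢ dual A ∷ A ∷ []

    cut : ∀ {Γ Δ A} → IsSequent (Γ ++ Δ) →
          ⊢ A ∷ Γ → ⊢ dual A ∷ Δ →
          ⊢ Γ ++ Δ

    ⊗-rule : ∀ {Γ Δ A B} → IsSequent (A ⊗ B ∷ Γ ++ Δ) →
             ⊢ A ∷ Γ → ⊢ B ∷ Δ →
             ⊢ A ⊗ B ∷ Γ ++ Δ

    ⅋-rule : ∀ {Γ A B} → IsSequent (A ⅋ B ∷ Γ) →
             ⊢ A ∷ B ∷ Γ →
             ⊢ A ⅋ B ∷ Γ

    ⊥→  : ∀ {Γ A i j} → IsSequent (⊥⟨ j / i ⟩ ∷ A [ i / j ]↑ ∷ Γ) →
          FI↑ A j → i ∉ occurrences A →
          ⊢ A ∷ Γ →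
          ⊢ ⊥⟨ j / i ⟩ ∷ A [ i / j ]↑ ∷ Γ

    ⊥←  : ∀ {Γ A i j} → IsSequent (A [ i / j ]↓ ∷ Γ) →
          FI↓ A j → i ∉ occurrences A →
          ⊢ ⊥⟨ j / i ⟩ ∷ A ∷ Γ →
          ⊢ A [ i / j ]↓ ∷ Γ

module ITTL (V : Vocabulary) where
  open Vocabulary V

  data Symbol : Set where
    lit : Lit → Symbol
    𝟏   : Symbol

  v : Symbol → ℕ × ℕ
  v (lit p) = valency p
  v 𝟏       = 1 , 1

  infixr 7 _⊗_
  infixr 6 _⊸_

  data Expr : Set where
    atom : (p : Symbol) → Vec Ind (proj₁ (v p)) → Vec Ind (proj₂ (v p)) → Expr
    _⊗_  : Expr → Expr → Expr
    _⊸_  : Expr → Expr → Expr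

  -- Occurrences by polarity: the antecedent of ⊸ has its polarities reversed.
  upper lower : Expr → List Ind
  upper (atom p us ls) = toList us
  upper (A ⊗ B)        = upper A ++ upper B
  upper (A ⊸ B)        = lower A ++ upper B
  lower (atom p us ls) = toList ls
  lower (A ⊗ B)        = lower A ++ lower B
  lower (A ⊸ B)        = upper A ++ lower B

  AtomsDistinct : Expr → Set
  AtomsDistinct (atom p us ls) = Unique (toList us ++ toList ls)
  AtomsDistinct (A ⊗ B)        = AtomsDistinct A × AtomsDistinct B
  AtomsDistinct (A ⊸ B)        = AtomsDistinct A × AtomsDistinct B

  open Indexed _≟ᵢ_ upper lower AtomsDistinct public

  IsSequent : List Expr → Expr → Set
  IsSequent Γ A =
    IsContext Γ × IsFormula A ×
    Empty (FI↑* Γ ∩ FI↓ A) × Empty (FI↓* Γ ∩ FI↑ A) ×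
    (FI↑* Γ ∪ FI↓ A) ≐ (FI↓* Γ ∪ FI↑ A)

  infix 8 _[_/_]↑ _[_/_]↓

  _[_/_]↑ _[_/_]↓ : Expr → Ind → Ind → Expr
  atom p us ls [ i / j ]↑ = atom p (Vec.map (replace i j) us) ls
  (A ⊗ B)      [ i / j ]↑ = A [ i / j ]↑ ⊗ B [ i / j ]↑
  (A ⊸ B)      [ i / j ]↑ = A [ i / j ]↓ ⊸ B [ i / j ]↑
  atom p us ls [ i / j ]↓ = atom p us (Vec.map (replace i j) ls)
  (A ⊗ B)      [ i / j ]↓ = A [ i / j ]↓ ⊗ B [ i / j ]↓
  (A ⊸ B)      [ i / j ]↓ = A [ i / j ]↑ ⊸ B [ i / j ]↓

  -- 𝟏⟨ i / j ⟩ has the upper index i and the lower index j.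
  𝟏⟨_/_⟩ : Ind → Ind → Expr
  𝟏⟨ i / j ⟩ = atom 𝟏 (Vec.[ i ]) (Vec.[ j ])

  infix 3 _⊢_

  data _⊢_ : List Expr → Expr → Set where
    exchange : ∀ {Γ Δ A} → Γ ↭ Δ → Γ ⊢ A → Δ ⊢ A

    id  : ∀ p us ls → let A = atom p us ls in
          IsSequent [ A ] A →
          [ A ] ⊢ A

    cut : ∀ {Γ Δ A B} → IsSequent (Γ ++ Δ) B →
          Γ ⊢ A → A ∷ Δ ⊢ B →
          Γ ++ Δ ⊢ B

    L⊸  : ∀ {Γ Δ A B C} → IsSequent (A ⊸ B ∷ Γ ++ Δ) C →
          Γ ⊢ A → B ∷ Δ ⊢ C →
          A ⊸ B ∷ Γ ++ Δ ⊢ C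

    R⊸  : ∀ {Γ A B} → IsSequent Γ (A ⊸ B) →
          A ∷ Γ ⊢ B →
          Γ ⊢ A ⊸ B

    L⊗  : ∀ {Γ A B C} → IsSequent (A ⊗ B ∷ Γ) C →
          A ∷ B ∷ Γ ⊢ C →
          A ⊗ B ∷ Γ ⊢ C

    R⊗  : ∀ {Γ Δ A B} → IsSequent (Γ ++ Δ) (A ⊗ B) →
          Γ ⊢ A → Δ ⊢ B →
          Γ ++ Δ ⊢ A ⊗ B

    L𝟏→ : ∀ {Γ A B i j} → IsSequent (𝟏⟨ i / j ⟩ ∷ A [ i / j ]↓ ∷ Γ) B →
          FI↓ A j → i ∉ occurrences A →
          A ∷ Γ ⊢ B →
          𝟏⟨ i / j ⟩ ∷ A [ i / j ]↓ ∷ Γ ⊢ B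

    R𝟏→ : ∀ {Γ A i j} → IsSequent (𝟏⟨ i / j ⟩ ∷ Γ) (A [ i / j ]↑) →
          FI↑ A j → i ∉ occurrences A →
          Γ ⊢ A →
          𝟏⟨ i / j ⟩ ∷ Γ ⊢ A [ i / j ]↑

    L𝟏← : ∀ {Γ A B i j} → IsSequent (A [ i / j ]↑ ∷ Γ) B →
          FI↑ A j → i ∉ occurrences A →
          𝟏⟨ i / j ⟩ ∷ A ∷ Γ ⊢ B →
          A [ i / j ]↑ ∷ Γ ⊢ B

    R𝟏← : ∀ {Γ A i j} → IsSequent Γ (A [ i / j ]↓) →
          FI↓ A j → i ∉ occurrences A →
          𝟏⟨ i / j ⟩ ∷ Γ ⊢ A →
          Γ ⊢ A [ i / j ]↓

{-# OPTIONS --safe #-}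
-- The rules ⊥→ and ⊥← only re-route the matching between the free upper and the
-- free lower indices of a sequent.  Replace a sequent by a list of tagged formulas
-- whose index occurrences are joined by explicit wires: then the premises of every
-- rule other than cut are determined, up to finitely many choices of the wires, by
-- the conclusion, and derivability without cut (D) is decided by enumerating the
-- wirings of each list of formulas.  Completeness of D for the calculus with cut
-- is proved semantically: formulas are interpreted as biorthogonally closed sets of
-- wired contexts, which validate all rules of TTL including cut.  Conversely a
-- wired derivation is realised in TTL without cut by giving all index occurrences
-- fresh names and materialising each wire as a pair of ⊥-formulas sharing a fresh
-- index, which ⊥← removes at the end.  ITTL embeds into TTL by reading A ⊸ B as
-- Ā ⅋ B; a cut-free proof of embedded formulas contains exactly one positively
-- embedded formula in every sequent, and is therefore itself an ITTL proof.

module Submission where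

open import Defs
import Algebra.Solver.CommutativeMonoid as CommutativeMonoidSolver
open import Data.Empty as Empty using (⊥-elim)
open import Data.List using (List; []; _∷_; _++_; [_]; map; filter; length)
import Data.List.Membership.DecPropositional as DecMembership
open import Data.List.Membership.Propositional using (_∈_; _∉_)
open import Data.List.Membership.Propositional.Properties using (∈-++⁺ˡ; ∈-++⁺ʳ; ∈-++⁻; ∈-map⁺; ∈-map⁻; ∈-filter⁺; ∈-filter⁻)
open import Data.List.Properties as Listₚ using (map-++; map-∘; map-cong; length-++; filter-++)
open import Data.List.Relation.Binary.Permutation.Propositional
open import Data.List.Relation.Binary.Permutation.Propositional.Properties
open import Data.List.Relation.Unary.All as All using (All; []; _∷_)
import Data.List.Relation.Unary.All.Properties as AllP
open import Data.List.Relation.Unary.AllPairs as AllPairs using (AllPairs; []; _∷_)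
import Data.List.Relation.Unary.AllPairs.Properties as AllPairsP
open import Data.List.Relation.Unary.Any as Any using (Any; here; there; any?)
import Data.List.Relation.Unary.Any.Properties as AnyP
open import Data.List.Relation.Unary.Unique.Propositional using (Unique)
import Data.List.Relation.Unary.Unique.Propositional.Properties as UniqueP
open import Data.Nat as Nat using (ℕ; suc; _+_; _≤_; s≤s)
import Data.Nat.Properties as ℕₚ
open import Data.Product using (Σ; ∃; ∃₂; _×_; _,_; -,_; proj₁; proj₂)
import Data.Product.Properties as ×ₚ
open import Data.Sum using (_⊎_; inj₁; inj₂; [_,_]′)
open import Data.Vec as Vec using (Vec; []; _∷_; toList; reverse; zipWith)
import Data.Vec.Properties as Vecₚ
open import Function using (_∘_)
open import Function.Bundles using (Injection)
open import Relation.Binary.Definitions using (DecidableEquality)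
open import Relation.Binary.PropositionalEquality hiding ([_]) renaming (trans to ≡-trans)
open import Relation.Nullary
open import Relation.Nullary.Decidable using (map′)

-- Two features of the calculi obstruct direct proof search. A premise of ⊥← contains a ⊥-formula
-- that its conclusion lacks, so searching upwards need not terminate; and which names may occur in
-- a premise depends on the renamings performed above it. With wires, names only label occurrences,
-- and all that the ⊥-rules change is the matching.
--
-- Joining two premises by ⊗ reconnects wires through the indices that become bound, and such a
-- connection may close up into a loop touching no formula. Loops cannot be forgotten: the wiring
-- read off from a sequent has none, so each loop of a premise must be opened by some ⊥-formula
-- further down. Hence the wires include `loop`, and ⊥ has two wired rules.
--
-- The semantics depends on confluence of contraction, which holds when no end belongs to two wires;
-- this is why sets of ports are kept disjoint throughout. The realisation depends on freshness
-- instead: upper and lower occurrences first receive separate names, so that the side conditions of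
-- the ⊥-rules hold, and an original name returns only where occurrences are about to be matched or
-- bound.

private open module ↭-Solver {A : Set} = CommutativeMonoidSolver (++-commutativeMonoid {A = A}) using (solve; _⊕_; _⊜_)

-- Permutations of duplicate-free lists

∈⇒↭ : ∀ {A : Set} {x : A} {xs} → x ∈ xs → ∃ λ ys → xs ↭ x ∷ ys
∈⇒↭ (here refl) = -, ↭-refl
∈⇒↭ {xs = y ∷ _} (there x∈) with ys , p ← ∈⇒↭ x∈ = -, trans (prep y p) (swap _ _ refl)

↭-∷∈ : ∀ {A : Set} {x : A} {xs ys} → xs ↭ x ∷ ys → x ∈ xs
↭-∷∈ p = ∈-resp-↭ (↭-sym p) (here refl)

∷-diamond : ∀ {A : Set} {a c : A} {R S} → a ∷ R ↭ c ∷ S → a ≢ c →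
            ∃ λ Q → R ↭ c ∷ Q × S ↭ a ∷ Q
∷-diamond {a = a} {c} p a≢c with ∈-resp-↭ (↭-sym p) (here refl)
... | here refl = contradiction refl a≢c
... | there c∈R with Q , q ← ∈⇒↭ c∈R =
  Q , q , drop-∷ (trans (↭-sym p) (trans (prep a q) (swap a c refl)))

Unique-resp-↭ : ∀ {A : Set} {xs ys : List A} → xs ↭ ys → Unique xs → Unique ys
Unique-resp-↭ refl u = u
Unique-resp-↭ (prep x p) (px ∷ u) = All-resp-↭ p px ∷ Unique-resp-↭ p u
Unique-resp-↭ (swap x y p) ((x≢y ∷ px) ∷ py ∷ u) =
  ((x≢y ∘ sym) ∷ All-resp-↭ p py) ∷ All-resp-↭ p px ∷ Unique-resp-↭ p u
Unique-resp-↭ (trans p q) u = Unique-resp-↭ q (Unique-resp-↭ p u)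

Unique-++⁻ˡ : ∀ {A : Set} {xs ys : List A} → Unique (xs ++ ys) → Unique xs
Unique-++⁻ˡ {xs = []} u = []
Unique-++⁻ˡ {xs = x ∷ xs} (p ∷ u) = AllP.++⁻ˡ xs p ∷ Unique-++⁻ˡ u

Unique-++⁻ʳ : ∀ {A : Set} (xs : List A) {ys} → Unique (xs ++ ys) → Unique ys
Unique-++⁻ʳ [] u = u
Unique-++⁻ʳ (x ∷ xs) (_ ∷ u) = Unique-++⁻ʳ xs u

Unique-disjoint : ∀ {A : Set} {xs ys : List A} {z} → Unique (xs ++ ys) → z ∈ xs → z ∉ ys
Unique-disjoint {xs = x ∷ xs} (p ∷ u) (here refl) z∈ys = All.lookup p (∈-++⁺ʳ xs z∈ys) refl
Unique-disjoint (p ∷ u) (there z∈) z∈ys = Unique-disjoint u z∈ z∈ys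

head-∉ : ∀ {A : Set} {x : A} {xs} → Unique (x ∷ xs) → x ∉ xs
head-∉ (p ∷ _) x∈ = All.lookup p x∈ refl

∷-Unique : ∀ {A : Set} {x : A} {xs} → x ∉ xs → Unique xs → Unique (x ∷ xs)
∷-Unique {xs = xs} x∉ u = All.tabulate (λ { y∈ refl → x∉ y∈ }) ∷ u

++-Unique : ∀ {A : Set} {xs ys : List A} → Unique xs → Unique ys → (∀ {z} → z ∈ xs → z ∉ ys) →
            Unique (xs ++ ys)
++-Unique [] v d = v
++-Unique {xs = x ∷ xs} (p ∷ u) v d =
  ∷-Unique (λ x∈ → case-∈ (∈-++⁻ xs x∈)) (++-Unique u v (d ∘ there))
  where
  case-∈ : _ → _
  case-∈ (inj₁ x∈xs) = head-∉ (p ∷ u) x∈xs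
  case-∈ (inj₂ x∈ys) = d (here refl) x∈ys

-- Without duplicates a permutation amounts to having the same members. Identities between lists of
-- free or shared indices are reduced to membership this way.
unique-↭ : ∀ {A : Set} {xs ys : List A} → Unique xs → Unique ys →
           (∀ {z} → z ∈ xs → z ∈ ys) → (∀ {z} → z ∈ ys → z ∈ xs) → xs ↭ ys
unique-↭ {xs = []} {[]} u v f g = refl
unique-↭ {xs = []} {y ∷ ys} u v f g with () ← g (here refl)
unique-↭ {xs = x ∷ xs} u v f g with zs , p ← ∈⇒↭ (f (here refl)) =
  trans (prep x (unique-↭ (Unique-++⁻ʳ [ x ] u) (Unique-++⁻ʳ [ x ] v′) f′ g′)) (↭-sym p)
  where
  v′ = Unique-resp-↭ p v
  f′ : ∀ {z} → z ∈ xs → z ∈ zs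
  f′ z∈ with ∈-resp-↭ p (f (there z∈))
  ... | here refl = contradiction z∈ (head-∉ u)
  ... | there q = q
  g′ : ∀ {z} → z ∈ zs → z ∈ xs
  g′ z∈ with g (∈-resp-↭ (↭-sym p) (there z∈))
  ... | here refl = contradiction z∈ (head-∉ v′)
  ... | there q = q

-- Disjointness forces `ys` to come out of `X`, and what then remains on both sides is the same list
-- `Z`. It later isolates the indices that the rest of a sequent matches within itself.
↭-exchange : ∀ {A : Set} (xs ys : List A) {X Y} → (∀ {z} → z ∈ xs → z ∉ ys) →
             xs ++ X ↭ ys ++ Y → ∃ λ Z → X ↭ ys ++ Z × Y ↭ xs ++ Z
↭-exchange xs [] {X} d p = X , refl , ↭-sym p
↭-exchange xs (y ∷ ys) {X} d p with ∈-++⁻ xs (∈-resp-↭ (↭-sym p) (here refl))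
... | inj₁ y∈xs = contradiction (here refl) (d y∈xs)
... | inj₂ y∈X with X′ , q ← ∈⇒↭ y∈X
    with Z , r , s ← ↭-exchange xs ys {X′} (λ z∈ → d z∈ ∘ there)
       (drop-∷ (trans (↭-sym (trans (++⁺ˡ xs q) (shift y xs X′))) p)) =
  Z , trans q (prep y r) , s

drop-++ : ∀ {A : Set} (xs : List A) {ys zs} → xs ++ ys ↭ xs ++ zs → ys ↭ zs
drop-++ [] p = p
drop-++ (x ∷ xs) p = drop-++ xs (drop-∷ p)

-- Wires and their contraction

-- An `edge` runs from an upper occurrence to the lower occurrence matched with it. A `loop` has no
-- ends, so `uppers` and `lowers` do not see it, yet its multiplicity is retained.
data Wire (N : Set) : Set where
  edge : N → N → Wire N
  loop : Wire N

module _ {N : Set} where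

  uppers lowers : List (Wire N) → List N
  uppers [] = []
  uppers (edge u l ∷ W) = u ∷ uppers W
  uppers (loop ∷ W) = uppers W
  lowers [] = []
  lowers (edge u l ∷ W) = l ∷ lowers W
  lowers (loop ∷ W) = lowers W

  uppers-++ : ∀ W {V} → uppers (W ++ V) ≡ uppers W ++ uppers V
  uppers-++ [] = refl
  uppers-++ (edge u l ∷ W) = cong (u ∷_) (uppers-++ W)
  uppers-++ (loop ∷ W) = uppers-++ W

  lowers-++ : ∀ W {V} → lowers (W ++ V) ≡ lowers W ++ lowers V
  lowers-++ [] = refl
  lowers-++ (edge u l ∷ W) = cong (l ∷_) (lowers-++ W)
  lowers-++ (loop ∷ W) = lowers-++ W

  uppers-↭ : ∀ {W V} → W ↭ V → uppers W ↭ uppers V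
  uppers-↭ refl = refl
  uppers-↭ (prep (edge u l) p) = prep u (uppers-↭ p)
  uppers-↭ (prep loop p) = uppers-↭ p
  uppers-↭ (swap (edge u l) (edge u′ l′) p) = swap u u′ (uppers-↭ p)
  uppers-↭ (swap (edge u l) loop p) = prep u (uppers-↭ p)
  uppers-↭ (swap loop (edge u l) p) = prep u (uppers-↭ p)
  uppers-↭ (swap loop loop p) = uppers-↭ p
  uppers-↭ (trans p q) = trans (uppers-↭ p) (uppers-↭ q)

  lowers-↭ : ∀ {W V} → W ↭ V → lowers W ↭ lowers V
  lowers-↭ refl = refl
  lowers-↭ (prep (edge u l) p) = prep l (lowers-↭ p)
  lowers-↭ (prep loop p) = lowers-↭ p
  lowers-↭ (swap (edge u l) (edge u′ l′) p) = swap l l′ (lowers-↭ p)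
  lowers-↭ (swap (edge u l) loop p) = prep l (lowers-↭ p)
  lowers-↭ (swap loop (edge u l) p) = prep l (lowers-↭ p)
  lowers-↭ (swap loop loop p) = lowers-↭ p
  lowers-↭ (trans p q) = trans (lowers-↭ p) (lowers-↭ q)

  find-upper : ∀ {W x} → x ∈ uppers W → ∃₂ λ l R → W ↭ edge x l ∷ R
  find-upper {edge u l ∷ W} (here refl) = l , W , refl
  find-upper {edge u l ∷ W} (there x∈) with l , R , q ← find-upper x∈ = l , _ , trans (prep _ q) (swap _ _ refl)
  find-upper {loop ∷ W} x∈ with l , R , q ← find-upper x∈ = l , _ , trans (prep _ q) (swap _ _ refl)

  upper-edge : ∀ W {x us} → uppers W ↭ x ∷ us →
               ∃₂ λ l R → W ↭ edge x l ∷ R × uppers R ↭ us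
  upper-edge W p with l , R , q ← find-upper (∈-resp-↭ (↭-sym p) (here refl)) =
    l , R , q , drop-∷ (trans (↭-sym (uppers-↭ q)) p)

  find-lower : ∀ {W x} → x ∈ lowers W → ∃₂ λ u R → W ↭ edge u x ∷ R
  find-lower {edge u l ∷ W} (here refl) = u , W , refl
  find-lower {edge u l ∷ W} (there x∈) with u , R , q ← find-lower x∈ = u , _ , trans (prep _ q) (swap _ _ refl)
  find-lower {loop ∷ W} x∈ with u , R , q ← find-lower x∈ = u , _ , trans (prep _ q) (swap _ _ refl)

  lower-edge : ∀ W {x ls} → lowers W ↭ x ∷ ls →
               ∃₂ λ u R → W ↭ edge u x ∷ R × lowers R ↭ ls
  lower-edge W p with u , R , q ← find-lower (∈-resp-↭ (↭-sym p) (here refl)) =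
    u , R , q , drop-∷ (trans (↭-sym (lowers-↭ q)) p)

  infix 3 _⟿[_]_ _⟿⟨_⟩_

  -- `via` composes the wire ending in `x` with the wire starting there; `cyc` is the case in which
  -- these are one and the same wire. Permutations on both sides make wirings behave as multisets.
  data _⟿[_]_ (W : List (Wire N)) (x : N) (V : List (Wire N)) : Set where
    via : ∀ {u l R} → W ↭ edge u x ∷ edge x l ∷ R → V ↭ edge u l ∷ R → W ⟿[ x ] V
    cyc : ∀ {R} → W ↭ edge x x ∷ R → V ↭ loop ∷ R → W ⟿[ x ] V

  data _⟿⟨_⟩_ : List (Wire N) → List N → List (Wire N) → Set where
    done : ∀ {W V} → W ↭ V → W ⟿⟨ [] ⟩ V
    _⨾_  : ∀ {W V U x xs} → W ⟿[ x ] V → V ⟿⟨ xs ⟩ U → W ⟿⟨ x ∷ xs ⟩ U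

  ⟿-++ : ∀ {W V x} S → W ⟿[ x ] V → W ++ S ⟿[ x ] V ++ S
  ⟿-++ S (via p q) = via (++⁺ʳ S p) (++⁺ʳ S q)
  ⟿-++ S (cyc p q) = cyc (++⁺ʳ S p) (++⁺ʳ S q)

  ⟿*-++ : ∀ {W V xs} S → W ⟿⟨ xs ⟩ V → W ++ S ⟿⟨ xs ⟩ V ++ S
  ⟿*-++ S (done p) = done (++⁺ʳ S p)
  ⟿*-++ S (s ⨾ t) = ⟿-++ S s ⨾ ⟿*-++ S t

  ↭⟿ : ∀ {W W′ x V} → W ↭ W′ → W′ ⟿[ x ] V → W ⟿[ x ] V
  ↭⟿ p (via q r) = via (trans p q) r
  ↭⟿ p (cyc q r) = cyc (trans p q) r

  ↭⟿* : ∀ {W W′ xs V} → W ↭ W′ → W′ ⟿⟨ xs ⟩ V → W ⟿⟨ xs ⟩ V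
  ↭⟿* p (done q) = done (trans p q)
  ↭⟿* p (s ⨾ t) = ↭⟿ p s ⨾ t

  ⟿*↭ : ∀ {W xs V V′} → W ⟿⟨ xs ⟩ V → V ↭ V′ → W ⟿⟨ xs ⟩ V′
  ⟿*↭ (done q) p = done (trans q p)
  ⟿*↭ (s ⨾ t) p = s ⨾ ⟿*↭ t p

  ⟿*-trans : ∀ {W xs V ys U} → W ⟿⟨ xs ⟩ V → V ⟿⟨ ys ⟩ U → W ⟿⟨ xs ++ ys ⟩ U
  ⟿*-trans (done p) t = ↭⟿* p t
  ⟿*-trans (s ⨾ s′) t = s ⨾ ⟿*-trans s′ t

  ⟿*-++ˡ : ∀ {W V xs} S → W ⟿⟨ xs ⟩ V → S ++ W ⟿⟨ xs ⟩ S ++ V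
  ⟿*-++ˡ {W} {V} S t = ↭⟿* (++-comm S W) (⟿*↭ (⟿*-++ S t) (++-comm V S))

  ⟿-ends : ∀ {W x V} → W ⟿[ x ] V → uppers W ↭ x ∷ uppers V × lowers W ↭ x ∷ lowers V
  ⟿-ends (via p q) =
    trans (trans (uppers-↭ p) (swap _ _ refl)) (prep _ (↭-sym (uppers-↭ q))) ,
    trans (lowers-↭ p) (prep _ (↭-sym (lowers-↭ q)))
  ⟿-ends (cyc p q) =
    trans (uppers-↭ p) (prep _ (↭-sym (uppers-↭ q))) ,
    trans (lowers-↭ p) (prep _ (↭-sym (lowers-↭ q)))

  ⟿*-ends : ∀ {W xs V} → W ⟿⟨ xs ⟩ V → uppers W ↭ xs ++ uppers V × lowers W ↭ xs ++ lowers V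
  ⟿*-ends (done p) = uppers-↭ p , lowers-↭ p
  ⟿*-ends (s ⨾ t) = let p , q = ⟿-ends s ; p′ , q′ = ⟿*-ends t in
    trans p (prep _ p′) , trans q (prep _ q′)

  contract : ∀ W {x us ls} → uppers W ↭ x ∷ us → lowers W ↭ x ∷ ls → ∃ λ V → W ⟿[ x ] V
  contract W p q with u , R , r , s ← lower-edge W q
    with ∈-resp-↭ (trans (↭-sym p) (uppers-↭ r)) (here refl)
  ... | here refl = -, cyc r refl
  ... | there x∈ with us′ , t ← ∈⇒↭ x∈ with l , R′ , r′ , s′ ← upper-edge R t =
    -, via (trans r (prep _ r′)) refl

  contract* : ∀ xs W {us ls} → uppers W ↭ xs ++ us → lowers W ↭ xs ++ ls →
              ∃ λ V → W ⟿⟨ xs ⟩ V × uppers V ↭ us × lowers V ↭ ls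
  contract* [] W p q = W , done refl , p , q
  contract* (x ∷ xs) W p q with V , s ← contract W p q with p′ , q′ ← ⟿-ends s
    with U , t , r ← contract* xs V (drop-∷ (trans (↭-sym p′) p)) (drop-∷ (trans (↭-sym q′) q)) =
    U , s ⨾ t , r

  -- The wiring is a partial matching. If two wires shared an end, the route through a contracted
  -- name would be ambiguous.
  Functional : List (Wire N) → Set
  Functional W = Unique (uppers W) × Unique (lowers W)

  functional-↭ : ∀ {W V} → W ↭ V → Functional W → Functional V
  functional-↭ p (f , g) = Unique-resp-↭ (uppers-↭ p) f , Unique-resp-↭ (lowers-↭ p) g

  functional-⟿ : ∀ {W x V} → W ⟿[ x ] V → Functional W → Functional V
  functional-⟿ {x = x} s (f , g) = let p , q = ⟿-ends s in
    Unique-++⁻ʳ [ x ] (Unique-resp-↭ p f) , Unique-++⁻ʳ [ x ] (Unique-resp-↭ q g)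

  functional-⟿* : ∀ {W xs V} → W ⟿⟨ xs ⟩ V → Functional W → Functional V
  functional-⟿* (done p) f = functional-↭ p f
  functional-⟿* (s ⨾ t) f = functional-⟿* t (functional-⟿ s f)

  same-lower : ∀ {W u u′ x R} → Functional W → W ↭ edge u x ∷ R → edge u′ x ∈ R → ∀ {A : Set} → A
  same-lower {u = u} {u′} {x} (_ , g) p e with Q , q ← ∈⇒↭ e =
    ⊥-elim (head-∉ (Unique-resp-↭ (lowers-↭ (trans p (prep _ q))) g) (here refl))

  same-upper : ∀ {W x l l′ R} → Functional W → W ↭ edge x l ∷ R → edge x l′ ∈ R → ∀ {A : Set} → A
  same-upper (f , _) p e with Q , q ← ∈⇒↭ e =
    ⊥-elim (head-∉ (Unique-resp-↭ (uppers-↭ (trans p (prep _ q))) f) (here refl))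

  private
    edge-injˡ : ∀ {a b c d : N} → edge a b ≡ edge c d → a ≡ c
    edge-injˡ refl = refl
    edge-injʳ : ∀ {a b c d : N} → edge a b ≡ edge c d → b ≡ d
    edge-injʳ refl = refl

  -- By uniqueness of ends both steps use the same wires into and out of `x`, and `via` cannot
  -- coexist with `cyc`; the remaining wires then agree as well.
  deterministic : ∀ {W x V V′} → Functional W → W ⟿[ x ] V → W ⟿[ x ] V′ → V ↭ V′
  deterministic f (via p q) (via p′ q′) with ∈-resp-↭ (trans (↭-sym p′) p) (here refl)
  ... | there (here refl) = same-lower f p (here refl)
  ... | there (there e) = same-lower f p (there e)
  ... | here refl with ∈-resp-↭ (drop-∷ (trans (↭-sym p′) p)) (here refl)
  ...   | there e = same-upper f (trans p (swap _ _ refl)) (there e)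
  ...   | here refl = trans q (trans (prep _ (drop-∷ (drop-∷ (trans (↭-sym p) p′)))) (↭-sym q′))
  deterministic f (via p q) (cyc p′ q′) with ∈-resp-↭ (trans (↭-sym p′) p) (here refl)
  ... | here refl = same-upper f p (here refl)
  ... | there e = same-lower f p e
  deterministic f (cyc p q) (via p′ q′) with ∈-resp-↭ (trans (↭-sym p) p′) (here refl)
  ... | here refl = same-upper f p′ (here refl)
  ... | there e = same-lower f p′ e
  deterministic f (cyc p q) (cyc p′ q′) =
    trans q (trans (prep _ (drop-∷ (trans (↭-sym p) p′))) (↭-sym q′))

  private
    via-via : ∀ {W V V′ x y u l u′ l′ R R′} → x ≢ y → edge u x ≢ edge y l′ → edge x l ≢ edge u′ y →
              W ↭ edge u x ∷ edge x l ∷ R → V ↭ edge u l ∷ R →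
              W ↭ edge u′ y ∷ edge y l′ ∷ R′ → V′ ↭ edge u′ l′ ∷ R′ →
              ∃ λ U → V ⟿[ y ] U × V′ ⟿[ x ] U
    via-via x≢y a≢d b≢c p q p′ q′
      with Q , r , s ← ∷-diamond (trans (↭-sym p) p′) (x≢y ∘ edge-injʳ)
      with Q₁ , r₁ , s₁ ← ∷-diamond r b≢c
      with Q₂ , r₂ , s₂ ← ∷-diamond s (a≢d ∘ sym)
      with Q₃ , r₃ , s₃ ← ∷-diamond (trans (↭-sym s₁) s₂) (x≢y ∘ edge-injˡ) =
      _ , via (trans q (trans (prep _ (trans r₁ (prep _ r₃))) (solve 4 (λ a b c d → a ⊕ b ⊕ c ⊕ d ⊜ b ⊕ c ⊕ a ⊕ d) refl [ _ ] [ _ ] [ _ ] Q₃))) refl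
        , via (trans q′ (trans (prep _ (trans r₂ (prep _ s₃))) (solve 4 (λ a b c d → a ⊕ b ⊕ c ⊕ d ⊜ b ⊕ c ⊕ a ⊕ d) refl [ _ ] [ _ ] [ _ ] Q₃))) (swap _ _ refl)

    chain : ∀ {W V V′ x y l u′ R R′} → x ≢ y → edge x l ≢ edge u′ y →
            W ↭ edge y x ∷ edge x l ∷ R → V ↭ edge y l ∷ R →
            W ↭ edge u′ y ∷ edge y x ∷ R′ → V′ ↭ edge u′ x ∷ R′ →
            ∃ λ U → V ⟿[ y ] U × V′ ⟿[ x ] U
    chain x≢y b≢c p q p′ q′
      with Q , r , s ← ∷-diamond (drop-∷ (trans (↭-sym p) (trans p′ (swap _ _ refl)))) b≢c =
      _ , via (trans q (trans (prep _ r) (swap _ _ refl))) refl , via (trans q′ (prep _ s)) refl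

    via-cyc : ∀ {W V V′ x y u l R R′} → x ≢ y →
              W ↭ edge u x ∷ edge x l ∷ R → V ↭ edge u l ∷ R →
              W ↭ edge y y ∷ R′ → V′ ↭ loop ∷ R′ →
              ∃ λ U → V ⟿[ y ] U × V′ ⟿[ x ] U
    via-cyc x≢y p q p′ q′
      with Q , r , s ← ∷-diamond (trans (↭-sym p) p′) (x≢y ∘ edge-injʳ)
      with Q₁ , r₁ , s₁ ← ∷-diamond r (x≢y ∘ edge-injˡ) =
      _ , cyc (trans q (trans (prep _ r₁) (swap _ _ refl))) refl
        , via (trans q′ (trans (prep _ (trans s (prep _ s₁))) (solve 4 (λ a b c d → a ⊕ b ⊕ c ⊕ d ⊜ b ⊕ c ⊕ a ⊕ d) refl [ _ ] [ _ ] [ _ ] Q₁))) (swap _ _ refl)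

  module _ (_≟_ : DecidableEquality N) where

    edge? : (a b c d : N) → Dec (edge a b ≡ edge c d)
    edge? a b c d with a ≟ c | b ≟ d
    ... | yes refl | yes refl = yes refl
    ... | no a≢c | _ = no (a≢c ∘ edge-injˡ)
    ... | _ | no b≢d = no (b≢d ∘ edge-injʳ)

    -- For two `via` steps the cases follow which wires they share: none, one wire running between
    -- the two names, or two wires forming a cycle through both. In the last case either step leaves
    -- a wire from a name to itself, which the other step closes into a loop.
    diamond-≢ : ∀ {W V V′ x y} → x ≢ y → W ⟿[ x ] V → W ⟿[ y ] V′ → ∃ λ U → V ⟿[ y ] U × V′ ⟿[ x ] U
    diamond-≢ {x = x} {y} x≢y (via {u} {l} p q) (via {u′} {l′} p′ q′)
      with edge? u x y l′ | edge? x l u′ y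
    ... | no a≢d | no b≢c = via-via x≢y a≢d b≢c p q p′ q′
    ... | yes refl | no b≢c = chain x≢y b≢c p q p′ q′
    ... | no a≢d | yes refl = let U , s , t = chain (x≢y ∘ sym) (a≢d ∘ sym) p′ q′ p q in U , t , s
    ... | yes refl | yes refl =
      _ , cyc q refl , cyc q′ (prep _ (drop-∷ (drop-∷ (trans (↭-sym p) (trans p′ (swap _ _ refl))))))
    diamond-≢ x≢y (via p q) (cyc p′ q′) = via-cyc x≢y p q p′ q′
    diamond-≢ x≢y (cyc p q) (via p′ q′) = let U , s , t = via-cyc (x≢y ∘ sym) p′ q′ p q in U , t , s
    diamond-≢ x≢y (cyc p q) (cyc p′ q′) with Q , r , s ← ∷-diamond (trans (↭-sym p) p′) (x≢y ∘ edge-injʳ) =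
      _ , cyc (trans q (trans (prep _ r) (swap _ _ refl))) refl
        , cyc (trans q′ (trans (prep _ s) (swap _ _ refl))) refl

    -- Since `x` is not an end in `Z`, the sequence contracts it somewhere. The given step is
    -- carried past the earlier contractions by the diamond and merges with that one by determinism.
    strip : ∀ {W x V ys Z} → Functional W → W ⟿[ x ] V → W ⟿⟨ ys ⟩ Z → x ∉ uppers Z →
            ∃ λ zs → V ⟿⟨ zs ⟩ Z × (∀ {z} → z ∈ zs → z ∈ ys)
    strip f s (done p) x∉ = contradiction (∈-resp-↭ (uppers-↭ p) (↭-∷∈ (proj₁ (⟿-ends s)))) x∉
    strip {x = x} f s (_⨾_ {x = y} t ts) x∉ with x ≟ y
    ... | yes refl = -, ↭⟿* (deterministic f s t) ts , there
    ... | no x≢y with U , s′ , t′ ← diamond-≢ x≢y s t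
        with zs , us , sub ← strip (functional-⟿ t f) t′ ts x∉ =
      -, s′ ⨾ us , λ { (here e) → here e ; (there z∈) → there (sub z∈) }

    strip* : ∀ {W xs V ys Z} → Functional W → W ⟿⟨ xs ⟩ V → W ⟿⟨ ys ⟩ Z →
             (∀ {x} → x ∈ xs → x ∉ uppers Z) →
             ∃ λ zs → V ⟿⟨ zs ⟩ Z × (∀ {z} → z ∈ zs → z ∈ ys)
    strip* f (done p) t x∉ = -, ↭⟿* (↭-sym p) t , λ i → i
    strip* f (s ⨾ ss) t x∉ with zs , t′ , sub ← strip f s t (x∉ (here refl))
      with zs′ , t″ , sub′ ← strip* (functional-⟿ s f) ss t′ (x∉ ∘ there) = zs′ , t″ , sub ∘ sub′

    -- Confluence leads from `V` to the result of the order `ys` through contractions of names in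
    -- `ys` only. All of these are already contracted in `V`, so none is left and the two results
    -- agree.
    ⟿*-perm : ∀ {W xs ys V} → Functional W → xs ↭ ys → W ⟿⟨ xs ⟩ V → W ⟿⟨ ys ⟩ V
    ⟿*-perm {W} {xs} {ys} {V} f p s with V′ , s′ , _ ← contract* ys W
        (trans (proj₁ (⟿*-ends s)) (++⁺ʳ (uppers V) p)) (trans (proj₂ (⟿*-ends s)) (++⁺ʳ (lowers V) p))
      with strip* f s s′ (λ x∈ → Unique-disjoint (Unique-resp-↭ (proj₁ (⟿*-ends s′)) (proj₁ f)) (∈-resp-↭ p x∈))
    ... | [] , done q , _ = ⟿*↭ s′ (↭-sym q)
    ... | z ∷ zs , t ⨾ _ , sub = contradiction (↭-∷∈ (proj₁ (⟿-ends t)))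
      (Unique-disjoint (Unique-resp-↭ (proj₁ (⟿*-ends s)) (proj₁ f)) (∈-resp-↭ (↭-sym p) (sub (here refl))))

module _ {N N′ : Set} (f : N → N′) where

  mapWire : Wire N → Wire N′
  mapWire (edge u l) = edge (f u) (f l)
  mapWire loop = loop

  uppers-map : ∀ W → uppers (map mapWire W) ≡ map f (uppers W)
  uppers-map [] = refl
  uppers-map (edge u l ∷ W) = cong (f u ∷_) (uppers-map W)
  uppers-map (loop ∷ W) = uppers-map W

  lowers-map : ∀ W → lowers (map mapWire W) ≡ map f (lowers W)
  lowers-map [] = refl
  lowers-map (edge u l ∷ W) = cong (f l ∷_) (lowers-map W)
  lowers-map (loop ∷ W) = lowers-map W

  ⟿-map : ∀ {W x V} → W ⟿[ x ] V → map mapWire W ⟿[ f x ] map mapWire V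
  ⟿-map (via p q) = via (map⁺ mapWire p) (map⁺ mapWire q)
  ⟿-map (cyc p q) = cyc (map⁺ mapWire p) (map⁺ mapWire q)

  ⟿*-map : ∀ {W xs V} → W ⟿⟨ xs ⟩ V → map mapWire W ⟿⟨ map f xs ⟩ map mapWire V
  ⟿*-map (done p) = done (map⁺ mapWire p)
  ⟿*-map (s ⨾ t) = ⟿-map s ⨾ ⟿*-map t

module _ (V : Vocabulary) where

  open Vocabulary V
  open TTL V
  open DecMembership _≟ᵢ_ using (_∈?_)

  -- Free indices of an expression and indices shared by two expressions.

  abstract

    frees common : List Ind → List Ind → List Ind
    frees us ls = filter (λ x → ¬? (x ∈? ls)) us
    common us ls = filter (_∈? ls) us

    ∈-frees⁺ : ∀ {x us ls} → x ∈ us → x ∉ ls → x ∈ frees us ls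
    ∈-frees⁺ x∈ x∉ = ∈-filter⁺ _ x∈ x∉

    ∈-frees⁻ : ∀ {x us ls} → x ∈ frees us ls → x ∈ us × x ∉ ls
    ∈-frees⁻ {us = us} = ∈-filter⁻ _ {xs = us}

    ∈-common⁺ : ∀ {x us ls} → x ∈ us → x ∈ ls → x ∈ common us ls
    ∈-common⁺ {ls = ls} = ∈-filter⁺ (_∈? ls)

    ∈-common⁻ : ∀ {x us ls} → x ∈ common us ls → x ∈ us × x ∈ ls
    ∈-common⁻ {us = us} {ls} = ∈-filter⁻ (_∈? ls) {xs = us}

    frees-Unique : ∀ {us ls} → Unique us → Unique (frees us ls)
    frees-Unique = UniqueP.filter⁺ _

    common-Unique : ∀ {us ls} → Unique us → Unique (common us ls)
    common-Unique = UniqueP.filter⁺ _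

    frees-all : ∀ {us ls} → (∀ {x} → x ∈ us → x ∉ ls) → frees us ls ≡ us
    frees-all {[]} d = refl
    frees-all {x ∷ us} {ls} d with x ∈? ls
    ... | yes x∈ = ⊥-elim (d (here refl) x∈)
    ... | no _ = cong (x ∷_) (frees-all (d ∘ there))

    frees-map : ∀ {f} us {ls} → (∀ {x y} → f x ≡ f y → x ≡ y) → frees (map f us) (map f ls) ≡ map f (frees us ls)
    frees-map [] inj = refl
    frees-map {f} (x ∷ us) {ls} inj with f x ∈? map f ls | x ∈? ls
    ... | yes _ | yes _ = frees-map us inj
    ... | no _ | no _ = cong (f x ∷_) (frees-map us inj)
    ... | no ∉ | yes ∈ = ⊥-elim (∉ (∈-map⁺ f ∈))
    ... | yes ∈ | no ∉ with y , y∈ , e ← ∈-map⁻ f ∈ with refl ← inj e = ⊥-elim (∉ y∈)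

    common-map : ∀ {f} us {ls} → (∀ {x y} → f x ≡ f y → x ≡ y) → common (map f us) (map f ls) ≡ map f (common us ls)
    common-map [] inj = refl
    common-map {f} (x ∷ us) {ls} inj with f x ∈? map f ls | x ∈? ls
    ... | no _ | no _ = common-map us inj
    ... | yes _ | yes _ = cong (f x ∷_) (common-map us inj)
    ... | no ∉ | yes ∈ = ⊥-elim (∉ (∈-map⁺ f ∈))
    ... | yes ∈ | no ∉ with y , y∈ , e ← ∈-map⁻ f ∈ with refl ← inj e = ⊥-elim (∉ y∈)

  fu fl : Expr → List Ind
  fu A = frees (upper A) (lower A)
  fl A = frees (lower A) (upper A)

  -- For a linear compound these are the indices that turn from free into bound when the parts are
  -- joined.
  shared : Expr → Expr → List Ind
  shared A B = common (upper A) (lower B) ++ common (upper B) (lower A)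

  frees-disjoint : ∀ {us ls x} → x ∈ frees us ls → x ∉ frees ls us
  frees-disjoint p q = proj₂ (∈-frees⁻ p) (proj₁ (∈-frees⁻ q))

  common-comm : ∀ {us ls} → Unique us → Unique ls → common us ls ↭ common ls us
  common-comm u v = unique-↭ (common-Unique u) (common-Unique v)
    (λ z∈ → let p , q = ∈-common⁻ z∈ in ∈-common⁺ q p)
    (λ z∈ → let p , q = ∈-common⁻ z∈ in ∈-common⁺ q p)

  -- An index free in one part stays free in the whole unless the other part has it with opposite
  -- polarity. The `frees` around `common` accounts for overlaps of `ls₁` with `ls₂`, which
  -- linearity excludes in `fu-split`.
  frees-++ : ∀ us₁ us₂ {ls₁ ls₂} → Unique (us₁ ++ us₂) →
             frees us₁ ls₁ ++ frees us₂ ls₂ ↭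
             (frees (common us₁ ls₂) ls₁ ++ frees (common us₂ ls₁) ls₂) ++ frees (us₁ ++ us₂) (ls₁ ++ ls₂)
  frees-++ us₁ us₂ {ls₁} {ls₂} u = unique-↭ u₁ u₂ to from
    where
    v₁ = Unique-++⁻ˡ {xs = us₁} u
    v₂ = Unique-++⁻ʳ us₁ u
    u₁ = ++-Unique (frees-Unique v₁) (frees-Unique v₂)
           (λ p q → Unique-disjoint u (proj₁ (∈-frees⁻ p)) (proj₁ (∈-frees⁻ q)))
    u₂ = ++-Unique (++-Unique (frees-Unique (common-Unique v₁)) (frees-Unique (common-Unique v₂))
           (λ p q → Unique-disjoint u (proj₁ (∈-common⁻ (proj₁ (∈-frees⁻ p)))) (proj₁ (∈-common⁻ (proj₁ (∈-frees⁻ q))))))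
           (frees-Unique u)
           (λ p q → let r = proj₂ (∈-frees⁻ q) in
             [ (λ s → r (∈-++⁺ʳ ls₁ (proj₂ (∈-common⁻ (proj₁ (∈-frees⁻ s))))))
             , (λ s → r (∈-++⁺ˡ (proj₂ (∈-common⁻ (proj₁ (∈-frees⁻ s)))))) ]′ (∈-++⁻ (frees (common us₁ ls₂) ls₁) p))
    to : ∀ {z} → z ∈ frees us₁ ls₁ ++ frees us₂ ls₂ → _
    to {z} z∈ with ∈-++⁻ (frees us₁ ls₁) z∈
    to {z} z∈ | inj₁ p with z∈u , z∉l ← ∈-frees⁻ p with z ∈? ls₂
    ... | yes q = ∈-++⁺ˡ (∈-++⁺ˡ (∈-frees⁺ (∈-common⁺ z∈u q) z∉l))
    ... | no q = ∈-++⁺ʳ (frees (common us₁ ls₂) ls₁ ++ frees (common us₂ ls₁) ls₂) (∈-frees⁺ (∈-++⁺ˡ z∈u) ([ z∉l , q ]′ ∘ ∈-++⁻ ls₁))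
    to {z} z∈ | inj₂ p with z∈u , z∉l ← ∈-frees⁻ p with z ∈? ls₁
    ... | yes q = ∈-++⁺ˡ (∈-++⁺ʳ (frees (common us₁ ls₂) ls₁) (∈-frees⁺ (∈-common⁺ z∈u q) z∉l))
    ... | no q = ∈-++⁺ʳ (frees (common us₁ ls₂) ls₁ ++ frees (common us₂ ls₁) ls₂) (∈-frees⁺ (∈-++⁺ʳ us₁ z∈u) ([ q , z∉l ]′ ∘ ∈-++⁻ ls₁))
    from : ∀ {z} → _ → z ∈ frees us₁ ls₁ ++ frees us₂ ls₂
    from z∈ with ∈-++⁻ (frees (common us₁ ls₂) ls₁ ++ frees (common us₂ ls₁) ls₂) z∈
    from z∈ | inj₁ p with ∈-++⁻ (frees (common us₁ ls₂) ls₁) p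
    ... | inj₁ q = let a , b = ∈-frees⁻ q in ∈-++⁺ˡ (∈-frees⁺ (proj₁ (∈-common⁻ a)) b)
    ... | inj₂ q = let a , b = ∈-frees⁻ q in ∈-++⁺ʳ _ (∈-frees⁺ (proj₁ (∈-common⁻ a)) b)
    from z∈ | inj₂ p with a , b ← ∈-frees⁻ p with ∈-++⁻ us₁ a
    ... | inj₁ q = ∈-++⁺ˡ (∈-frees⁺ q (b ∘ ∈-++⁺ˡ))
    ... | inj₂ q = ∈-++⁺ʳ _ (∈-frees⁺ q (b ∘ ∈-++⁺ʳ ls₁))

  Linear : Expr → Set
  Linear A = Unique (upper A) × Unique (lower A)

  module _ {A B : Expr} (lin : Linear (A ⊗ B)) where
    private
      dU : ∀ {x} → x ∈ upper A → x ∉ upper B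
      dU = Unique-disjoint (proj₁ lin)
      dL : ∀ {x} → x ∈ lower A → x ∉ lower B
      dL = Unique-disjoint (proj₂ lin)

    linearˡ : Linear A
    linearˡ = Unique-++⁻ˡ (proj₁ lin) , Unique-++⁻ˡ (proj₂ lin)

    linearʳ : Linear B
    linearʳ = Unique-++⁻ʳ (upper A) (proj₁ lin) , Unique-++⁻ʳ (lower A) (proj₂ lin)

    shared-Unique : Unique (shared A B)
    shared-Unique = ++-Unique (common-Unique (proj₁ linearˡ)) (common-Unique (proj₁ linearʳ))
      (λ p q → dU (proj₁ (∈-common⁻ p)) (proj₁ (∈-common⁻ q)))

    -- Together with `fl-split`: the same list `shared A B` disappears above and below, so joining
    -- the parts is contraction along that one list.
    fu-split : fu A ++ fu B ↭ shared A B ++ fu (A ⊗ B)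
    fu-split = subst₂ (λ s t → fu A ++ fu B ↭ (s ++ t) ++ fu (A ⊗ B))
      (frees-all (λ p q → dL q (proj₂ (∈-common⁻ p))))
      (frees-all (λ p q → dL (proj₂ (∈-common⁻ p)) q))
      (frees-++ (upper A) (upper B) (proj₁ lin))

    fl-split : fl A ++ fl B ↭ shared A B ++ fl (A ⊗ B)
    fl-split = trans (subst₂ (λ s t → fl A ++ fl B ↭ (s ++ t) ++ fl (A ⊗ B))
      (frees-all (λ p q → dU q (proj₂ (∈-common⁻ p))))
      (frees-all (λ p q → dU (proj₂ (∈-common⁻ p)) q))
      (frees-++ (lower A) (lower B) (proj₂ lin)))
      (++⁺ʳ (fl (A ⊗ B)) (trans (++⁺ (common-comm (proj₂ linearˡ) (proj₁ linearʳ)) (common-comm (proj₂ linearʳ) (proj₁ linearˡ)))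
        (++-comm (common (upper B) (lower A)) _)))

  -- Wired derivations

  -- A tag distinguishes the formula occurrences of a sequent; the subformulas
  -- of an occurrence keep its tag, so a port names one index occurrence throughout.
  Port Item : Set
  Port = ℕ × Ind
  Item = ℕ × Expr

  _≟ₚ_ : DecidableEquality Port
  _≟ₚ_ = ×ₚ.≡-dec Nat._≟_ _≟ᵢ_

  tag : ℕ → List Ind → List Port
  tag k = map (k ,_)

  links : ℕ → List Ind → List (Wire Port)
  links k = map (λ x → edge (k , x) (k , x))

  -- Duality reverses index lists, so matching an atom with its dual pairs one list with the
  -- reversal of the other. Tag `k` belongs to the negative atom, `k′` to the positive one.
  axiom-wires : ∀ {m n} → ℕ → ℕ → Vec Ind n → Vec Ind m → Vec Ind m → Vec Ind n → List (Wire Port)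
  axiom-wires k k′ us ls us′ ls′ =
    toList (zipWith (λ u l → edge (k′ , u) (k , l)) us′ (reverse ls)) ++
    toList (zipWith (λ u l → edge (k , u) (k′ , l)) (reverse us) ls′)

  -- Derivations without cut of sequents whose free upper occurrences are joined
  -- to the free lower ones by explicit wires; composing two premises may close
  -- wires into loops, and ⊥ may consume a loop.
  data D : List Item → List (Wire Port) → Set where
    axiom : ∀ {Γ W k k′ p us ls us′ ls′} →
            Γ ↭ (k , atom (neg p) us ls) ∷ (k′ , atom (pos p) us′ ls′) ∷ [] →
            W ↭ axiom-wires k k′ us ls us′ ls′ → D Γ W
    one : ∀ {Γ W k u l} → Γ ↭ [ k , atom 𝟏 (u ∷ []) (l ∷ []) ] → W ↭ [ edge (k , u) (k , l) ] → D Γ W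
    bot : ∀ {Γ Γ′ W W′ k j i x y} → Γ ↭ (k , ⊥⟨ j / i ⟩) ∷ Γ′ → D Γ′ (edge x y ∷ W′) →
          W ↭ edge x (k , i) ∷ edge (k , j) y ∷ W′ → D Γ W
    bot-loop : ∀ {Γ Γ′ W W′ k j i} → Γ ↭ (k , ⊥⟨ j / i ⟩) ∷ Γ′ → D Γ′ (loop ∷ W′) →
               W ↭ edge (k , j) (k , i) ∷ W′ → D Γ W
    par : ∀ {Γ Γ′ W k A B} → Γ ↭ (k , A ⅋ B) ∷ Γ′ →
          D ((k , A) ∷ (k , B) ∷ Γ′) (links k (shared A B) ++ W) → D Γ W
    tensor : ∀ {Γ Γ₁ Γ₂ W W₁ W₂ k A B} → Γ ↭ (k , A ⊗ B) ∷ Γ₁ ++ Γ₂ →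
             D ((k , A) ∷ Γ₁) W₁ → D ((k , B) ∷ Γ₂) W₂ →
             W₁ ++ W₂ ⟿⟨ tag k (shared A B) ⟩ W → D Γ W

  D-exchange : ∀ {Γ Γ′ W} → Γ ↭ Γ′ → D Γ W → D Γ′ W
  D-exchange p (axiom q r) = axiom (trans (↭-sym p) q) r
  D-exchange p (one q r) = one (trans (↭-sym p) q) r
  D-exchange p (bot q d r) = bot (trans (↭-sym p) q) d r
  D-exchange p (bot-loop q d r) = bot-loop (trans (↭-sym p) q) d r
  D-exchange p (par q d) = par (trans (↭-sym p) q) d
  D-exchange p (tensor q d e r) = tensor (trans (↭-sym p) q) d e r

  D-wires : ∀ {Γ W W′} → W ↭ W′ → D Γ W → D Γ W′
  D-wires p (axiom q r) = axiom q (trans (↭-sym p) r)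
  D-wires p (one q r) = one q (trans (↭-sym p) r)
  D-wires p (bot q d r) = bot q d (trans (↭-sym p) r)
  D-wires p (bot-loop q d r) = bot-loop q d (trans (↭-sym p) r)
  D-wires p (par {k = k} {A} {B} q d) = par q (D-wires (++⁺ˡ (links k (shared A B)) p) d)
  D-wires p (tensor q d e r) = tensor q d e (⟿*↭ r p)

  -- Decidability of wired derivability

  selects : ∀ {A : Set} → List A → List (A × List A)
  selects [] = []
  selects (x ∷ xs) = (x , xs) ∷ map (λ (y , ys) → y , x ∷ ys) (selects xs)

  selects-sound : ∀ {A : Set} {y : A} {ys} xs → (y , ys) ∈ selects xs → xs ↭ y ∷ ys
  selects-sound (x ∷ xs) (here refl) = refl
  selects-sound (x ∷ xs) (there p) with (y , ys) , q , refl ← ∈-map⁻ _ p =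
    trans (prep x (selects-sound xs q)) (swap _ _ refl)

  selects-∈ : ∀ {A : Set} {y : A} xs → y ∈ xs → ∃ λ zs → (y , zs) ∈ selects xs
  selects-∈ (x ∷ xs) (here refl) = xs , here refl
  selects-∈ (x ∷ xs) (there p) with zs , q ← selects-∈ xs p = x ∷ zs , there (∈-map⁺ _ q)

  selects-complete : ∀ {A : Set} {y : A} {ys} xs → xs ↭ y ∷ ys → ∃ λ zs → (y , zs) ∈ selects xs × zs ↭ ys
  selects-complete xs p with zs , q ← selects-∈ xs (↭-∷∈ p) = zs , q , drop-∷ (trans (↭-sym (selects-sound xs q)) p)

  splits : ∀ {A : Set} → List A → List (List A × List A)
  splits [] = ([] , []) ∷ []
  splits (x ∷ xs) = map (λ (ys , zs) → x ∷ ys , zs) (splits xs) ++ map (λ (ys , zs) → ys , x ∷ zs) (splits xs)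

  splits-sound : ∀ {A : Set} {ys zs : List A} xs → (ys , zs) ∈ splits xs → xs ↭ ys ++ zs
  splits-sound [] (here refl) = refl
  splits-sound (x ∷ xs) p with ∈-++⁻ (map (λ (ys , zs) → x ∷ ys , zs) (splits xs)) p
  ... | inj₁ q with (ys , zs) , r , refl ← ∈-map⁻ _ q = prep x (splits-sound xs r)
  ... | inj₂ q with (ys , zs) , r , refl ← ∈-map⁻ _ q =
    trans (prep x (splits-sound xs r)) (↭-sym (shift x ys zs))

  splits-complete : ∀ {A : Set} {ys zs : List A} xs → xs ↭ ys ++ zs →
                    ∃₂ λ ys′ zs′ → (ys′ , zs′) ∈ splits xs × ys′ ↭ ys × zs′ ↭ zs
  splits-complete {ys = []} {[]} [] p = [] , [] , here refl , refl , refl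
  splits-complete {ys = []} {z ∷ zs} [] p with () ← ∈-resp-↭ (↭-sym p) (here refl)
  splits-complete {ys = y ∷ ys} [] p with () ← ∈-resp-↭ (↭-sym p) (here refl)
  splits-complete {ys = ys} {zs} (x ∷ xs) p with ∈-++⁻ ys (∈-resp-↭ p (here refl))
  ... | inj₁ x∈ with ys₁ , q ← ∈⇒↭ x∈
      with ys′ , zs′ , r , s , t ← splits-complete xs (drop-∷ (trans p (++⁺ʳ zs q))) =
    x ∷ ys′ , zs′ , ∈-++⁺ˡ (∈-map⁺ _ r) , trans (prep x s) (↭-sym q) , t
  ... | inj₂ x∈ with zs₁ , q ← ∈⇒↭ x∈
      with ys′ , zs′ , r , s , t ← splits-complete xs (drop-∷ (trans p (trans (++⁺ˡ ys q) (shift x ys zs₁)))) =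
    ys′ , x ∷ zs′ , ∈-++⁺ʳ _ (∈-map⁺ _ r) , s , trans (prep x t) (↭-sym q)

  Wires : Set
  Wires = List (Wire Port)

  -- Derivable wirings are listed rather than tested one by one: the wires of the premises of
  -- `tensor` are not determined by those of the conclusion, whereas every list of formulas has only
  -- finitely many derivable wirings up to permutation.
  Enum : (Wires → Set) → Set
  Enum P = ∃ λ Ws → All P Ws × (∀ {W} → P W → Any (W ↭_) Ws)

  module _ {P Q : Wires → Set} where

    enum-⇔ : (∀ {W} → P W → Q W) → (∀ {W} → Q W → P W) → Enum P → Enum Q
    enum-⇔ f g (Ws , s , c) = Ws , All.map f s , c ∘ g

    enum-⊎ : Enum P → Enum Q → Enum (λ W → P W ⊎ Q W)
    enum-⊎ (Ws , s , c) (Ws′ , s′ , c′) =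
      Ws ++ Ws′ , AllP.++⁺ (All.map inj₁ s) (All.map inj₂ s′) ,
      [ AnyP.++⁺ˡ ∘ c , AnyP.++⁺ʳ Ws ∘ c′ ]′

  enum-∅ : ∀ {P : Wires → Set} → (∀ {W} → ¬ P W) → Enum P
  enum-∅ f = [] , [] , λ p → ⊥-elim (f p)

  enum-↭ : ∀ U → Enum (_↭ U)
  enum-↭ U = [ U ] , refl ∷ [] , here

  enum-∃∈ : ∀ {X : Set} {P : X → Wires → Set} (xs : List X) → (∀ {x} → x ∈ xs → Enum (P x)) →
            Enum (λ W → ∃ λ x → x ∈ xs × P x W)
  enum-∃∈ [] e = enum-∅ λ ()
  enum-∃∈ (x ∷ xs) e = enum-⇔
    [ (λ p → x , here refl , p) , (λ (y , y∈ , p) → y , there y∈ , p) ]′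
    (λ { (_ , here refl , p) → inj₁ p ; (y , there y∈ , p) → inj₂ (y , y∈ , p) })
    (enum-⊎ (e (here refl)) (enum-∃∈ xs (e ∘ there)))

  enum-× : ∀ {A : Set} {P : Wires → Set} → Dec A → (A → Enum P) → Enum (λ W → A × P W)
  enum-× (yes a) e = enum-⇔ (a ,_) proj₂ (e a)
  enum-× (no ¬a) e = enum-∅ (¬a ∘ proj₁)

  any-↭ : ∀ {U : Wires} {Us} → Any (U ↭_) Us → ∃ λ U′ → U′ ∈ Us × U ↭ U′
  any-↭ (here p) = -, here refl , p
  any-↭ (there p) = let U′ , q , r = any-↭ p in U′ , there q , r

  -- Invariance of `R` is required because an enumeration contains its wirings only up to
  -- permutation.
  enum-bind : ∀ {P : Wires → Set} {R : Wires → Wires → Set} → (∀ {U U′ W} → U ↭ U′ → R U W → R U′ W) →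
              Enum P → (∀ U → Enum (R U)) → Enum (λ W → ∃ λ U → P U × R U W)
  enum-bind resp (Us , s , c) e = enum-⇔
    (λ (U , U∈ , r) → U , All.lookup s U∈ , r)
    (λ (U , p , r) → let U′ , U′∈ , q = any-↭ (c p) in U′ , U′∈ , resp q r)
    (enum-∃∈ Us (λ {U} _ → e U))

  _≟ʷ_ : DecidableEquality (Wire Port)
  edge a b ≟ʷ edge c d = edge? _≟ₚ_ a b c d
  edge a b ≟ʷ loop = no λ ()
  loop ≟ʷ edge a b = no λ ()
  loop ≟ʷ loop = yes refl

  enum-minus : ∀ Ls U → Enum (λ W → U ↭ Ls ++ W)
  enum-minus [] U = enum-⇔ ↭-sym ↭-sym (enum-↭ U)
  enum-minus (e ∷ Ls) U = enum-⇔
    (λ { ((_ , R) , m , refl , p) → trans (selects-sound U m) (prep e p) })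
    (λ p → let R , m , q = selects-complete U p in (e , R) , m , refl , trans q refl)
    (enum-∃∈ (selects U) λ { {e′ , R} m → enum-× (e′ ≟ʷ e) λ _ → enum-minus Ls R })

  via? : ∀ x e e′ → Dec (∃₂ λ u l → e ≡ edge {Port} u x × e′ ≡ edge x l)
  via? x loop e′ = no λ ()
  via? x (edge u y) loop = no λ ()
  via? x (edge u y) (edge z l) with y ≟ₚ x | z ≟ₚ x
  ... | yes refl | yes refl = yes (u , l , refl , refl)
  ... | no y≢x | _ = no λ { (_ , _ , refl , _) → y≢x refl }
  ... | _ | no z≢x = no λ { (_ , _ , _ , refl) → z≢x refl }

  enum-⟿ : ∀ x U → Enum (U ⟿[ x ]_)
  enum-⟿ x U = enum-⇔
    [ (λ { ((_ , R) , m , (_ , R′) , m′ , (u , l , refl , refl) , p) →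
         via (trans (selects-sound U m) (prep _ (selects-sound R m′))) p })
    , (λ { ((_ , R) , m , refl , p) → cyc (selects-sound U m) p }) ]′
    (λ { (via p q) → let R , m , r = selects-complete U p ; R′ , m′ , r′ = selects-complete R r in
           inj₁ ((_ , R) , m , (_ , R′) , m′ , (_ , _ , refl , refl) , trans q (prep _ (↭-sym r′)))
       ; (cyc p q) → let R , m , r = selects-complete U p in
           inj₂ ((_ , R) , m , refl , trans q (prep _ (↭-sym r))) })
    (enum-⊎
      (enum-∃∈ (selects U) λ { {e , R} _ → enum-∃∈ (selects R) λ { {e′ , R′} _ → enum-via R′ (via? x e e′) } })
      (enum-∃∈ (selects U) λ { {e , R} _ → enum-× (e ≟ʷ edge x x) λ _ → enum-↭ (loop ∷ R) }))
    where
    enum-via : ∀ {e e′} R′ → Dec (∃₂ λ u l → e ≡ edge u x × e′ ≡ edge x l) →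
               Enum (λ W → Σ (∃₂ λ u l → e ≡ edge u x × e′ ≡ edge x l) λ (u , l , _) → W ↭ edge u l ∷ R′)
    enum-via R′ (yes (u , l , refl , refl)) =
      enum-⇔ (λ p → (u , l , refl , refl) , p) (λ { ((_ , _ , refl , refl) , p) → p }) (enum-↭ (edge u l ∷ R′))
    enum-via R′ (no ¬p) = enum-∅ (¬p ∘ proj₁)

  enum-⟿* : ∀ xs U → Enum (U ⟿⟨ xs ⟩_)
  enum-⟿* [] U = enum-⇔ (done ∘ ↭-sym) (λ { (done p) → ↭-sym p }) (enum-↭ U)
  enum-⟿* (x ∷ xs) U = enum-⇔ (λ (_ , s , t) → s ⨾ t) (λ { (s ⨾ t) → -, s , t })
    (enum-bind (λ p → ↭⟿* (↭-sym p)) (enum-⟿ x U) (enum-⟿* xs))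

  -- Merges `bot` and `bot-loop` into one relation from the wires of the premise to those of the
  -- conclusion, so that the premise can be enumerated before it is known which of the two rules
  -- applies.
  data Insert (k : ℕ) (j i : Ind) (U W : Wires) : Set where
    cut-edge : ∀ {x y R} → U ↭ edge x y ∷ R → W ↭ edge x (k , i) ∷ edge (k , j) y ∷ R → Insert k j i U W
    open-loop : ∀ {R} → U ↭ loop ∷ R → W ↭ edge (k , j) (k , i) ∷ R → Insert k j i U W

  insert-↭ : ∀ {k j i U U′ W} → U ↭ U′ → Insert k j i U W → Insert k j i U′ W
  insert-↭ p (cut-edge q r) = cut-edge (trans (↭-sym p) q) r
  insert-↭ p (open-loop q r) = open-loop (trans (↭-sym p) q) r

  enum-insert : ∀ k j i U → Enum (Insert k j i U)
  enum-insert k j i U = enum-⇔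
    (λ { ((edge x y , R) , m , p) → cut-edge (selects-sound U m) p ; ((loop , R) , m , p) → open-loop (selects-sound U m) p })
    (λ { (cut-edge p q) → let R , m , r = selects-complete U p in
           (edge _ _ , R) , m , trans q (prep _ (prep _ (↭-sym r)))
       ; (open-loop p q) → let R , m , r = selects-complete U p in (loop , R) , m , trans q (prep _ (↭-sym r)) })
    (enum-∃∈ (selects U) λ { {e , R} _ → enum-↭ (after e R) })
    where
    after : Wire Port → Wires → Wires
    after (edge x y) R = edge x (k , i) ∷ edge (k , j) y ∷ R
    after loop R = edge (k , j) (k , i) ∷ R

  size : Expr → ℕ
  size (atom p us ls) = 1
  size (A ⊗ B) = suc (size A + size B)
  size (A ⅋ B) = suc (size A + size B)

  sizes : List Item → ℕ
  sizes [] = 0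
  sizes ((k , A) ∷ Γ) = size A + sizes Γ

  sizes-↭ : ∀ {Γ Δ} → Γ ↭ Δ → sizes Γ ≡ sizes Δ
  sizes-↭ refl = refl
  sizes-↭ (prep (k , A) p) = cong (size A +_) (sizes-↭ p)
  sizes-↭ (swap {xs = Γ} (k , A) (k′ , B) p) = ≡-trans (sym (ℕₚ.+-assoc (size A) (size B) (sizes Γ)))
    (≡-trans (cong₂ _+_ (ℕₚ.+-comm (size A) (size B)) (sizes-↭ p)) (ℕₚ.+-assoc (size B) (size A) _))
  sizes-↭ (trans p q) = ≡-trans (sizes-↭ p) (sizes-↭ q)

  sizes-++ : ∀ Γ {Δ} → sizes (Γ ++ Δ) ≡ sizes Γ + sizes Δ
  sizes-++ [] = refl
  sizes-++ ((k , A) ∷ Γ) = ≡-trans (cong (size A +_) (sizes-++ Γ)) (sym (ℕₚ.+-assoc (size A) _ _))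

  -- `D` with its principal formula singled out and the residual list fixed on the nose, so that the
  -- possible last rules can be read off from the shape of the formula. An axiom counts its negative
  -- atom as principal.
  data Step (k : ℕ) : Expr → List Item → Wires → Set where
    axiom : ∀ {W k′ p us ls us′ ls′} → W ↭ axiom-wires k k′ us ls us′ ls′ →
            Step k (atom (neg p) us ls) [ k′ , atom (pos p) us′ ls′ ] W
    one : ∀ {W u l} → W ↭ [ edge (k , u) (k , l) ] → Step k (atom 𝟏 (u ∷ []) (l ∷ [])) [] W
    bot : ∀ {Γ U W j i} → D Γ U → Insert k j i U W → Step k ⊥⟨ j / i ⟩ Γ W
    par : ∀ {Γ U W A B} → D ((k , A) ∷ (k , B) ∷ Γ) U → U ↭ links k (shared A B) ++ W → Step k (A ⅋ B) Γ W
    tensor : ∀ {Γ Γ₁ Γ₂ W W₁ W₂ A B} → (Γ₁ , Γ₂) ∈ splits Γ →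
             D ((k , A) ∷ Γ₁) W₁ → D ((k , B) ∷ Γ₂) W₂ →
             W₁ ++ W₂ ⟿⟨ tag k (shared A B) ⟩ W → Step k (A ⊗ B) Γ W

  step-sound : ∀ {k A Γ W} → Step k A Γ W → D ((k , A) ∷ Γ) W
  step-sound (axiom p) = axiom refl p
  step-sound (one p) = one refl p
  step-sound (bot d (cut-edge p q)) = bot refl (D-wires p d) q
  step-sound (bot d (open-loop p q)) = bot-loop refl (D-wires p d) q
  step-sound (par d p) = par refl (D-wires p d)
  step-sound {Γ = Γ} (tensor m d e r) = tensor (prep _ (splits-sound Γ m)) d e r

  step-complete : ∀ {Γ W} → D Γ W → ∃₂ λ k A → ∃ λ Γ′ → ((k , A) , Γ′) ∈ selects Γ × Step k A Γ′ W
  step-complete {Γ} (axiom p q) with Γ′ , m , r ← selects-complete Γ p with refl ← ↭-singleton-inv r =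
    -, -, -, m , axiom q
  step-complete {Γ} (one p q) with Γ′ , m , r ← selects-complete Γ p with refl ← ↭-empty-inv r =
    -, -, -, m , one q
  step-complete {Γ} (bot p d q) with Γ′ , m , r ← selects-complete Γ p =
    -, -, -, m , bot (D-exchange (↭-sym r) d) (cut-edge refl q)
  step-complete {Γ} (bot-loop p d q) with Γ′ , m , r ← selects-complete Γ p =
    -, -, -, m , bot (D-exchange (↭-sym r) d) (open-loop refl q)
  step-complete {Γ} (par p d) with Γ′ , m , r ← selects-complete Γ p =
    -, -, -, m , par (D-exchange (prep _ (prep _ (↭-sym r))) d) refl
  step-complete {Γ} (tensor p d e s) with Γ′ , m , r ← selects-complete Γ p
    with Γ₁ , Γ₂ , m′ , q , q′ ← splits-complete Γ′ r =
    -, -, -, m , tensor m′ (D-exchange (prep _ (↭-sym q)) d) (D-exchange (prep _ (↭-sym q′)) e) s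

  enum-D : ∀ n Γ → sizes Γ ≤ n → Enum (D Γ)
  enum-step : ∀ n k A Γ → size A + sizes Γ ≤ n → Enum (Step k A Γ)

  enum-D n Γ b = enum-⇔
    (λ (((k , A) , Γ′) , m , s) → D-exchange (↭-sym (selects-sound Γ m)) (step-sound s))
    (λ d → let k , A , Γ′ , m , s = step-complete d in ((k , A) , Γ′) , m , s)
    (enum-∃∈ (selects Γ) λ { {(k , A) , Γ′} m →
      enum-step n k A Γ′ (subst (_≤ n) (sizes-↭ (selects-sound Γ m)) b) })

  enum-step n k (atom (pos p) us ls) Γ b = enum-∅ λ ()
  enum-step n k (atom (neg p) us ls) [] b = enum-∅ λ ()
  enum-step n k (atom (neg p) us ls) (_ ∷ _ ∷ _) b = enum-∅ λ ()
  enum-step n k (atom (neg p) us ls) ((k′ , _ ⊗ _) ∷ []) b = enum-∅ λ ()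
  enum-step n k (atom (neg p) us ls) ((k′ , _ ⅋ _) ∷ []) b = enum-∅ λ ()
  enum-step n k (atom (neg p) us ls) ((k′ , atom (neg _) us′ ls′) ∷ []) b = enum-∅ λ ()
  enum-step n k (atom (neg p) us ls) ((k′ , atom 𝟏 us′ ls′) ∷ []) b = enum-∅ λ ()
  enum-step n k (atom (neg p) us ls) ((k′ , atom ⊥ us′ ls′) ∷ []) b = enum-∅ λ ()
  enum-step n k (atom (neg p) us ls) ((k′ , atom (pos q) us′ ls′) ∷ []) b with p ≟ₗ q
  ... | yes refl = enum-⇔ axiom (λ { (axiom r) → r }) (enum-↭ (axiom-wires k k′ us ls us′ ls′))
  ... | no p≢q = enum-∅ λ { (axiom _) → p≢q refl }
  enum-step n k (atom 𝟏 (u ∷ []) (l ∷ [])) [] b = enum-⇔ one (λ { (one r) → r }) (enum-↭ [ edge (k , u) (k , l) ])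
  enum-step n k (atom 𝟏 (u ∷ []) (l ∷ [])) (_ ∷ _) b = enum-∅ λ ()
  enum-step (suc n) k (atom ⊥ (j ∷ []) (i ∷ [])) Γ (s≤s b) = enum-⇔
    (λ (U , d , s) → bot d s) (λ { (bot d s) → -, d , s })
    (enum-bind insert-↭ (enum-D n Γ b) (enum-insert k j i))
  enum-step (suc n) k (A ⅋ B) Γ (s≤s b) = enum-⇔
    (λ (U , d , s) → par d s) (λ { (par d s) → -, d , s })
    (enum-bind (λ p → trans (↭-sym p)) (enum-D n ((k , A) ∷ (k , B) ∷ Γ)
      (subst (_≤ n) (ℕₚ.+-assoc (size A) (size B) (sizes Γ)) b)) (enum-minus (links k (shared A B))))
  enum-step (suc n) k (A ⊗ B) Γ (s≤s b) = enum-⇔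
    (λ ((Γ₁ , Γ₂) , m , W₁ , d , W₂ , e , s) → tensor m d e s)
    (λ { (tensor m d e s) → -, m , -, d , -, e , s })
    (enum-∃∈ (splits Γ) λ { {Γ₁ , Γ₂} m →
      let c = subst (_≤ n) (cong (size A + size B +_) (≡-trans (sizes-↭ (splits-sound Γ m)) (sizes-++ Γ₁))) b in
      enum-bind (λ p (W₂ , e , s) → W₂ , e , ↭⟿* (++⁺ʳ W₂ (↭-sym p)) s)
        (enum-D n ((k , A) ∷ Γ₁) (ℕₚ.≤-trans (ℕₚ.+-mono-≤ (ℕₚ.m≤m+n (size A) (size B)) (ℕₚ.m≤m+n (sizes Γ₁) (sizes Γ₂))) c))
        λ W₁ → enum-bind (λ p s → ↭⟿* (++⁺ˡ W₁ (↭-sym p)) s)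
          (enum-D n ((k , B) ∷ Γ₂) (ℕₚ.≤-trans (ℕₚ.+-mono-≤ (ℕₚ.m≤n+m (size B) (size A)) (ℕₚ.m≤n+m (sizes Γ₂) (sizes Γ₁))) c))
          λ W₂ → enum-⟿* (tag k (shared A B)) (W₁ ++ W₂) })

  ↭? : (U W : Wires) → Dec (U ↭ W)
  ↭? [] [] = yes refl
  ↭? [] (e ∷ W) = no λ p → case-∈ (∈-resp-↭ (↭-sym p) (here refl))
    where case-∈ : ∀ {e : Wire Port} → ¬ e ∈ []
          case-∈ ()
  ↭? (e ∷ U) W with any? (e ≟ʷ_) W
  ... | no e∉ = no λ p → e∉ (∈-resp-↭ p (here refl))
  ... | yes e∈ with W′ , p ← ∈⇒↭ e∈ with ↭? U W′
  ...   | yes q = yes (trans (prep e q) (↭-sym p))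
  ...   | no ¬q = no λ q → ¬q (drop-∷ (trans q p))

  D? : ∀ Γ W → Dec (D Γ W)
  D? Γ W with Ws , s , c ← enum-D (sizes Γ) Γ ℕₚ.≤-refl with any? (↭? W) Ws
  ... | yes p = let U , U∈ , q = any-↭ p in yes (D-wires (↭-sym q) (All.lookup s U∈))
  ... | no ¬p = no λ d → ¬p (c d)

  -- Renaming, duality and balanced sequents

  -- Two renamings, one for each polarity, because the ⊥-rules substitute on one side only; their
  -- substitutions are the instances in which the other renaming is the identity.
  ren : (Ind → Ind) → (Ind → Ind) → Expr → Expr
  ren f g (atom p us ls) = atom p (Vec.map f us) (Vec.map g ls)
  ren f g (A ⊗ B) = ren f g A ⊗ ren f g B
  ren f g (A ⅋ B) = ren f g A ⅋ ren f g B

  upper-ren : ∀ f g A → upper (ren f g A) ≡ map f (upper A)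
  upper-ren f g (atom p us ls) = Vecₚ.toList-map f us
  upper-ren f g (A ⊗ B) = ≡-trans (cong₂ _++_ (upper-ren f g A) (upper-ren f g B)) (sym (map-++ f (upper A) (upper B)))
  upper-ren f g (A ⅋ B) = ≡-trans (cong₂ _++_ (upper-ren f g A) (upper-ren f g B)) (sym (map-++ f (upper A) (upper B)))

  lower-ren : ∀ f g A → lower (ren f g A) ≡ map g (lower A)
  lower-ren f g (atom p us ls) = Vecₚ.toList-map g ls
  lower-ren f g (A ⊗ B) = ≡-trans (cong₂ _++_ (lower-ren f g A) (lower-ren f g B)) (sym (map-++ g (lower A) (lower B)))
  lower-ren f g (A ⅋ B) = ≡-trans (cong₂ _++_ (lower-ren f g A) (lower-ren f g B)) (sym (map-++ g (lower A) (lower B)))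

  map-cong-∈ : ∀ {n} {f g : Ind → Ind} (xs : Vec Ind n) → (∀ {x} → x ∈ toList xs → f x ≡ g x) → Vec.map f xs ≡ Vec.map g xs
  map-cong-∈ [] e = refl
  map-cong-∈ (x ∷ xs) e = cong₂ _∷_ (e (here refl)) (map-cong-∈ xs (e ∘ there))

  ren-cong : ∀ {f g f′ g′} A → (∀ {x} → x ∈ upper A → f x ≡ f′ x) → (∀ {x} → x ∈ lower A → g x ≡ g′ x) →
             ren f g A ≡ ren f′ g′ A
  ren-cong (atom p us ls) e e′ = cong₂ (atom p) (map-cong-∈ us e) (map-cong-∈ ls e′)
  ren-cong (A ⊗ B) e e′ = cong₂ _⊗_ (ren-cong A (e ∘ ∈-++⁺ˡ) (e′ ∘ ∈-++⁺ˡ)) (ren-cong B (e ∘ ∈-++⁺ʳ _) (e′ ∘ ∈-++⁺ʳ _))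
  ren-cong (A ⅋ B) e e′ = cong₂ _⅋_ (ren-cong A (e ∘ ∈-++⁺ˡ) (e′ ∘ ∈-++⁺ˡ)) (ren-cong B (e ∘ ∈-++⁺ʳ _) (e′ ∘ ∈-++⁺ʳ _))

  ren-∘ : ∀ {f g f′ g′ : Ind → Ind} A → ren f g (ren f′ g′ A) ≡ ren (f ∘ f′) (g ∘ g′) A
  ren-∘ (atom p us ls) = cong₂ (atom p) (sym (Vecₚ.map-∘ _ _ us)) (sym (Vecₚ.map-∘ _ _ ls))
  ren-∘ (A ⊗ B) = cong₂ _⊗_ (ren-∘ A) (ren-∘ B)
  ren-∘ (A ⅋ B) = cong₂ _⅋_ (ren-∘ A) (ren-∘ B)

  ren-id : ∀ A → ren (λ x → x) (λ x → x) A ≡ A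
  ren-id (atom p us ls) = cong₂ (atom p) (Vecₚ.map-id us) (Vecₚ.map-id ls)
  ren-id (A ⊗ B) = cong₂ _⊗_ (ren-id A) (ren-id B)
  ren-id (A ⅋ B) = cong₂ _⅋_ (ren-id A) (ren-id B)

  subst↑-ren : ∀ i j A → A [ i / j ]↑ ≡ ren (replace i j) (λ x → x) A
  subst↑-ren i j (atom p us ls) = cong (atom p _) (sym (Vecₚ.map-id ls))
  subst↑-ren i j (A ⊗ B) = cong₂ _⊗_ (subst↑-ren i j A) (subst↑-ren i j B)
  subst↑-ren i j (A ⅋ B) = cong₂ _⅋_ (subst↑-ren i j A) (subst↑-ren i j B)

  subst↓-ren : ∀ i j A → A [ i / j ]↓ ≡ ren (λ x → x) (replace i j) A
  subst↓-ren i j (atom p us ls) = cong (λ us → atom p us _) (sym (Vecₚ.map-id us))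
  subst↓-ren i j (A ⊗ B) = cong₂ _⊗_ (subst↓-ren i j A) (subst↓-ren i j B)
  subst↓-ren i j (A ⅋ B) = cong₂ _⅋_ (subst↓-ren i j A) (subst↓-ren i j B)

  replace-≡ : ∀ i j → replace i j j ≡ i
  replace-≡ i j with j ≟ᵢ j
  ... | yes _ = refl
  ... | no j≢j = contradiction refl j≢j

  replace-≢ : ∀ {i j k} → k ≢ j → replace i j k ≡ k
  replace-≢ {j = j} {k} k≢j with k ≟ᵢ j
  ... | yes k≡j = contradiction k≡j k≢j
  ... | no _ = refl

  dual-ren : ∀ f g A → dual (ren f g A) ≡ ren g f (dual A)
  dual-ren f g (atom (pos p) us ls) = cong₂ (atom (neg p)) (sym (Vecₚ.map-reverse g ls)) (sym (Vecₚ.map-reverse f us))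
  dual-ren f g (atom (neg p) us ls) = cong₂ (atom (pos p)) (sym (Vecₚ.map-reverse g ls)) (sym (Vecₚ.map-reverse f us))
  dual-ren f g (atom 𝟏 us ls) = cong₂ (atom ⊥) (sym (Vecₚ.map-reverse g ls)) (sym (Vecₚ.map-reverse f us))
  dual-ren f g (atom ⊥ us ls) = cong₂ (atom 𝟏) (sym (Vecₚ.map-reverse g ls)) (sym (Vecₚ.map-reverse f us))
  dual-ren f g (A ⊗ B) = cong₂ _⅋_ (dual-ren f g B) (dual-ren f g A)
  dual-ren f g (A ⅋ B) = cong₂ _⊗_ (dual-ren f g B) (dual-ren f g A)

  dual-involutive : ∀ A → dual (dual A) ≡ A
  dual-involutive (atom (pos p) us ls) = cong₂ (atom (pos p)) (Vecₚ.reverse-involutive us) (Vecₚ.reverse-involutive ls)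
  dual-involutive (atom (neg p) us ls) = cong₂ (atom (neg p)) (Vecₚ.reverse-involutive us) (Vecₚ.reverse-involutive ls)
  dual-involutive (atom 𝟏 us ls) = cong₂ (atom 𝟏) (Vecₚ.reverse-involutive us) (Vecₚ.reverse-involutive ls)
  dual-involutive (atom ⊥ us ls) = cong₂ (atom ⊥) (Vecₚ.reverse-involutive us) (Vecₚ.reverse-involutive ls)
  dual-involutive (A ⊗ B) = cong₂ _⊗_ (dual-involutive A) (dual-involutive B)
  dual-involutive (A ⅋ B) = cong₂ _⅋_ (dual-involutive A) (dual-involutive B)

  toList-reverse-↭ : ∀ {A : Set} {n} (xs : Vec A n) → toList (reverse xs) ↭ toList xs
  toList-reverse-↭ xs = subst (_↭ toList xs) (sym (Vecₚ.toList-reverse xs)) (↭-reverse (toList xs))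

  upper-dual : ∀ A → upper (dual A) ↭ lower A
  lower-dual : ∀ A → lower (dual A) ↭ upper A
  upper-dual (atom (pos p) us ls) = toList-reverse-↭ ls
  upper-dual (atom (neg p) us ls) = toList-reverse-↭ ls
  upper-dual (atom 𝟏 us ls) = toList-reverse-↭ ls
  upper-dual (atom ⊥ us ls) = toList-reverse-↭ ls
  upper-dual (A ⊗ B) = trans (++⁺ (upper-dual B) (upper-dual A)) (++-comm (lower B) (lower A))
  upper-dual (A ⅋ B) = trans (++⁺ (upper-dual B) (upper-dual A)) (++-comm (lower B) (lower A))
  lower-dual (atom (pos p) us ls) = toList-reverse-↭ us
  lower-dual (atom (neg p) us ls) = toList-reverse-↭ us
  lower-dual (atom 𝟏 us ls) = toList-reverse-↭ us
  lower-dual (atom ⊥ us ls) = toList-reverse-↭ us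
  lower-dual (A ⊗ B) = trans (++⁺ (lower-dual B) (lower-dual A)) (++-comm (upper B) (upper A))
  lower-dual (A ⅋ B) = trans (++⁺ (lower-dual B) (lower-dual A)) (++-comm (upper B) (upper A))

  atoms-dual : ∀ A → AtomsDistinct A → AtomsDistinct (dual A)
  atoms-dual A@(atom (pos p) us ls) d = Unique-resp-↭ (trans (++-comm (toList us) _) (++⁺ (↭-sym (upper-dual A)) (↭-sym (lower-dual A)))) d
  atoms-dual A@(atom (neg p) us ls) d = Unique-resp-↭ (trans (++-comm (toList us) _) (++⁺ (↭-sym (upper-dual A)) (↭-sym (lower-dual A)))) d
  atoms-dual A@(atom 𝟏 us ls) d = Unique-resp-↭ (trans (++-comm (toList us) _) (++⁺ (↭-sym (upper-dual A)) (↭-sym (lower-dual A)))) d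
  atoms-dual A@(atom ⊥ us ls) d = Unique-resp-↭ (trans (++-comm (toList us) _) (++⁺ (↭-sym (upper-dual A)) (↭-sym (lower-dual A)))) d
  atoms-dual (A ⊗ B) (d , e) = atoms-dual B e , atoms-dual A d
  atoms-dual (A ⅋ B) (d , e) = atoms-dual B e , atoms-dual A d

  formula-dual : ∀ {A} → IsFormula A → IsFormula (dual A)
  formula-dual {A} (d , u , l) =
    atoms-dual A d , Unique-resp-↭ (↭-sym (upper-dual A)) l , Unique-resp-↭ (↭-sym (lower-dual A)) u

  formulaˡ : ∀ {A B} → IsFormula (A ⊗ B) → IsFormula A
  formulaˡ {A} {B} ((d , _) , lin) = d , linearˡ {A} {B} lin

  formulaʳ : ∀ {A B} → IsFormula (A ⊗ B) → IsFormula B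
  formulaʳ {A} {B} ((_ , d) , lin) = d , linearʳ {A} {B} lin

  frees-↭ : ∀ {us us′ ls ls′} → us ↭ us′ → ls ↭ ls′ → Unique us → frees us ls ↭ frees us′ ls′
  frees-↭ p q u = unique-↭ (frees-Unique u) (frees-Unique (Unique-resp-↭ p u))
    (λ z∈ → let a , b = ∈-frees⁻ z∈ in ∈-frees⁺ (∈-resp-↭ p a) (b ∘ ∈-resp-↭ (↭-sym q)))
    (λ z∈ → let a , b = ∈-frees⁻ z∈ in ∈-frees⁺ (∈-resp-↭ (↭-sym p) a) (b ∘ ∈-resp-↭ q))

  fu-dual : ∀ {A} → Linear A → fu (dual A) ↭ fl A
  fu-dual {A} (u , l) = ↭-sym (frees-↭ (↭-sym (upper-dual A)) (↭-sym (lower-dual A)) l)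

  fl-dual : ∀ {A} → Linear A → fl (dual A) ↭ fu A
  fl-dual {A} (u , l) = ↭-sym (frees-↭ (↭-sym (lower-dual A)) (↭-sym (upper-dual A)) u)

  fu-⊥ : ∀ {i j} → i ≢ j → fu ⊥⟨ j / i ⟩ ≡ [ j ]
  fu-⊥ i≢j = frees-all λ { (here refl) (here refl) → i≢j refl }

  fl-⊥ : ∀ {i j} → i ≢ j → fl ⊥⟨ j / i ⟩ ≡ [ i ]
  fl-⊥ i≢j = frees-all λ { (here refl) (here refl) → i≢j refl }

  FU FL : List Expr → List Ind
  FU [] = []
  FU (A ∷ Γ) = fu A ++ FU Γ
  FL [] = []
  FL (A ∷ Γ) = fl A ++ FL Γ

  FU-++ : ∀ Γ {Δ} → FU (Γ ++ Δ) ≡ FU Γ ++ FU Δ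
  FU-++ [] = refl
  FU-++ (A ∷ Γ) {Δ} = ≡-trans (cong (fu A ++_) (FU-++ Γ)) (sym (Listₚ.++-assoc (fu A) (FU Γ) (FU Δ)))

  FL-++ : ∀ Γ {Δ} → FL (Γ ++ Δ) ≡ FL Γ ++ FL Δ
  FL-++ [] = refl
  FL-++ (A ∷ Γ) {Δ} = ≡-trans (cong (fl A ++_) (FL-++ Γ)) (sym (Listₚ.++-assoc (fl A) (FL Γ) (FL Δ)))

  FU-↭ : ∀ {Γ Δ} → Γ ↭ Δ → FU Γ ↭ FU Δ
  FU-↭ refl = refl
  FU-↭ (prep A p) = ++⁺ˡ (fu A) (FU-↭ p)
  FU-↭ (swap A B p) = trans (++⁺ˡ (fu A) (++⁺ˡ (fu B) (FU-↭ p))) (shifts (fu A) (fu B))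
  FU-↭ (trans p q) = trans (FU-↭ p) (FU-↭ q)

  FL-↭ : ∀ {Γ Δ} → Γ ↭ Δ → FL Γ ↭ FL Δ
  FL-↭ refl = refl
  FL-↭ (prep A p) = ++⁺ˡ (fl A) (FL-↭ p)
  FL-↭ (swap A B p) = trans (++⁺ˡ (fl A) (++⁺ˡ (fl B) (FL-↭ p))) (shifts (fl A) (fl B))
  FL-↭ (trans p q) = trans (FL-↭ p) (FL-↭ q)

  ∈-FU⁺ : ∀ {Γ A x} → A ∈ Γ → x ∈ fu A → x ∈ FU Γ
  ∈-FU⁺ (here refl) x∈ = ∈-++⁺ˡ x∈
  ∈-FU⁺ {B ∷ Γ} (there A∈) x∈ = ∈-++⁺ʳ (fu B) (∈-FU⁺ A∈ x∈)

  ∈-FL⁺ : ∀ {Γ A x} → A ∈ Γ → x ∈ fl A → x ∈ FL Γ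
  ∈-FL⁺ (here refl) x∈ = ∈-++⁺ˡ x∈
  ∈-FL⁺ {B ∷ Γ} (there A∈) x∈ = ∈-++⁺ʳ (fl B) (∈-FL⁺ A∈ x∈)

  ∈-FU⁻ : ∀ Γ {x} → x ∈ FU Γ → ∃ λ A → A ∈ Γ × x ∈ fu A
  ∈-FU⁻ (A ∷ Γ) x∈ with ∈-++⁻ (fu A) x∈
  ... | inj₁ p = A , here refl , p
  ... | inj₂ p = let B , q , r = ∈-FU⁻ Γ p in B , there q , r

  ∈-FL⁻ : ∀ Γ {x} → x ∈ FL Γ → ∃ λ A → A ∈ Γ × x ∈ fl A
  ∈-FL⁻ (A ∷ Γ) x∈ with ∈-++⁻ (fl A) x∈
  ... | inj₁ p = A , here refl , p
  ... | inj₂ p = let B , q , r = ∈-FL⁻ Γ p in B , there q , r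

  count : Ind → List Ind → ℕ
  count i xs = length (filter (i ≟ᵢ_) xs)

  count-++ : ∀ i xs {ys} → count i (xs ++ ys) ≡ count i xs + count i ys
  count-++ i xs = ≡-trans (cong length (filter-++ (i ≟ᵢ_) xs _)) (length-++ (filter (i ≟ᵢ_) xs))

  count-∉ : ∀ {i xs} → i ∉ xs → count i xs ≡ 0
  count-∉ {i} {[]} i∉ = refl
  count-∉ {i} {x ∷ xs} i∉ with i ≟ᵢ x
  ... | yes refl = contradiction (here refl) i∉
  ... | no _ = count-∉ (i∉ ∘ there)

  count-∈ : ∀ {i xs} → i ∈ xs → ∃ λ n → count i xs ≡ suc n
  count-∈ {i} {x ∷ xs} i∈ with i ≟ᵢ x | i∈
  ... | yes _ | _ = -, refl
  ... | no i≢x | here i≡x = contradiction i≡x i≢x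
  ... | no _ | there i∈ = count-∈ i∈

  count-Unique : ∀ {i xs} → Unique xs → i ∈ xs → count i xs ≡ 1
  count-Unique {i} {x ∷ xs} u i∈ with i ≟ᵢ x | i∈
  ... | yes refl | _ = cong suc (count-∉ (head-∉ u))
  ... | no i≢x | here i≡x = contradiction i≡x i≢x
  count-Unique (_ ∷ u) _ | no _ | there i∈ = count-Unique u i∈

  -- The calculus defines freeness by counting, the proof works with membership; one occurrence of
  -- each polarity would already count two.
  single⇒∉ : ∀ {i us ls} → count i (us ++ ls) ≡ 1 → i ∈ us → i ∉ ls
  single⇒∉ {i} {us} {ls} e i∈us i∈ls with m , p ← count-∈ i∈us | n , q ← count-∈ i∈ls
    with () ← ≡-trans (sym (ℕₚ.+-suc m n)) (ℕₚ.suc-injective (≡-trans (sym (≡-trans (count-++ i us) (cong₂ _+_ p q))) e))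

  ∉⇒single : ∀ {i us ls} → Unique us → i ∈ us → i ∉ ls → count i (us ++ ls) ≡ 1
  ∉⇒single {i} {us} u i∈ i∉ = ≡-trans (count-++ i us) (cong₂ _+_ (count-Unique u i∈) (count-∉ i∉))

  count-↭ : ∀ {i xs ys} → xs ↭ ys → count i xs ≡ count i ys
  count-↭ {i} p = ↭-length (filter-↭ (i ≟ᵢ_) p)

  count-comm : ∀ i us {ls} → count i (us ++ ls) ≡ count i (ls ++ us)
  count-comm i us {ls} = count-↭ (++-comm us ls)

  FI↑⇒fu : ∀ A {x} → FI↑ A x → x ∈ fu A
  FI↑⇒fu A (e , x∈) = ∈-frees⁺ x∈ (single⇒∉ e x∈)

  FI↓⇒fl : ∀ A {x} → FI↓ A x → x ∈ fl A
  FI↓⇒fl A {x} (e , x∈) = ∈-frees⁺ x∈ (single⇒∉ (≡-trans (count-comm x (lower A)) e) x∈)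

  fu⇒FI↑ : ∀ A {x} → Linear A → x ∈ fu A → FI↑ A x
  fu⇒FI↑ A (u , l) x∈ = let a , b = ∈-frees⁻ x∈ in ∉⇒single u a b , a

  fl⇒FI↓ : ∀ A {x} → Linear A → x ∈ fl A → FI↓ A x
  fl⇒FI↓ A {x} (u , l) x∈ = let a , b = ∈-frees⁻ x∈ in ≡-trans (count-comm x (upper A)) (∉⇒single l a b) , a

  -- `IsSequent` with lists in place of predicates: on duplicate-free lists the equality of the sets
  -- of free indices becomes a permutation, from which common parts can be cancelled.
  Balanced : List Expr → Set
  Balanced Γ = All IsFormula Γ × Unique (FU Γ) × FU Γ ↭ FL Γ

  FI↑*⇒FU : ∀ {Γ x} → FI↑* Γ x → x ∈ FU Γ
  FI↑*⇒FU {A ∷ _} (here p) = ∈-++⁺ˡ (FI↑⇒fu A p)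
  FI↑*⇒FU {A ∷ Γ} (there p) = ∈-++⁺ʳ (fu A) (FI↑*⇒FU p)

  FI↓*⇒FL : ∀ {Γ x} → FI↓* Γ x → x ∈ FL Γ
  FI↓*⇒FL {A ∷ _} (here p) = ∈-++⁺ˡ (FI↓⇒fl A p)
  FI↓*⇒FL {A ∷ Γ} (there p) = ∈-++⁺ʳ (fl A) (FI↓*⇒FL p)

  FU⇒FI↑* : ∀ {Γ x} → All IsFormula Γ → x ∈ FU Γ → FI↑* Γ x
  FU⇒FI↑* {A ∷ Γ} ((_ , lin) ∷ f) x∈ with ∈-++⁻ (fu A) x∈
  ... | inj₁ p = here (fu⇒FI↑ A lin p)
  ... | inj₂ p = there (FU⇒FI↑* f p)

  FL⇒FI↓* : ∀ {Γ x} → All IsFormula Γ → x ∈ FL Γ → FI↓* Γ x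
  FL⇒FI↓* {A ∷ Γ} ((_ , lin) ∷ f) x∈ with ∈-++⁻ (fl A) x∈
  ... | inj₁ p = here (fl⇒FI↓ A lin p)
  ... | inj₂ p = there (FL⇒FI↓* f p)

  context-FU : ∀ {Γ} → IsContext Γ → Unique (FU Γ) × Unique (FL Γ)
  context-FU {[]} c = [] , []
  context-FU {A ∷ Γ} ((a , lin) ∷ f , c ∷ cs) with u , l ← context-FU (f , cs) =
    ++-Unique (frees-Unique (proj₁ lin)) u (λ p q → let B , B∈ , r = ∈-FU⁻ Γ q in
      proj₁ (All.lookup c B∈) _ (fu⇒FI↑ A lin p , fu⇒FI↑ B (proj₂ (All.lookup f B∈)) r)) ,
    ++-Unique (frees-Unique (proj₂ lin)) l (λ p q → let B , B∈ , r = ∈-FL⁻ Γ q in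
      proj₂ (All.lookup c B∈) _ (fl⇒FI↓ A lin p , fl⇒FI↓ B (proj₂ (All.lookup f B∈)) r))

  FU-context : ∀ {Γ} → All IsFormula Γ → Unique (FU Γ) → Unique (FL Γ) → IsContext Γ
  FU-context {[]} f u l = [] , []
  FU-context {A ∷ Γ} (a ∷ f) u l = a ∷ f ,
    All.tabulate (λ {B} B∈ →
      (λ x (p , q) → Unique-disjoint u (FI↑⇒fu A p) (∈-FU⁺ B∈ (FI↑⇒fu B q))) ,
      (λ x (p , q) → Unique-disjoint l (FI↓⇒fl A p) (∈-FL⁺ B∈ (FI↓⇒fl B q)))) ∷
    proj₂ (FU-context f (Unique-++⁻ʳ (fu A) u) (Unique-++⁻ʳ (fl A) l))

  sequent⇒balanced : ∀ {Γ} → IsSequent Γ → Balanced Γ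
  sequent⇒balanced {Γ} (c@(f , _) , to , from) with u , l ← context-FU c =
    f , u , unique-↭ u l (λ z∈ → FI↓*⇒FL {Γ} (to (FU⇒FI↑* f z∈))) (λ z∈ → FI↑*⇒FU {Γ} (from (FL⇒FI↓* f z∈)))

  balanced⇒sequent : ∀ {Γ} → Balanced Γ → IsSequent Γ
  balanced⇒sequent {Γ} (f , u , p) = FU-context f u (Unique-resp-↭ p u) ,
    (λ x∈ → FL⇒FI↓* f (∈-resp-↭ p (FI↑*⇒FU {Γ} x∈))) , (λ x∈ → FU⇒FI↑* f (∈-resp-↭ (↭-sym p) (FI↓*⇒FL {Γ} x∈)))

  balanced-↭ : ∀ {Γ Δ} → Γ ↭ Δ → Balanced Γ → Balanced Δ
  balanced-↭ p (f , u , q) = All-resp-↭ p f , Unique-resp-↭ (FU-↭ p) u , trans (FU-↭ (↭-sym p)) (trans q (FL-↭ p))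

  derivable⇒balanced : ∀ {Γ} → ⊢ Γ → Balanced Γ
  derivable⇒balanced (exchange p d) = balanced-↭ p (derivable⇒balanced d)
  derivable⇒balanced (id p us ls s) = sequent⇒balanced s
  derivable⇒balanced (cut s _ _) = sequent⇒balanced s
  derivable⇒balanced (⊗-rule s _ _) = sequent⇒balanced s
  derivable⇒balanced (⅋-rule s _) = sequent⇒balanced s
  derivable⇒balanced (⊥→ s _ _ _) = sequent⇒balanced s
  derivable⇒balanced (⊥← s _ _ _) = sequent⇒balanced s

  -- Phase semantics

  collect : (Expr → List Ind) → List Item → List Port
  collect f [] = []
  collect f ((k , A) ∷ Γ) = tag k (f A) ++ collect f Γ

  collect-++ : ∀ f Γ {Δ} → collect f (Γ ++ Δ) ≡ collect f Γ ++ collect f Δ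
  collect-++ f [] = refl
  collect-++ f ((k , A) ∷ Γ) = ≡-trans (cong (tag k (f A) ++_) (collect-++ f Γ)) (sym (Listₚ.++-assoc (tag k (f A)) _ _))

  collect-↭ : ∀ f {Γ Δ} → Γ ↭ Δ → collect f Γ ↭ collect f Δ
  collect-↭ f refl = refl
  collect-↭ f (prep (k , A) p) = ++⁺ˡ (tag k (f A)) (collect-↭ f p)
  collect-↭ f (swap (k , A) (k′ , B) p) =
    trans (++⁺ˡ (tag k (f A)) (++⁺ˡ (tag k′ (f B)) (collect-↭ f p))) (shifts (tag k (f A)) (tag k′ (f B)))
  collect-↭ f (trans p q) = trans (collect-↭ f p) (collect-↭ f q)

  collect-mono : ∀ {f g : Expr → List Ind} → (∀ A {x} → x ∈ f A → x ∈ g A) → ∀ Γ {p} → p ∈ collect f Γ → p ∈ collect g Γ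
  collect-mono {f} {g} h ((k , A) ∷ Γ) p∈ with ∈-++⁻ (tag k (f A)) p∈
  ... | inj₁ q with x , x∈ , refl ← ∈-map⁻ (k ,_) q = ∈-++⁺ˡ (∈-map⁺ (k ,_) (h A x∈))
  ... | inj₂ q = ∈-++⁺ʳ _ (collect-mono h Γ q)

  tag-Unique : ∀ {k xs} → Unique xs → Unique (tag k xs)
  tag-Unique = UniqueP.map⁺ λ { refl → refl }

  tag-Unique⁻ : ∀ {k xs} → Unique (tag k xs) → Unique xs
  tag-Unique⁻ = UniqueP.map⁻

  collect-Unique : ∀ {f g : Expr → List Ind} → (∀ A {x} → x ∈ f A → x ∈ g A) → (∀ A → Unique (g A) → Unique (f A)) →
                   ∀ Γ → Unique (collect g Γ) → Unique (collect f Γ)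
  collect-Unique h h′ [] u = []
  collect-Unique {f} {g} h h′ ((k , A) ∷ Γ) u =
    ++-Unique (tag-Unique (h′ A (tag-Unique⁻ (Unique-++⁻ˡ u)))) (collect-Unique h h′ Γ (Unique-++⁻ʳ (tag k (g A)) u))
      (λ p q → Unique-disjoint u (mono p) (collect-mono h Γ q))
    where
    mono : ∀ {p} → p ∈ tag k (f A) → p ∈ tag k (g A)
    mono p with x , x∈ , refl ← ∈-map⁻ (k ,_) p = ∈-map⁺ (k ,_) (h A x∈)

  ups lows : List Item → List Port
  ups = collect fu
  lows = collect fl

  -- Formulas split off from one item keep its tag, so tags alone do not separate the members of a
  -- list. What matters is that no port occurs twice in one polarity, which makes wires ending at
  -- ports functional.
  Apart : List Item → Set
  Apart Γ = Unique (collect upper Γ) × Unique (collect lower Γ)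

  apart-↭ : ∀ {Γ Δ} → Γ ↭ Δ → Apart Γ → Apart Δ
  apart-↭ p (u , l) = Unique-resp-↭ (collect-↭ upper p) u , Unique-resp-↭ (collect-↭ lower p) l

  apart-++ˡ : ∀ {Γ} Δ → Apart (Γ ++ Δ) → Apart Γ
  apart-++ˡ {Γ} Δ (u , l) = Unique-++⁻ˡ (subst Unique (collect-++ upper Γ) u) , Unique-++⁻ˡ (subst Unique (collect-++ lower Γ) l)

  apart-++ʳ : ∀ Γ {Δ} → Apart (Γ ++ Δ) → Apart Δ
  apart-++ʳ Γ (u , l) = Unique-++⁻ʳ _ (subst Unique (collect-++ upper Γ) u) , Unique-++⁻ʳ _ (subst Unique (collect-++ lower Γ) l)

  ups-Unique : ∀ Γ → Apart Γ → Unique (ups Γ)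
  ups-Unique Γ (u , _) = collect-Unique {fu} (λ A → proj₁ ∘ ∈-frees⁻) (λ A → frees-Unique) Γ u

  lows-Unique : ∀ Γ → Apart Γ → Unique (lows Γ)
  lows-Unique Γ (_ , l) = collect-Unique {fl} (λ A → proj₁ ∘ ∈-frees⁻) (λ A → frees-Unique) Γ l

  apart-⅋ : ∀ k A B Γ → Apart ((k , A ⅋ B) ∷ Γ) → Apart ((k , A) ∷ (k , B) ∷ Γ)
  apart-⅋ k A B Γ (u , l) = subst Unique (e upper refl) u , subst Unique (e lower refl) l
    where
    e : ∀ f → f (A ⅋ B) ≡ f A ++ f B → collect f ((k , A ⅋ B) ∷ Γ) ≡ collect f ((k , A) ∷ (k , B) ∷ Γ)
    e f eq = ≡-trans (cong (λ xs → tag k xs ++ collect f Γ) eq) (≡-trans (cong (_++ collect f Γ) (map-++ (k ,_) (f A) (f B)))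
      (Listₚ.++-assoc (tag k (f A)) (tag k (f B)) (collect f Γ)))

  number : ℕ → List Expr → List Item
  number k [] = []
  number k (A ∷ Γ) = (k , A) ∷ number (suc k) Γ

  collect-number : ∀ f k Γ {p} → p ∈ collect f (number k Γ) → k ≤ proj₁ p
  collect-number f k (A ∷ Γ) p∈ with ∈-++⁻ (tag k (f A)) p∈
  ... | inj₁ q with _ , _ , refl ← ∈-map⁻ (k ,_) q = ℕₚ.≤-refl
  ... | inj₂ q = ℕₚ.<⇒≤ (collect-number f (suc k) Γ q)

  number-Unique : ∀ f k {Γ} → All (Unique ∘ f) Γ → Unique (collect f (number k Γ))
  number-Unique f k [] = []
  number-Unique f k {A ∷ Γ} (u ∷ us) = ++-Unique (tag-Unique u) (number-Unique f (suc k) us) disj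
    where
    disj : ∀ {p} → p ∈ tag k (f A) → p ∉ collect f (number (suc k) Γ)
    disj p q with _ , _ , refl ← ∈-map⁻ (k ,_) p = ℕₚ.<-irrefl refl (collect-number f (suc k) Γ q)

  apart-number : ∀ k {Γ} → All IsFormula Γ → Apart (number k Γ)
  apart-number k fs = number-Unique upper k (All.map (proj₁ ∘ proj₂) fs) , number-Unique lower k (All.map (proj₂ ∘ proj₂) fs)

  -- A wire joining the upper occurrence of an index in one formula to the lower one in another.
  record Joint : Set where
    constructor joint
    field
      source target : ℕ
      name : Ind

  upper-port lower-port : Joint → Port
  upper-port (joint k k′ x) = k , x
  lower-port (joint k k′ x) = k′ , x

  wire : Joint → Wire Port
  wire z = edge (upper-port z) (lower-port z)

  -- A wire of a context ends at an occurrence inside the context or at an interface index of the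
  -- formula for which the context stands. The latter ends are contracted when contexts are plugged
  -- together.
  data End : Set where
    port : Port → End
    idx  : Ind → End

  _≟ₑ_ : DecidableEquality End
  port p ≟ₑ port q with p ≟ₚ q
  ... | yes refl = yes refl
  ... | no p≢q = no λ { refl → p≢q refl }
  port p ≟ₑ idx x = no λ ()
  idx x ≟ₑ port p = no λ ()
  idx x ≟ₑ idx y with x ≟ᵢ y
  ... | yes refl = yes refl
  ... | no x≢y = no λ { refl → x≢y refl }

  EWires : Set
  EWires = List (Wire End)

  -- (Γ , W) has the same dangling indices as a formula with the free upper
  -- indices U and the free lower indices L: an index in U is the lower end of a wire.
  record Typed (U L : List Ind) (Γ : List Item) (W : EWires) : Set where
    constructor typed
    field
      typed-upper : uppers W ↭ map port (ups Γ) ++ map idx L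
      typed-lower : lowers W ↭ map port (lows Γ) ++ map idx U
  open Typed

  typed-resp : ∀ {U U′ L L′ Γ W} → U ↭ U′ → L ↭ L′ → Typed U L Γ W → Typed U′ L′ Γ W
  typed-resp {Γ = Γ} p q (typed t t′) =
    typed (trans t (++⁺ˡ (map port (ups Γ)) (map⁺ idx q))) (trans t′ (++⁺ˡ (map port (lows Γ)) (map⁺ idx p)))

  typed-++ : ∀ {U U′ L L′ Γ Γ′ W W′} → Typed U L Γ W → Typed U′ L′ Γ′ W′ → Typed (U ++ U′) (L ++ L′) (Γ ++ Γ′) (W ++ W′)
  typed-++ {U} {U′} {L} {L′} {Γ} {Γ′} {W} (typed t t′) (typed s s′) = typed
    (subst₂ _↭_ (sym (uppers-++ W)) (sym (cong₂ _++_ (≡-trans (cong (map port) (collect-++ fu Γ)) (map-++ port (ups Γ) _)) (map-++ idx L L′)))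
      (trans (++⁺ t s) (solve 4 (λ a b c d → (a ⊕ b) ⊕ c ⊕ d ⊜ (a ⊕ c) ⊕ b ⊕ d) refl (map port (ups Γ)) (map idx L) (map port (ups Γ′)) (map idx L′))))
    (subst₂ _↭_ (sym (lowers-++ W)) (sym (cong₂ _++_ (≡-trans (cong (map port) (collect-++ fl Γ)) (map-++ port (lows Γ) _)) (map-++ idx U U′)))
      (trans (++⁺ t′ s′) (solve 4 (λ a b c d → (a ⊕ b) ⊕ c ⊕ d ⊜ (a ⊕ c) ⊕ b ⊕ d) refl (map port (lows Γ)) (map idx U) (map port (lows Γ′)) (map idx U′))))

  ports-idx-Unique : ∀ {ps xs} → Unique ps → Unique xs → Unique (map port ps ++ map idx xs)
  ports-idx-Unique u v = ++-Unique (UniqueP.map⁺ (λ { refl → refl }) u) (UniqueP.map⁺ (λ { refl → refl }) v) disj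
    where
    disj : ∀ {ps xs z} → z ∈ map port ps → z ∉ map idx xs
    disj p q with _ , _ , refl ← ∈-map⁻ port p with _ , _ , () ← ∈-map⁻ idx q

  typed-functional : ∀ {U L Γ W} → Unique U → Unique L → Apart Γ → Typed U L Γ W → Functional W
  typed-functional {Γ = Γ} u l a (typed t t′) =
    Unique-resp-↭ (↭-sym t) (ports-idx-Unique (ups-Unique Γ a) l) ,
    Unique-resp-↭ (↭-sym t′) (ports-idx-Unique (lows-Unique Γ a) u)

  contract-typed : ∀ Int {U L U′ L′ Γ W} → U ↭ U′ ++ Int → L ↭ L′ ++ Int → Typed U L Γ W →
                   ∃ λ W′ → W ⟿⟨ map idx Int ⟩ W′ × Typed U′ L′ Γ W′
  contract-typed Int {U} {L} {U′} {L′} {Γ} {W} p q t =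
    let W′ , s , r , r′ = contract* (map idx Int) W (move L q (map port (ups Γ)) (typed-upper t)) (move U p (map port (lows Γ)) (typed-lower t))
    in W′ , s , typed r r′
    where
    move : ∀ {es} X {X′} → X ↭ X′ ++ Int → ∀ ps → es ↭ ps ++ map idx X → es ↭ map idx Int ++ ps ++ map idx X′
    move X {X′} q ps t = trans t (trans (++⁺ˡ ps (trans (map⁺ idx q) (↭-reflexive (map-++ idx X′ Int))))
      (solve 3 (λ a b c → a ⊕ b ⊕ c ⊜ c ⊕ a ⊕ b) refl ps (map idx X′) (map idx Int)))

  -- The pole of the phase semantics. As the list of contracted indices is existential, the pole is
  -- stable under contraction in both directions, `D̂-back` and `D̂-forth`.
  D̂ : List Item → EWires → Set
  D̂ Γ W = ∃₂ λ xs V → W ⟿⟨ map idx xs ⟩ map (mapWire port) V × D Γ V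

  D̂-resp : ∀ {Γ Γ′ W W′} → Γ ↭ Γ′ → W ↭ W′ → D̂ Γ W → D̂ Γ′ W′
  D̂-resp p q (xs , V , s , d) = xs , V , ↭⟿* (↭-sym q) s , D-exchange p d

  D̂-swap : ∀ Γ {Δ} W {W′} → D̂ (Γ ++ Δ) (W ++ W′) → D̂ (Δ ++ Γ) (W′ ++ W)
  D̂-swap Γ {Δ} W {W′} = D̂-resp (++-comm Γ Δ) (++-comm W W′)

  D̂-back : ∀ {Γ W W′} Int → W ⟿⟨ map idx Int ⟩ W′ → D̂ Γ W′ → D̂ Γ W
  D̂-back {W = W} Int s (xs , V , t , d) =
    Int ++ xs , V , subst (W ⟿⟨_⟩ _) (sym (map-++ idx Int xs)) (⟿*-trans s t) , d

  ⊆-map : ∀ {A B : Set} {f : A → B} {xs} zs → (∀ {z} → z ∈ zs → z ∈ map f xs) → ∃ λ ys → zs ≡ map f ys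
  ⊆-map [] h = [] , refl
  ⊆-map {f = f} (z ∷ zs) h with y , _ , refl ← ∈-map⁻ f (h (here refl)) with ys , refl ← ⊆-map zs (h ∘ there) = y ∷ ys , refl

  idx∉ports : ∀ {x} V → idx x ∉ uppers (map (mapWire port) V)
  idx∉ports V i with _ , _ , () ← ∈-map⁻ port (subst (_ ∈_) (uppers-map port V) i)

  -- The final wires end at ports only, so every index in `Int` is contracted somewhere along the
  -- given sequence; by confluence it can be contracted first.
  D̂-forth : ∀ {Γ W W′} Int → Functional W → W ⟿⟨ map idx Int ⟩ W′ → D̂ Γ W → D̂ Γ W′
  D̂-forth Int f s (xs , V , t , d)
    with zs , t′ , sub ← strip* _≟ₑ_ f s t (λ { x∈ → let _ , _ , e = ∈-map⁻ idx x∈ in subst (_∉ _) (sym e) (idx∉ports V) })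
    with ys , refl ← ⊆-map zs sub = ys , V , t′ , d

  mapWire-port-inj : ∀ {V V′ : Wires} → map (mapWire port) V ≡ map (mapWire port) V′ → V ≡ V′
  mapWire-port-inj {[]} {[]} e = refl
  mapWire-port-inj {edge a b ∷ V} {edge c d ∷ V′} e with refl , e′ ← Listₚ.∷-injective e = cong (_ ∷_) (mapWire-port-inj e′)
  mapWire-port-inj {edge a b ∷ V} {loop ∷ V′} ()
  mapWire-port-inj {loop ∷ V} {edge _ _ ∷ V′} ()
  mapWire-port-inj {loop ∷ V} {loop ∷ V′} e = cong (loop ∷_) (mapWire-port-inj (proj₂ (Listₚ.∷-injective e)))

  -- Wires between ports offer no interface index to contract, so the contraction sequence is empty.
  D̂-ports : ∀ {Γ} V → D̂ Γ (map (mapWire port) V) → D Γ V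
  D̂-ports V ([] , V′ , done p , d) with V″ , e , q ← ↭-map-inv (mapWire port) p with refl ← mapWire-port-inj {V′} e = D-wires (↭-sym q) d
  D̂-ports V (x ∷ xs , V′ , s ⨾ _ , d) = contradiction (∈-resp-↭ (↭-sym (proj₁ (⟿-ends s))) (here refl)) (idx∉ports V)

  Ctx : Set₁
  Ctx = List Item → EWires → Set

  -- Tests have the opposite interface, because an upper index of one side is matched with a lower
  -- one of the other. `Apart` demands that they use other ports, so that the combined wiring has
  -- unique ends.
  data Orth (U L : List Ind) (X : Ctx) (Γ : List Item) (W : EWires) : Set where
    orth : Typed U L Γ W → (∀ {Ξ N} → Typed L U Ξ N → X Ξ N → Apart (Γ ++ Ξ) → D̂ (Γ ++ Ξ) (W ++ N)) → Orth U L X Γ W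

  orth-typed : ∀ {U L X Γ W} → Orth U L X Γ W → Typed U L Γ W
  orth-typed (orth t _) = t

  orth-app : ∀ {U L X Γ W Ξ N} → Orth U L X Γ W → Typed L U Ξ N → X Ξ N → Apart (Γ ++ Ξ) → D̂ (Γ ++ Ξ) (W ++ N)
  orth-app (orth _ f) = f

  orth-anti : ∀ {U U′ L L′} {X Y : Ctx} → U ↭ U′ → L ↭ L′ → (∀ {Ξ N} → Y Ξ N → X Ξ N) →
              ∀ {Γ W} → Orth U L X Γ W → Orth U′ L′ Y Γ W
  orth-anti p q h (orth t f) = orth (typed-resp p q t) λ t′ y → f (typed-resp (↭-sym q) (↭-sym p) t′) (h y)

  orth² : ∀ {U L} {X : Ctx} {Γ W} → Typed U L Γ W → X Γ W → Orth U L (Orth L U X) Γ W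
  orth² {Γ = Γ} {W} t x = orth t λ {Ξ} {N} _ o a →
    D̂-swap Ξ N (orth-app o t x (apart-↭ (++-comm Γ Ξ) a))

  orth³ : ∀ {U L} {X : Ctx} {Γ W} → Orth U L (Orth L U (Orth U L X)) Γ W → Orth U L X Γ W
  orth³ (orth t f) = orth t λ t′ x → f t′ (orth² t′ x)

  -- A single occurrence of the literal, wired to the interface `us`, `ls`. Only the wiring matters,
  -- so its tag and its own index names are arbitrary.
  data Generator (p : Lit) (us : Vec Ind (proj₁ (valency p))) (ls : Vec Ind (proj₂ (valency p))) : Ctx where
    generator : ∀ k us′ ls′ → Generator p us ls [ k , atom (pos p) us′ ls′ ]
      (toList (zipWith (λ u′ u → edge (port (k , u′)) (idx u)) us′ us) ++
       toList (zipWith (λ l l′ → edge (idx l) (port (k , l′))) ls ls′))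

  -- ⊥ is generated by a context without formulas: one wire between its two interface indices.
  -- Plugging it in merely prolongs a wire, which is all that the ⊥-rules do to a matching.
  data Bare : Vec Ind 1 → Vec Ind 1 → Ctx where
    bare : ∀ {j i} → Bare (j ∷ []) (i ∷ []) [] [ edge (idx i) (idx j) ]

  data Pair (S : List Ind) (X Y : Ctx) : Ctx where
    pair : ∀ {Θ Ξ Ξ′ N N′ C Int} → X Ξ N → Y Ξ′ N′ → Θ ↭ Ξ ++ Ξ′ → Int ↭ S →
           N ++ N′ ⟿⟨ map idx Int ⟩ C → Pair S X Y Θ C

  pr co : Expr → Ctx → Ctx
  pr A = Orth (fu A) (fl A)
  co A = Orth (fl A) (fu A)

  -- K A consists of the contexts that can replace A in any sequent.
  K : Expr → Ctx
  K A@(atom (pos p) us ls) = pr A (co A (Generator p us ls))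
  K A@(atom (neg p) us ls) = pr A (Generator p (reverse ls) (reverse us))
  K A@(atom ⊥ us ls) = pr A (co A (Bare us ls))
  K A@(atom 𝟏 us ls) = pr A (Bare (reverse ls) (reverse us))
  K (A ⊗ B) = pr (A ⊗ B) (Pair (shared A B) (co A (K A)) (co B (K B)))
  K (A ⅋ B) = pr (A ⅋ B) (co (A ⅋ B) (Pair (shared A B) (K A) (K B)))

  K-typed : ∀ A {Γ W} → K A Γ W → Typed (fu A) (fl A) Γ W
  K-typed (atom (pos p) us ls) = orth-typed
  K-typed (atom (neg p) us ls) = orth-typed
  K-typed (atom ⊥ us ls) = orth-typed
  K-typed (atom 𝟏 us ls) = orth-typed
  K-typed (A ⊗ B) = orth-typed
  K-typed (A ⅋ B) = orth-typed

  K-closed : ∀ A {Γ W} → pr A (co A (K A)) Γ W → K A Γ W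
  K-closed (atom (pos p) us ls) = orth³
  K-closed (atom (neg p) us ls) = orth³
  K-closed (atom ⊥ us ls) = orth³
  K-closed (atom 𝟏 us ls) = orth³
  K-closed (A ⊗ B) = orth³
  K-closed (A ⅋ B) = orth³

  shared-comm : ∀ {A B} → Linear (A ⊗ B) → shared (dual B) (dual A) ↭ shared A B
  shared-comm {A} {B} lin = ++⁺
    (trans (common-resp (upper-dual B) (lower-dual A) (proj₂ (linearʳ {A} {B} lin))) (common-comm (proj₂ (linearʳ {A} {B} lin)) (proj₁ (linearˡ {A} {B} lin))))
    (trans (common-resp (upper-dual A) (lower-dual B) (proj₂ (linearˡ {A} {B} lin))) (common-comm (proj₂ (linearˡ {A} {B} lin)) (proj₁ (linearʳ {A} {B} lin))))
    where
    common-resp : ∀ {us us′ ls ls′} → us ↭ us′ → ls ↭ ls′ → Unique us′ → common us ls ↭ common us′ ls′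
    common-resp p q u = unique-↭ (common-Unique (Unique-resp-↭ (↭-sym p) u)) (common-Unique u)
      (λ z∈ → let a , b = ∈-common⁻ z∈ in ∈-common⁺ (∈-resp-↭ p a) (∈-resp-↭ q b))
      (λ z∈ → let a , b = ∈-common⁻ z∈ in ∈-common⁺ (∈-resp-↭ (↭-sym p) a) (∈-resp-↭ (↭-sym q) b))

  mapEnd : (Ind → Ind) → End → End
  mapEnd σ (port p) = port p
  mapEnd σ (idx x) = idx (σ x)

  rename : (Ind → Ind) → EWires → EWires
  rename σ = map (mapWire (mapEnd σ))

  map-mapEnd-port : ∀ σ ps → map (mapEnd σ) (map port ps) ≡ map port ps
  map-mapEnd-port σ ps = sym (map-∘ ps)

  map-mapEnd-idx : ∀ σ xs → map (mapEnd σ) (map idx xs) ≡ map idx (map σ xs)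
  map-mapEnd-idx σ xs = ≡-trans (sym (map-∘ xs)) (map-∘ xs)

  map-zipWith : ∀ {A B C D : Set} (h : C → D) (f : A → B → C) {n} (xs : Vec A n) ys →
                map h (toList (zipWith f xs ys)) ≡ toList (zipWith (λ x y → h (f x y)) xs ys)
  map-zipWith h f [] [] = refl
  map-zipWith h f (x ∷ xs) (y ∷ ys) = cong (_ ∷_) (map-zipWith h f xs ys)

  typed-rename : ∀ σ {U L Γ W} → Typed U L Γ W → Typed (map σ U) (map σ L) Γ (rename σ W)
  typed-rename σ {U} {L} {Γ} {W} (typed t t′) = typed
    (subst₂ _↭_ (sym (uppers-map (mapEnd σ) W))
      (≡-trans (map-++ (mapEnd σ) (map port (ups Γ)) _) (cong₂ _++_ (map-mapEnd-port σ (ups Γ)) (map-mapEnd-idx σ L))) (map⁺ (mapEnd σ) t))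
    (subst₂ _↭_ (sym (lowers-map (mapEnd σ) W))
      (≡-trans (map-++ (mapEnd σ) (map port (lows Γ)) _) (cong₂ _++_ (map-mapEnd-port σ (lows Γ)) (map-mapEnd-idx σ U))) (map⁺ (mapEnd σ) t′))

  rename-ports : ∀ σ (V : Wires) → rename σ (map (mapWire port) V) ≡ map (mapWire port) V
  rename-ports σ [] = refl
  rename-ports σ (edge p q ∷ V) = cong (_ ∷_) (rename-ports σ V)
  rename-ports σ (loop ∷ V) = cong (_ ∷_) (rename-ports σ V)

  D̂-rename : ∀ σ {Γ W} → D̂ Γ W → D̂ Γ (rename σ W)
  D̂-rename σ {W = W} (xs , V , s , d) = map σ xs , V ,
    subst₂ (rename σ W ⟿⟨_⟩_) (map-mapEnd-idx σ xs) (rename-ports σ V) (⟿*-map (mapEnd σ) s) , d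

  -- A renaming acts on an orthogonal by carrying tests back along its inverse. For an involution
  -- the inverse is `σ` itself.
  module Involution (σ : Ind → Ind) (inv : ∀ x → σ (σ x) ≡ x) where

    σ-injective : ∀ {x y} → σ x ≡ σ y → x ≡ y
    σ-injective {x} {y} e = ≡-trans (sym (inv x)) (≡-trans (cong σ e) (inv y))

    map-inv : ∀ xs → map σ (map σ xs) ≡ xs
    map-inv [] = refl
    map-inv (x ∷ xs) = cong₂ _∷_ (inv x) (map-inv xs)

    vec-inv : ∀ {n} (xs : Vec Ind n) → Vec.map σ (Vec.map σ xs) ≡ xs
    vec-inv [] = refl
    vec-inv (x ∷ xs) = cong₂ _∷_ (inv x) (vec-inv xs)

    end-inv : ∀ e → mapEnd σ (mapEnd σ e) ≡ e
    end-inv (port p) = refl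
    end-inv (idx x) = cong idx (inv x)

    rename-inv : ∀ W → rename σ (rename σ W) ≡ W
    rename-inv [] = refl
    rename-inv (edge u l ∷ W) = cong₂ _∷_ (cong₂ edge (end-inv u) (end-inv l)) (rename-inv W)
    rename-inv (loop ∷ W) = cong (loop ∷_) (rename-inv W)

    fu-ren : ∀ A → fu (ren σ σ A) ≡ map σ (fu A)
    fu-ren A = ≡-trans (cong₂ frees (upper-ren σ σ A) (lower-ren σ σ A)) (frees-map (upper A) σ-injective)

    fl-ren : ∀ A → fl (ren σ σ A) ≡ map σ (fl A)
    fl-ren A = ≡-trans (cong₂ frees (lower-ren σ σ A) (upper-ren σ σ A)) (frees-map (lower A) σ-injective)

    shared-ren : ∀ A B → shared (ren σ σ A) (ren σ σ B) ≡ map σ (shared A B)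
    shared-ren A B = ≡-trans (cong₂ _++_
      (≡-trans (cong₂ common (upper-ren σ σ A) (lower-ren σ σ B)) (common-map (upper A) σ-injective))
      (≡-trans (cong₂ common (upper-ren σ σ B) (lower-ren σ σ A)) (common-map (upper B) σ-injective)))
      (sym (map-++ σ (common (upper A) (lower B)) _))

    orth-rename : ∀ {U L} {X Y : Ctx} → (∀ {Ξ N} → Y Ξ N → X Ξ (rename σ N)) →
                  ∀ {Γ W} → Orth U L X Γ W → Orth (map σ U) (map σ L) Y Γ (rename σ W)
    orth-rename {U} {L} h {Γ} {W} (orth t f) = orth (typed-rename σ t) λ {Ξ} {N} tN y a →
      subst (D̂ (Γ ++ Ξ)) (≡-trans (map-++ _ W _) (cong (rename σ W ++_) (rename-inv N)))
        (D̂-rename σ (f (subst₂ (λ L U → Typed L U Ξ (rename σ N)) (map-inv L) (map-inv U) (typed-rename σ tN)) (h y) a))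

    pr-rename : ∀ A {X Y : Ctx} → (∀ {Ξ N} → Y Ξ N → X Ξ (rename σ N)) →
                ∀ {Γ W} → pr A X Γ W → pr (ren σ σ A) Y Γ (rename σ W)
    pr-rename A {Y = Y} h {Γ} {W} o = subst₂ (λ U L → Orth U L Y Γ (rename σ W)) (sym (fu-ren A)) (sym (fl-ren A)) (orth-rename h o)

    co-rename⁻ : ∀ A {X Y : Ctx} → (∀ {Ξ N} → X Ξ N → Y Ξ (rename σ N)) →
                 ∀ {Γ W} → co (ren σ σ A) Y Γ W → co A X Γ (rename σ W)
    co-rename⁻ A {X = X} h {Γ} {W} o = subst₂ (λ U L → Orth U L X Γ (rename σ W))
      (≡-trans (cong (map σ) (fl-ren A)) (map-inv (fl A))) (≡-trans (cong (map σ) (fu-ren A)) (map-inv (fu A))) (orth-rename h o)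

    generator-rename : ∀ {p us ls Ξ N} → Generator p us ls Ξ N → Generator p (Vec.map σ us) (Vec.map σ ls) Ξ (rename σ N)
    generator-rename {p} {us} {ls} (generator k us′ ls′) = subst (Generator p (Vec.map σ us) (Vec.map σ ls) _)
      (sym (≡-trans (map-++ _ (toList (zipWith _ us′ us)) _) (cong₂ _++_
        (≡-trans (map-zipWith _ _ us′ us) (cong toList (sym (Vecₚ.zipWith-map₂ _ σ us′ us))))
        (≡-trans (map-zipWith _ _ ls ls′) (cong toList (sym (Vecₚ.zipWith-map₁ _ σ ls ls′)))))))
      (generator k us′ ls′)

    generator-rename⁻ : ∀ {p us ls Ξ N} → Generator p (Vec.map σ us) (Vec.map σ ls) Ξ N → Generator p us ls Ξ (rename σ N)
    generator-rename⁻ {p} {us} {ls} g = subst₂ (λ us ls → Generator p us ls _ _) (vec-inv us) (vec-inv ls) (generator-rename g)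

    bare-rename : ∀ {us ls Ξ N} → Bare us ls Ξ N → Bare (Vec.map σ us) (Vec.map σ ls) Ξ (rename σ N)
    bare-rename bare = bare

    bare-rename⁻ : ∀ {us ls Ξ N} → Bare (Vec.map σ us) (Vec.map σ ls) Ξ N → Bare us ls Ξ (rename σ N)
    bare-rename⁻ {us} {ls} b = subst₂ (λ us ls → Bare us ls _ _) (vec-inv us) (vec-inv ls) (bare-rename b)

    pair-rename : ∀ {S} {X X′ Y Y′ : Ctx} → (∀ {Ξ N} → X Ξ N → X′ Ξ (rename σ N)) → (∀ {Ξ N} → Y Ξ N → Y′ Ξ (rename σ N)) →
                  ∀ {Ξ N} → Pair S X Y Ξ N → Pair (map σ S) X′ Y′ Ξ (rename σ N)
    pair-rename h h′ (pair {N = N} {C = C} {Int} x y q p s) = pair (h x) (h′ y) q (map⁺ σ p)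
      (subst₂ (_⟿⟨_⟩ rename σ C) (map-++ _ N _) (map-mapEnd-idx σ Int) (⟿*-map (mapEnd σ) s))

    -- Index names enter the interpretation only through the interface, so renaming formula and
    -- interface together preserves it.
    K-rename : ∀ A {Γ W} → K A Γ W → K (ren σ σ A) Γ (rename σ W)
    K-rename A@(atom (pos p) us ls) = pr-rename A (co-rename⁻ A generator-rename)
    K-rename A@(atom (neg p) us ls) = pr-rename A λ {Ξ} {N} g → generator-rename⁻
      (subst₂ (λ us ls → Generator p us ls Ξ N) (sym (Vecₚ.map-reverse σ ls)) (sym (Vecₚ.map-reverse σ us)) g)
    K-rename A@(atom ⊥ us ls) = pr-rename A (co-rename⁻ A bare-rename)
    K-rename A@(atom 𝟏 us ls) = pr-rename A λ {Ξ} {N} g → bare-rename⁻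
      (subst₂ (λ us ls → Bare us ls Ξ N) (sym (Vecₚ.map-reverse σ ls)) (sym (Vecₚ.map-reverse σ us)) g)
    K-rename (A ⊗ B) = pr-rename (A ⊗ B) λ {Ξ} {N} q → subst (λ S → Pair S _ _ Ξ (rename σ N))
      (≡-trans (cong (map σ) (shared-ren A B)) (map-inv (shared A B)))
      (pair-rename (co-rename⁻ A (K-rename A)) (co-rename⁻ B (K-rename B)) q)
    K-rename (A ⅋ B) = pr-rename (A ⅋ B) (co-rename⁻ (A ⅋ B) λ {Ξ} {N} q → subst (λ S → Pair S _ _ Ξ (rename σ N))
      (sym (shared-ren A B)) (pair-rename (K-rename A) (K-rename B) q))

  -- Where `K A` is a biorthogonal, a triple orthogonal collapses; the other cases compare
  -- orthogonals by antitonicity. The ⅋ case calls for the converse inclusion on the parts, which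
  -- `undual` obtains from this one because `K` is biorthogonally closed.
  dual-sound : ∀ A → Linear A → ∀ {Γ W} → co A (K A) Γ W → K (dual A) Γ W
  dual-sound A@(atom (pos p) us ls) lin {Γ} {W} o = orth-anti (↭-sym (fu-dual {A} lin)) (↭-sym (fl-dual {A} lin))
    (λ {Ξ} {N} g → subst₂ (λ us ls → Generator p us ls Ξ N) (Vecₚ.reverse-involutive us) (Vecₚ.reverse-involutive ls) g) (orth³ o)
  dual-sound A@(atom (neg p) us ls) lin = orth-anti (↭-sym (fu-dual {A} lin)) (↭-sym (fl-dual {A} lin))
    (orth-anti (fl-dual {A} lin) (fu-dual {A} lin) λ g → g)
  dual-sound A@(atom ⊥ us ls) lin {Γ} {W} o = orth-anti (↭-sym (fu-dual {A} lin)) (↭-sym (fl-dual {A} lin))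
    (λ {Ξ} {N} g → subst₂ (λ us ls → Bare us ls Ξ N) (Vecₚ.reverse-involutive us) (Vecₚ.reverse-involutive ls) g) (orth³ o)
  dual-sound A@(atom 𝟏 us ls) lin = orth-anti (↭-sym (fu-dual {A} lin)) (↭-sym (fl-dual {A} lin))
    (orth-anti (fl-dual {A} lin) (fu-dual {A} lin) λ g → g)
  dual-sound (A ⊗ B) lin = orth-anti (↭-sym (fu-dual {A ⊗ B} lin)) (↭-sym (fl-dual {A ⊗ B} lin))
    (orth-anti (fl-dual {A ⊗ B} lin) (fu-dual {A ⊗ B} lin) λ { (pair {Ξ = Ξ} {Ξ′} {N} {N′} x y q p s) →
      pair (dual-sound B (linearʳ {A} {B} lin) y) (dual-sound A (linearˡ {A} {B} lin) x) (trans q (++-comm Ξ Ξ′))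
        (trans p (↭-sym (shared-comm {A} {B} lin))) (↭⟿* (++-comm N′ N) s) })
  dual-sound (A ⅋ B) lin o = orth-anti (↭-sym (fu-dual {A ⊗ B} lin)) (↭-sym (fl-dual {A ⊗ B} lin))
    (λ { (pair {Ξ = Ξ} {Ξ′} {N} {N′} x y q p s) →
      pair (undual A (linearˡ {A} {B} lin) y) (undual B (linearʳ {A} {B} lin) x) (trans q (++-comm Ξ Ξ′))
        (trans p (shared-comm {A} {B} lin)) (↭⟿* (++-comm N′ N) s) }) (orth³ o)
    where
    undual : ∀ C → Linear C → ∀ {Γ W} → co (dual C) (K (dual C)) Γ W → K C Γ W
    undual C lin o = K-closed C (orth-anti (fl-dual {C} lin) (fu-dual {C} lin) (dual-sound C lin) o)

  -- Soundness of the rules for the interpretation.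

  data Real : List Expr → Ctx where
    []  : Real [] [] []
    _∷_ : ∀ {A Γ Ξ Ξ′ N N′} → K A Ξ N → Real Γ Ξ′ N′ → Real (A ∷ Γ) (Ξ ++ Ξ′) (N ++ N′)

  real-typed : ∀ {Γ Ξ N} → Real Γ Ξ N → Typed (FU Γ) (FL Γ) Ξ N
  real-typed [] = typed refl refl
  real-typed {A ∷ Γ} (a ∷ r) = typed-++ (K-typed A a) (real-typed r)

  real-++⁻ : ∀ Γ {Δ} (P : Ctx) → (∀ {Ξ N Ξ′ N′} → Real Γ Ξ N → Real Δ Ξ′ N′ → P (Ξ ++ Ξ′) (N ++ N′)) →
             ∀ {Ξ N} → Real (Γ ++ Δ) Ξ N → P Ξ N
  real-++⁻ [] P h r = h [] r
  real-++⁻ (A ∷ Γ) P h (_∷_ {Ξ = Ξ} {N = N} a r) =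
    real-++⁻ Γ (λ Ξ′ N′ → P (Ξ ++ Ξ′) (N ++ N′))
      (λ {Ξ₁} {N₁} r₁ r₂ → subst₂ P (Listₚ.++-assoc Ξ Ξ₁ _) (Listₚ.++-assoc N N₁ _) (h (a ∷ r₁) r₂)) r

  real-↭ : ∀ {Γ Δ Ξ N} → Γ ↭ Δ → Real Γ Ξ N → ∃₂ λ Ξ′ N′ → Real Δ Ξ′ N′ × Ξ ↭ Ξ′ × N ↭ N′
  real-↭ refl r = -, -, r , refl , refl
  real-↭ (prep A p) (_∷_ {Ξ = Ξ} {N = N} a r) with _ , _ , r′ , q , q′ ← real-↭ p r =
    -, -, a ∷ r′ , ++⁺ˡ Ξ q , ++⁺ˡ N q′
  real-↭ (swap A B p) (_∷_ {Ξ = Ξ} {N = N} a (_∷_ {Ξ = Ξ′} {N = N′} b r)) with _ , _ , r′ , q , q′ ← real-↭ p r =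
    -, -, b ∷ (a ∷ r′) , trans (++⁺ˡ Ξ (++⁺ˡ Ξ′ q)) (shifts Ξ Ξ′) , trans (++⁺ˡ N (++⁺ˡ N′ q′)) (shifts N N′)
  real-↭ (trans p₁ p₂) r with _ , _ , r₁ , q₁ , q₁′ ← real-↭ p₁ r with _ , _ , r₂ , q₂ , q₂′ ← real-↭ p₂ r₁ =
    -, -, r₂ , trans q₁ q₂ , trans q₁′ q₂′

  Sound : List Expr → Set
  Sound Γ = ∀ {Ξ N} → Real Γ Ξ N → Apart Ξ → D̂ Ξ N

  balanced-FL : ∀ {Γ} → Balanced Γ → Unique (FL Γ)
  balanced-FL (_ , u , p) = Unique-resp-↭ p u

  real-functional : ∀ {Γ Ξ N} → Balanced Γ → Real Γ Ξ N → Apart Ξ → Functional N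
  real-functional b r a = typed-functional (proj₁ (proj₂ b)) (balanced-FL b) a (real-typed r)

  head-formula : ∀ {A Γ} → Balanced (A ∷ Γ) → IsFormula A
  head-formula (f ∷ _ , _) = f

  -- The indices of Γ other than those of A are internal to the rest of the
  -- sequent, so contracting them leaves a context with the interface dual to A.
  internal : ∀ {A Γ} → Balanced (A ∷ Γ) → ∃ λ Int → FU Γ ↭ fl A ++ Int × FL Γ ↭ fu A ++ Int
  internal {A} (_ , _ , p) = ↭-exchange (fu A) (fl A) frees-disjoint p

  -- Contracting the internal indices of the realised `Γ` leaves the interface opposite to that of
  -- `A`; validity of the sequent then says that the result is a test of `A`.
  focus : ∀ {A Γ G N} → Balanced (A ∷ Γ) → Sound (A ∷ Γ) → Real Γ G N →
          ∃₂ λ Int M → N ⟿⟨ map idx Int ⟩ M × co A (K A) G M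
  focus {A} {Γ} {G} {N} b s r =
    let Int , p , q = internal {A} b
        M , c , t = contract-typed Int p q (real-typed r)
    in Int , M , c , orth t λ {Ξ} {N′} _ k a → D̂-swap Ξ N′ (let a′ = apart-↭ (++-comm G Ξ) a in
      D̂-forth Int (real-functional b (k ∷ r) a′) (⟿*-++ˡ N′ c) (s (k ∷ r) a′))

  -- By `focus` the realised `Γ` becomes a test of `A`, hence a replacement for the dual of `A`, and
  -- is plugged into the other premise.
  cut-sound : ∀ {A Γ Δ} → Balanced (A ∷ Γ) → Sound (A ∷ Γ) → Sound (dual A ∷ Δ) → Sound (Γ ++ Δ)
  cut-sound {A} {Γ} b s s′ = real-++⁻ Γ (λ Ξ N → Apart Ξ → D̂ Ξ N) λ {_} {_} {_} {N′} r r′ a →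
    let Int , M , c , o = focus {A} b s r
    in D̂-back Int (⟿*-++ N′ c) (s′ (dual-sound A (proj₂ (head-formula b)) o ∷ r′) a)

  -- Focusing both premises gives a test of `A` and a test of `B`. Joined along the shared indices
  -- they form one of the pairs to which the elements of `K (A ⊗ B)` are orthogonal.
  ⊗-sound : ∀ {A B Γ Δ} → IsFormula (A ⊗ B) → Balanced (A ∷ Γ) → Balanced (B ∷ Δ) →
            Sound (A ∷ Γ) → Sound (B ∷ Δ) → Sound (A ⊗ B ∷ Γ ++ Δ)
  ⊗-sound {A} {B} {Γ} (_ , lin) b b′ s s′ (_∷_ {Ξ = Ξ} {N = N} k r) =
    real-++⁻ Γ (λ Ξ′ N′ → Apart (Ξ ++ Ξ′) → D̂ (Ξ ++ Ξ′) (N ++ N′)) (λ {_} {_} {_} {N₂} r₁ r₂ a →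
      let Int₁ , M₁ , c₁ , o₁ = focus {A} b s r₁
          Int₂ , M₂ , c₂ , o₂ = focus {B} b′ s′ r₂
          M , c , t = contract-typed (shared A B) (trans (fl-split {A} {B} lin) (++-comm (shared A B) _))
                        (trans (fu-split {A} {B} lin) (++-comm (shared A B) _)) (typed-++ (orth-typed o₁) (orth-typed o₂))
      in D̂-back Int₁ (⟿*-++ˡ N (⟿*-++ N₂ c₁)) (D̂-back Int₂ (⟿*-++ˡ N (⟿*-++ˡ M₁ c₂)) (D̂-back (shared A B) (⟿*-++ˡ N c)
           (orth-app k t (pair o₁ o₂ refl refl c) a)))) r

  -- It is enough to show that the realised `Γ` is orthogonal to pairs from `K A` and `K B`, and
  -- such a pair realises the premise. What remains is to perform the contractions at `S` and at
  -- `Int` on the wires of the premise.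
  ⅋-sound : ∀ {A B Γ} → Balanced (A ⅋ B ∷ Γ) → Balanced (A ∷ B ∷ Γ) → Sound (A ∷ B ∷ Γ) → Sound (A ⅋ B ∷ Γ)
  ⅋-sound {A} {B} {Γ} b b′ s (_∷_ {Ξ = Ξ} {Ξ′ = G} {N = N} {N′ = N₁} k r) a =
    let Int , p , q = internal {A ⅋ B} b
        M , c , t = contract-typed Int p q (real-typed r)
    in D̂-back Int (⟿*-++ˡ N c) (orth-app k t (orth t λ { {Θ} {C} tC (pair {Ξ = Ξ₁} {Ξ₂} {K₁} {K₂} {Int = S} x y r′ p′ c′) a₁ →
      let e : Θ ++ G ↭ Ξ₁ ++ Ξ₂ ++ G
          e = trans (++⁺ʳ G r′) (↭-reflexive (Listₚ.++-assoc Ξ₁ Ξ₂ G))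
          a₂ = apart-↭ (trans (++-comm G Θ) e) a₁
          f = real-functional b′ (x ∷ (y ∷ r)) a₂
          d = s (x ∷ (y ∷ r)) a₂
          f′ = functional-↭ (↭-sym (↭-reflexive (Listₚ.++-assoc K₁ K₂ N₁))) f
          d′ = D̂-resp refl (↭-sym (↭-reflexive (Listₚ.++-assoc K₁ K₂ N₁))) d
      in D̂-resp (trans (↭-sym e) (++-comm Θ G)) (++-comm C M)
           (D̂-forth Int (functional-⟿* (⟿*-++ N₁ c′) f′) (⟿*-++ˡ C c) (D̂-forth S f′ (⟿*-++ N₁ c′) d′)) }) a)

  exchange-sound : ∀ {Γ Δ} → Γ ↭ Δ → Sound Γ → Sound Δ
  exchange-sound p s r a = let _ , _ , r′ , q , q′ = real-↭ (↭-sym p) r in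
    D̂-resp (↭-sym q) (↭-sym q′) (s r′ (apart-↭ q a))

  -- Index substitution as transposition, and soundness of the ⊥-rules.

  transpose : Ind → Ind → Ind → Ind
  transpose i j x with x ≟ᵢ i
  ... | yes _ = j
  ... | no _ with x ≟ᵢ j
  ...   | yes _ = i
  ...   | no _ = x

  transpose-i : ∀ i j → transpose i j i ≡ j
  transpose-i i j with i ≟ᵢ i
  ... | yes _ = refl
  ... | no i≢i = contradiction refl i≢i

  transpose-j : ∀ i j → transpose i j j ≡ i
  transpose-j i j with j ≟ᵢ i
  ... | yes refl = refl
  ... | no _ with j ≟ᵢ j
  ...   | yes _ = refl
  ...   | no j≢j = contradiction refl j≢j

  transpose-≢ : ∀ {i j x} → x ≢ i → x ≢ j → transpose i j x ≡ x
  transpose-≢ {i} {j} {x} x≢i x≢j with x ≟ᵢ i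
  ... | yes e = contradiction e x≢i
  ... | no _ with x ≟ᵢ j
  ...   | yes e = contradiction e x≢j
  ...   | no _ = refl

  transpose-inv : ∀ i j x → transpose i j (transpose i j x) ≡ x
  transpose-inv i j x with x ≟ᵢ i
  ... | yes refl = transpose-j x j
  ... | no x≢i with x ≟ᵢ j
  ...   | yes refl = transpose-i i x
  ...   | no x≢j = transpose-≢ x≢i x≢j

  transpose-replace : ∀ {i j x} → x ≢ i → transpose i j x ≡ replace i j x
  transpose-replace {i} {j} {x} x≢i with x ≟ᵢ i
  ... | yes e = contradiction e x≢i
  ... | no _ with x ≟ᵢ j
  ...   | yes _ = refl
  ...   | no _ = refl

  mapEnd-fix : ∀ σ e → (∀ {x} → idx x ≡ e → σ x ≡ x) → mapEnd σ e ≡ e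
  mapEnd-fix σ (port p) h = refl
  mapEnd-fix σ (idx x) h = cong idx (h refl)

  rename-fix : ∀ σ W → (∀ {x} → idx x ∈ uppers W → σ x ≡ x) → (∀ {x} → idx x ∈ lowers W → σ x ≡ x) → rename σ W ≡ W
  rename-fix σ [] h h′ = refl
  rename-fix σ (edge u l ∷ W) h h′ = cong₂ _∷_ (cong₂ edge (mapEnd-fix σ u (h ∘ here)) (mapEnd-fix σ l (h′ ∘ here))) (rename-fix σ W (h ∘ there) (h′ ∘ there))
  rename-fix σ (loop ∷ W) h h′ = cong (loop ∷_) (rename-fix σ W h h′)

  idx-∈ : ∀ {x} ps {xs} → idx x ∈ map port ps ++ map idx xs → x ∈ xs
  idx-∈ ps i with ∈-++⁻ (map port ps) i
  ... | inj₁ q with _ , _ , () ← ∈-map⁻ port q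
  ... | inj₂ q with _ , y∈ , refl ← ∈-map⁻ idx q = y∈

  module _ {U L : List Ind} {Γ : List Item} {W : EWires} {i j : Ind} (t : Typed U L Γ W) where

    -- Exactly one end is `idx i` and none is `idx j`, so the transposition redirects one wire and
    -- fixes all others.
    rename-lower : ∀ {U′} → U ↭ i ∷ U′ → i ∉ U′ → j ∉ U′ → i ∉ L → j ∉ L →
                   ∃₂ λ u R → W ↭ edge u (idx i) ∷ R × rename (transpose i j) W ↭ edge u (idx j) ∷ R
    rename-lower {U′} p i∉ j∉ i∉L j∉L
      with u , R , q , r ← lower-edge W (trans (Typed.typed-lower t) (trans (++⁺ˡ (map port (lows Γ)) (map⁺ idx p)) (shift (idx i) (map port (lows Γ)) (map idx U′)))) =
      u , R , q , subst (λ e → rename (transpose i j) W ↭ e) (cong₂ _∷_ (cong₂ edge eu (cong idx (transpose-i i j))) eR) (map⁺ _ q)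
      where
      fixU : ∀ {x} → idx x ∈ uppers (edge u (idx i) ∷ R) → transpose i j x ≡ x
      fixU x∈ with y∈ ← idx-∈ (ups Γ) (∈-resp-↭ (trans (↭-sym (uppers-↭ q)) (Typed.typed-upper t)) x∈) =
        transpose-≢ (λ { refl → i∉L y∈ }) (λ { refl → j∉L y∈ })
      fixL : ∀ {x} → idx x ∈ lowers R → transpose i j x ≡ x
      fixL x∈ with y∈ ← idx-∈ (lows Γ) (∈-resp-↭ r x∈) = transpose-≢ (λ { refl → i∉ y∈ }) (λ { refl → j∉ y∈ })
      eR = rename-fix (transpose i j) R (fixU ∘ there) fixL
      eu : mapEnd (transpose i j) u ≡ u
      eu = mapEnd-fix _ u (λ { refl → fixU (here refl) })

    rename-upper : ∀ {L′} → L ↭ i ∷ L′ → i ∉ L′ → j ∉ L′ → i ∉ U → j ∉ U →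
                   ∃₂ λ l R → W ↭ edge (idx i) l ∷ R × rename (transpose i j) W ↭ edge (idx j) l ∷ R
    rename-upper {L′} p i∉ j∉ i∉U j∉U
      with l , R , q , r ← upper-edge W (trans (Typed.typed-upper t) (trans (++⁺ˡ (map port (ups Γ)) (map⁺ idx p)) (shift (idx i) (map port (ups Γ)) (map idx L′)))) =
      l , R , q , subst (λ e → rename (transpose i j) W ↭ e) (cong₂ _∷_ (cong₂ edge (cong idx (transpose-i i j)) el) eR) (map⁺ _ q)
      where
      fixL : ∀ {x} → idx x ∈ lowers (edge (idx i) l ∷ R) → transpose i j x ≡ x
      fixL x∈ with y∈ ← idx-∈ (lows Γ) (∈-resp-↭ (trans (↭-sym (lowers-↭ q)) (Typed.typed-lower t)) x∈) =
        transpose-≢ (λ { refl → i∉U y∈ }) (λ { refl → j∉U y∈ })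
      fixU : ∀ {x} → idx x ∈ uppers R → transpose i j x ≡ x
      fixU x∈ with y∈ ← idx-∈ (ups Γ) (∈-resp-↭ r x∈) = transpose-≢ (λ { refl → i∉ y∈ }) (λ { refl → j∉ y∈ })
      eR = rename-fix (transpose i j) R fixU (fixL ∘ there)
      el : mapEnd (transpose i j) l ≡ l
      el = mapEnd-fix _ l (λ { refl → fixL (here refl) })

  module _ {A : Expr} {i j : Ind} (i∉ : i ∉ occurrences A) where
    private
      i∉u : i ∉ upper A
      i∉u = i∉ ∘ ∈-++⁺ˡ
      i∉l : i ∉ lower A
      i∉l = i∉ ∘ ∈-++⁺ʳ (upper A)

    -- As `i` is absent from `A` and `j` has no lower occurrence, substituting above is the same as
    -- exchanging `i` and `j` everywhere, which is an involution.
    subst↑-transpose : j ∈ fu A → A [ i / j ]↑ ≡ ren (transpose i j) (transpose i j) A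
    subst↑-transpose j∈ = ≡-trans (subst↑-ren i j A) (ren-cong A
      (λ x∈ → sym (transpose-replace λ { refl → i∉u x∈ }))
      (λ x∈ → sym (transpose-≢ (λ { refl → i∉l x∈ }) (λ { refl → proj₂ (∈-frees⁻ j∈) x∈ }))))

    subst↓-transpose : j ∈ fl A → A [ i / j ]↓ ≡ ren (transpose i j) (transpose i j) A
    subst↓-transpose j∈ = ≡-trans (subst↓-ren i j A) (ren-cong A
      (λ x∈ → sym (transpose-≢ (λ { refl → i∉u x∈ }) (λ { refl → proj₂ (∈-frees⁻ j∈) x∈ })))
      (λ x∈ → sym (transpose-replace λ { refl → i∉l x∈ })))


  ∉-transpose : ∀ {i j xs} → i ∉ xs → j ∉ xs → i ∉ map (transpose i j) xs × j ∉ map (transpose i j) xs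
  ∉-transpose {i} {j} {xs} i∉ j∉ = ∉-map (transpose-i i j) j∉ , ∉-map (transpose-j i j) i∉
    where
    ∉-map : ∀ {y z} → transpose i j y ≡ z → z ∉ xs → y ∉ map (transpose i j) xs
    ∉-map e z∉ y∈ with x , x∈ , e′ ← ∈-map⁻ _ y∈ =
      z∉ (subst (_∈ xs) (≡-trans (sym (transpose-inv i j x)) (≡-trans (cong (transpose i j) (sym e′)) e)) x∈)

  K-↭ : ∀ A {Γ W W′} → W ↭ W′ → K A Γ W → K A Γ W′
  K-↭ A {Γ} {W} {W′} p k = K-closed A (orth (typed (trans (↭-sym (uppers-↭ p)) (Typed.typed-upper t)) (trans (↭-sym (lowers-↭ p)) (Typed.typed-lower t)))
    λ {Ξ} {N} _ o a → D̂-resp refl (++⁺ʳ N p) (D̂-swap Ξ N (orth-app o t k (apart-↭ (++-comm Γ Ξ) a))))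
    where t = K-typed A k

  module _ {A : Expr} {i j : Ind} (lin : Linear A) (i∉ : i ∉ occurrences A) where
    private
      τ = transpose i j
      open module I = Involution τ (transpose-inv i j)
      i∉fu : i ∉ fu A
      i∉fu = i∉ ∘ ∈-++⁺ˡ ∘ proj₁ ∘ ∈-frees⁻
      i∉fl : i ∉ fl A
      i∉fl = i∉ ∘ ∈-++⁺ʳ (upper A) ∘ proj₁ ∘ ∈-frees⁻

    -- The transposition redirects to `j` the only wire into `i` and turns a replacement for the
    -- substituted formula into one for `A`.
    K-subst↑ : j ∈ fu A → ∀ {Γ W} → K (A [ i / j ]↑) Γ W →
               ∃₂ λ u R → W ↭ edge u (idx i) ∷ R × K A Γ (edge u (idx j) ∷ R)
    K-subst↑ j∈ {Γ} {W} k rewrite subst↑-transpose {A} {i} {j} i∉ j∈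
      with F , p ← ∈⇒↭ j∈ with u′ ← Unique-resp-↭ p (frees-Unique (proj₁ lin))
      with i∉F , j∉F ← ∉-transpose (λ i∈ → i∉fu (∈-resp-↭ (↭-sym p) (there i∈))) (head-∉ u′)
      with i∉l , j∉l ← ∉-transpose i∉fl (frees-disjoint j∈)
      with u , R , q , r ← rename-lower {j = j} (K-typed (ren τ τ A) k)
             (subst₂ _↭_ (sym (fu-ren A)) (cong (_∷ map τ F) (transpose-j i j)) (map⁺ τ p)) i∉F j∉F
             (subst (i ∉_) (sym (fl-ren A)) i∉l) (subst (j ∉_) (sym (fl-ren A)) j∉l) =
      u , R , q , K-↭ A r (subst (λ B → K B Γ (rename τ W)) (≡-trans (ren-∘ A) (≡-trans (ren-cong A (λ _ → transpose-inv i j _) (λ _ → transpose-inv i j _)) (ren-id A))) (K-rename (ren τ τ A) k))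

    K-subst↓ : j ∈ fl A → ∀ {Γ W} → K (A [ i / j ]↓) Γ W →
               ∃₂ λ l R → W ↭ edge (idx i) l ∷ R × K A Γ (edge (idx j) l ∷ R)
    K-subst↓ j∈ {Γ} {W} k rewrite subst↓-transpose {A} {i} {j} i∉ j∈
      with F , p ← ∈⇒↭ j∈ with u′ ← Unique-resp-↭ p (frees-Unique (proj₂ lin))
      with i∉F , j∉F ← ∉-transpose (λ i∈ → i∉fl (∈-resp-↭ (↭-sym p) (there i∈))) (head-∉ u′)
      with i∉u , j∉u ← ∉-transpose i∉fu (λ j∈′ → frees-disjoint j∈′ j∈)
      with l , R , q , r ← rename-upper {j = j} (K-typed (ren τ τ A) k)
             (subst₂ _↭_ (sym (fl-ren A)) (cong (_∷ map τ F) (transpose-j i j)) (map⁺ τ p)) i∉F j∉F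
             (subst (i ∉_) (sym (fu-ren A)) i∉u) (subst (j ∉_) (sym (fu-ren A)) j∉u) =
      l , R , q , K-↭ A r (subst (λ B → K B Γ (rename τ W)) (≡-trans (ren-∘ A) (≡-trans (ren-cong A (λ _ → transpose-inv i j _) (λ _ → transpose-inv i j _)) (ren-id A))) (K-rename (ren τ τ A) k))

  -- Since ⊥ is generated by bare wires, testing with the wire from `i` to `j` suffices. It prolongs
  -- the wire from `u` to `i` into one from `u` to `j`, which is what a replacement for the
  -- premise's `A` has.
  ⊥→-sound : ∀ {A Γ i j} → Balanced (⊥⟨ j / i ⟩ ∷ A [ i / j ]↑ ∷ Γ) → Balanced (A ∷ Γ) →
             j ∈ fu A → i ∉ occurrences A → Sound (A ∷ Γ) → Sound (⊥⟨ j / i ⟩ ∷ A [ i / j ]↑ ∷ Γ)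
  ⊥→-sound {A} {Γ} {i} {j} b b′ j∈ i∉ s (_∷_ {N = Nc} c r@(_∷_ {Ξ = Ξ} {Ξ′ = G} {N = Na} {N′ = Ng} k r′)) a =
    let u , R , q , k′ = K-subst↑ {A} (proj₂ (head-formula b′)) i∉ j∈ k
        Int , p , p′ = internal {⊥⟨ j / i ⟩} b
        M , s′ , t = contract-typed Int p p′ (real-typed r)
    in
    D̂-back Int (⟿*-++ˡ Nc s′) (orth-app c t (orth t λ { tB bare a₁ →
      let W≡ : (Na ++ Ng) ++ [ edge (idx i) (idx j) ] ↭ edge u (idx i) ∷ edge (idx i) (idx j) ∷ R ++ Ng
          W≡ = trans (++⁺ʳ _ (++⁺ʳ Ng q)) (solve 3 (λ e f g → (e ⊕ f) ⊕ g ⊜ e ⊕ g ⊕ f) refl [ _ ] (R ++ Ng) [ _ ])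
          f = typed-functional (Unique-resp-↭ (++-comm (fu ⊥⟨ j / i ⟩) _) (proj₁ (proj₂ b)))
                (Unique-resp-↭ (++-comm (fl ⊥⟨ j / i ⟩) _) (balanced-FL b)) a₁ (typed-++ (real-typed r) tB)
          d = s (k′ ∷ r′) (apart-++ˡ {Ξ ++ G} [] a₁)
      in D̂-forth Int f (⟿*-++ _ s′) (D̂-resp (↭-sym (++-identityʳ _)) refl (D̂-back [ i ] (via W≡ refl ⨾ done refl) d)) }) a)

  -- The ⊥-formula of the premise is realised by the bare wire from `i` to `j`. Contracting `j`
  -- composes it with the wire starting at `j` and restores the given wire starting at `i`.
  ⊥←-sound : ∀ {A Γ i j} → Balanced (⊥⟨ j / i ⟩ ∷ A ∷ Γ) → j ∈ fl A → i ∉ occurrences A →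
             Sound (⊥⟨ j / i ⟩ ∷ A ∷ Γ) → Sound (A [ i / j ]↓ ∷ Γ)
  ⊥←-sound {A} {Γ} {i} {j} b@(_ ∷ fA ∷ _ , _) j∈ i∉ s (_∷_ {Ξ = Ξ} {Ξ′ = G} {N = Na} {N′ = Ng} k r) a =
    let l , R , q , k′ = K-subst↓ {A} (proj₂ fA) i∉ j∈ k
        i≢j : i ≢ j
        i≢j = λ { refl → i∉ (∈-++⁺ʳ (upper A) (proj₁ (∈-frees⁻ j∈))) }
        k⊥ : K ⊥⟨ j / i ⟩ [] [ edge (idx i) (idx j) ]
        k⊥ = orth² (typed (↭-reflexive (cong (map idx) (sym (fl-⊥ i≢j)))) (↭-reflexive (cong (map idx) (sym (fu-⊥ i≢j))))) bare
        r₁ = k⊥ ∷ (k′ ∷ r)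
    in D̂-resp refl (↭-sym (++⁺ʳ Ng q)) (D̂-forth [ j ] (real-functional b r₁ a) (via refl refl ⨾ done refl) (s r₁ a))

  atom-sound : ∀ A → IsSequent (dual A ∷ A ∷ []) → (∀ {Ξ N Ξ′ N′} → K (dual A) Ξ N → K A Ξ′ N′ → Apart (Ξ ++ Ξ′) → D̂ (Ξ ++ Ξ′) (N ++ N′)) →
               Sound (dual A ∷ A ∷ [])
  atom-sound A s h (_∷_ {Ξ = Ξ} {N = N} k (_∷_ {Ξ = Ξ′} {N = N′} k′ [])) a =
    D̂-resp (++⁺ˡ Ξ (↭-sym (++-identityʳ Ξ′))) (++⁺ˡ N (↭-sym (++-identityʳ N′)))
      (h k k′ (apart-↭ (++⁺ˡ Ξ (++-identityʳ Ξ′)) a))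

  module _ (A : Expr) (lin : Linear A) where

    -- K A is orthogonal to K (dual A) by definition when A is 𝟏 or negative ...
    orth-dual : ∀ {X : Ctx} → (∀ {Ξ N} → K A Ξ N → pr A X Ξ N) → (∀ {Ξ N} → K (dual A) Ξ N → pr (dual A) (co (dual A) X) Ξ N) →
                ∀ {Ξ N Ξ′ N′} → K (dual A) Ξ N → K A Ξ′ N′ → Apart (Ξ ++ Ξ′) → D̂ (Ξ ++ Ξ′) (N ++ N′)
    orth-dual h h′ k k′ = orth-app (h′ k) (typed-resp (↭-sym (fl-dual {A} lin)) (↭-sym (fu-dual {A} lin)) (K-typed A k′))
      (orth-anti (↭-sym (fl-dual {A} lin)) (↭-sym (fu-dual {A} lin)) (λ x → x) (h k′))

    -- ... and otherwise by the involutivity of duality.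
    orth-dual⁻ : ∀ {X : Ctx} → (∀ {Ξ N} → K A Ξ N → pr A X Ξ N) → (∀ {Ξ N} → K (dual A) Ξ N → pr (dual A) (co (dual A) X) Ξ N) →
                 ∀ {Ξ N Ξ′ N′} → K (dual (dual A)) Ξ N → K (dual A) Ξ′ N′ → Apart (Ξ ++ Ξ′) → D̂ (Ξ ++ Ξ′) (N ++ N′)
    orth-dual⁻ h h′ {Ξ} {N} {Ξ′} {N′} k k′ a =
      D̂-swap Ξ′ N′ (orth-dual h h′ k′ (subst (λ B → K B Ξ N) (dual-involutive A) k) (apart-↭ (++-comm Ξ Ξ′) a))

  id-sound : ∀ p us ls → let A = atom p us ls in IsSequent (dual A ∷ A ∷ []) → Sound (dual A ∷ A ∷ [])
  id-sound p us ls s = atom-sound (atom p us ls) s (go p us ls (proj₂ (All.lookup (proj₁ (proj₁ s)) (there (here refl)))))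
    where
    Orthogonal : Expr → Set
    Orthogonal A = ∀ {Ξ N Ξ′ N′} → K (dual A) Ξ N → K A Ξ′ N′ → Apart (Ξ ++ Ξ′) → D̂ (Ξ ++ Ξ′) (N ++ N′)
    undual : ∀ A → Orthogonal (dual (dual A)) → Orthogonal A
    undual A = subst Orthogonal (dual-involutive A)
    linear-dual : ∀ {A} → Linear A → Linear (dual A)
    linear-dual {A} (u , l) = Unique-resp-↭ (↭-sym (upper-dual A)) l , Unique-resp-↭ (↭-sym (lower-dual A)) u
    go : ∀ p us ls → let A = atom p us ls in Linear A →
         ∀ {Ξ N Ξ′ N′} → K (dual A) Ξ N → K A Ξ′ N′ → Apart (Ξ ++ Ξ′) → D̂ (Ξ ++ Ξ′) (N ++ N′)
    go (neg p) us ls lin = orth-dual (atom (neg p) us ls) lin (λ k → k) (λ k → k)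
    go 𝟏 us ls lin = orth-dual (atom 𝟏 us ls) lin (λ k → k) (λ k → k)
    go (pos p) us ls lin = undual (atom (pos p) us ls) (orth-dual⁻ (dual (atom (pos p) us ls)) (linear-dual {atom (pos p) us ls} lin) (λ k → k) (λ k → k))
    go ⊥ us ls lin = undual (atom ⊥ us ls) (orth-dual⁻ (dual (atom ⊥ us ls)) (linear-dual {atom ⊥ us ls} lin) (λ k → k) (λ k → k))

  sound : ∀ {Γ} → ⊢ Γ → Sound Γ
  sound (exchange p d) = exchange-sound p (sound d)
  sound (id p us ls s) = id-sound p us ls s
  sound (cut {Γ} {Δ} {A} _ d e) = cut-sound {A} {Γ} {Δ} (derivable⇒balanced d) (sound d) (sound e)
  sound (⊗-rule {Γ} {Δ} {A} {B} s d e) =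
    ⊗-sound {A} {B} {Γ} {Δ} (head-formula (sequent⇒balanced s)) (derivable⇒balanced d) (derivable⇒balanced e) (sound d) (sound e)
  sound (⅋-rule s d) = ⅋-sound (sequent⇒balanced s) (derivable⇒balanced d) (sound d)
  sound (⊥→ {A = A} s j∈ i∉ d) = ⊥→-sound (sequent⇒balanced s) (derivable⇒balanced d) (FI↑⇒fu A j∈) i∉ (sound d)
  sound (⊥← {A = A} s j∈ i∉ d) = ⊥←-sound (derivable⇒balanced d) (FI↓⇒fl A j∈) i∉ (sound d)

  -- Formulas as replacements for themselves, and completeness of wired derivations.

  outward inward : Port → Wire End
  outward p = edge (port p) (idx (proj₂ p))
  inward p = edge (idx (proj₂ p)) (port p)

  net : ℕ → Expr → EWires
  net k A = map outward (tag k (fu A)) ++ map inward (tag k (fl A))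

  untag : ℕ → End → Port
  untag k (port p) = p
  untag k (idx x) = k , x

  mapUpper mapLower : (End → End) → Wire End → Wire End
  mapUpper f (edge u l) = edge (f u) l
  mapUpper f loop = loop
  mapLower f (edge u l) = edge u (f l)
  mapLower f loop = loop

  uppers-mapLower : ∀ f W → uppers (map (mapLower f) W) ≡ uppers W
  uppers-mapLower f [] = refl
  uppers-mapLower f (edge u l ∷ W) = cong (u ∷_) (uppers-mapLower f W)
  uppers-mapLower f (loop ∷ W) = uppers-mapLower f W

  mapUpper-ports : ∀ k W → (∀ {e} → e ∈ uppers W → ∃ λ p → e ≡ port p) → map (mapUpper (port ∘ untag k)) W ≡ W
  mapUpper-ports k [] h = refl
  mapUpper-ports k (edge u l ∷ W) h with p , refl ← h (here refl) = cong (edge (port p) l ∷_) (mapUpper-ports k W (h ∘ there))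
  mapUpper-ports k (loop ∷ W) h = cong (loop ∷_) (mapUpper-ports k W h)

  mapLower-ports : ∀ k W → (∀ {e} → e ∈ lowers W → ∃ λ p → e ≡ port p) → map (mapLower (port ∘ untag k)) W ≡ W
  mapLower-ports k [] h = refl
  mapLower-ports k (edge u l ∷ W) h with p , refl ← h (here refl) = cong (edge u (port p) ∷_) (mapLower-ports k W (h ∘ there))
  mapLower-ports k (loop ∷ W) h = cong (loop ∷_) (mapLower-ports k W h)

  all-ports : ∀ {es ps e} → es ↭ map port ps ++ [] → e ∈ es → ∃ λ p → e ≡ port p
  all-ports {ps = ps} p e∈ with q , _ , refl ← ∈-map⁻ port (∈-resp-↭ (trans p (++-identityʳ (map port ps))) e∈) = q , refl

  join-uppers : ∀ k xs W ps → uppers W ↭ map port ps ++ map idx xs →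
                map outward (tag k xs) ++ W ⟿⟨ map idx xs ⟩ map (mapUpper (port ∘ untag k)) W
  join-uppers k [] W ps p = done (↭-reflexive (sym (mapUpper-ports k W (all-ports p))))
  join-uppers k (x ∷ xs) W ps p =
    let l , R , q , r = upper-edge W (trans p (shift (idx x) (map port ps) (map idx xs)))
        Os = map outward (tag k xs)
        e = edge (port (k , x)) l
    in via (prep _ (trans (++⁺ˡ Os q) (shift _ Os R))) (shift e Os R) ⨾
       ⟿*↭ (join-uppers k xs (e ∷ R) ((k , x) ∷ ps) (prep _ r)) (↭-sym (map⁺ (mapUpper (port ∘ untag k)) q))

  join-lowers : ∀ k xs W ps → lowers W ↭ map port ps ++ map idx xs →
                map inward (tag k xs) ++ W ⟿⟨ map idx xs ⟩ map (mapLower (port ∘ untag k)) W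
  join-lowers k [] W ps p = done (↭-reflexive (sym (mapLower-ports k W (all-ports p))))
  join-lowers k (x ∷ xs) W ps p =
    let u , R , q , r = lower-edge W (trans p (shift (idx x) (map port ps) (map idx xs)))
        Is = map inward (tag k xs)
        e = edge u (port (k , x))
    in via (trans (prep _ (trans (++⁺ˡ Is q) (shift _ Is R))) (swap _ _ refl)) (shift e Is R) ⨾
       ⟿*↭ (join-lowers k xs (e ∷ R) ((k , x) ∷ ps) (prep _ r)) (↭-sym (map⁺ (mapLower (port ∘ untag k)) q))

  mapUpper-mapLower : ∀ k W → map (mapUpper (port ∘ untag k)) (map (mapLower (port ∘ untag k)) W) ≡
                      map (mapWire port) (map (mapWire (untag k)) W)
  mapUpper-mapLower k [] = refl
  mapUpper-mapLower k (edge u l ∷ W) = cong (_ ∷_) (mapUpper-mapLower k W)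
  mapUpper-mapLower k (loop ∷ W) = cong (_ ∷_) (mapUpper-mapLower k W)

  -- Each wire of `net k A` swallows one interface end of `W`, whose index `x` thereby becomes the
  -- port `(k , x)`; lower ends are treated before upper ones.
  join : ∀ k A {Γ W} → Typed (fl A) (fu A) Γ W →
         net k A ++ W ⟿⟨ map idx (fl A ++ fu A) ⟩ map (mapWire port) (map (mapWire (untag k)) W)
  join k A {Γ} {W} (typed t t′) = subst₂ (net k A ++ W ⟿⟨_⟩_) (sym (map-++ idx (fl A) (fu A))) (mapUpper-mapLower k W)
    (⟿*-trans (↭⟿* (↭-reflexive (Listₚ.++-assoc Os Is W)) (⟿*-++ˡ Os (join-lowers k (fl A) W (lows Γ) t′)))
      (join-uppers k (fu A) (map (mapLower (port ∘ untag k)) W) (ups Γ) (subst (_↭ _) (sym (uppers-mapLower (port ∘ untag k) W)) t)))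
    where
    Os = map outward (tag k (fu A))
    Is = map inward (tag k (fl A))

  uppers-outward : ∀ ps → uppers (map outward ps) ≡ map port ps
  uppers-outward [] = refl
  uppers-outward (p ∷ ps) = cong (port p ∷_) (uppers-outward ps)

  lowers-outward : ∀ ps → lowers (map outward ps) ≡ map idx (map proj₂ ps)
  lowers-outward [] = refl
  lowers-outward (p ∷ ps) = cong (idx (proj₂ p) ∷_) (lowers-outward ps)

  uppers-inward : ∀ ps → uppers (map inward ps) ≡ map idx (map proj₂ ps)
  uppers-inward [] = refl
  uppers-inward (p ∷ ps) = cong (idx (proj₂ p) ∷_) (uppers-inward ps)

  lowers-inward : ∀ ps → lowers (map inward ps) ≡ map port ps
  lowers-inward [] = refl
  lowers-inward (p ∷ ps) = cong (port p ∷_) (lowers-inward ps)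

  names-tag : ∀ k xs → map proj₂ (tag k xs) ≡ xs
  names-tag k [] = refl
  names-tag k (x ∷ xs) = cong (x ∷_) (names-tag k xs)

  uppers-net : ∀ k A → uppers (net k A) ≡ map port (tag k (fu A)) ++ map idx (fl A)
  uppers-net k A = ≡-trans (uppers-++ (map outward (tag k (fu A)))) (cong₂ _++_ (uppers-outward (tag k (fu A)))
    (≡-trans (uppers-inward (tag k (fl A))) (cong (map idx) (names-tag k (fl A)))))

  lowers-net : ∀ k A → lowers (net k A) ↭ map port (tag k (fl A)) ++ map idx (fu A)
  lowers-net k A = trans (↭-reflexive (≡-trans (lowers-++ (map outward (tag k (fu A)))) (cong₂ _++_
    (≡-trans (lowers-outward (tag k (fu A))) (cong (map idx) (names-tag k (fu A)))) (lowers-inward (tag k (fl A))))))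
    (++-comm (map idx (fu A)) _)

  net-typed : ∀ k A → Typed (fu A) (fl A) [ k , A ] (net k A)
  net-typed k A = typed
    (↭-reflexive (≡-trans (uppers-net k A) (cong (λ ps → map port ps ++ map idx (fl A)) (sym (Listₚ.++-identityʳ (tag k (fu A)))))))
    (trans (lowers-net k A) (↭-reflexive (cong (λ ps → map port ps ++ map idx (fu A)) (sym (Listₚ.++-identityʳ (tag k (fl A)))))))

  interface-Unique : ∀ {A} → Linear A → Unique (fu A ++ fl A) × Unique (fl A ++ fu A)
  interface-Unique (u , l) = ++-Unique (frees-Unique u) (frees-Unique l) frees-disjoint ,
    ++-Unique (frees-Unique l) (frees-Unique u) frees-disjoint

  -- Trades the interface ends used by the semantics for the ports of `A` used by derivations;
  -- `leave` goes back.
  enter : ∀ k {A Γ W} → Linear A → Typed (fl A) (fu A) Γ W → Apart ((k , A) ∷ Γ) →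
          D̂ ((k , A) ∷ Γ) (net k A ++ W) → D ((k , A) ∷ Γ) (map (mapWire (untag k)) W)
  enter k {A} {Γ} {W} lin t a d = D̂-ports _ (D̂-forth (fl A ++ fu A)
    (typed-functional (proj₁ (interface-Unique {A} lin)) (proj₂ (interface-Unique {A} lin)) a (typed-++ (net-typed k A) t)) (join k A t) d)

  leave : ∀ k A {Γ W Δ} → Typed (fl A) (fu A) Γ W → D Δ (map (mapWire (untag k)) W) → D̂ Δ (net k A ++ W)
  leave k A {Γ} {W} t d = D̂-back (fl A ++ fu A) (join k A t) ([] , _ , done refl , d)

  adjoin : ∀ k A {Γ W} → Linear A → K A [ k , A ] (net k A) → co A (K A) Γ W → Apart ((k , A) ∷ Γ) →
           D ((k , A) ∷ Γ) (map (mapWire (untag k)) W)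
  adjoin k A {Γ} {W} lin kA o a = enter k lin (orth-typed o) a
    (D̂-swap Γ W (orth-app o (net-typed k A) kA (apart-↭ (++-comm [ k , A ] Γ) a)))

  zipWith-diagonal : ∀ {A B : Set} (f : A → A → B) {n} (xs : Vec A n) → toList (zipWith f xs xs) ≡ map (λ x → f x x) (toList xs)
  zipWith-diagonal f [] = refl
  zipWith-diagonal f (x ∷ xs) = cong (f x x ∷_) (zipWith-diagonal f xs)

  map-link : ∀ k xs → map outward (tag k xs) ++ map inward (tag k xs) ⟿⟨ map idx xs ⟩ map (mapWire port) (links k xs)
  map-link k [] = done refl
  map-link k (x ∷ xs) = via (prep _ (shift _ (map outward (tag k xs)) _)) refl ⨾ ⟿*-++ˡ [ _ ] (map-link k xs)

  net-split : ∀ k {A B} → Linear (A ⊗ B) →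
              net k A ++ net k B ⟿⟨ map idx (shared A B) ⟩ map (mapWire port) (links k (shared A B)) ++ net k (A ⊗ B)
  net-split k {A} {B} lin = ↭⟿* perm (⟿*-++ (net k (A ⊗ B)) (map-link k (shared A B)))
    where
    S = shared A B
    part : ∀ (f : Port → Wire End) {xs ys zs} → xs ++ ys ↭ S ++ zs →
           map f (tag k xs) ++ map f (tag k ys) ↭ map f (tag k S) ++ map f (tag k zs)
    part f {xs} {ys} {zs} p = subst₂ _↭_ (e xs ys) (e S zs) (map⁺ f (map⁺ (k ,_) p))
      where
      e : ∀ xs ys → map f (tag k (xs ++ ys)) ≡ map f (tag k xs) ++ map f (tag k ys)
      e xs ys = ≡-trans (cong (map f) (map-++ (k ,_) xs ys)) (map-++ f (tag k xs) (tag k ys))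
    perm : net k A ++ net k B ↭ (map outward (tag k S) ++ map inward (tag k S)) ++ net k (A ⊗ B)
    perm = trans (solve 4 (λ a b c d → (a ⊕ b) ⊕ c ⊕ d ⊜ (a ⊕ c) ⊕ b ⊕ d) refl
        (map outward (tag k (fu A))) (map inward (tag k (fl A))) (map outward (tag k (fu B))) (map inward (tag k (fl B))))
      (trans (++⁺ (part outward {fu A} {fu B} {fu (A ⊗ B)} (fu-split {A} {B} lin)) (part inward {fl A} {fl B} {fl (A ⊗ B)} (fl-split {A} {B} lin)))
        (solve 4 (λ a b c d → (a ⊕ b) ⊕ c ⊕ d ⊜ (a ⊕ c) ⊕ b ⊕ d) refl
        (map outward (tag k S)) (map outward (tag k (fu (A ⊗ B)))) (map inward (tag k S)) (map inward (tag k (fl (A ⊗ B))))))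

  untag-idx : ∀ k xs → map (untag k) (map idx xs) ≡ tag k xs
  untag-idx k xs = sym (Listₚ.map-∘ xs)

  typed-⟿* : ∀ S {U L U′ L′ Γ W W′} → U ↭ S ++ U′ → L ↭ S ++ L′ → Typed U L Γ W → W ⟿⟨ map idx S ⟩ W′ → Typed U′ L′ Γ W′
  typed-⟿* S {U} {L} {U′} {L′} {Γ} p q (typed t t′) s =
    let e , e′ = ⟿*-ends s in typed (move L q (ups Γ) (trans (↭-sym e) t)) (move U p (lows Γ) (trans (↭-sym e′) t′))
    where
    move : ∀ {es} X {X′} → X ↭ S ++ X′ → ∀ ps → map idx S ++ es ↭ map port ps ++ map idx X → es ↭ map port ps ++ map idx X′
    move X {X′} q ps t = drop-++ (map idx S) (trans t (trans (++⁺ˡ (map port ps) (trans (map⁺ idx q) (↭-reflexive (map-++ idx S X′))))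
      (shifts (map port ps) (map idx S))))

  ported : ∀ k W → (∀ {e} → e ∈ uppers W → ∃ λ p → e ≡ port p) → (∀ {e} → e ∈ lowers W → ∃ λ p → e ≡ port p) →
           map (mapWire port) (map (mapWire (untag k)) W) ≡ W
  ported k [] h h′ = refl
  ported k (edge u l ∷ W) h h′ with p , refl ← h (here refl) | q , refl ← h′ (here refl) =
    cong (_ ∷_) (ported k W (h ∘ there) (h′ ∘ there))
  ported k (loop ∷ W) h h′ = cong (_ ∷_) (ported k W h h′)

  -- Combined with the bare wire and contracted at `i` and `j`, the test gives a derivation without
  -- the ⊥-formula. If its wire into `i` starts at `j`, the contraction closes a loop and `bot-loop`
  -- applies; otherwise it joins two wires, which `bot` separates again.
  adequate-⊥ : ∀ k {j i} → i ≢ j → ∀ {Ξ N} → co ⊥⟨ j / i ⟩ (Bare (j ∷ []) (i ∷ [])) Ξ N → Apart Ξ →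
               D ((k , ⊥⟨ j / i ⟩) ∷ Ξ) (map (mapWire (untag k)) N)
  adequate-⊥ k {j} {i} i≢j {Ξ} {N} o a =
    let u , R , q , r = lower-edge N (trans (Typed.typed-lower tN) (++-comm (map port (lows Ξ)) [ idx i ]))
    in go q (∈-resp-↭ (trans (↭-sym (trans (Typed.typed-upper tN) (++-comm (map port (ups Ξ)) [ idx j ]))) (uppers-↭ q)) (here refl))
    where
    τ = map (mapWire (untag k))
    tN : Typed [ i ] [ j ] Ξ N
    tN = subst₂ (λ U L → Typed U L Ξ N) (fl-⊥ i≢j) (fu-⊥ i≢j) (orth-typed o)
    tB : Typed [ j ] [ i ] [] [ edge (idx i) (idx j) ]
    tB = typed refl refl
    d : D̂ Ξ (N ++ [ edge (idx i) (idx j) ])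
    d = D̂-resp (++-identityʳ Ξ) refl (orth-app o (subst₂ (λ U L → Typed U L [] _) (sym (fu-⊥ i≢j)) (sym (fl-⊥ i≢j)) tB) bare
          (apart-↭ (↭-sym (++-identityʳ Ξ)) a))
    t : Typed (i ∷ [ j ]) (j ∷ [ i ]) Ξ (N ++ [ edge (idx i) (idx j) ])
    t = subst (λ Γ → Typed (i ∷ [ j ]) (j ∷ [ i ]) Γ _) (Listₚ.++-identityʳ Ξ) (typed-++ tN tB)
    f : Functional (N ++ [ edge (idx i) (idx j) ])
    f = typed-functional (∷-Unique (λ { (here refl) → i≢j refl }) ([] ∷ [])) (∷-Unique (λ { (here refl) → i≢j refl }) ([] ∷ [])) a t
    close : ∀ {W} → N ++ [ edge (idx i) (idx j) ] ⟿⟨ idx i ∷ [ idx j ] ⟩ W → D Ξ (τ W)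
    close {W} s = D̂-ports _ (subst (D̂ Ξ) (sym (ported k W (all-ports (Typed.typed-upper t′)) (all-ports (Typed.typed-lower t′))))
      (D̂-forth (i ∷ [ j ]) f s d))
      where t′ = typed-⟿* (i ∷ [ j ]) {U′ = []} {L′ = []} refl (swap j i refl) t s
    go : ∀ {u R} → N ↭ edge u (idx i) ∷ R → idx j ∈ u ∷ uppers R → D ((k , ⊥⟨ j / i ⟩) ∷ Ξ) (τ N)
    go {R = R} q (here refl) = bot-loop refl
      (close (via (trans (++⁺ʳ _ q) (prep _ (++-comm R [ _ ]))) refl ⨾ (cyc refl refl ⨾ done refl)))
      (map⁺ (mapWire (untag k)) q)
    go {u} {R} q (there j∈) =
      let us , r = ∈⇒↭ j∈
          l , R′ , q′ , _ = upper-edge R r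
      in bot refl
      (close (via (trans (++⁺ʳ _ q) (prep _ (++-comm R [ _ ]))) refl ⨾ (via (prep _ q′) refl ⨾ done refl)))
      (map⁺ (mapWire (untag k)) (trans q (prep _ q′)))

  pair-Unique : ∀ {A B} → Linear (A ⊗ B) → Unique (fu A ++ fu B) × Unique (fl A ++ fl B)
  pair-Unique {A} {B} lin@(u , l) =
    ++-Unique (frees-Unique (proj₁ (linearˡ {A} {B} lin))) (frees-Unique (proj₁ (linearʳ {A} {B} lin)))
      (λ p q → Unique-disjoint u (proj₁ (∈-frees⁻ p)) (proj₁ (∈-frees⁻ q))) ,
    ++-Unique (frees-Unique (proj₂ (linearˡ {A} {B} lin))) (frees-Unique (proj₂ (linearʳ {A} {B} lin)))
      (λ p q → Unique-disjoint l (proj₁ (∈-frees⁻ p)) (proj₁ (∈-frees⁻ q)))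

  -- This plays the part of identity expansion: it allows validity of a sequent to be specialised to
  -- the sequent itself. For ⊗ the two given tests supply the premises of the wired rule; for ⅋ the
  -- pair of nets of the parts does.
  adequate : ∀ A → IsFormula A → ∀ k → K A [ k , A ] (net k A)
  adequate A@(atom (pos p) us ls) (d , _) k = orth (net-typed k A) λ {Ξ} {N} t o a →
    D̂-swap Ξ N (subst (λ M → D̂ (Ξ ++ [ k , A ]) (N ++ M)) net≡
      (orth-app o (subst (Typed (fu A) (fl A) [ k , A ]) (sym net≡) (net-typed k A)) (generator k us ls) (apart-↭ (++-comm [ k , A ] Ξ) a)))
    where
    zip≡ : ∀ (f : Port → Wire End) {n} (xs : Vec Ind n) {ys} → ys ≡ toList xs →
           ∀ {g : Ind → Ind → Wire End} → (∀ x → g x x ≡ f (k , x)) → toList (zipWith g xs xs) ≡ map f (tag k ys)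
    zip≡ f xs refl {g} h = ≡-trans (zipWith-diagonal g xs) (≡-trans (Listₚ.map-cong h (toList xs)) (Listₚ.map-∘ (toList xs)))
    net≡ : toList (zipWith (λ u′ u → edge (port (k , u′)) (idx u)) us us) ++
           toList (zipWith (λ l l′ → edge (idx l) (port (k , l′))) ls ls) ≡ net k A
    net≡ = cong₂ _++_ (zip≡ outward us (frees-all (Unique-disjoint d)) (λ _ → refl))
                      (zip≡ inward ls (frees-all (λ p q → Unique-disjoint d q p)) (λ _ → refl))
  adequate A@(atom (neg p) us ls) _ k = orth (net-typed k A) λ { t (generator k′ us′ ls′) _ →
    leave k A t (axiom refl (↭-reflexive (≡-trans (map-++ (mapWire (untag k)) (toList (zipWith _ us′ (reverse ls))) _)
      (cong₂ _++_ (map-zipWith _ _ us′ (reverse ls)) (map-zipWith _ _ (reverse us) ls′))))) }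
  adequate A@(atom ⊥ (j ∷ []) (i ∷ [])) (d , _) k = orth (net-typed k A) λ {Ξ} t o a →
    leave k A t (adequate-⊥ k (λ { refl → head-∉ d (here refl) }) o (apart-++ʳ [ k , A ] {Ξ} a))
  adequate A@(atom 𝟏 (i ∷ []) (j ∷ [])) _ k = orth (net-typed k A) λ { t bare _ → leave k A t (one refl refl) }
  adequate (A ⊗ B) f@(_ , lin) k = orth (net-typed k (A ⊗ B)) λ { {Ξ} {C} t (pair {Ξ = Ξ₁} {Ξ₂} {M₁} {M₂} {Int = Int} o₁ o₂ q p s) a →
    let a′ : Apart (((k , A) ∷ Ξ₁) ++ ((k , B) ∷ Ξ₂))
        a′ = apart-↭ {(k , A) ∷ (k , B) ∷ Ξ} (trans (prep _ (prep _ q)) (prep _ (↭-sym (shift (k , B) Ξ₁ Ξ₂)))) (apart-⅋ k A B Ξ a)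
        d₁ = adjoin k A (linearˡ {A} {B} lin) (adequate A (formulaˡ f) k) o₁ (apart-++ˡ {(k , A) ∷ Ξ₁} ((k , B) ∷ Ξ₂) a′)
        d₂ = adjoin k B (linearʳ {A} {B} lin) (adequate B (formulaʳ f) k) o₂ (apart-++ʳ ((k , A) ∷ Ξ₁) a′)
        fn = typed-functional (proj₂ (pair-Unique {A} {B} lin)) (proj₁ (pair-Unique {A} {B} lin))
               (apart-↭ q (apart-++ʳ [ k , A ⊗ B ] {Ξ} a)) (typed-++ (orth-typed o₁) (orth-typed o₂))
        -- The pair may contract the shared indices in another order than `tensor` prescribes.
        s′ = ⟿*-map (untag k) (⟿*-perm _≟ₑ_ fn (map⁺ idx p) s)
    in leave k (A ⊗ B) t (tensor (prep _ q) d₁ d₂ (subst₂ (_⟿⟨_⟩ map (mapWire (untag k)) C) (map-++ _ M₁ M₂) (untag-idx k (shared A B)) s′)) }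
  adequate (A ⅋ B) f@(_ , lin) k = orth (net-typed k (A ⅋ B)) λ {Ξ} {N} t o a →
    let L = links k (shared A B)
        C = map (mapWire port) L ++ net k (A ⅋ B)
        tC : Typed (fu (A ⅋ B)) (fl (A ⅋ B)) ((k , A) ∷ [ k , B ]) C
        tC = typed-⟿* (shared A B) (fu-split {A} {B} lin) (fl-split {A} {B} lin) (typed-++ (net-typed k A) (net-typed k B)) (net-split k {A} {B} lin)
        a′ = apart-↭ (++-comm ((k , A) ∷ [ k , B ]) Ξ) (apart-⅋ k A B Ξ a)
        d = orth-app o tC (pair (adequate A (formulaˡ f) k) (adequate B (formulaʳ f) k) refl refl (net-split k {A} {B} lin)) a′
        e : C ++ N ⟿⟨ map idx (fl (A ⅋ B) ++ fu (A ⅋ B)) ⟩ map (mapWire port) (L ++ map (mapWire (untag k)) N)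
        e = ⟿*↭ (↭⟿* (↭-reflexive (Listₚ.++-assoc (map (mapWire port) L) (net k (A ⅋ B)) N)) (⟿*-++ˡ (map (mapWire port) L) (join k (A ⅋ B) t)))
              (↭-reflexive (sym (map-++ (mapWire port) L _)))
        fn = typed-functional (proj₁ (interface-Unique {A ⅋ B} lin)) (proj₂ (interface-Unique {A ⅋ B} lin)) (apart-⅋ k A B Ξ a)
               (typed-++ tC (orth-typed o))
    in leave k (A ⅋ B) t (par refl (D̂-ports _ (D̂-forth (fl (A ⅋ B) ++ fu (A ⅋ B)) fn e (D̂-swap Ξ N d))))

  nets : ℕ → List Expr → EWires
  nets k [] = []
  nets k (A ∷ Γ) = net k A ++ nets (suc k) Γ

  real-number : ∀ k {Γ} → All IsFormula Γ → Real Γ (number k Γ) (nets k Γ)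
  real-number k [] = []
  real-number k (f ∷ fs) = adequate _ f k ∷ real-number (suc k) fs

  names-FU : ∀ k Γ → map proj₂ (ups (number k Γ)) ≡ FU Γ
  names-FU k [] = refl
  names-FU k (A ∷ Γ) = ≡-trans (map-++ proj₂ (tag k (fu A)) _) (cong₂ _++_ (names-tag k (fu A)) (names-FU (suc k) Γ))

  names-FL : ∀ k Γ → map proj₂ (lows (number k Γ)) ≡ FL Γ
  names-FL k [] = refl
  names-FL k (A ∷ Γ) = ≡-trans (map-++ proj₂ (tag k (fl A)) _) (cong₂ _++_ (names-tag k (fl A)) (names-FL (suc k) Γ))

  nets-split : ∀ k Γ → nets k Γ ↭ map outward (ups (number k Γ)) ++ map inward (lows (number k Γ))
  nets-split k [] = refl
  nets-split k (A ∷ Γ) = trans (++⁺ˡ (net k A) (nets-split (suc k) Γ))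
    (trans (solve 4 (λ a b c d → (a ⊕ b) ⊕ c ⊕ d ⊜ (a ⊕ c) ⊕ b ⊕ d) refl (map outward (tag k (fu A))) (map inward (tag k (fl A))) (map outward (ups (number (suc k) Γ))) _)
      (↭-reflexive (sym (cong₂ _++_ (map-++ outward (tag k (fu A)) _) (map-++ inward (tag k (fl A)) _)))))

  joints : ∀ (U L : List Port) → map proj₂ U ↭ map proj₂ L →
           ∃ λ Zs → U ≡ map upper-port Zs × L ↭ map lower-port Zs
  joints [] [] p = [] , refl , refl
  joints [] (q ∷ L) p with () ← ∈-resp-↭ (↭-sym p) (here refl)
  joints ((k , x) ∷ U) L p with (k′ , _) , q , refl ← ∈-map⁻ proj₂ (∈-resp-↭ p (here refl))
    with L′ , r ← ∈⇒↭ q with Zs , refl , s ← joints U L′ (drop-∷ (trans p (map⁺ proj₂ r))) =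
    joint k k′ x ∷ Zs , refl , trans r (prep _ s)

  join-joints : ∀ Zs → map outward (map upper-port Zs) ++ map inward (map lower-port Zs) ⟿⟨ map idx (map Joint.name Zs) ⟩
                map (mapWire port) (map wire Zs)
  join-joints [] = done refl
  join-joints (z ∷ Zs) = via (prep _ (shift _ (map outward (map upper-port Zs)) _)) refl ⨾ ⟿*-++ˡ [ _ ] (join-joints Zs)

  sequent-joints : ∀ {Γ} → Balanced Γ → ∃ λ Zs → ups (number 0 Γ) ≡ map upper-port Zs × lows (number 0 Γ) ↭ map lower-port Zs
  sequent-joints {Γ} (_ , _ , p) = joints (ups (number 0 Γ)) (lows (number 0 Γ))
    (subst₂ _↭_ (sym (names-FU 0 Γ)) (sym (names-FL 0 Γ)) p)

  -- Validity is specialised to the formulas themselves by `adequate`; contracting every free index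
  -- of the sequent then leaves the wires joining its upper to its lower occurrence.
  complete : ∀ {Γ} → ⊢ Γ → (b : Balanced Γ) → D (number 0 Γ) (map wire (proj₁ (sequent-joints b)))
  complete {Γ} d b@(fs , _) =
    let Zs , e , p = sequent-joints b
        r = real-number 0 fs
        a = apart-number 0 fs
    in D̂-ports _ (D̂-forth (map Joint.name Zs) (real-functional b r a)
         (↭⟿* (trans (nets-split 0 Γ) (++⁺ (↭-reflexive (cong (map outward) e)) (map⁺ inward p))) (join-joints Zs))
         (sound d r a))

  -- The cut-free calculus

  -- Well-formedness is expressed by `Balanced` and freeness by membership in `fu` and `fl`, the
  -- forms in which the realisation computes them.
  data CF : List Expr → Set where
    exchange : ∀ {Γ Δ} → Γ ↭ Δ → CF Γ → CF Δ
    id : ∀ p us ls → let A = atom p us ls in Balanced (dual A ∷ A ∷ []) → CF (dual A ∷ A ∷ [])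
    tensor : ∀ {Γ Δ A B} → Balanced (A ⊗ B ∷ Γ ++ Δ) → CF (A ∷ Γ) → CF (B ∷ Δ) → CF (A ⊗ B ∷ Γ ++ Δ)
    par : ∀ {Γ A B} → Balanced (A ⅋ B ∷ Γ) → CF (A ∷ B ∷ Γ) → CF (A ⅋ B ∷ Γ)
    ⊥→ : ∀ {Γ A i j} → Balanced (⊥⟨ j / i ⟩ ∷ A [ i / j ]↑ ∷ Γ) → j ∈ fu A → i ∉ occurrences A →
         CF (A ∷ Γ) → CF (⊥⟨ j / i ⟩ ∷ A [ i / j ]↑ ∷ Γ)
    ⊥← : ∀ {Γ A i j} → Balanced (A [ i / j ]↓ ∷ Γ) → j ∈ fl A → i ∉ occurrences A →
         CF (⊥⟨ j / i ⟩ ∷ A ∷ Γ) → CF (A [ i / j ]↓ ∷ Γ)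

  CF-balanced : ∀ {Γ} → CF Γ → Balanced Γ
  CF-balanced (exchange p d) = balanced-↭ p (CF-balanced d)
  CF-balanced (id p us ls b) = b
  CF-balanced (tensor b _ _) = b
  CF-balanced (par b _) = b
  CF-balanced (⊥→ b _ _ _) = b
  CF-balanced (⊥← b _ _ _) = b

  CF⇒⊢ : ∀ {Γ} → CF Γ → ⊢ Γ
  CF⇒⊢ (exchange p d) = exchange p (CF⇒⊢ d)
  CF⇒⊢ (id p us ls b) = id p us ls (balanced⇒sequent b)
  CF⇒⊢ (tensor b d e) = ⊗-rule (balanced⇒sequent b) (CF⇒⊢ d) (CF⇒⊢ e)
  CF⇒⊢ (par b d) = ⅋-rule (balanced⇒sequent b) (CF⇒⊢ d)
  CF⇒⊢ (⊥→ {A = A} b j∈ i∉ d) = ⊥→ (balanced⇒sequent b) (fu⇒FI↑ A (proj₂ (All.head (proj₁ (CF-balanced d)))) j∈) i∉ (CF⇒⊢ d)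
  CF⇒⊢ (⊥← {A = A} b j∈ i∉ d) =
    ⊥← (balanced⇒sequent b) (fl⇒FI↓ A (proj₂ (All.head (All.tail (proj₁ (CF-balanced d))))) j∈) i∉ (CF⇒⊢ d)

  -- The renaming neither merges nor separates indices: `cross` prevents new bound indices from
  -- arising, `bound` keeps the old ones bound.
  record Safe (f g : Ind → Ind) (A : Expr) : Set where
    field
      injᵘ  : ∀ {x y} → x ∈ upper A → y ∈ upper A → f x ≡ f y → x ≡ y
      injˡ  : ∀ {x y} → x ∈ lower A → y ∈ lower A → g x ≡ g y → x ≡ y
      cross : ∀ {x y} → x ∈ upper A → y ∈ lower A → f x ≡ g y → x ≡ y
      bound : ∀ {x} → x ∈ upper A → x ∈ lower A → f x ≡ g x

  map-Unique : ∀ {f : Ind → Ind} {xs} → (∀ {x y} → x ∈ xs → y ∈ xs → f x ≡ f y → x ≡ y) → Unique xs → Unique (map f xs)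
  map-Unique {xs = []} inj u = []
  map-Unique {f} {x ∷ xs} inj u = ∷-Unique
    (λ i → let y , y∈ , e = ∈-map⁻ f i in head-∉ u (subst (_∈ xs) (sym (inj (here refl) (there y∈) e)) y∈))
    (map-Unique (λ p q → inj (there p) (there q)) (Unique-++⁻ʳ [ x ] u))

  module _ {f g : Ind → Ind} where
    open Safe

    safe-atoms : ∀ A → Safe f g A → AtomsDistinct A → AtomsDistinct (ren f g A)
    safe-atoms (atom p us ls) s d = subst₂ (λ us ls → Unique (us ++ ls)) (sym (Vecₚ.toList-map f us)) (sym (Vecₚ.toList-map g ls))
      (++-Unique (map-Unique (injᵘ s) (Unique-++⁻ˡ d)) (map-Unique (injˡ s) (Unique-++⁻ʳ (toList us) d)) disj)
      where
      disj : ∀ {z} → z ∈ map f (toList us) → z ∉ map g (toList ls)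
      disj p q with x , x∈ , refl ← ∈-map⁻ f p with y , y∈ , e ← ∈-map⁻ g q with refl ← cross s x∈ y∈ e = Unique-disjoint d x∈ y∈
    safe-atoms (A ⊗ B) s (d , e) = safe-atoms A record
        { injᵘ = λ p q → injᵘ s (∈-++⁺ˡ p) (∈-++⁺ˡ q) ; injˡ = λ p q → injˡ s (∈-++⁺ˡ p) (∈-++⁺ˡ q)
        ; cross = λ p q → cross s (∈-++⁺ˡ p) (∈-++⁺ˡ q) ; bound = λ p q → bound s (∈-++⁺ˡ p) (∈-++⁺ˡ q) } d ,
      safe-atoms B record
        { injᵘ = λ p q → injᵘ s (∈-++⁺ʳ _ p) (∈-++⁺ʳ _ q) ; injˡ = λ p q → injˡ s (∈-++⁺ʳ _ p) (∈-++⁺ʳ _ q)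
        ; cross = λ p q → cross s (∈-++⁺ʳ _ p) (∈-++⁺ʳ _ q) ; bound = λ p q → bound s (∈-++⁺ʳ _ p) (∈-++⁺ʳ _ q) } e
    safe-atoms (A ⅋ B) s (d , e) = safe-atoms A record
        { injᵘ = λ p q → injᵘ s (∈-++⁺ˡ p) (∈-++⁺ˡ q) ; injˡ = λ p q → injˡ s (∈-++⁺ˡ p) (∈-++⁺ˡ q)
        ; cross = λ p q → cross s (∈-++⁺ˡ p) (∈-++⁺ˡ q) ; bound = λ p q → bound s (∈-++⁺ˡ p) (∈-++⁺ˡ q) } d ,
      safe-atoms B record
        { injᵘ = λ p q → injᵘ s (∈-++⁺ʳ _ p) (∈-++⁺ʳ _ q) ; injˡ = λ p q → injˡ s (∈-++⁺ʳ _ p) (∈-++⁺ʳ _ q)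
        ; cross = λ p q → cross s (∈-++⁺ʳ _ p) (∈-++⁺ʳ _ q) ; bound = λ p q → bound s (∈-++⁺ʳ _ p) (∈-++⁺ʳ _ q) } e

    safe-linear : ∀ {A} → Safe f g A → Linear A → Linear (ren f g A)
    safe-linear {A} s (u , l) = subst Unique (sym (upper-ren f g A)) (map-Unique (injᵘ s) u) ,
      subst Unique (sym (lower-ren f g A)) (map-Unique (injˡ s) l)

    safe-formula : ∀ {A} → Safe f g A → IsFormula A → IsFormula (ren f g A)
    safe-formula {A} s (d , lin) = safe-atoms A s d , safe-linear s lin

    private
      frees-safe : ∀ {us ls} {f g : Ind → Ind} → (∀ {x y} → x ∈ us → y ∈ us → f x ≡ f y → x ≡ y) →
                   (∀ {x y} → x ∈ us → y ∈ ls → f x ≡ g y → x ≡ y) → (∀ {x} → x ∈ us → x ∈ ls → f x ≡ g x) →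
                   Unique us → frees (map f us) (map g ls) ↭ map f (frees us ls)
      frees-safe {us} {ls} {f} {g} inj cr bd u = unique-↭ (frees-Unique (map-Unique inj u))
        (map-Unique (λ p q → inj (proj₁ (∈-frees⁻ p)) (proj₁ (∈-frees⁻ q))) (frees-Unique u)) to from
        where
        to : ∀ {z} → z ∈ frees (map f us) (map g ls) → z ∈ map f (frees us ls)
        to z∈ with p , q ← ∈-frees⁻ z∈ with x , x∈ , refl ← ∈-map⁻ f p =
          ∈-map⁺ f (∈-frees⁺ x∈ λ x∈ls → q (subst (_∈ map g ls) (sym (bd x∈ x∈ls)) (∈-map⁺ g x∈ls)))
        from : ∀ {z} → z ∈ map f (frees us ls) → z ∈ frees (map f us) (map g ls)
        from z∈ with x , p , refl ← ∈-map⁻ f z∈ with x∈ , x∉ ← ∈-frees⁻ p =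
          ∈-frees⁺ (∈-map⁺ f x∈) λ q → let y , y∈ , e = ∈-map⁻ g q in x∉ (subst (_∈ ls) (sym (cr x∈ y∈ e)) y∈)

    safe-fu : ∀ {A} → Safe f g A → Linear A → fu (ren f g A) ↭ map f (fu A)
    safe-fu {A} s (u , l) = subst₂ (λ us ls → frees us ls ↭ map f (fu A)) (sym (upper-ren f g A)) (sym (lower-ren f g A))
      (frees-safe (injᵘ s) (cross s) (bound s) u)

    safe-fl : ∀ {A} → Safe f g A → Linear A → fl (ren f g A) ↭ map g (fl A)
    safe-fl {A} s (u , l) = subst₂ (λ us ls → frees ls us ↭ map g (fl A)) (sym (upper-ren f g A)) (sym (lower-ren f g A))
      (frees-safe (injˡ s) (λ p q e → sym (cross s q p (sym e))) (λ p q → sym (bound s q p)) l)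

  replace-injective : ∀ {i j xs} → i ∉ xs → ∀ {x y} → x ∈ xs → y ∈ xs → replace i j x ≡ replace i j y → x ≡ y
  replace-injective {i} {j} i∉ {x} {y} x∈ y∈ e with x ≟ᵢ j | y ≟ᵢ j
  ... | yes refl | yes refl = refl
  ... | yes refl | no _ = contradiction (subst (_∈ _) (sym e) y∈) i∉
  ... | no _ | yes refl = contradiction (subst (_∈ _) e x∈) i∉
  ... | no _ | no _ = e

  map-replace-∉ : ∀ {i j} xs → j ∉ xs → map (replace i j) xs ≡ xs
  map-replace-∉ [] j∉ = refl
  map-replace-∉ (x ∷ xs) j∉ = cong₂ _∷_ (replace-≢ λ { refl → j∉ (here refl) }) (map-replace-∉ xs (j∉ ∘ there))

  module _ {A : Expr} {i j : Ind} (f : IsFormula A) (i∉ : i ∉ occurrences A) where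
    private
      lin = proj₂ f
      i∉u : i ∉ upper A
      i∉u = i∉ ∘ ∈-++⁺ˡ
      i∉l : i ∉ lower A
      i∉l = i∉ ∘ ∈-++⁺ʳ (upper A)

    module _ (j∈ : j ∈ fu A) where
      private
        j∉l = proj₂ (∈-frees⁻ j∈)
        safe : Safe (replace i j) (λ x → x) A
        safe = record
          { injᵘ = replace-injective i∉u ; injˡ = λ _ _ e → e
          ; cross = λ { {x} {y} x∈ y∈ e → cr x y y∈ e }
          ; bound = λ _ x∈l → replace-≢ λ { refl → j∉l x∈l } }
          where
          cr : ∀ x y → y ∈ lower A → replace i j x ≡ y → x ≡ y
          cr x y y∈ e with x ≟ᵢ j
          ... | yes _ = contradiction (subst (_∈ lower A) (sym e) y∈) i∉l
          ... | no _ = e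

      formula↑ : IsFormula (A [ i / j ]↑)
      formula↑ = subst IsFormula (sym (subst↑-ren i j A)) (safe-formula safe f)

      fl↑ : fl (A [ i / j ]↑) ↭ fl A
      fl↑ = subst (λ B → fl B ↭ fl A) (sym (subst↑-ren i j A)) (trans (safe-fl safe lin) (↭-reflexive (Listₚ.map-id (fl A))))

      fu↑ : ∀ {F} → fu A ↭ j ∷ F → fu (A [ i / j ]↑) ↭ i ∷ F
      fu↑ {F} p = subst (λ B → fu B ↭ i ∷ F) (sym (subst↑-ren i j A)) (trans (safe-fu safe lin) (trans (map⁺ (replace i j) p)
        (↭-reflexive (cong₂ _∷_ (replace-≡ i j) (map-replace-∉ F (head-∉ (Unique-resp-↭ p (frees-Unique (proj₁ lin)))))))))

    module _ (j∈ : j ∈ fl A) where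
      private
        j∉u = proj₂ (∈-frees⁻ j∈)
        safe : Safe (λ x → x) (replace i j) A
        safe = record
          { injᵘ = λ _ _ e → e ; injˡ = replace-injective i∉l
          ; cross = λ { {x} {y} x∈ y∈ e → cr x y x∈ e }
          ; bound = λ x∈u _ → sym (replace-≢ λ { refl → j∉u x∈u }) }
          where
          cr : ∀ x y → x ∈ upper A → x ≡ replace i j y → x ≡ y
          cr x y x∈ e with y ≟ᵢ j
          ... | yes _ = contradiction (subst (_∈ upper A) e x∈) i∉u
          ... | no _ = e

      formula↓ : IsFormula (A [ i / j ]↓)
      formula↓ = subst IsFormula (sym (subst↓-ren i j A)) (safe-formula safe f)

      fu↓ : fu (A [ i / j ]↓) ↭ fu A
      fu↓ = subst (λ B → fu B ↭ fu A) (sym (subst↓-ren i j A)) (trans (safe-fu safe lin) (↭-reflexive (Listₚ.map-id (fu A))))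

      fl↓ : ∀ {F} → fl A ↭ j ∷ F → fl (A [ i / j ]↓) ↭ i ∷ F
      fl↓ {F} p = subst (λ B → fl B ↭ i ∷ F) (sym (subst↓-ren i j A)) (trans (safe-fl safe lin) (trans (map⁺ (replace i j) p)
        (↭-reflexive (cong₂ _∷_ (replace-≡ i j) (map-replace-∉ F (head-∉ (Unique-resp-↭ p (frees-Unique (proj₂ lin)))))))))

  formula-bot : ∀ {i j} → i ≢ j → IsFormula ⊥⟨ j / i ⟩
  formula-bot i≢j = ∷-Unique (λ { (here refl) → i≢j refl }) ([] ∷ []) , [] ∷ [] , [] ∷ []

  -- Well-formedness of the conclusion is computed from that of the premise. The index `i` is new to
  -- the sequent, so it has to avoid the context as well as `A`.
  ⊥→′ : ∀ {Γ A} i j → CF (A ∷ Γ) → j ∈ fu A → i ∉ occurrences A → i ∉ FU Γ → CF (⊥⟨ j / i ⟩ ∷ A [ i / j ]↑ ∷ Γ)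
  ⊥→′ {Γ} {A} i j d j∈ i∉ i∉Γ with fA ∷ fs , u , b ← CF-balanced d with F , p ← ∈⇒↭ j∈ =
    ⊥→ (formula-bot i≢j ∷ formula↑ fA i∉ j∈ ∷ fs , Unique-resp-↭ (↭-sym FU↭) u′ , trans FU↭ (trans ↭₁ (↭-sym FL↭))) j∈ i∉ d
    where
    i≢j : i ≢ j
    i≢j refl = i∉ (∈-++⁺ˡ (proj₁ (∈-frees⁻ j∈)))
    FU↭ : FU (⊥⟨ j / i ⟩ ∷ A [ i / j ]↑ ∷ Γ) ↭ i ∷ j ∷ F ++ FU Γ
    FU↭ = trans (++⁺ (↭-reflexive (fu-⊥ i≢j)) (++⁺ʳ (FU Γ) (fu↑ fA i∉ j∈ p))) (swap j i refl)
    FL↭ : FL (⊥⟨ j / i ⟩ ∷ A [ i / j ]↑ ∷ Γ) ↭ i ∷ fl A ++ FL Γ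
    FL↭ = ++⁺ (↭-reflexive (fl-⊥ i≢j)) (++⁺ʳ (FL Γ) (fl↑ fA i∉ j∈))
    ↭₁ : i ∷ j ∷ F ++ FU Γ ↭ i ∷ fl A ++ FL Γ
    ↭₁ = prep i (trans (++⁺ʳ (FU Γ) (↭-sym p)) b)
    u′ : Unique (i ∷ j ∷ F ++ FU Γ)
    u′ = ∷-Unique (λ q → [ i∉ ∘ ∈-++⁺ˡ ∘ proj₁ ∘ ∈-frees⁻ , i∉Γ ]′ (∈-++⁻ (fu A) (∈-resp-↭ (++⁺ʳ (FU Γ) (↭-sym p)) q)))
           (Unique-resp-↭ (++⁺ʳ (FU Γ) p) u)

  -- Here `i` is a free index of the premise from the start, and balance is inherited by cancelling
  -- `j` on both sides.
  ⊥←′ : ∀ {Γ A} i j → CF (⊥⟨ j / i ⟩ ∷ A ∷ Γ) → j ∈ fl A → i ∉ occurrences A → CF (A [ i / j ]↓ ∷ Γ)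
  ⊥←′ {Γ} {A} i j d j∈ i∉ with _ ∷ fA ∷ fs , u , b ← CF-balanced d with F , p ← ∈⇒↭ j∈ =
    ⊥← (formula↓ fA i∉ j∈ ∷ fs , Unique-resp-↭ (↭-sym FU↭) (Unique-++⁻ʳ (fu ⊥⟨ j / i ⟩) u) ,
      trans FU↭ (trans (drop-∷ (trans (trans (++⁺ʳ _ (↭-reflexive (sym (fu-⊥ i≢j)))) b) FL↭)) (↭-sym FL↭′))) j∈ i∉ d
    where
    i≢j : i ≢ j
    i≢j refl = i∉ (∈-++⁺ʳ (upper A) (proj₁ (∈-frees⁻ j∈)))
    FU↭ : FU (A [ i / j ]↓ ∷ Γ) ↭ fu A ++ FU Γ
    FU↭ = ++⁺ʳ (FU Γ) (fu↓ fA i∉ j∈)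
    FL↭ : FL (⊥⟨ j / i ⟩ ∷ A ∷ Γ) ↭ j ∷ i ∷ F ++ FL Γ
    FL↭ = trans (++⁺ (↭-reflexive (fl-⊥ i≢j)) (++⁺ʳ (FL Γ) p)) (swap i j refl)
    FL↭′ : FL (A [ i / j ]↓ ∷ Γ) ↭ i ∷ F ++ FL Γ
    FL↭′ = ++⁺ʳ (FL Γ) (fl↓ fA i∉ j∈ p)

  par′ : ∀ {Γ A B} → CF (A ∷ B ∷ Γ) → IsFormula (A ⅋ B) → CF (A ⅋ B ∷ Γ)
  par′ {Γ} {A} {B} d f@(_ , lin) with _ ∷ _ ∷ fs , u , b ← CF-balanced d =
    par (f ∷ fs , Unique-++⁻ʳ (shared A B) (Unique-resp-↭ p u) , drop-++ (shared A B) (trans (↭-sym p) (trans b q))) d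
    where
    assoc : ∀ {a b c s t} → a ++ b ↭ s ++ t → a ++ b ++ c ↭ s ++ t ++ c
    assoc {a} {b} {c} {s} {t} r = subst₂ _↭_ (Listₚ.++-assoc a b c) (Listₚ.++-assoc s t c) (++⁺ʳ c r)
    p : FU (A ∷ B ∷ Γ) ↭ shared A B ++ FU (A ⅋ B ∷ Γ)
    p = assoc {fu A} {fu B} {FU Γ} {shared A B} (fu-split {A} {B} lin)
    q : FL (A ∷ B ∷ Γ) ↭ shared A B ++ FL (A ⅋ B ∷ Γ)
    q = assoc {fl A} {fl B} {FL Γ} {shared A B} (fl-split {A} {B} lin)

  -- The matching of the free indices follows from the premises. Their distinctness across the two
  -- contexts is assumed separately, because the premises have been named independently.
  tensor′ : ∀ {Γ Δ A B} → CF (A ∷ Γ) → CF (B ∷ Δ) → IsFormula (A ⊗ B) → Unique (fu (A ⊗ B) ++ FU Γ ++ FU Δ) → CF (A ⊗ B ∷ Γ ++ Δ)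
  tensor′ {Γ} {Δ} {A} {B} d e f@(_ , lin) u with _ ∷ fs , _ , b ← CF-balanced d | _ ∷ fs′ , _ , b′ ← CF-balanced e =
    tensor (f ∷ AllP.++⁺ fs fs′ , subst (λ xs → Unique (fu (A ⊗ B) ++ xs)) (sym (FU-++ Γ)) u ,
      subst₂ (λ xs ys → fu (A ⊗ B) ++ xs ↭ fl (A ⊗ B) ++ ys) (sym (FU-++ Γ)) (sym (FL-++ Γ))
        (drop-++ (shared A B) (trans (p (fu A) (fu B) (fu (A ⊗ B)) (FU Γ) (FU Δ) (fu-split {A} {B} lin))
          (trans (++⁺ b b′) (↭-sym (p (fl A) (fl B) (fl (A ⊗ B)) (FL Γ) (FL Δ) (fl-split {A} {B} lin))))))) d e
    where
    s = shared A B
    p : ∀ a b t c c′ → a ++ b ↭ s ++ t → s ++ t ++ c ++ c′ ↭ (a ++ c) ++ b ++ c′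
    p a b t c c′ r = trans (solve 4 (λ s t c c′ → s ⊕ t ⊕ c ⊕ c′ ⊜ (s ⊕ t) ⊕ c ⊕ c′) refl s t c c′)
      (trans (++⁺ʳ (c ++ c′) (↭-sym r)) (solve 4 (λ a b c c′ → (a ⊕ b) ⊕ c ⊕ c′ ⊜ (a ⊕ c) ⊕ b ⊕ c′) refl a b c c′))

  Formulas : List Item → Set
  Formulas = All (IsFormula ∘ proj₂)

  uppers-zip : ∀ {A B : Set} (f : A → Port) (g : B → Port) {n} (xs : Vec A n) ys →
               uppers (toList (zipWith (λ x y → edge (f x) (g y)) xs ys)) ≡ map f (toList xs)
  uppers-zip f g [] [] = refl
  uppers-zip f g (x ∷ xs) (y ∷ ys) = cong (f x ∷_) (uppers-zip f g xs ys)

  lowers-zip : ∀ {A B : Set} (f : A → Port) (g : B → Port) {n} (xs : Vec A n) ys →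
               lowers (toList (zipWith (λ x y → edge (f x) (g y)) xs ys)) ≡ map g (toList ys)
  lowers-zip f g [] [] = refl
  lowers-zip f g (x ∷ xs) (y ∷ ys) = cong (g y ∷_) (lowers-zip f g xs ys)

  uppers-links : ∀ k xs → uppers (links k xs) ≡ tag k xs
  uppers-links k [] = refl
  uppers-links k (x ∷ xs) = cong (_ ∷_) (uppers-links k xs)

  lowers-links : ∀ k xs → lowers (links k xs) ≡ tag k xs
  lowers-links k [] = refl
  lowers-links k (x ∷ xs) = cong (_ ∷_) (lowers-links k xs)

  fu-atom : ∀ p us ls → IsFormula (atom p us ls) → fu (atom p us ls) ≡ toList us
  fu-atom p us ls (d , _) = frees-all (Unique-disjoint d)

  fl-atom : ∀ p us ls → IsFormula (atom p us ls) → fl (atom p us ls) ≡ toList ls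
  fl-atom p us ls (d , _) = frees-all (λ x∈ y∈ → Unique-disjoint d y∈ x∈)

  tag-split : ∀ k xs ys S zs → xs ++ ys ↭ S ++ zs → ∀ ps → tag k xs ++ tag k ys ++ ps ↭ tag k S ++ tag k zs ++ ps
  tag-split k xs ys S zs p ps = subst₂ _↭_ (e xs ys) (e S zs) (++⁺ʳ ps (map⁺ (k ,_) p))
    where
    e : ∀ as bs → tag k (as ++ bs) ++ ps ≡ tag k as ++ tag k bs ++ ps
    e as bs = ≡-trans (cong (_++ ps) (map-++ (k ,_) as bs)) (Listₚ.++-assoc (tag k as) (tag k bs) ps)

  -- Each wired rule preserves that the ends of the wires are exactly the free occurrences. The
  -- shared ports hidden by ⅋ and ⊗ cancel against the links and the contractions.
  D-ends : ∀ {Γ W} → D Γ W → Formulas Γ → uppers W ↭ ups Γ × lowers W ↭ lows Γ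
  D-ends (axiom {k = k} {k′} {c} {us} {ls} {us′} {ls′} p q) fs with f ∷ f′ ∷ [] ← All-resp-↭ p fs =
    trans (uppers-↭ q) (trans (subst₂ _↭_ (sym (≡-trans (uppers-++ (toList (zipWith _ us′ (reverse ls)))) (cong₂ _++_ (uppers-zip _ _ us′ (reverse ls)) (uppers-zip _ _ (reverse us) ls′))))
      (cong₂ (λ xs ys → tag k xs ++ tag k′ ys ++ []) (sym (fu-atom (neg c) us ls f)) (sym (fu-atom (pos c) us′ ls′ f′)))
      (trans (++⁺ˡ (tag k′ (toList us′)) (map⁺ (k ,_) (toList-reverse-↭ us))) (trans (++-comm (tag k′ (toList us′)) (tag k (toList us))) (++⁺ˡ (tag k (toList us)) (↭-sym (++-identityʳ (tag k′ (toList us′))))))))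
      (collect-↭ fu (↭-sym p))) ,
    trans (lowers-↭ q) (trans (subst₂ _↭_ (sym (≡-trans (lowers-++ (toList (zipWith _ us′ (reverse ls)))) (cong₂ _++_ (lowers-zip _ _ us′ (reverse ls)) (lowers-zip _ _ (reverse us) ls′))))
      (cong₂ (λ xs ys → tag k xs ++ tag k′ ys ++ []) (sym (fl-atom (neg c) us ls f)) (sym (fl-atom (pos c) us′ ls′ f′)))
      (++⁺ (map⁺ (k ,_) (toList-reverse-↭ ls)) (↭-sym (++-identityʳ _))))
      (collect-↭ fl (↭-sym p)))
  D-ends (one {k = k} {u} {l} p q) fs with f ∷ [] ← All-resp-↭ p fs =
    trans (uppers-↭ q) (trans (↭-reflexive (cong (λ xs → tag k xs ++ []) (sym (fu-atom 𝟏 (u ∷ []) (l ∷ []) f)))) (collect-↭ fu (↭-sym p))) ,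
    trans (lowers-↭ q) (trans (↭-reflexive (cong (λ xs → tag k xs ++ []) (sym (fl-atom 𝟏 (u ∷ []) (l ∷ []) f)))) (collect-↭ fl (↭-sym p)))
  D-ends (bot {Γ′ = Γ′} {k = k} {j} {i} p d q) fs with f ∷ fs′ ← All-resp-↭ p fs with u , l ← D-ends d fs′ =
    trans (uppers-↭ q) (trans (swap _ _ refl) (trans (++⁺ (↭-reflexive (cong (tag k) (sym (fu-atom ⊥ (j ∷ []) (i ∷ []) f)))) u) (collect-↭ fu (↭-sym p)))) ,
    trans (lowers-↭ q) (trans (++⁺ (↭-reflexive (cong (tag k) (sym (fl-atom ⊥ (j ∷ []) (i ∷ []) f)))) l) (collect-↭ fl (↭-sym p)))
  D-ends (bot-loop {k = k} {j} {i} p d q) fs with f ∷ fs′ ← All-resp-↭ p fs with u , l ← D-ends d fs′ =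
    trans (uppers-↭ q) (trans (++⁺ (↭-reflexive (cong (tag k) (sym (fu-atom ⊥ (j ∷ []) (i ∷ []) f)))) u) (collect-↭ fu (↭-sym p))) ,
    trans (lowers-↭ q) (trans (++⁺ (↭-reflexive (cong (tag k) (sym (fl-atom ⊥ (j ∷ []) (i ∷ []) f)))) l) (collect-↭ fl (↭-sym p)))
  D-ends (par {Γ′ = Γ′} {W = W} {k} {A} {B} p d) fs with f ∷ fs′ ← All-resp-↭ p fs
    with u , l ← D-ends d (formulaˡ f ∷ formulaʳ f ∷ fs′) =
    trans (drop-++ (tag k (shared A B)) (trans (↭-reflexive (sym (≡-trans (uppers-++ (links k (shared A B))) (cong (_++ uppers W) (uppers-links k (shared A B))))))
      (trans u (tag-split k (fu A) (fu B) (shared A B) (fu (A ⅋ B)) (fu-split {A} {B} (proj₂ f)) (ups Γ′))))) (collect-↭ fu (↭-sym p)) ,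
    trans (drop-++ (tag k (shared A B)) (trans (↭-reflexive (sym (≡-trans (lowers-++ (links k (shared A B))) (cong (_++ lowers W) (lowers-links k (shared A B))))))
      (trans l (tag-split k (fl A) (fl B) (shared A B) (fl (A ⅋ B)) (fl-split {A} {B} (proj₂ f)) (lows Γ′))))) (collect-↭ fl (↭-sym p))
  D-ends (tensor {Γ₁ = Γ₁} {Γ₂} {W} {W₁} {W₂} {k} {A} {B} p d e s) fs with f ∷ fs′ ← All-resp-↭ p fs
    with u , l ← D-ends d (formulaˡ f ∷ AllP.++⁻ˡ Γ₁ fs′) | u′ , l′ ← D-ends e (formulaʳ f ∷ AllP.++⁻ʳ Γ₁ fs′) =
    trans (drop-++ (tag k (shared A B)) (trans (↭-sym (proj₁ (⟿*-ends s))) (trans (↭-reflexive (uppers-++ W₁)) (trans (++⁺ u u′)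
      (trans (mix (tag k (fu A)) (ups Γ₁) (tag k (fu B)) (ups Γ₂)) (tag-split k (fu A) (fu B) (shared A B) (fu (A ⊗ B)) (fu-split {A} {B} (proj₂ f)) _))))))
      (trans (↭-reflexive (cong (tag k (fu (A ⊗ B)) ++_) (sym (collect-++ fu Γ₁)))) (collect-↭ fu (↭-sym p))) ,
    trans (drop-++ (tag k (shared A B)) (trans (↭-sym (proj₂ (⟿*-ends s))) (trans (↭-reflexive (lowers-++ W₁)) (trans (++⁺ l l′)
      (trans (mix (tag k (fl A)) (lows Γ₁) (tag k (fl B)) (lows Γ₂)) (tag-split k (fl A) (fl B) (shared A B) (fl (A ⊗ B)) (fl-split {A} {B} (proj₂ f)) _))))))
      (trans (↭-reflexive (cong (tag k (fl (A ⊗ B)) ++_) (sym (collect-++ fl Γ₁)))) (collect-↭ fl (↭-sym p)))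
    where
    mix : ∀ (a b c d : List Port) → (a ++ b) ++ c ++ d ↭ a ++ c ++ b ++ d
    mix a b c d = solve 4 (λ a b c d → (a ⊕ b) ⊕ c ⊕ d ⊜ a ⊕ c ⊕ b ⊕ d) refl a b c d

  -- If `ι 0` lies in `Z`, it is deleted there and the search continues with `ι` shifted by one; by
  -- injectivity the deleted value does not come back.
  fresh : ∀ Z → ∃ λ x → x ∉ Z
  fresh Z = let n , p = avoid Z (Injection.to infinite) (Injection.injective infinite) in Injection.to infinite n , p
    where
    avoid : ∀ Z (ι : ℕ → Ind) → (∀ {m n} → ι m ≡ ι n → m ≡ n) → ∃ λ n → ι n ∉ Z
    avoid Z ι inj = go (Data.List.length Z) Z ℕₚ.≤-refl ι inj
      where
      import Data.List
      go : ∀ b Z → Data.List.length Z ≤ b → (ι : ℕ → Ind) → (∀ {m n} → ι m ≡ ι n → m ≡ n) → ∃ λ n → ι n ∉ Z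
      go b [] _ ι inj = 0 , λ ()
      go (suc b) (z ∷ Z) (s≤s l) ι inj with ι 0 ∈? (z ∷ Z)
      ... | no p = 0 , p
      ... | yes p with Z′ , q ← ∈⇒↭ p
        with n , r ← go b Z′ (subst (_≤ b) (ℕₚ.suc-injective (↭-length q)) l) (ι ∘ suc) (ℕₚ.suc-injective ∘ inj) =
        suc n , λ s → case (∈-resp-↭ q s) r
        where
        case : ∀ {n Z′} → ι (suc n) ∈ ι 0 ∷ Z′ → ι (suc n) ∉ Z′ → _
        case (here e) r with () ← inj e
        case (there s) r = r s

  -- Lengthening, shortening and rerouting chains of ⊥-formulas.

  bot≢ : ∀ {a b Γ} → CF (⊥⟨ b / a ⟩ ∷ Γ) → a ≢ b
  bot≢ d refl with (d′ , _) ∷ _ , _ ← CF-balanced d = head-∉ d′ (here refl)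

  ∈-fu-bot : ∀ {a b} → a ≢ b → b ∈ fu ⊥⟨ b / a ⟩
  ∈-fu-bot a≢b = ∈-frees⁺ (here refl) λ { (here refl) → a≢b refl }

  ∈-fl-bot : ∀ {a b} → a ≢ b → a ∈ fl ⊥⟨ b / a ⟩
  ∈-fl-bot a≢b = ∈-frees⁺ (here refl) λ { (here refl) → a≢b refl }

  ∉-bot : ∀ {a b c} → c ≢ a → c ≢ b → c ∉ occurrences ⊥⟨ b / a ⟩
  ∉-bot c≢a c≢b (here e) = c≢b e
  ∉-bot c≢a c≢b (there (here e)) = c≢a e

  ∉-FU-bot : ∀ {a b c} Γ → c ≢ b → c ∉ FU Γ → c ∉ FU (⊥⟨ b / a ⟩ ∷ Γ)
  ∉-FU-bot {a} {b} Γ c≢b c∉ c∈ with ∈-++⁻ (fu ⊥⟨ b / a ⟩) c∈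
  ... | inj₁ p with here refl ← proj₁ (∈-frees⁻ p) = c≢b refl
  ... | inj₂ q = c∉ q

  ∉-FU-∷ : ∀ A {c} Γ → c ∉ occurrences A → c ∉ FU Γ → c ∉ FU (A ∷ Γ)
  ∉-FU-∷ A Γ c∉A c∉ c∈ with ∈-++⁻ (fu A) c∈
  ... | inj₁ p = c∉A (∈-++⁺ˡ (proj₁ (∈-frees⁻ p)))
  ... | inj₂ q = c∉ q

  -- ⊥→ applied to a ⊥-formula itself: the chain from `a` to `b` acquires the intermediate index
  -- `c`. `glue-step` undoes this by ⊥←.
  split-step : ∀ {a b Γ} c → CF (⊥⟨ b / a ⟩ ∷ Γ) → c ≢ a → c ≢ b → c ∉ FU Γ → CF (⊥⟨ b / c ⟩ ∷ ⊥⟨ c / a ⟩ ∷ Γ)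
  split-step {a} {b} {Γ} c d c≢a c≢b c∉ = subst (λ e → CF (⊥⟨ b / c ⟩ ∷ ⊥⟨ e / a ⟩ ∷ Γ)) (replace-≡ c b)
    (⊥→′ c b d (∈-fu-bot (bot≢ d)) (∉-bot c≢a c≢b) c∉)

  glue-step : ∀ {a b m Γ} → CF (⊥⟨ m / a ⟩ ∷ ⊥⟨ b / m ⟩ ∷ Γ) → a ≢ b → a ≢ m → CF (⊥⟨ b / a ⟩ ∷ Γ)
  glue-step {a} {b} {m} {Γ} d a≢b a≢m = subst (λ e → CF (⊥⟨ b / e ⟩ ∷ Γ)) (replace-≡ a m)
    (⊥←′ a m d (∈-fl-bot (bot≢ (exchange (swap _ _ refl) d))) (∉-bot a≢m a≢b))

  -- Renames an index at both of its free occurrences: ⊥→ inserts `⊥⟨ a / v ⟩`, and ⊥← merges it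
  -- with `⊥⟨ m / a ⟩`.
  openU-step : ∀ {A a m Γ} v → CF (A ∷ ⊥⟨ m / a ⟩ ∷ Γ) → a ∈ fu A → v ∉ occurrences A → v ≢ m → v ∉ FU Γ →
               CF (A [ v / a ]↑ ∷ ⊥⟨ m / v ⟩ ∷ Γ)
  openU-step {A} {a} {m} {Γ} v d a∈ v∉ v≢m v∉Γ = exchange (swap _ _ refl)
    (subst (λ e → CF (⊥⟨ m / e ⟩ ∷ A [ v / a ]↑ ∷ Γ)) (replace-≡ v a)
      (⊥←′ v a (exchange (prep _ (swap _ _ refl)) (⊥→′ v a d a∈ v∉ (∉-FU-bot {a} Γ v≢m v∉Γ)))
        (∈-fl-bot (bot≢ (exchange (swap _ _ refl) d)))
        (∉-bot (λ { refl → v∉ (∈-++⁺ˡ (proj₁ (∈-frees⁻ a∈))) }) v≢m)))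

  -- The ⊥-formula is split at `v`, and ⊥← lets `A` absorb the piece next to it.
  openL-step : ∀ {A b m Γ} v → CF (A ∷ ⊥⟨ b / m ⟩ ∷ Γ) → b ∈ fl A → v ∉ occurrences A → v ≢ m → v ∉ FU Γ →
               CF (A [ v / b ]↓ ∷ ⊥⟨ v / m ⟩ ∷ Γ)
  openL-step {A} {b} {m} {Γ} v d b∈ v∉ v≢m v∉Γ =
    ⊥←′ v b (exchange (prep _ (swap _ _ refl))
      (split-step v (exchange (swap _ _ refl) d) v≢m (λ { refl → v∉ (∈-++⁺ʳ (upper A) (proj₁ (∈-frees⁻ b∈))) }) (∉-FU-∷ A Γ v∉ v∉Γ))) b∈ v∉

  -- Once `a` has been renamed to `s`, the two ⊥-formulas merge into `⊥⟨ b / s ⟩`, which `B` absorbs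
  -- by ⊥←. What remains is a direct match of `A` and `B` in `s`.
  link-step : ∀ {A B a b m Γ} s → CF (A ∷ B ∷ ⊥⟨ m / a ⟩ ∷ ⊥⟨ b / m ⟩ ∷ Γ) → a ∈ fu A → b ∈ fl B →
              s ∉ occurrences A → s ∉ occurrences B → s ≢ m → s ∉ FU Γ → CF (A [ s / a ]↑ ∷ B [ s / b ]↓ ∷ Γ)
  link-step {A} {B} {a} {b} {m} {Γ} s d a∈ b∈ s∉A s∉B s≢m s∉Γ =
    let s≢b = λ { refl → s∉B (∈-++⁺ʳ (upper B) (proj₁ (∈-frees⁻ b∈))) }
        d₁ = openU-step s (exchange (prep A (swap B _ refl)) d) a∈ s∉A s≢m (∉-FU-∷ B (⊥⟨ b / m ⟩ ∷ Γ) s∉B (∉-FU-bot {m} Γ s≢b s∉Γ))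
        d₂ = glue-step (exchange (solve 5 (λ a m b c g → a ⊕ m ⊕ b ⊕ c ⊕ g ⊜ m ⊕ c ⊕ b ⊕ a ⊕ g) refl [ A [ s / a ]↑ ] [ ⊥⟨ m / s ⟩ ] [ B ] [ ⊥⟨ b / m ⟩ ] Γ) d₁) s≢b s≢m
    in exchange (swap _ _ refl) (⊥←′ s b d₂ b∈ s∉B)

  open DecMembership _≟ₚ_ using () renaming (_∈?_ to _∈ₚ?_)

  collect-∈ : ∀ f Γ {k x} → (k , x) ∈ collect f Γ → ∃₂ λ E Γ′ → Γ ↭ (k , E) ∷ Γ′ × x ∈ f E
  collect-∈ f ((k , A) ∷ Γ) p with ∈-++⁻ (tag k (f A)) p
  ... | inj₁ q with x , x∈ , refl ← ∈-map⁻ (k ,_) q = A , Γ , refl , x∈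
  ... | inj₂ q with E , Γ′ , r , x∈ ← collect-∈ f Γ q = E , _ , trans (prep _ r) (swap _ _ refl) , x∈

  -- Realisation of wired derivations

  -- A wire is realised by two ⊥-formulas meeting in a fresh middle index, a loop
  -- by a cycle of two of them.
  data Strand : Set where
    strand : Port → Ind → Port → Strand
    ring   : Ind → Ind → Strand

  erase : Strand → Wire Port
  erase (strand p m q) = edge p q
  erase (ring m n) = loop

  mids : List Strand → List Ind
  mids [] = []
  mids (strand p m q ∷ ws) = m ∷ mids ws
  mids (ring m n ∷ ws) = m ∷ n ∷ mids ws

  mids-↭ : ∀ {ws ws′} → ws ↭ ws′ → mids ws ↭ mids ws′
  mids-↭ refl = refl
  mids-↭ (prep (strand p m q) r) = prep m (mids-↭ r)
  mids-↭ (prep (ring m n) r) = prep m (prep n (mids-↭ r))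
  mids-↭ (swap (strand p m q) (strand p′ m′ q′) r) = swap m m′ (mids-↭ r)
  mids-↭ (swap (strand p m q) (ring m′ n′) r) = trans (prep m (prep m′ (prep n′ (mids-↭ r)))) (shifts [ m ] (m′ ∷ n′ ∷ []))
  mids-↭ (swap (ring m n) (strand p′ m′ q′) r) = trans (prep m (prep n (prep m′ (mids-↭ r)))) (shifts (m ∷ n ∷ []) [ m′ ])
  mids-↭ (swap (ring m n) (ring m′ n′) r) = trans (prep m (prep n (prep m′ (prep n′ (mids-↭ r))))) (shifts (m ∷ n ∷ []) (m′ ∷ n′ ∷ []))
  mids-↭ (trans r s) = trans (mids-↭ r) (mids-↭ s)

  mids-++ : ∀ ws {ws′} → mids (ws ++ ws′) ≡ mids ws ++ mids ws′
  mids-++ [] = refl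
  mids-++ (strand p m q ∷ ws) = cong (m ∷_) (mids-++ ws)
  mids-++ (ring m n ∷ ws) = cong (λ xs → m ∷ n ∷ xs) (mids-++ ws)

  unerase : ∀ {ws e W} → map erase ws ↭ e ∷ W → ∃₂ λ w ws′ → ws ↭ w ∷ ws′ × erase w ≡ e × map erase ws′ ↭ W
  unerase {ws} p with ys , e , q ← ↭-map-inv erase p with ys | e
  ... | w ∷ ws′ | refl = w , ws′ , q , refl , refl

  unerase-edge : ∀ {ws p q W} → map erase ws ↭ edge p q ∷ W → ∃₂ λ m ws′ → ws ↭ strand p m q ∷ ws′ × map erase ws′ ↭ W
  unerase-edge r with unerase r
  ... | strand p m q , ws′ , s , refl , t = m , ws′ , s , t

  unerase-loop : ∀ {ws W} → map erase ws ↭ loop ∷ W → ∃ λ m → ∃₂ λ n ws′ → ws ↭ ring m n ∷ ws′ × map erase ws′ ↭ W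
  unerase-loop r with unerase r
  ... | ring m n , ws′ , s , refl , t = m , n , ws′ , s , t

  abstract

    -- `O` is the list of opened ports, which bear their own index again; all others still have the
    -- fresh name given by `θ`.
    nm : List Port → (Port → Ind) → Port → Ind
    nm O θ p with p ∈ₚ? O
    ... | yes _ = proj₂ p
    ... | no _ = θ p

    nm-∈ : ∀ {O θ p} → p ∈ O → nm O θ p ≡ proj₂ p
    nm-∈ {O} {θ} {p} p∈ with p ∈ₚ? O
    ... | yes _ = refl
    ... | no p∉ = contradiction p∈ p∉

    nm-∉ : ∀ {O θ p} → p ∉ O → nm O θ p ≡ θ p
    nm-∉ {O} {θ} {p} p∉ with p ∈ₚ? O
    ... | yes p∈ = contradiction p∈ p∉
    ... | no _ = refl

    nm-cases : ∀ O θ p → (p ∈ O × nm O θ p ≡ proj₂ p) ⊎ (p ∉ O × nm O θ p ≡ θ p)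
    nm-cases O θ p with p ∈ₚ? O
    ... | yes p∈ = inj₁ (p∈ , refl)
    ... | no p∉ = inj₂ (p∉ , refl)

    nm-cong : ∀ {O O′ θ p} → (p ∈ O → p ∈ O′) → (p ∈ O′ → p ∈ O) → nm O θ p ≡ nm O′ θ p
    nm-cong {O} {O′} {θ} {p} h h′ with p ∈ₚ? O
    ... | yes p∈ = sym (nm-∈ (h p∈))
    ... | no p∉ = sym (nm-∉ (p∉ ∘ h′))

    nm-∷ : ∀ {O θ p q} → q ≢ p → nm O θ q ≡ nm (p ∷ O) θ q
    nm-∷ q≢p = nm-cong there λ { (here e) → contradiction e q≢p ; (there i) → i }

    -- `B` will be the list of occurrences of the opposite polarity, so membership in it means that
    -- the index is bound and keeps its name.
    fix : List Ind → (Port → Ind) → ℕ → Ind → Ind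
    fix B n k x with x ∈? B
    ... | yes _ = x
    ... | no _ = n (k , x)

    fix-∈ : ∀ {B n k x} → x ∈ B → fix B n k x ≡ x
    fix-∈ {B} {x = x} x∈ with x ∈? B
    ... | yes _ = refl
    ... | no x∉ = contradiction x∈ x∉

    fix-∉ : ∀ {B n k x} → x ∉ B → fix B n k x ≡ n (k , x)
    fix-∉ {B} {x = x} x∉ with x ∈? B
    ... | yes x∈ = contradiction x∈ x∉
    ... | no _ = refl

    fix-cong : ∀ {B n n′ k x} → (x ∉ B → n (k , x) ≡ n′ (k , x)) → fix B n k x ≡ fix B n′ k x
    fix-cong {B} {x = x} e with x ∈? B
    ... | yes _ = refl
    ... | no x∉ = e x∉

    fix-nm : ∀ B O θ k x → fix B (nm O θ) k x ≡ x ⊎ fix B (nm O θ) k x ≡ θ (k , x)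
    fix-nm B O θ k x with x ∈? B
    ... | yes _ = inj₁ refl
    ... | no _ with nm-cases O θ (k , x)
    ...   | inj₁ (_ , e) = inj₁ e
    ...   | inj₂ (_ , e) = inj₂ e

  map-Unique-injective : ∀ {f : Ind → Ind} {xs} → Unique (map f xs) → ∀ {x y} → x ∈ xs → y ∈ xs → f x ≡ f y → x ≡ y
  map-Unique-injective u (here refl) (here refl) e = refl
  map-Unique-injective {f} {_ ∷ xs} u (here refl) (there j) e = ⊥-elim (head-∉ u (subst (_∈ map f xs) (sym e) (∈-map⁺ f j)))
  map-Unique-injective {f} {_ ∷ xs} u (there i) (here refl) e = ⊥-elim (head-∉ u (subst (_∈ map f xs) e (∈-map⁺ f i)))
  map-Unique-injective {f} {x ∷ xs} u (there i) (there j) e = map-Unique-injective (Unique-++⁻ʳ [ f x ] u) i j e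

  abstract

    select : ∀ {A : Set} → List Ind → (Ind → A) → (Ind → A) → Ind → A
    select D a b x with x ∈? D
    ... | yes _ = a x
    ... | no _ = b x

    select-∈ : ∀ {A : Set} {D} {a b : Ind → A} {x} → x ∈ D → select D a b x ≡ a x
    select-∈ {D = D} {x = x} x∈ with x ∈? D
    ... | yes _ = refl
    ... | no x∉ = contradiction x∈ x∉

    select-∉ : ∀ {A : Set} {D} {a b : Ind → A} {x} → x ∉ D → select D a b x ≡ b x
    select-∉ {D = D} {x = x} x∉ with x ∈? D
    ... | yes x∈ = contradiction x∈ x∉
    ... | no _ = refl

    select-cases : ∀ {A : Set} D (a b : Ind → A) x → (x ∈ D × select D a b x ≡ a x) ⊎ (x ∉ D × select D a b x ≡ b x)
    select-cases D a b x with x ∈? D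
    ... | yes x∈ = inj₁ (x∈ , refl)
    ... | no x∉ = inj₂ (x∉ , refl)

    select-∷ : ∀ {A : Set} {D} {a b : Ind → A} {x y} → y ≢ x → select D a b y ≡ select (x ∷ D) a b y
    select-∷ {D = D} {a} {b} {x} {y} y≢x = [ (λ (i , e) → ≡-trans e (sym (select-∈ {a = a} {b} (there i))))
      , (λ (i , e) → ≡-trans e (sym (select-∉ {D = x ∷ D} {a} {b} λ { (here e) → y≢x e ; (there j) → i j }))) ]′ (select-cases D a b y)

  zipWith-∷ʳ : ∀ {A B C : Set} (f : A → B → C) {n} (xs : Vec A n) ys x y →
               zipWith f (xs Vec.∷ʳ x) (ys Vec.∷ʳ y) ≡ zipWith f xs ys Vec.∷ʳ f x y
  zipWith-∷ʳ f [] [] x y = refl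
  zipWith-∷ʳ f (_ ∷ xs) (_ ∷ ys) x y = cong (_ ∷_) (zipWith-∷ʳ f xs ys x y)

  reverse-zipWith : ∀ {A B C : Set} (f : A → B → C) {n} (xs : Vec A n) ys →
                    reverse (zipWith f xs ys) ≡ zipWith f (reverse xs) (reverse ys)
  reverse-zipWith f [] [] = refl
  reverse-zipWith f (x ∷ xs) (y ∷ ys) = ≡-trans (Vecₚ.reverse-∷ (f x y) (zipWith f xs ys))
    (≡-trans (cong (Vec._∷ʳ f x y) (reverse-zipWith f xs ys)) (≡-trans (sym (zipWith-∷ʳ f (reverse xs) (reverse ys) x y))
      (sym (cong₂ (zipWith f) (Vecₚ.reverse-∷ x xs) (Vecₚ.reverse-∷ y ys)))))

  -- `θU` and `θL` are injective on the ports `P₀`, with disjoint values outside the original names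
  -- `Z₀`. Before any port is opened, no free occurrence in a formula shares its name with another,
  -- and all matching passes through ⊥-formulas.
  module Realisation
    (P₀ : List Port) (Z₀ : List Ind) (θU θL : Port → Ind)
    (θU-inj : ∀ {p q} → p ∈ P₀ → q ∈ P₀ → θU p ≡ θU q → p ≡ q)
    (θL-inj : ∀ {p q} → p ∈ P₀ → q ∈ P₀ → θL p ≡ θL q → p ≡ q)
    (θ-disj : ∀ {p q} → p ∈ P₀ → q ∈ P₀ → θU p ≢ θL q)
    (θU-fresh : ∀ {p} → p ∈ P₀ → θU p ∉ Z₀)
    (θL-fresh : ∀ {p} → p ∈ P₀ → θL p ∉ Z₀)
    (names : ∀ {p} → p ∈ P₀ → proj₂ p ∈ Z₀)
    where

    Zθ : List Ind
    Zθ = Z₀ ++ map θU P₀ ++ map θL P₀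

    Z₀∈ : ∀ {x} → x ∈ Z₀ → x ∈ Zθ
    Z₀∈ = ∈-++⁺ˡ

    θU∈ : ∀ {p} → p ∈ P₀ → θU p ∈ Zθ
    θU∈ p∈ = ∈-++⁺ʳ Z₀ (∈-++⁺ˡ (∈-map⁺ θU p∈))

    θL∈ : ∀ {p} → p ∈ P₀ → θL p ∈ Zθ
    θL∈ p∈ = ∈-++⁺ʳ Z₀ (∈-++⁺ʳ (map θU P₀) (∈-map⁺ θL p∈))

    nmU∈ : ∀ O {p} → p ∈ P₀ → nm O θU p ∈ Zθ
    nmU∈ O {p} p∈ with nm-cases O θU p
    ... | inj₁ (_ , e) = subst (_∈ Zθ) (sym e) (Z₀∈ (names p∈))
    ... | inj₂ (_ , e) = subst (_∈ Zθ) (sym e) (θU∈ p∈)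

    nmL∈ : ∀ O {p} → p ∈ P₀ → nm O θL p ∈ Zθ
    nmL∈ O {p} p∈ with nm-cases O θL p
    ... | inj₁ (_ , e) = subst (_∈ Zθ) (sym e) (Z₀∈ (names p∈))
    ... | inj₂ (_ , e) = subst (_∈ Zθ) (sym e) (θL∈ p∈)

    record OK (Γ : List Item) : Set where
      field
        forms : Formulas Γ
        apart : Apart Γ
        inU   : ∀ {p} → p ∈ collect upper Γ → p ∈ P₀
        inL   : ∀ {p} → p ∈ collect lower Γ → p ∈ P₀
    open OK

    ok-↭ : ∀ {Γ Γ′} → Γ ↭ Γ′ → OK Γ → OK Γ′
    ok-↭ p o = record { forms = All-resp-↭ p (forms o) ; apart = apart-↭ p (apart o)
      ; inU = λ q → inU o (∈-resp-↭ (collect-↭ upper (↭-sym p)) q) ; inL = λ q → inL o (∈-resp-↭ (collect-↭ lower (↭-sym p)) q) }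

    ok-++ˡ : ∀ {Γ} Δ → OK (Γ ++ Δ) → OK Γ
    ok-++ˡ {Γ} Δ o = record { forms = AllP.++⁻ˡ Γ (forms o) ; apart = apart-++ˡ {Γ} Δ (apart o)
      ; inU = λ q → inU o (subst (_ ∈_) (sym (collect-++ upper Γ)) (∈-++⁺ˡ q))
      ; inL = λ q → inL o (subst (_ ∈_) (sym (collect-++ lower Γ)) (∈-++⁺ˡ q)) }

    ok-++ʳ : ∀ Γ {Δ} → OK (Γ ++ Δ) → OK Δ
    ok-++ʳ Γ {Δ} o = record { forms = AllP.++⁻ʳ Γ (forms o) ; apart = apart-++ʳ Γ {Δ} (apart o)
      ; inU = λ q → inU o (subst (_ ∈_) (sym (collect-++ upper Γ)) (∈-++⁺ʳ _ q))
      ; inL = λ q → inL o (subst (_ ∈_) (sym (collect-++ lower Γ)) (∈-++⁺ʳ _ q)) }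

    ups-in : ∀ {Γ} → OK Γ → ∀ {p} → p ∈ ups Γ → p ∈ P₀
    ups-in {Γ} o p∈ = inU o (collect-mono {fu} (λ A → proj₁ ∘ ∈-frees⁻) Γ p∈)

    lows-in : ∀ {Γ} → OK Γ → ∀ {p} → p ∈ lows Γ → p ∈ P₀
    lows-in {Γ} o p∈ = inL o (collect-mono {fl} (λ A → proj₁ ∘ ∈-frees⁻) Γ p∈)

    -- The formula with tag k in which the opened ports and the bound indices keep
    -- their names and the other ports are named by θU and θL.
    real : List Port → List Port → Item → Expr
    real OU OL (k , E) = ren (fix (lower E) (nm OU θU) k) (fix (upper E) (nm OL θL) k) E

    real-safe : ∀ OU OL k E → (∀ {x} → x ∈ upper E → (k , x) ∈ P₀) → (∀ {x} → x ∈ lower E → (k , x) ∈ P₀) →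
                Safe (fix (lower E) (nm OU θU) k) (fix (upper E) (nm OL θL) k) E
    real-safe OU OL k E iU iL = record
      { injᵘ = λ {x} {y} p q e → inj θU-inj θU-fresh (fix-nm (lower E) OU θU k x) (fix-nm (lower E) OU θU k y) (iU p) (iU q) e
      ; injˡ = λ {x} {y} p q e → inj θL-inj θL-fresh (fix-nm (upper E) OL θL k x) (fix-nm (upper E) OL θL k y) (iL p) (iL q) e
      ; cross = λ {x} {y} p q e → cr (fix-nm (lower E) OU θU k x) (fix-nm (upper E) OL θL k y) (iU p) (iL q) e
      ; bound = λ p q → ≡-trans (fix-∈ q) (sym (fix-∈ p)) }
      where
      inj : ∀ {θ : Port → Ind} {a b x y} → (∀ {p q} → p ∈ P₀ → q ∈ P₀ → θ p ≡ θ q → p ≡ q) → (∀ {p} → p ∈ P₀ → θ p ∉ Z₀) →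
            a ≡ x ⊎ a ≡ θ (k , x) → b ≡ y ⊎ b ≡ θ (k , y) → (k , x) ∈ P₀ → (k , y) ∈ P₀ → a ≡ b → x ≡ y
      inj i f (inj₁ refl) (inj₁ refl) p q e = e
      inj i f (inj₁ refl) (inj₂ refl) p q e = ⊥-elim (f q (subst (_∈ Z₀) e (names p)))
      inj i f (inj₂ refl) (inj₁ refl) p q e = ⊥-elim (f p (subst (_∈ Z₀) (sym e) (names q)))
      inj i f (inj₂ refl) (inj₂ refl) p q e with refl ← i p q e = refl
      cr : ∀ {a b x y} → a ≡ x ⊎ a ≡ θU (k , x) → b ≡ y ⊎ b ≡ θL (k , y) → (k , x) ∈ P₀ → (k , y) ∈ P₀ → a ≡ b → x ≡ y
      cr (inj₁ refl) (inj₁ refl) p q e = e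
      cr (inj₁ refl) (inj₂ refl) p q e = ⊥-elim (θL-fresh q (subst (_∈ Z₀) e (names p)))
      cr (inj₂ refl) (inj₁ refl) p q e = ⊥-elim (θU-fresh p (subst (_∈ Z₀) (sym e) (names q)))
      cr (inj₂ refl) (inj₂ refl) p q e = ⊥-elim (θ-disj p q e)

    -- For a strand, the lower index of the first ⊥-formula meets the upper occurrence `p`, and the
    -- upper index of the second meets the lower occurrence `q`.
    cords : List Port → List Port → List Strand → List Expr
    cords OU OL [] = []
    cords OU OL (strand p m q ∷ ws) = ⊥⟨ m / nm OU θU p ⟩ ∷ ⊥⟨ nm OL θL q / m ⟩ ∷ cords OU OL ws
    cords OU OL (ring m n ∷ ws) = ⊥⟨ m / n ⟩ ∷ ⊥⟨ n / m ⟩ ∷ cords OU OL ws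

    cord : List Port → List Port → Strand → List Expr
    cord OU OL w = cords OU OL [ w ]

    cords-∷ : ∀ OU OL w ws → cords OU OL (w ∷ ws) ≡ cord OU OL w ++ cords OU OL ws
    cords-∷ OU OL (strand p m q) ws = refl
    cords-∷ OU OL (ring m n) ws = refl

    cords-++ : ∀ OU OL ws {ws′} → cords OU OL (ws ++ ws′) ≡ cords OU OL ws ++ cords OU OL ws′
    cords-++ OU OL [] = refl
    cords-++ OU OL (strand p m q ∷ ws) = cong (λ xs → _ ∷ _ ∷ xs) (cords-++ OU OL ws)
    cords-++ OU OL (ring m n ∷ ws) = cong (λ xs → _ ∷ _ ∷ xs) (cords-++ OU OL ws)

    cords-↭ : ∀ OU OL {ws ws′} → ws ↭ ws′ → cords OU OL ws ↭ cords OU OL ws′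
    cords-↭ OU OL refl = refl
    cords-↭ OU OL (prep w p) = subst₂ _↭_ (sym (cords-∷ OU OL w _)) (sym (cords-∷ OU OL w _)) (++⁺ˡ (cord OU OL w) (cords-↭ OU OL p))
    cords-↭ OU OL (swap w w′ p) = subst₂ _↭_ (sym (e w w′ _)) (sym (e w′ w _))
      (trans (++⁺ˡ (cord OU OL w) (++⁺ˡ (cord OU OL w′) (cords-↭ OU OL p))) (shifts (cord OU OL w) (cord OU OL w′)))
      where
      e : ∀ w w′ ws → cords OU OL (w ∷ w′ ∷ ws) ≡ cord OU OL w ++ cord OU OL w′ ++ cords OU OL ws
      e w w′ ws = ≡-trans (cords-∷ OU OL w (w′ ∷ ws)) (cong (cord OU OL w ++_) (cords-∷ OU OL w′ ws))
    cords-↭ OU OL (trans p q) = trans (cords-↭ OU OL p) (cords-↭ OU OL q)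

    R : List Port → List Port → List Item → List Strand → List Expr
    R OU OL Γ ws = map (real OU OL) Γ ++ cords OU OL ws

    R-↭ : ∀ OU OL {Γ Γ′ ws ws′} → Γ ↭ Γ′ → ws ↭ ws′ → R OU OL Γ ws ↭ R OU OL Γ′ ws′
    R-↭ OU OL p q = ++⁺ (map⁺ (real OU OL) p) (cords-↭ OU OL q)

    AgreeU AgreeL : List Port → List Port → List Port → Set
    AgreeU O O′ ps = ∀ {p} → p ∈ ps → nm O θU p ≡ nm O′ θU p
    AgreeL O O′ ps = ∀ {p} → p ∈ ps → nm O θL p ≡ nm O′ θL p

    real-cong : ∀ {OU OU′ OL OL′} k E → AgreeU OU OU′ (tag k (fu E)) → AgreeL OL OL′ (tag k (fl E)) →
                real OU OL (k , E) ≡ real OU′ OL′ (k , E)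
    real-cong k E e e′ = ren-cong E
      (λ x∈ → fix-cong {lower E} λ x∉ → e (∈-map⁺ (k ,_) (∈-frees⁺ x∈ x∉)))
      (λ x∈ → fix-cong {upper E} λ x∉ → e′ (∈-map⁺ (k ,_) (∈-frees⁺ x∈ x∉)))

    reals-cong : ∀ {OU OU′ OL OL′} Γ → AgreeU OU OU′ (ups Γ) → AgreeL OL OL′ (lows Γ) →
                 map (real OU OL) Γ ≡ map (real OU′ OL′) Γ
    reals-cong [] e e′ = refl
    reals-cong ((k , E) ∷ Γ) e e′ = cong₂ _∷_ (real-cong k E (e ∘ ∈-++⁺ˡ) (e′ ∘ ∈-++⁺ˡ))
      (reals-cong Γ (e ∘ ∈-++⁺ʳ (tag k (fu E))) (e′ ∘ ∈-++⁺ʳ (tag k (fl E))))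

    cords-cong : ∀ {OU OU′ OL OL′} ws → AgreeU OU OU′ (uppers (map erase ws)) → AgreeL OL OL′ (lowers (map erase ws)) →
                 cords OU OL ws ≡ cords OU′ OL′ ws
    cords-cong [] e e′ = refl
    cords-cong (strand p m q ∷ ws) e e′ = cong₂ _∷_ (cong (λ a → ⊥⟨ m / a ⟩) (e (here refl)))
      (cong₂ _∷_ (cong (λ b → ⊥⟨ b / m ⟩) (e′ (here refl))) (cords-cong ws (e ∘ there) (e′ ∘ there)))
    cords-cong (ring m n ∷ ws) e e′ = cong (λ xs → _ ∷ _ ∷ xs) (cords-cong ws e e′)

    -- The free upper indices of a realisation.
    data Name (OU OL us : List Port) (ms : List Ind) (ls : List Port) (x : Ind) : Set where
      nameU : ∀ {p} → p ∈ us → x ≡ nm OU θU p → Name OU OL us ms ls x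
      nameM : x ∈ ms → Name OU OL us ms ls x
      nameL : ∀ {q} → q ∈ ls → x ≡ nm OL θL q → Name OU OL us ms ls x

    name-mono : ∀ {OU OL us us′ ms ms′ ls ls′ x} → (∀ {p} → p ∈ us → p ∈ us′) → (∀ {m} → m ∈ ms → m ∈ ms′) → (∀ {q} → q ∈ ls → q ∈ ls′) →
                Name OU OL us ms ls x → Name OU OL us′ ms′ ls′ x
    name-mono f g h (nameU i e) = nameU (f i) e
    name-mono f g h (nameM i) = nameM (g i)
    name-mono f g h (nameL i e) = nameL (h i) e

    fu-real : ∀ OU OL k E {x} → x ∈ fu (real OU OL (k , E)) → ∃ λ y → y ∈ fu E × x ≡ nm OU θU (k , y)
    fu-real OU OL k E x∈ with p , q ← ∈-frees⁻ x∈
      with y , y∈ , refl ← ∈-map⁻ _ (subst (_ ∈_) (upper-ren _ _ E) p) with y ∈? lower E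
    ... | yes y∈l = ⊥-elim (q (subst (_∈ lower (real OU OL (k , E))) (≡-trans (fix-∈ y∈) (sym (fix-∈ y∈l)))
      (subst (fix (upper E) (nm OL θL) k y ∈_) (sym (lower-ren _ _ E)) (∈-map⁺ (fix (upper E) (nm OL θL) k) y∈l))))
    ... | no y∉l = y , ∈-frees⁺ y∈ y∉l , fix-∉ y∉l

    FU-reals : ∀ OU OL Γ {x} → x ∈ FU (map (real OU OL) Γ) → ∃ λ p → p ∈ ups Γ × x ≡ nm OU θU p
    FU-reals OU OL ((k , E) ∷ Γ) x∈ with ∈-++⁻ (fu (real OU OL (k , E))) x∈
    ... | inj₁ p = let y , y∈ , e = fu-real OU OL k E p in (k , y) , ∈-++⁺ˡ (∈-map⁺ (k ,_) y∈) , e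
    ... | inj₂ q = let p , p∈ , e = FU-reals OU OL Γ q in p , ∈-++⁺ʳ (tag k (fu E)) p∈ , e

    fu-⊥⁻ : ∀ {a b x} → x ∈ fu ⊥⟨ b / a ⟩ → x ≡ b
    fu-⊥⁻ x∈ with here e ← proj₁ (∈-frees⁻ x∈) = e

    FU-cords : ∀ OU OL ws {x} → x ∈ FU (cords OU OL ws) → Name OU OL [] (mids ws) (lowers (map erase ws)) x
    FU-cords OU OL (strand p m q ∷ ws) x∈ with ∈-++⁻ (fu ⊥⟨ m / nm OU θU p ⟩) x∈
    ... | inj₁ i = nameM (here (fu-⊥⁻ i))
    ... | inj₂ j with ∈-++⁻ (fu ⊥⟨ nm OL θL q / m ⟩) j
    ...   | inj₁ i = nameL (here refl) (fu-⊥⁻ i)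
    ...   | inj₂ i = name-mono (λ i → i) there there (FU-cords OU OL ws i)
    FU-cords OU OL (ring m n ∷ ws) x∈ with ∈-++⁻ (fu ⊥⟨ m / n ⟩) x∈
    ... | inj₁ i = nameM (here (fu-⊥⁻ i))
    ... | inj₂ j with ∈-++⁻ (fu ⊥⟨ n / m ⟩) j
    ...   | inj₁ i = nameM (there (here (fu-⊥⁻ i)))
    ...   | inj₂ i = name-mono (λ i → i) (there ∘ there) (λ i → i) (FU-cords OU OL ws i)

    FU-R : ∀ OU OL Γ ws {x} → x ∈ FU (R OU OL Γ ws) → Name OU OL (ups Γ) (mids ws) (lowers (map erase ws)) x
    FU-R OU OL Γ ws x∈ with ∈-++⁻ (FU (map (real OU OL) Γ)) (subst (_ ∈_) (FU-++ (map (real OU OL) Γ)) x∈)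
    ... | inj₁ i = let p , p∈ , e = FU-reals OU OL Γ i in nameU p∈ e
    ... | inj₂ j = name-mono (λ ()) (λ i → i) (λ i → i) (FU-cords OU OL ws j)

    Mids : List Strand → Set
    Mids ws = ∀ {m} → m ∈ mids ws → m ∉ Zθ

    record Ends (W : Wires) : Set where
      field
        funU : Unique (uppers W)
        funL : Unique (lowers W)
        endU : ∀ {p} → p ∈ uppers W → p ∈ P₀
        endL : ∀ {p} → p ∈ lowers W → p ∈ P₀
    open Ends

    ends-↭ : ∀ {W W′} → W ↭ W′ → Ends W → Ends W′
    ends-↭ p e = record
      { funU = Unique-resp-↭ (uppers-↭ p) (funU e) ; funL = Unique-resp-↭ (lowers-↭ p) (funL e)
      ; endU = λ i → endU e (∈-resp-↭ (uppers-↭ (↭-sym p)) i)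
      ; endL = λ i → endL e (∈-resp-↭ (lowers-↭ (↭-sym p)) i) }

    ∉-names : ∀ OU OL {us ms ls s} → (∀ {p} → p ∈ us → p ∈ P₀) → (∀ {m} → m ∈ ms → m ∉ Zθ) → (∀ {q} → q ∈ ls → q ∈ P₀) →
              s ∈ Z₀ → s ∉ map proj₂ OU → s ∉ map proj₂ OL → ¬ Name OU OL us ms ls s
    ∉-names OU OL iU mf iL s∈ s∉U s∉L (nameM i) = mf i (Z₀∈ s∈)
    ∉-names OU OL iU mf iL s∈ s∉U s∉L (nameU {p} i e) with nm-cases OU θU p
    ... | inj₁ (p∈ , e′) = s∉U (subst (_∈ map proj₂ OU) (sym (≡-trans e e′)) (∈-map⁺ proj₂ p∈))
    ... | inj₂ (_ , e′) = θU-fresh (iU i) (subst (_∈ Z₀) (≡-trans e e′) s∈)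
    ∉-names OU OL iU mf iL s∈ s∉U s∉L (nameL {q} i e) with nm-cases OL θL q
    ... | inj₁ (q∈ , e′) = s∉L (subst (_∈ map proj₂ OL) (sym (≡-trans e e′)) (∈-map⁺ proj₂ q∈))
    ... | inj₂ (_ , e′) = θL-fresh (iL i) (subst (_∈ Z₀) (≡-trans e e′) s∈)

    module _ {OU OL : List Port} {k : ℕ} {E : Expr} (iU : ∀ {x} → x ∈ upper E → (k , x) ∈ P₀) (iL : ∀ {x} → x ∈ lower E → (k , x) ∈ P₀) where
      private
        f = fix (lower E) (nm OU θU) k
        g = fix (upper E) (nm OL θL) k
        safe = real-safe OU OL k E iU iL

      module _ {s : Ind} (s∈ : s ∈ fu E) (s∉ : s ∉ map proj₂ OU) where
        private
          s∈u = proj₁ (∈-frees⁻ s∈)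
          s∉l = proj₂ (∈-frees⁻ s∈)
          p∉ : (k , s) ∉ OU
          p∉ = s∉ ∘ ∈-map⁺ proj₂
          fs : f s ≡ θU (k , s)
          fs = ≡-trans (fix-∉ s∉l) (nm-∉ p∉)

        fu-real⁺ : Linear E → θU (k , s) ∈ fu (real OU OL (k , E))
        fu-real⁺ lin = ∈-resp-↭ (↭-sym (safe-fu safe lin)) (subst (_∈ map f (fu E)) fs (∈-map⁺ f s∈))

        ∉-realU : s ∉ occurrences (real OU OL (k , E))
        ∉-realU i with ∈-++⁻ (upper (real OU OL (k , E))) i
        ... | inj₁ q with y , y∈ , e ← ∈-map⁻ f (subst (s ∈_) (upper-ren f g E) q) with fix-nm (lower E) OU θU k y
        ...   | inj₁ e′ = θU-fresh (iU s∈u) (subst (_∈ Z₀) (≡-trans e (≡-trans (cong f (sym (≡-trans e e′))) fs)) (names (iU s∈u)))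
        ...   | inj₂ e′ = θU-fresh (iU y∈) (subst (_∈ Z₀) (≡-trans e e′) (names (iU s∈u)))
        ∉-realU i | inj₂ q with y , y∈ , e ← ∈-map⁻ g (subst (s ∈_) (lower-ren f g E) q) with fix-nm (upper E) OL θL k y
        ...   | inj₁ e′ = s∉l (subst (_∈ lower E) (sym (≡-trans e e′)) y∈)
        ...   | inj₂ e′ = θL-fresh (iL y∈) (subst (_∈ Z₀) (≡-trans e e′) (names (iU s∈u)))

        real-openU : real OU OL (k , E) [ s / θU (k , s) ]↑ ≡ real ((k , s) ∷ OU) OL (k , E)
        real-openU = ≡-trans (subst↑-ren s (θU (k , s)) _) (≡-trans (ren-∘ E) (ren-cong E step (λ _ → refl)))
          where
          step : ∀ {x} → x ∈ upper E → replace s (θU (k , s)) (f x) ≡ fix (lower E) (nm ((k , s) ∷ OU) θU) k x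
          step {x} x∈ with x ≟ᵢ s
          ... | yes refl = ≡-trans (cong (replace s (θU (k , s))) fs)
            (≡-trans (replace-≡ s (θU (k , s))) (sym (≡-trans (fix-∉ s∉l) (nm-∈ (here refl)))))
          ... | no x≢s = ≡-trans (replace-≢ λ e → x≢s (Safe.injᵘ safe x∈ s∈u (≡-trans e (sym fs))))
            (fix-cong {lower E} λ _ → nm-∷ λ { refl → x≢s refl })

      module _ {t : Ind} (t∈ : t ∈ fl E) (t∉ : t ∉ map proj₂ OL) where
        private
          t∈l = proj₁ (∈-frees⁻ t∈)
          t∉u = proj₂ (∈-frees⁻ t∈)
          q∉ : (k , t) ∉ OL
          q∉ = t∉ ∘ ∈-map⁺ proj₂
          gt : g t ≡ θL (k , t)
          gt = ≡-trans (fix-∉ t∉u) (nm-∉ q∉)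

        fl-real⁺ : Linear E → θL (k , t) ∈ fl (real OU OL (k , E))
        fl-real⁺ lin = ∈-resp-↭ (↭-sym (safe-fl safe lin)) (subst (_∈ map g (fl E)) gt (∈-map⁺ g t∈))

        ∉-realL : t ∉ occurrences (real OU OL (k , E))
        ∉-realL i with ∈-++⁻ (upper (real OU OL (k , E))) i
        ... | inj₁ q with y , y∈ , e ← ∈-map⁻ f (subst (t ∈_) (upper-ren f g E) q) with fix-nm (lower E) OU θU k y
        ...   | inj₁ e′ = t∉u (subst (_∈ upper E) (sym (≡-trans e e′)) y∈)
        ...   | inj₂ e′ = θU-fresh (iU y∈) (subst (_∈ Z₀) (≡-trans e e′) (names (iL t∈l)))
        ∉-realL i | inj₂ q with y , y∈ , e ← ∈-map⁻ g (subst (t ∈_) (lower-ren f g E) q) with fix-nm (upper E) OL θL k y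
        ...   | inj₁ e′ = θL-fresh (iL t∈l) (subst (_∈ Z₀) (≡-trans e (≡-trans (cong g (sym (≡-trans e e′))) gt)) (names (iL t∈l)))
        ...   | inj₂ e′ = θL-fresh (iL y∈) (subst (_∈ Z₀) (≡-trans e e′) (names (iL t∈l)))

        real-openL : real OU OL (k , E) [ t / θL (k , t) ]↓ ≡ real OU ((k , t) ∷ OL) (k , E)
        real-openL = ≡-trans (subst↓-ren t (θL (k , t)) _) (≡-trans (ren-∘ E) (ren-cong E (λ _ → refl) step))
          where
          step : ∀ {x} → x ∈ lower E → replace t (θL (k , t)) (g x) ≡ fix (upper E) (nm ((k , t) ∷ OL) θL) k x
          step {x} x∈ with x ≟ᵢ t
          ... | yes refl = ≡-trans (cong (replace t (θL (k , t))) gt)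
            (≡-trans (replace-≡ t (θL (k , t))) (sym (≡-trans (fix-∉ t∉u) (nm-∈ (here refl)))))
          ... | no x≢t = ≡-trans (replace-≢ λ e → x≢t (Safe.injˡ safe x∈ t∈l (≡-trans e (sym gt))))
            (fix-cong {upper E} λ _ → nm-∷ λ { refl → x≢t refl })

    agree-∷U : ∀ {O p ps} → p ∉ ps → AgreeU O (p ∷ O) ps
    agree-∷U {p = p} p∉ {q} q∈ = nm-∷ λ { refl → p∉ q∈ }

    agree-∷L : ∀ {O p ps} → p ∉ ps → AgreeL O (p ∷ O) ps
    agree-∷L {p = p} p∉ {q} q∈ = nm-∷ λ { refl → p∉ q∈ }

    ∉-tag : ∀ {k k′ x xs} → x ∉ xs → (k′ , x) ∉ tag k xs
    ∉-tag x∉ i with y , y∈ , refl ← ∈-map⁻ _ i = x∉ y∈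

    pull : ∀ OU OL {Γ ws k E Γ′ p m q ws′} → Γ ↭ (k , E) ∷ Γ′ → ws ↭ strand p m q ∷ ws′ →
           R OU OL Γ ws ↭ real OU OL (k , E) ∷ ⊥⟨ m / nm OU θU p ⟩ ∷ ⊥⟨ nm OL θL q / m ⟩ ∷ R OU OL Γ′ ws′
    pull OU OL {Γ′ = Γ′} {p} {m} {q} r r′ = trans (R-↭ OU OL r r′) (prep _ (shifts (map (real OU OL) Γ′) (⊥⟨ m / nm OU θU p ⟩ ∷ ⊥⟨ nm OL θL q / m ⟩ ∷ [])))

    mids-∈ : ∀ {ws p m q ws′} → ws ↭ strand p m q ∷ ws′ → m ∈ mids ws
    mids-∈ r = ∈-resp-↭ (mids-↭ (↭-sym r)) (here refl)

    ups-∉ : ∀ {k E Γ s} → OK ((k , E) ∷ Γ) → s ∈ upper E → (k , s) ∉ ups Γ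
    ups-∉ {k} {E} {Γ} o s∈ i = Unique-disjoint (proj₁ (apart o)) (∈-map⁺ (k ,_) s∈) (collect-mono {fu} (λ A → proj₁ ∘ ∈-frees⁻) Γ i)

    lows-∉ : ∀ {k E Γ s} → OK ((k , E) ∷ Γ) → s ∈ lower E → (k , s) ∉ lows Γ
    lows-∉ {k} {E} {Γ} o s∈ i = Unique-disjoint (proj₂ (apart o)) (∈-map⁺ (k ,_) s∈) (collect-mono {fl} (λ A → proj₁ ∘ ∈-frees⁻) Γ i)

    item-U : ∀ {k E Γ} → OK ((k , E) ∷ Γ) → ∀ {x} → x ∈ upper E → (k , x) ∈ P₀
    item-U {k} o x∈ = inU o (∈-++⁺ˡ (∈-map⁺ (k ,_) x∈))

    item-L : ∀ {k E Γ} → OK ((k , E) ∷ Γ) → ∀ {x} → x ∈ lower E → (k , x) ∈ P₀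
    item-L {k} o x∈ = inL o (∈-++⁺ˡ (∈-map⁺ (k ,_) x∈))

    ∉-FU-R : ∀ {OU OL Γ ws s} → OK Γ → Ends (map erase ws) → Mids ws → s ∈ Z₀ → s ∉ map proj₂ OU → s ∉ map proj₂ OL →
             s ∉ FU (R OU OL Γ ws)
    ∉-FU-R {OU} {OL} {Γ} {ws} o e mf s∈ s∉U s∉L i = ∉-names OU OL (ups-in o) mf (endL e) s∈ s∉U s∉L (FU-R OU OL Γ ws i)

    -- The original name is restored in the formula and in its strand at once, so the sequent stays
    -- balanced. The rest is unaffected, as a port lies in one formula and on one strand.
    openU : ∀ {OU OL Γ ws k s} → OK Γ → Ends (map erase ws) → Mids ws → (k , s) ∈ ups Γ → (k , s) ∈ uppers (map erase ws) →
            s ∉ map proj₂ OU → s ∉ map proj₂ OL → CF (R OU OL Γ ws) → CF (R ((k , s) ∷ OU) OL Γ ws)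
    openU {OU} {OL} {Γ} {ws} {k} {s} o e mf p∈ w∈ s∉U s∉L d =
      let p = k , s
          E , Γ′ , r , s∈ = collect-∈ fu Γ p∈
          us , w = ∈⇒↭ w∈
          q , W , t , _ = upper-edge (map erase ws) w
          m , ws′ , r′ , _ = unerase-edge {ws} t
          o′ = ok-↭ r o
          e′ = ends-↭ (map⁺ erase r′) e
          s∈Z = names (ups-in o p∈)
          s∉R = ∉-FU-R {OU} {OL} {Γ} {ws} o e mf s∈Z s∉U s∉L
          π = pull OU OL r r′
          s∉Θ = λ i → s∉R (∈-resp-↭ (FU-↭ (↭-sym π)) (∈-++⁺ʳ (fu (real OU OL (k , E))) (∈-++⁺ʳ (fu ⊥⟨ m / nm OU θU p ⟩) i)))
          iU = item-U o′
          iL = item-L o′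
          Rest : List Port → List Expr
          Rest O = ⊥⟨ nm OL θL q / m ⟩ ∷ R O OL Γ′ ws′
          d₁ = subst (λ a → CF (real OU OL (k , E) ∷ ⊥⟨ m / a ⟩ ∷ Rest OU)) (nm-∉ (s∉U ∘ ∈-map⁺ proj₂)) (exchange π d)
          d₂ = openU-step s d₁ (fu-real⁺ {OU} {OL} {k} {E} iU iL s∈ s∉U (proj₂ (All.head (forms o′)))) (∉-realU {OU} {OL} {k} {E} iU iL s∈ s∉U)
                 (λ s≡m → mf (mids-∈ r′) (subst (_∈ Zθ) s≡m (Z₀∈ s∈Z))) s∉Θ
          eR : R OU OL Γ′ ws′ ≡ R (p ∷ OU) OL Γ′ ws′
          eR = cong₂ _++_ (reals-cong Γ′ (agree-∷U (ups-∉ o′ (proj₁ (∈-frees⁻ s∈)))) (λ _ → refl))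
                 (cords-cong ws′ (agree-∷U (head-∉ (funU e′))) (λ _ → refl))
      in exchange (↭-sym (pull (p ∷ OU) OL r r′)) (subst CF (cong₂ _∷_ (real-openU {OU} {OL} {k} {E} iU iL s∈ s∉U)
           (cong₂ _∷_ (cong (λ a → ⊥⟨ m / a ⟩) (sym (nm-∈ {p ∷ OU} {θU} (here refl)))) (cong (⊥⟨ nm OL θL q / m ⟩ ∷_) eR))) d₂)

    openL : ∀ {OU OL Γ ws k s} → OK Γ → Ends (map erase ws) → Mids ws → (k , s) ∈ lows Γ → (k , s) ∈ lowers (map erase ws) →
            s ∉ map proj₂ OU → s ∉ map proj₂ OL → CF (R OU OL Γ ws) → CF (R OU ((k , s) ∷ OL) Γ ws)
    openL {OU} {OL} {Γ} {ws} {k} {s} o e mf q∈ w∈ s∉U s∉L d =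
      let q = k , s
          E , Γ′ , r , s∈ = collect-∈ fl Γ q∈
          ls , w = ∈⇒↭ w∈
          p , W , t , _ = lower-edge (map erase ws) w
          m , ws′ , r′ , _ = unerase-edge {ws} t
          o′ = ok-↭ r o
          e′ = ends-↭ (map⁺ erase r′) e
          s∈Z = names (lows-in o q∈)
          s∉R = ∉-FU-R {OU} {OL} {Γ} {ws} o e mf s∈Z s∉U s∉L
          π = λ O → trans (pull OU O r r′) (prep _ (swap _ _ refl))
          s∉Θ = λ i → s∉R (∈-resp-↭ (FU-↭ (↭-sym (π OL))) (∈-++⁺ʳ (fu (real OU OL (k , E))) (∈-++⁺ʳ (fu ⊥⟨ nm OL θL q / m ⟩) i)))
          iU = item-U o′
          iL = item-L o′
          Rest : List Port → List Expr
          Rest O = ⊥⟨ m / nm OU θU p ⟩ ∷ R OU O Γ′ ws′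
          d₁ = subst (λ a → CF (real OU OL (k , E) ∷ ⊥⟨ a / m ⟩ ∷ Rest OL)) (nm-∉ (s∉L ∘ ∈-map⁺ proj₂)) (exchange (π OL) d)
          d₂ = openL-step s d₁ (fl-real⁺ {OU} {OL} {k} {E} iU iL s∈ s∉L (proj₂ (All.head (forms o′)))) (∉-realL {OU} {OL} {k} {E} iU iL s∈ s∉L)
                 (λ s≡m → mf (mids-∈ r′) (subst (_∈ Zθ) s≡m (Z₀∈ s∈Z))) s∉Θ
          eR : R OU OL Γ′ ws′ ≡ R OU (q ∷ OL) Γ′ ws′
          eR = cong₂ _++_ (reals-cong Γ′ (λ _ → refl) (agree-∷L (lows-∉ o′ (proj₁ (∈-frees⁻ s∈)))))
                 (cords-cong ws′ (λ _ → refl) (agree-∷L (head-∉ (funL e′))))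
      in exchange (↭-sym (π (q ∷ OL))) (subst CF (cong₂ _∷_ (real-openL {OU} {OL} {k} {E} iU iL s∈ s∉L)
           (cong₂ _∷_ (cong (λ a → ⊥⟨ a / m ⟩) (sym (nm-∈ {q ∷ OL} {θL} (here refl)))) (cong (⊥⟨ m / nm OU θU p ⟩ ∷_) eR))) d₂)

    link : ∀ {OU OL Γ ws k k′ s m ws′} → OK Γ → Ends (map erase ws) → Mids ws → (k , s) ∈ ups Γ → (k′ , s) ∈ lows Γ →
           s ∉ map proj₂ OU → s ∉ map proj₂ OL → ws ↭ strand (k , s) m (k′ , s) ∷ ws′ →
           CF (R OU OL Γ ws) → CF (R ((k , s) ∷ OU) ((k′ , s) ∷ OL) Γ ws′)
    link {OU} {OL} {Γ} {ws} {k} {k′} {s} {m} {ws′} o e mf p∈ q∈ s∉U s∉L r′ d =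
      let p = k , s
          q = k′ , s
          E , Γ₁ , r₁ , s∈ = collect-∈ fu Γ p∈
          E′ , Γ′ , r₂ , s∈′ = collect-∈ fl Γ₁ (tail-∈ E Γ₁ s∈ (∈-resp-↭ (collect-↭ fl r₁) q∈))
          r = trans r₁ (prep (k , E) r₂)
          o′ = ok-↭ r o
          oE′ = ok-++ʳ [ k , E ] o′
          e′ = ends-↭ (map⁺ erase r′) e
          s∈Z = names (ups-in o p∈)
          s∉R = ∉-FU-R {OU} {OL} {Γ} {ws} o e mf s∈Z s∉U s∉L
          A = real OU OL (k , E)
          B = real OU OL (k′ , E′)
          a = nm OU θU p
          b = nm OL θL q
          π : R OU OL Γ ws ↭ A ∷ B ∷ ⊥⟨ m / a ⟩ ∷ ⊥⟨ b / m ⟩ ∷ R OU OL Γ′ ws′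
          π = trans (pull OU OL {Γ} {ws} r r′) (solve 5 (λ a b c d f → a ⊕ b ⊕ c ⊕ d ⊕ f ⊜ a ⊕ d ⊕ b ⊕ c ⊕ f) refl
                [ A ] [ ⊥⟨ m / a ⟩ ] [ ⊥⟨ b / m ⟩ ] [ B ] (R OU OL Γ′ ws′))
          s∉Θ = λ i → s∉R (∈-resp-↭ (FU-↭ (↭-sym π)) (∈-++⁺ʳ (fu A) (∈-++⁺ʳ (fu B) (∈-++⁺ʳ (fu ⊥⟨ m / a ⟩) (∈-++⁺ʳ (fu ⊥⟨ b / m ⟩) i)))))
          d₁ = subst₂ (λ a b → CF (A ∷ B ∷ ⊥⟨ m / a ⟩ ∷ ⊥⟨ b / m ⟩ ∷ R OU OL Γ′ ws′))
                 (nm-∉ (s∉U ∘ ∈-map⁺ proj₂)) (nm-∉ (s∉L ∘ ∈-map⁺ proj₂)) (exchange π d)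
          d₂ = link-step s d₁ (fu-real⁺ {OU} {OL} {k} {E} (item-U o′) (item-L o′) s∈ s∉U (proj₂ (All.head (forms o′))))
                 (fl-real⁺ {OU} {OL} {k′} {E′} (item-U oE′) (item-L oE′) s∈′ s∉L (proj₂ (All.head (forms oE′))))
                 (∉-realU {OU} {OL} {k} {E} (item-U o′) (item-L o′) s∈ s∉U) (∉-realL {OU} {OL} {k′} {E′} (item-U oE′) (item-L oE′) s∈′ s∉L)
                 (λ s≡m → mf (mids-∈ r′) (subst (_∈ Zθ) s≡m (Z₀∈ s∈Z))) s∉Θ
          eA : A [ s / θU p ]↑ ≡ real (p ∷ OU) (q ∷ OL) (k , E)
          eA = ≡-trans (real-openU {OU} {OL} {k} {E} (item-U o′) (item-L o′) s∈ s∉U)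
                 (real-cong k E (λ _ → refl) (agree-∷L (∉-tag λ i → frees-disjoint s∈ i)))
          eB : B [ s / θL q ]↓ ≡ real (p ∷ OU) (q ∷ OL) (k′ , E′)
          eB = ≡-trans (real-openL {OU} {OL} {k′} {E′} (item-U oE′) (item-L oE′) s∈′ s∉L)
                 (real-cong k′ E′ (agree-∷U (∉-tag λ i → frees-disjoint i s∈′)) (λ _ → refl))
          eR : R OU OL Γ′ ws′ ≡ R (p ∷ OU) (q ∷ OL) Γ′ ws′
          eR = cong₂ _++_ (reals-cong Γ′ (agree-∷U (ups-∉ o′ (proj₁ (∈-frees⁻ s∈)) ∘ ∈-++⁺ʳ (tag k′ (fu E′)))) (agree-∷L (lows-∉ oE′ (proj₁ (∈-frees⁻ s∈′)))))
                 (cords-cong ws′ (agree-∷U (head-∉ (funU e′))) (agree-∷L (head-∉ (funL e′))))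
      in exchange (↭-sym (R-↭ (p ∷ OU) (q ∷ OL) {Γ} {_} {ws′} r refl)) (subst CF (cong₂ _∷_ eA (cong₂ _∷_ eB eR)) d₂)
      where
      tail-∈ : ∀ E Γ₁ → s ∈ fu E → (k′ , s) ∈ lows ((k , E) ∷ Γ₁) → (k′ , s) ∈ lows Γ₁
      tail-∈ E Γ₁ s∈ i with ∈-++⁻ (tag k (fl E)) i
      ... | inj₁ j = ⊥-elim (∉-tag (frees-disjoint s∈) j)
      ... | inj₂ j = j

    link* : ∀ Zs {Γ ws W} → OK Γ → Ends (map erase ws) → Mids ws → map erase ws ↭ map wire Zs ++ W →
            (∀ {z} → z ∈ Zs → upper-port z ∈ ups Γ × lower-port z ∈ lows Γ) → Unique (map Joint.name Zs) →
            CF (R [] [] Γ ws) →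
            ∃₂ λ xs ws′ → ws ↭ xs ++ ws′ × map erase ws′ ↭ W × CF (R (map upper-port Zs) (map lower-port Zs) Γ ws′)
    link* [] {ws = ws} o e mf r h u d = [] , ws , refl , r , d
    link* (z@(joint k k′ s) ∷ Zs) {Γ} {ws} {W} o e mf r h u d =
      let xs , ws₁ , p , r₁ , d₁ = link* Zs o e mf (trans r (↭-sym (shift (wire z) (map wire Zs) W))) (h ∘ there) (Unique-++⁻ʳ [ s ] u) d
          m , ws₂ , q , r₂ = unerase-edge {ws₁} r₁
          i , j = h (here refl)
          e₁ = ends-++ʳ xs (ends-↭ (↭-trans (map⁺ erase p) (↭-reflexive (map-++ erase xs ws₁))) e)
          mf₁ = λ {m} (m∈ : m ∈ mids ws₁) → mf (∈-resp-↭ (mids-↭ (↭-sym p)) (subst (m ∈_) (sym (mids-++ xs)) (∈-++⁺ʳ (mids xs) m∈)))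
          eq : ∀ {f : Joint → Port} → (∀ z → proj₂ (f z) ≡ Joint.name z) → s ∉ map proj₂ (map f Zs)
          eq {f} h s∈ = head-∉ u (subst (s ∈_) (≡-trans (sym (Listₚ.map-∘ Zs)) (Listₚ.map-cong h Zs)) s∈)
      in xs ++ [ strand (k , s) m (k′ , s) ] , ws₂ ,
         trans p (trans (++⁺ˡ xs q) (↭-reflexive (sym (Listₚ.++-assoc xs _ ws₂)))) , r₂ ,
         link o e₁ mf₁ i j (eq {upper-port} (λ _ → refl)) (eq {lower-port} (λ _ → refl)) q d₁
      where
      ends-++ʳ : ∀ ws {ws′} → Ends (map erase ws ++ map erase ws′) → Ends (map erase ws′)
      ends-++ʳ ws {ws′} e = record
        { funU = Unique-++⁻ʳ (uppers (map erase ws)) (subst Unique (uppers-++ (map erase ws)) (funU e))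
        ; funL = Unique-++⁻ʳ (lowers (map erase ws)) (subst Unique (lowers-++ (map erase ws)) (funL e))
        ; endU = λ i → endU e (subst (_ ∈_) (sym (uppers-++ (map erase ws))) (∈-++⁺ʳ _ i))
        ; endL = λ i → endL e (subst (_ ∈_) (sym (lowers-++ (map erase ws))) (∈-++⁺ʳ _ i)) }

    openU* : ∀ k ss {Γ ws} → OK Γ → Ends (map erase ws) → Mids ws →
             (∀ {s} → s ∈ ss → (k , s) ∈ ups Γ × (k , s) ∈ uppers (map erase ws)) → Unique ss →
             CF (R [] [] Γ ws) → CF (R (tag k ss) [] Γ ws)
    openU* k [] o e mf h u d = d
    openU* k (s ∷ ss) o e mf h u d = let i , j = h (here refl) in
      openU o e mf i j (λ s∈ → head-∉ u (subst (s ∈_) (≡-trans (sym (Listₚ.map-∘ ss)) (Listₚ.map-id ss)) s∈)) (λ ())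
        (openU* k ss o e mf (h ∘ there) (Unique-++⁻ʳ [ s ] u) d)

    openL* : ∀ k ss {OU Γ ws} → OK Γ → Ends (map erase ws) → Mids ws →
             (∀ {s} → s ∈ ss → (k , s) ∈ lows Γ × (k , s) ∈ lowers (map erase ws)) → Unique ss → (∀ {s} → s ∈ ss → s ∉ map proj₂ OU) →
             CF (R OU [] Γ ws) → CF (R OU (tag k ss) Γ ws)
    openL* k [] o e mf h u n d = d
    openL* k (s ∷ ss) o e mf h u n d = let i , j = h (here refl) in
      openL o e mf i j (n (here refl)) (λ s∈ → head-∉ u (subst (s ∈_) (≡-trans (sym (Listₚ.map-∘ ss)) (Listₚ.map-id ss)) s∈))
        (openL* k ss o e mf (h ∘ there) (Unique-++⁻ʳ [ s ] u) (n ∘ there) d)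

    -- Middle indices must avoid every name that formulas can bear. The parameter `Z` lets one
    -- premise of a ⊗ avoid the middle indices of the other.
    Good : List Ind → List Strand → Set
    Good Z ws = Unique (mids ws) × (∀ {m} → m ∈ mids ws → m ∉ Zθ × m ∉ Z)

    good-mids : ∀ {Z ws} → Good Z ws → Mids ws
    good-mids g = proj₁ ∘ proj₂ g

    good-⊆ : ∀ {Z ws ws′} ms → mids ws ↭ ms ++ mids ws′ → Good Z ws → Good Z ws′
    good-⊆ ms p (u , h) = Unique-++⁻ʳ ms (Unique-resp-↭ p u) , λ i → h (∈-resp-↭ (↭-sym p) (∈-++⁺ʳ ms i))

    good-∷ : ∀ {Z m ws} → m ∉ Zθ → m ∉ Z → m ∉ mids ws → Good Z ws →
             Unique (m ∷ mids ws) × (∀ {m′} → m′ ∈ m ∷ mids ws → m′ ∉ Zθ × m′ ∉ Z)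
    good-∷ {Z} {m} {ws} a b c (u , h) = ∷-Unique c u , λ { (here refl) → a , b ; (there i) → h i }

    ends-⟿ : ∀ {W p W′} → W ⟿[ p ] W′ → Ends W → Ends W′
    ends-⟿ {p = p} s e = let a , b = ⟿-ends s in record
      { funU = Unique-++⁻ʳ [ p ] (Unique-resp-↭ a (funU e)) ; funL = Unique-++⁻ʳ [ p ] (Unique-resp-↭ b (funL e))
      ; endU = λ i → endU e (∈-resp-↭ (↭-sym a) (there i)) ; endL = λ i → endL e (∈-resp-↭ (↭-sym b) (there i)) }

    -- At an opened port both strands meet in its index `x`, so the chain through `m`, `x` and `m′`
    -- is shortened by two gluings to one through `m` alone. If a single strand returns to its
    -- starting point, its chain becomes a ring.
    contract-step : ∀ Z O {Θ ws W W′ p} → p ∈ O → W ⟿[ p ] W′ → map erase ws ↭ W → Ends W → Good Z ws → CF (Θ ++ cords O O ws) →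
                    ∃ λ ws′ → map erase ws′ ↭ W′ × Good Z ws′ × CF (Θ ++ cords O O ws′)
    contract-step Z O {Θ} {ws} {p = p} p∈ (via {u} {l} q r) w e g d =
      let m , ws₁ , s₁ , w₁ = unerase-edge {ws} (trans w q)
          m′ , ws₂ , s₂ , w₂ = unerase-edge {ws₁} w₁
          x = proj₂ p
          e′ = ends-↭ q e
          x∈ = Z₀∈ (names (endL e′ (here refl)))
          μ : mids ws ↭ m ∷ m′ ∷ mids ws₂
          μ = mids-↭ (trans s₁ (prep _ s₂))
          m∉ = proj₁ (proj₂ g (∈-resp-↭ (↭-sym μ) (here refl)))
          m≢m′ = λ { eq → head-∉ (Unique-resp-↭ μ (proj₁ g)) (here eq) }
          m≢ : ∀ {y} → y ∈ Zθ → m ≢ y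
          m≢ y∈ eq = m∉ (subst (_∈ Zθ) (sym eq) y∈)
          X = cords O O ws₂
          b = nm O θL l
          A = ⊥⟨ m / nm O θU u ⟩
          π : Θ ++ cords O O ws ↭ ⊥⟨ nm O θL p / m ⟩ ∷ ⊥⟨ m′ / nm O θU p ⟩ ∷ ⊥⟨ b / m′ ⟩ ∷ A ∷ Θ ++ X
          π = trans (++⁺ˡ Θ (cords-↭ O O (trans s₁ (prep _ s₂)))) (solve 6 (λ t a b c d x → t ⊕ a ⊕ b ⊕ c ⊕ d ⊕ x ⊜ b ⊕ c ⊕ d ⊕ a ⊕ t ⊕ x) refl
                Θ [ A ] [ ⊥⟨ nm O θL p / m ⟩ ] [ ⊥⟨ m′ / nm O θU p ⟩ ] [ ⊥⟨ b / m′ ⟩ ] X)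
          d₁ = subst₂ (λ y z → CF (⊥⟨ y / m ⟩ ∷ ⊥⟨ m′ / z ⟩ ∷ ⊥⟨ b / m′ ⟩ ∷ A ∷ Θ ++ X)) (nm-∈ p∈) (nm-∈ p∈) (exchange π d)
          d₂ = glue-step d₁ m≢m′ (m≢ x∈)
          d₃ = glue-step d₂ (m≢ (nmL∈ O (endL e′ (there (here refl))))) m≢m′
      in strand u m l ∷ ws₂ , trans (prep _ w₂) (↭-sym r) ,
         good-⊆ {Z} {ws} {strand u m l ∷ ws₂} [ m′ ] (trans μ (swap _ _ refl)) g ,
         exchange (solve 4 (λ c a t x → c ⊕ a ⊕ t ⊕ x ⊜ t ⊕ a ⊕ c ⊕ x) refl [ ⊥⟨ b / m ⟩ ] [ A ] Θ X) d₃
    contract-step Z O {Θ} {ws} {p = p} p∈ (cyc q r) w e g d =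
      let m , ws₁ , s₁ , w₁ = unerase-edge {ws} (trans w q)
          x = proj₂ p
          e′ = ends-↭ q e
          x∈ = Z₀∈ (names (endL e′ (here refl)))
          μ = mids-↭ s₁
          m∉ = proj₁ (proj₂ g (∈-resp-↭ (↭-sym μ) (here refl)))
          X = cords O O ws₁
          -- A ring may contain only indices outside `Zθ`, so `x` has to give way to a fresh index.
          c , c∉ = fresh (Zθ ++ Z ++ mids ws ++ FU (Θ ++ X))
          c∉θ = c∉ ∘ ∈-++⁺ˡ
          c∉Z = c∉ ∘ ∈-++⁺ʳ Zθ ∘ ∈-++⁺ˡ
          c∉m = c∉ ∘ ∈-++⁺ʳ Zθ ∘ ∈-++⁺ʳ Z ∘ ∈-++⁺ˡ
          c∉F = c∉ ∘ ∈-++⁺ʳ Zθ ∘ ∈-++⁺ʳ Z ∘ ∈-++⁺ʳ (mids ws)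
          c≢m = λ eq → c∉m (subst (_∈ mids ws) (sym eq) (∈-resp-↭ (↭-sym μ) (here refl)))
          c≢x = λ eq → c∉θ (subst (_∈ Zθ) (sym eq) x∈)
          π : Θ ++ cords O O ws ↭ ⊥⟨ nm O θL p / m ⟩ ∷ ⊥⟨ m / nm O θU p ⟩ ∷ Θ ++ X
          π = trans (++⁺ˡ Θ (cords-↭ O O s₁)) (solve 4 (λ t a b x → t ⊕ a ⊕ b ⊕ x ⊜ b ⊕ a ⊕ t ⊕ x) refl
                Θ [ ⊥⟨ m / nm O θU p ⟩ ] [ ⊥⟨ nm O θL p / m ⟩ ] X)
          d₁ = subst₂ (λ y z → CF (⊥⟨ y / m ⟩ ∷ ⊥⟨ m / z ⟩ ∷ Θ ++ X)) (nm-∈ p∈) (nm-∈ p∈) (exchange π d)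
          d₂ = openU-step c d₁ (∈-fu-bot (bot≢ d₁)) (∉-bot c≢m c≢x) c≢m c∉F
          d₃ = subst (λ y → CF (⊥⟨ y / m ⟩ ∷ ⊥⟨ m / c ⟩ ∷ Θ ++ X)) (replace-≡ c x) d₂
          g₁ : Unique (c ∷ m ∷ mids ws₁) × (∀ {m′} → m′ ∈ c ∷ m ∷ mids ws₁ → m′ ∉ Zθ × m′ ∉ Z)
          g₁ = good-∷ {Z} {c} {strand p m p ∷ ws₁} c∉θ c∉Z (c∉m ∘ ∈-resp-↭ (↭-sym μ)) (good-⊆ {Z} {ws} {strand p m p ∷ ws₁} [] μ g)
      in ring m c ∷ ws₁ , trans (prep _ w₁) (↭-sym r) ,
         (Unique-resp-↭ (swap _ _ refl) (proj₁ g₁) , λ i → proj₂ g₁ (∈-resp-↭ (swap _ _ refl) i)) ,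
         exchange (solve 4 (λ a b t x → a ⊕ b ⊕ t ⊕ x ⊜ t ⊕ b ⊕ a ⊕ x) refl [ ⊥⟨ c / m ⟩ ] [ ⊥⟨ m / c ⟩ ] Θ X) d₃

    contract-CF : ∀ Z O {Θ ws W xs W′} → (∀ {x} → x ∈ xs → x ∈ O) → W ⟿⟨ xs ⟩ W′ → map erase ws ↭ W → Ends W → Good Z ws →
                  CF (Θ ++ cords O O ws) → ∃ λ ws′ → map erase ws′ ↭ W′ × Good Z ws′ × CF (Θ ++ cords O O ws′)
    contract-CF Z O {ws = ws} h (done p) w e g d = ws , trans w p , g , d
    contract-CF Z O {Θ} h (s ⨾ t) w e g d =
      let ws₁ , w₁ , g₁ , d₁ = contract-step Z O {Θ} (h (here refl)) s w e g d
      in contract-CF Z O {Θ} (h ∘ there) t w₁ (ends-⟿ s e) g₁ d₁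

    -- The middle indices of ws can be chosen outside any given list Z.
    T : List Item → Wires → Set
    T Γ W = OK Γ → ∀ Z → ∃ λ ws → map erase ws ↭ W × Good Z ws × CF (R [] [] Γ ws)

    D-Ends : ∀ {Γ W} → D Γ W → OK Γ → Ends W
    D-Ends {Γ} d o = let u , l = D-ends d (forms o) in record
      { funU = Unique-resp-↭ (↭-sym u) (ups-Unique Γ (apart o)) ; funL = Unique-resp-↭ (↭-sym l) (lows-Unique Γ (apart o))
      ; endU = λ i → ups-in o (∈-resp-↭ u i) ; endL = λ i → lows-in o (∈-resp-↭ l i) }

    ok-⅋ : ∀ {k A B Γ} → OK ((k , A ⅋ B) ∷ Γ) → OK ((k , A) ∷ (k , B) ∷ Γ)
    ok-⅋ {k} {A} {B} {Γ} o = record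
      { forms = formulaˡ (All.head (forms o)) ∷ formulaʳ (All.head (forms o)) ∷ All.tail (forms o) ; apart = apart-⅋ k A B Γ (apart o)
      ; inU = λ i → inU o (subst (_ ∈_) (sym (e upper refl)) i) ; inL = λ i → inL o (subst (_ ∈_) (sym (e lower refl)) i) }
      where
      e : ∀ f → f (A ⅋ B) ≡ f A ++ f B → collect f ((k , A ⅋ B) ∷ Γ) ≡ collect f ((k , A) ∷ (k , B) ∷ Γ)
      e f eq = ≡-trans (cong (λ xs → tag k xs ++ collect f Γ) eq) (≡-trans (cong (_++ collect f Γ) (map-++ (k ,_) (f A) (f B)))
        (Listₚ.++-assoc (tag k (f A)) (tag k (f B)) (collect f Γ)))

    ok-⊗ : ∀ {k A B} Γ₁ Γ₂ → OK ((k , A ⊗ B) ∷ Γ₁ ++ Γ₂) → OK ((k , A) ∷ Γ₁) × OK ((k , B) ∷ Γ₂)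
    ok-⊗ {k} {A} {B} Γ₁ Γ₂ o = ok-++ˡ {(k , A) ∷ Γ₁} ((k , B) ∷ Γ₂) o₁ , ok-++ʳ ((k , A) ∷ Γ₁) o₁
      where
      o₀ : OK ((k , A ⅋ B) ∷ Γ₁ ++ Γ₂)
      o₀ = record { forms = All.head (forms o) ∷ All.tail (forms o) ; apart = apart o ; inU = inU o ; inL = inL o }
      o₁ = ok-↭ (prep _ (↭-sym (shift (k , B) Γ₁ Γ₂))) (ok-⅋ o₀)

    -- Opening the shared indices of A and B makes them bound in the compound.
    module _ {k : ℕ} {A B : Expr} where
      private
        O = tag k (shared A B)
        ∈O : ∀ {x} → x ∈ shared A B → (k , x) ∈ O
        ∈O = ∈-map⁺ (k ,_)
        sub : ∀ {us ls ms n x} → x ∈ us → (x ∈ us → x ∈ ms → nm O n (k , x) ≡ x) →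
              fix (ls ++ ms) (nm O n) k x ≡ fix ls (nm O n) k x
        sub {us} {ls} {ms} {n} {x} x∈ h with x ∈? ls | x ∈? ms
        ... | yes i | _ = ≡-trans (fix-∈ (∈-++⁺ˡ i)) (sym (fix-∈ i))
        ... | no i | yes j = ≡-trans (fix-∈ (∈-++⁺ʳ ls j)) (sym (≡-trans (fix-∉ i) (h x∈ j)))
        ... | no i | no j = ≡-trans (fix-∉ ([ i , j ]′ ∘ ∈-++⁻ ls)) (sym (fix-∉ i))
        sub′ : ∀ {us ls ms n x} → x ∈ us → (x ∈ us → x ∈ ms → nm O n (k , x) ≡ x) →
               fix (ms ++ ls) (nm O n) k x ≡ fix ls (nm O n) k x
        sub′ {us} {ls} {ms} {n} {x} x∈ h with x ∈? ls | x ∈? ms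
        ... | yes i | _ = ≡-trans (fix-∈ (∈-++⁺ʳ ms i)) (sym (fix-∈ i))
        ... | no i | yes j = ≡-trans (fix-∈ (∈-++⁺ˡ j)) (sym (≡-trans (fix-∉ i) (h x∈ j)))
        ... | no i | no j = ≡-trans (fix-∉ ([ j , i ]′ ∘ ∈-++⁻ ms)) (sym (fix-∉ i))
        S₁ : ∀ {x} → x ∈ upper A → x ∈ lower B → x ∈ shared A B
        S₁ p q = ∈-++⁺ˡ (∈-common⁺ p q)
        S₂ : ∀ {x} → x ∈ upper B → x ∈ lower A → x ∈ shared A B
        S₂ p q = ∈-++⁺ʳ _ (∈-common⁺ p q)

      real-left : ren (fix (lower A ++ lower B) (nm O θU) k) (fix (upper A ++ upper B) (nm O θL) k) A ≡ real O O (k , A)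
      real-left = ren-cong A (λ x∈ → sub {upper A} x∈ λ p q → nm-∈ (∈O (S₁ p q))) (λ x∈ → sub {lower A} x∈ λ p q → nm-∈ (∈O (S₂ q p)))

      real-right : ren (fix (lower A ++ lower B) (nm O θU) k) (fix (upper A ++ upper B) (nm O θL) k) B ≡ real O O (k , B)
      real-right = ren-cong B (λ x∈ → sub′ {upper B} x∈ λ p q → nm-∈ (∈O (S₂ p q))) (λ x∈ → sub′ {lower B} x∈ λ p q → nm-∈ (∈O (S₁ q p)))

      ∈-shared⁻ : ∀ {x} → x ∈ shared A B → x ∈ upper A ++ upper B × x ∈ lower A ++ lower B
      ∈-shared⁻ x∈ with ∈-++⁻ (common (upper A) (lower B)) x∈
      ... | inj₁ i = let p , q = ∈-common⁻ i in ∈-++⁺ˡ p , ∈-++⁺ʳ (lower A) q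
      ... | inj₂ i = let p , q = ∈-common⁻ i in ∈-++⁺ʳ (upper A) p , ∈-++⁺ˡ q

      ups-avoid : ∀ {Γ} → OK ((k , A ⅋ B) ∷ Γ) → ∀ {p} → p ∈ ups ((k , A ⅋ B) ∷ Γ) → p ∉ O
      ups-avoid {Γ} o i j with x , x∈ , refl ← ∈-map⁻ (k ,_) j with ∈-++⁻ (tag k (fu (A ⅋ B))) i
      ... | inj₁ i′ with y , y∈ , refl ← ∈-map⁻ (k ,_) i′ = proj₂ (∈-frees⁻ y∈) (proj₂ (∈-shared⁻ x∈))
      ... | inj₂ i′ = ups-∉ o (proj₁ (∈-shared⁻ x∈)) i′

      lows-avoid : ∀ {Γ} → OK ((k , A ⅋ B) ∷ Γ) → ∀ {p} → p ∈ lows ((k , A ⅋ B) ∷ Γ) → p ∉ O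
      lows-avoid {Γ} o i j with x , x∈ , refl ← ∈-map⁻ (k ,_) j with ∈-++⁻ (tag k (fl (A ⅋ B))) i
      ... | inj₁ i′ with y , y∈ , refl ← ∈-map⁻ (k ,_) i′ = proj₂ (∈-frees⁻ y∈) (proj₁ (∈-shared⁻ x∈))
      ... | inj₂ i′ = lows-∉ o (proj₂ (∈-shared⁻ x∈)) i′

    -- Used after ⅋ and ⊗, where the opened indices are bound in the compound: no remaining free
    -- port is opened, so the list `O` may be emptied.
    close : ∀ {O Γ ws W} → (∀ {p} → p ∈ ups Γ → p ∉ O) → (∀ {p} → p ∈ lows Γ → p ∉ O) →
            uppers W ↭ ups Γ × lowers W ↭ lows Γ → map erase ws ↭ W → R O O Γ ws ≡ R [] [] Γ ws
    close {O} {Γ} {ws} h h′ (u , l) w = cong₂ _++_ (reals-cong Γ (ag h) (ag h′))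
      (cords-cong ws (λ i → ag h (∈-resp-↭ (trans (uppers-↭ w) u) i)) (λ i → ag h′ (∈-resp-↭ (trans (lowers-↭ w) l) i)))
      where
      ag : ∀ {θ ps} → (∀ {p} → p ∈ ps → p ∉ O) → ∀ {p} → p ∈ ps → nm O θ p ≡ nm [] θ p
      ag h p∈ = nm-cong (λ i → contradiction i (h p∈)) λ ()

    real-formula : ∀ {k E Γ} OU OL → OK ((k , E) ∷ Γ) → IsFormula (real OU OL (k , E))
    real-formula {k} {E} OU OL o = safe-formula (real-safe OU OL k E (item-U o) (item-L o)) (All.head (forms o))

    -- The premise has a strand joining the two occurrences of each shared index. `link*` removes
    -- these strands, after which `A` and `B` bear the shared names and ⅋ binds them.
    T-par : ∀ {Γ W k A B} → D ((k , A) ∷ (k , B) ∷ Γ) (links k (shared A B) ++ W) → T ((k , A) ∷ (k , B) ∷ Γ) (links k (shared A B) ++ W) → T ((k , A ⅋ B) ∷ Γ) W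
    T-par {Γ} {W} {k} {A} {B} δ t o Z =
      let o′ = ok-⅋ o
          f@(_ , lin) = All.head (forms o)
          S = shared A B
          O = tag k S
          Zs = map (joint k k) S
          ws , w , g , d = t o′ Z
          e = ends-↭ (↭-sym w) (D-Ends δ o′)
          xs , ws′ , p , w′ , d′ = link* Zs o′ e (good-mids {Z} {ws} g) (subst (λ L → map erase ws ↭ L ++ W) (Listₚ.map-∘ S) w) h
                 (subst Unique (sym (≡-trans (sym (Listₚ.map-∘ S)) (Listₚ.map-id S))) (shared-Unique {A} {B} lin)) d
          d″ : CF (real O O (k , A) ∷ real O O (k , B) ∷ R O O Γ ws′)
          d″ = subst₂ (λ OU OL → CF (R OU OL ((k , A) ∷ (k , B) ∷ Γ) ws′)) (sym (Listₚ.map-∘ S)) (sym (Listₚ.map-∘ S)) d′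
          e⅋ : real O O (k , A ⅋ B) ≡ real O O (k , A) ⅋ real O O (k , B)
          e⅋ = cong₂ _⅋_ (real-left {k} {A} {B}) (real-right {k} {A} {B})
          d‴ : CF (R O O ((k , A ⅋ B) ∷ Γ) ws′)
          d‴ = subst (λ E → CF (E ∷ R O O Γ ws′)) (sym e⅋) (par′ d″ (subst IsFormula e⅋ (real-formula O O o)))
      in ws′ , w′ , good-⊆ {Z} {ws} {ws′} (mids xs) (trans (mids-↭ p) (↭-reflexive (mids-++ xs))) g ,
         subst CF (close {O} {(k , A ⅋ B) ∷ Γ} {ws′} (ups-avoid {k} {A} {B} o) (lows-avoid {k} {A} {B} o) (D-ends (par refl δ) (forms o)) w′) d‴
      where
      h : ∀ {z} → z ∈ map (joint k k) (shared A B) → upper-port z ∈ ups ((k , A) ∷ (k , B) ∷ Γ) × lower-port z ∈ lows ((k , A) ∷ (k , B) ∷ Γ)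
      h z∈ with s , s∈ , refl ← ∈-map⁻ (joint k k) z∈ = let lin = proj₂ (All.head (forms o)) in
        ∈-resp-↭ (↭-sym (tag-split k (fu A) (fu B) (shared A B) (fu (A ⅋ B)) (fu-split {A} {B} lin) (ups Γ))) (∈-++⁺ˡ (∈-map⁺ (k ,_) s∈)) ,
        ∈-resp-↭ (↭-sym (tag-split k (fl A) (fl B) (shared A B) (fl (A ⅋ B)) (fl-split {A} {B} lin) (lows Γ))) (∈-++⁺ˡ (∈-map⁺ (k ,_) s∈))

    -- Fresh names determine their ports, and opened ports all have the tag `k`, so their names
    -- determine them too. A clash of names would therefore be a common port or a common middle
    -- index.
    names-disjoint : ∀ {k S us us′ ms ms′ ls ls′ x} →
      (∀ {p} → p ∈ us → p ∈ P₀ × p ∉ tag k S) → (∀ {p} → p ∈ us′ → p ∈ P₀ × p ∉ tag k S) →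
      (∀ {q} → q ∈ ls → q ∈ P₀) → (∀ {q} → q ∈ ls′ → q ∈ P₀) →
      (∀ {m} → m ∈ ms → m ∉ Zθ) → (∀ {m} → m ∈ ms′ → m ∉ Zθ) →
      (∀ {p} → p ∈ us → p ∉ us′) → (∀ {m} → m ∈ ms → m ∉ ms′) → (∀ {q} → q ∈ ls → q ∉ ls′) →
      Name (tag k S) (tag k S) us ms ls x → ¬ Name (tag k S) (tag k S) us′ ms′ ls′ x
    names-disjoint {k} {S} iu iu′ il il′ mf mf′ du dm dl = go
      where
      O = tag k S
      UL : ∀ {p q x} → p ∈ P₀ × p ∉ O → q ∈ P₀ → x ≡ nm O θU p → x ≢ nm O θL q
      UL {p} {q} (p∈ , p∉) q∈ e e′ with nm-cases O θL q
      ... | inj₁ (_ , f) = θU-fresh p∈ (subst (_∈ Z₀) (sym (≡-trans (sym (≡-trans e (nm-∉ p∉))) (≡-trans e′ f))) (names q∈))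
      ... | inj₂ (_ , f) = θ-disj p∈ q∈ (≡-trans (sym (≡-trans e (nm-∉ p∉))) (≡-trans e′ f))
      same-tag : ∀ {p q} → p ∈ O → q ∈ O → proj₂ p ≡ proj₂ q → p ≡ q
      same-tag i j e with _ , _ , refl ← ∈-map⁻ (k ,_) i | _ , _ , refl ← ∈-map⁻ (k ,_) j = cong (k ,_) e
      LL : ∀ {p q x} → p ∈ P₀ → q ∈ P₀ → x ≡ nm O θL p → x ≡ nm O θL q → p ≡ q
      LL {p} {q} p∈ q∈ e e′ with nm-cases O θL p | nm-cases O θL q
      ... | inj₁ (i , f) | inj₁ (j , f′) = same-tag i j (≡-trans (sym (≡-trans e f)) (≡-trans e′ f′))
      ... | inj₁ (_ , f) | inj₂ (_ , f′) = ⊥-elim (θL-fresh q∈ (subst (_∈ Z₀) (≡-trans (sym (≡-trans e f)) (≡-trans e′ f′)) (names p∈)))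
      ... | inj₂ (_ , f) | inj₁ (_ , f′) = ⊥-elim (θL-fresh p∈ (subst (_∈ Z₀) (≡-trans (sym (≡-trans e′ f′)) (≡-trans e f)) (names q∈)))
      ... | inj₂ (_ , f) | inj₂ (_ , f′) = θL-inj p∈ q∈ (≡-trans (sym (≡-trans e f)) (≡-trans e′ f′))
      UU : ∀ {p q x} → p ∈ P₀ × p ∉ O → q ∈ P₀ × q ∉ O → x ≡ nm O θU p → x ≡ nm O θU q → p ≡ q
      UU (p∈ , p∉) (q∈ , q∉) e e′ = θU-inj p∈ q∈ (≡-trans (sym (≡-trans e (nm-∉ p∉))) (≡-trans e′ (nm-∉ q∉)))
      go : ∀ {x} → Name O O _ _ _ x → ¬ Name O O _ _ _ x
      go (nameU i e) (nameU j e′) with refl ← UU (iu i) (iu′ j) e e′ = du i j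
      go (nameU i e) (nameM j) = mf′ j (subst (_∈ Zθ) (sym e) (nmU∈ O (proj₁ (iu i))))
      go (nameU i e) (nameL j e′) = UL (iu i) (il′ j) e e′
      go (nameM i) (nameU j e′) = mf i (subst (_∈ Zθ) (sym e′) (nmU∈ O (proj₁ (iu′ j))))
      go (nameM i) (nameM j) = dm i j
      go (nameM i) (nameL j e′) = mf i (subst (_∈ Zθ) (sym e′) (nmL∈ O (il′ j)))
      go (nameL i e) (nameU j e′) = UL (iu′ j) (il i) e′ e
      go (nameL i e) (nameM j) = mf′ j (subst (_∈ Zθ) (sym e) (nmL∈ O (il i)))
      go (nameL i e) (nameL j e′) with refl ← LL (il i) (il′ j) e e′ = dl i j

    -- In one premise a shared index is free in one polarity only, so opening the whole list has the
    -- effect of opening the occurrences actually present.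
    shared-opened : ∀ {k S S₁ S₂ Γ ws} → (∀ {s} → s ∈ S₁ → s ∈ S) → (∀ {s} → s ∈ S₂ → s ∈ S) →
                    (∀ {s} → s ∈ S → s ∈ S₁ ⊎ (k , s) ∉ ups Γ) → (∀ {s} → s ∈ S → s ∈ S₂ ⊎ (k , s) ∉ lows Γ) →
                    uppers (map erase ws) ↭ ups Γ → lowers (map erase ws) ↭ lows Γ →
                    R (tag k S₁) (tag k S₂) Γ ws ≡ R (tag k S) (tag k S) Γ ws
    shared-opened {k} {S} {S₁} {S₂} {Γ} {ws} h₁ h₂ n₁ n₂ u l = cong₂ _++_ (reals-cong Γ (ag h₁ n₁) (ag h₂ n₂))
      (cords-cong ws (λ i → ag h₁ n₁ (∈-resp-↭ u i)) (λ i → ag h₂ n₂ (∈-resp-↭ l i)))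
      where
      ag : ∀ {S₁ ps θ} → (∀ {s} → s ∈ S₁ → s ∈ S) → (∀ {s} → s ∈ S → s ∈ S₁ ⊎ (k , s) ∉ ps) →
           ∀ {p} → p ∈ ps → nm (tag k S₁) θ p ≡ nm (tag k S) θ p
      ag {S₁} {ps} h n {p} p∈ = nm-cong
        (λ i → let s , s∈ , e = ∈-map⁻ (k ,_) i in subst (_∈ tag k S) (sym e) (∈-map⁺ (k ,_) (h s∈)))
        (λ i → let s , s∈ , e = ∈-map⁻ (k ,_) i in
          [ (λ j → subst (_∈ tag k S₁) (sym e) (∈-map⁺ (k ,_) j)) , (λ j → ⊥-elim (j (subst (_∈ ps) e p∈))) ]′ (n s∈))

    -- Opening the shared indices in both premises makes them bound in the compound, while the
    -- ⊥-formulas that they met in the two premises now match each other. The contractions of the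
    -- wired rule are then carried out on these strands.
    T-tensor : ∀ {Γ₁ Γ₂ W W₁ W₂ k A B} → D ((k , A) ∷ Γ₁) W₁ → D ((k , B) ∷ Γ₂) W₂ → W₁ ++ W₂ ⟿⟨ tag k (shared A B) ⟩ W →
               T ((k , A) ∷ Γ₁) W₁ → T ((k , B) ∷ Γ₂) W₂ → T ((k , A ⊗ B) ∷ Γ₁ ++ Γ₂) W
    T-tensor {Γ₁} {Γ₂} {W} {W₁} {W₂} {k} {A} {B} δ₁ δ₂ s t₁ t₂ o Z =
      ws , w , g , subst CF (close {O} {(k , A ⊗ B) ∷ Γ₁ ++ Γ₂} {ws} (ups-avoid {k} {A} {B} oG) (lows-avoid {k} {A} {B} oG)
        (D-ends (tensor {A = A} {B} refl δ₁ δ₂ s) (forms o)) w) d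
      where
      lin = proj₂ (All.head (forms o))
      o₁ = proj₁ (ok-⊗ {k} {A} {B} Γ₁ Γ₂ o)
      o₂ = proj₂ (ok-⊗ {k} {A} {B} Γ₁ Γ₂ o)
      oG : OK ((k , A ⅋ B) ∷ Γ₁ ++ Γ₂)
      oG = record { forms = All.head (forms o) ∷ All.tail (forms o) ; apart = apart o ; inU = inU o ; inL = inL o }
      S₁ = common (upper A) (lower B)
      S₂ = common (upper B) (lower A)
      O = tag k (shared A B)
      uA = proj₁ lin
      lA = proj₂ lin
      r₁ = t₁ o₁ Z
      ws₁ = proj₁ r₁
      w₁ = proj₁ (proj₂ r₁)
      g₁ = proj₁ (proj₂ (proj₂ r₁))
      -- The middle indices of the second premise are chosen outside those of the first.
      r₂ = t₂ o₂ (Z ++ mids ws₁)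
      ws₂ = proj₁ r₂
      w₂ = proj₁ (proj₂ r₂)
      g₂ = proj₁ (proj₂ (proj₂ r₂))
      m₁ = good-mids {Z} {ws₁} g₁
      m₂ = good-mids {Z ++ mids ws₁} {ws₂} g₂
      E₁ = ends-↭ (↭-sym w₁) (D-Ends δ₁ o₁)
      E₂ = ends-↭ (↭-sym w₂) (D-Ends δ₂ o₂)
      u₁ = trans (uppers-↭ w₁) (proj₁ (D-ends δ₁ (forms o₁)))
      l₁ = trans (lowers-↭ w₁) (proj₂ (D-ends δ₁ (forms o₁)))
      u₂ = trans (uppers-↭ w₂) (proj₁ (D-ends δ₂ (forms o₂)))
      l₂ = trans (lowers-↭ w₂) (proj₂ (D-ends δ₂ (forms o₂)))
      headU : ∀ {A Γ x} → x ∈ upper A → x ∉ lower A → (k , x) ∈ ups ((k , A) ∷ Γ)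
      headU p q = ∈-++⁺ˡ (∈-map⁺ (k ,_) (∈-frees⁺ p q))
      headL : ∀ {A Γ x} → x ∈ lower A → x ∉ upper A → (k , x) ∈ lows ((k , A) ∷ Γ)
      headL p q = ∈-++⁺ˡ (∈-map⁺ (k ,_) (∈-frees⁺ p q))
      both : ∀ {f ps qs} → ps ↭ qs → (∀ {s} → s ∈ f → (k , s) ∈ qs) → ∀ {s} → s ∈ f → (k , s) ∈ qs × (k , s) ∈ ps
      both p h i = h i , ∈-resp-↭ (↭-sym p) (h i)
      S₁∩S₂ : ∀ {x} → x ∈ S₁ → x ∉ S₂
      S₁∩S₂ i j = Unique-disjoint uA (proj₁ (∈-common⁻ i)) (proj₁ (∈-common⁻ j))
      uniqueS₁ = common-Unique {ls = lower B} (proj₁ (linearˡ {A} {B} lin))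
      uniqueS₂ = common-Unique {ls = lower A} (proj₁ (linearʳ {A} {B} lin))
      d₁ : CF (R (tag k S₁) (tag k S₂) ((k , A) ∷ Γ₁) ws₁)
      d₁ = openL* k S₂ o₁ E₁ m₁
        (both l₁ λ i → let p , q = ∈-common⁻ i in headL {A} {Γ₁} q λ q′ → Unique-disjoint uA q′ p) uniqueS₂
        (λ i j → S₁∩S₂ (subst (_ ∈_) (names-tag k S₁) j) i)
        (openU* k S₁ o₁ E₁ m₁ (both u₁ λ i → let p , q = ∈-common⁻ i in headU {A} {Γ₁} p λ q′ → Unique-disjoint lA q′ q) uniqueS₁
          (proj₂ (proj₂ (proj₂ r₁))))
      d₂ : CF (R (tag k S₂) (tag k S₁) ((k , B) ∷ Γ₂) ws₂)
      d₂ = openL* k S₁ o₂ E₂ m₂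
        (both l₂ λ i → let p , q = ∈-common⁻ i in headL {B} {Γ₂} q λ q′ → Unique-disjoint uA p q′) uniqueS₁
        (λ i j → S₁∩S₂ i (subst (_ ∈_) (names-tag k S₂) j))
        (openU* k S₂ o₂ E₂ m₂ (both u₂ λ i → let p , q = ∈-common⁻ i in headU {B} {Γ₂} p λ q′ → Unique-disjoint lA q q′) uniqueS₂
          (proj₂ (proj₂ (proj₂ r₂))))
      a₁₂ : Apart (((k , A) ∷ Γ₁) ++ ((k , B) ∷ Γ₂))
      a₁₂ = apart-↭ {(k , A) ∷ (k , B) ∷ Γ₁ ++ Γ₂} (prep _ (↭-sym (shift (k , B) Γ₁ Γ₂))) (apart-⅋ k A B (Γ₁ ++ Γ₂) (apart o))
      disjU : ∀ {p} → p ∈ collect upper ((k , A) ∷ Γ₁) → p ∉ collect upper ((k , B) ∷ Γ₂)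
      disjU = Unique-disjoint (subst Unique (collect-++ upper ((k , A) ∷ Γ₁)) (proj₁ a₁₂))
      disjL : ∀ {p} → p ∈ collect lower ((k , A) ∷ Γ₁) → p ∉ collect lower ((k , B) ∷ Γ₂)
      disjL = Unique-disjoint (subst Unique (collect-++ lower ((k , A) ∷ Γ₁)) (proj₂ a₁₂))
      ups⊆ : ∀ Γ {p} → p ∈ ups Γ → p ∈ collect upper Γ
      ups⊆ Γ = collect-mono {fu} (λ A → proj₁ ∘ ∈-frees⁻) Γ
      lows⊆ : ∀ Γ {p} → p ∈ lows Γ → p ∈ collect lower Γ
      lows⊆ Γ = collect-mono {fl} (λ A → proj₁ ∘ ∈-frees⁻) Γ
      inA : ∀ {f : Expr → List Ind} {C Γ x} → x ∈ f C → (k , x) ∈ collect f ((k , C) ∷ Γ)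
      inA i = ∈-++⁺ˡ (∈-map⁺ (k ,_) i)
      e₁ : R (tag k S₁) (tag k S₂) ((k , A) ∷ Γ₁) ws₁ ≡ R O O ((k , A) ∷ Γ₁) ws₁
      e₁ = shared-opened {k} {shared A B} {S₁} {S₂} {(k , A) ∷ Γ₁} {ws₁} ∈-++⁺ˡ (∈-++⁺ʳ S₁)
        (λ i → [ inj₁ , (λ j → inj₂ λ i′ → disjU (ups⊆ ((k , A) ∷ Γ₁) i′) (inA {upper} {B} {Γ₂} (proj₁ (∈-common⁻ j)))) ]′ (∈-++⁻ S₁ i))
        (λ i → [ (λ j → inj₂ λ i′ → disjL (lows⊆ ((k , A) ∷ Γ₁) i′) (inA {lower} {B} {Γ₂} (proj₂ (∈-common⁻ j)))) , inj₁ ]′ (∈-++⁻ S₁ i))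
        u₁ l₁
      e₂ : R (tag k S₂) (tag k S₁) ((k , B) ∷ Γ₂) ws₂ ≡ R O O ((k , B) ∷ Γ₂) ws₂
      e₂ = shared-opened {k} {shared A B} {S₂} {S₁} {(k , B) ∷ Γ₂} {ws₂} (∈-++⁺ʳ S₁) ∈-++⁺ˡ
        (λ i → [ (λ j → inj₂ λ i′ → disjU (inA {upper} {A} {Γ₁} (proj₁ (∈-common⁻ j))) (ups⊆ ((k , B) ∷ Γ₂) i′)) , inj₁ ]′ (∈-++⁻ S₁ i))
        (λ i → [ inj₁ , (λ j → inj₂ λ i′ → disjL (inA {lower} {A} {Γ₁} (proj₂ (∈-common⁻ j))) (lows⊆ ((k , B) ∷ Γ₂) i′)) ]′ (∈-++⁻ S₁ i))
        u₂ l₂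
      d₁′ = subst CF e₁ d₁
      d₂′ = subst CF e₂ d₂
      e⊗ : real O O (k , A ⊗ B) ≡ real O O (k , A) ⊗ real O O (k , B)
      e⊗ = cong₂ _⊗_ (real-left {k} {A} {B}) (real-right {k} {A} {B})
      X₁ = R O O Γ₁ ws₁
      X₂ = R O O Γ₂ ws₂
      name₀ : ∀ {x} → x ∈ fu (real O O (k , A ⊗ B)) → Name O O (tag k (fu (A ⊗ B))) [] [] x
      name₀ i = let y , y∈ , e = fu-real O O k (A ⊗ B) i in nameU (∈-map⁺ (k ,_) y∈) e
      avoid : ∀ {p} → p ∈ ups ((k , A ⊗ B) ∷ Γ₁ ++ Γ₂) → p ∈ P₀ × p ∉ O
      avoid i = ups-in o i , ups-avoid {k} {A} {B} oG i
      av₀ : ∀ {p} → p ∈ tag k (fu (A ⊗ B)) → p ∈ P₀ × p ∉ O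
      av₀ = avoid ∘ ∈-++⁺ˡ
      av₁ : ∀ {p} → p ∈ ups Γ₁ → p ∈ P₀ × p ∉ O
      av₁ i = avoid (∈-++⁺ʳ (tag k (fu (A ⊗ B))) (subst (_ ∈_) (sym (collect-++ fu Γ₁)) (∈-++⁺ˡ i)))
      av₂ : ∀ {p} → p ∈ ups Γ₂ → p ∈ P₀ × p ∉ O
      av₂ i = avoid (∈-++⁺ʳ (tag k (fu (A ⊗ B))) (subst (_ ∈_) (sym (collect-++ fu Γ₁)) (∈-++⁺ʳ (ups Γ₁) i)))
      apartG = ups-Unique ((k , A ⊗ B) ∷ Γ₁ ++ Γ₂) (apart o)
      apartΓ : Unique (ups Γ₁ ++ ups Γ₂)
      apartΓ = subst Unique (collect-++ fu Γ₁) (Unique-++⁻ʳ (tag k (fu (A ⊗ B))) apartG)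
      mm : ∀ {m} → m ∈ mids ws₁ → m ∉ mids ws₂
      mm i j = proj₂ (proj₂ g₂ j) (∈-++⁺ʳ Z i)
      unique : Unique (fu (real O O (k , A) ⊗ real O O (k , B)) ++ FU X₁ ++ FU X₂)
      unique = subst (λ E → Unique (fu E ++ FU X₁ ++ FU X₂)) e⊗
        (++-Unique (frees-Unique (proj₁ (proj₂ (real-formula O O o))))
          (++-Unique (Unique-++⁻ʳ (fu (real O O (k , A))) (proj₁ (proj₂ (CF-balanced d₁′)))) (Unique-++⁻ʳ (fu (real O O (k , B))) (proj₁ (proj₂ (CF-balanced d₂′))))
            (λ i j → names-disjoint av₁ av₂ (endL E₁) (endL E₂) m₁ m₂ (Unique-disjoint apartΓ) mm
              (λ i j → disjL (lows⊆ ((k , A) ∷ Γ₁) (∈-resp-↭ l₁ i)) (lows⊆ ((k , B) ∷ Γ₂) (∈-resp-↭ l₂ j)))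
              (FU-R O O Γ₁ ws₁ i) (FU-R O O Γ₂ ws₂ j)))
          (λ i j → [ (λ j → names-disjoint av₀ av₁ (λ ()) (endL E₁) (λ ()) m₁
                       (λ i j → Unique-disjoint apartG i (subst (_ ∈_) (sym (collect-++ fu Γ₁)) (∈-++⁺ˡ j))) (λ ()) (λ ()) (name₀ i) (FU-R O O Γ₁ ws₁ j))
                   , (λ j → names-disjoint av₀ av₂ (λ ()) (endL E₂) (λ ()) m₂
                       (λ i j → Unique-disjoint apartG i (subst (_ ∈_) (sym (collect-++ fu Γ₁)) (∈-++⁺ʳ (ups Γ₁) j))) (λ ()) (λ ()) (name₀ i) (FU-R O O Γ₂ ws₂ j))
                   ]′ (∈-++⁻ (FU X₁) j)))
      d₀ : CF (real O O (k , A ⊗ B) ∷ X₁ ++ X₂)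
      d₀ = subst (λ E → CF (E ∷ X₁ ++ X₂)) (sym e⊗) (tensor′ d₁′ d₂′ (subst IsFormula e⊗ (real-formula O O o)) unique)
      Θ = map (real O O) ((k , A ⊗ B) ∷ Γ₁ ++ Γ₂)
      d₀′ : CF (Θ ++ cords O O (ws₁ ++ ws₂))
      d₀′ = exchange (prep _ (trans (solve 4 (λ a b c d → (a ⊕ b) ⊕ c ⊕ d ⊜ (a ⊕ c) ⊕ b ⊕ d) refl
                (map (real O O) Γ₁) (cords O O ws₁) (map (real O O) Γ₂) (cords O O ws₂))
              (↭-reflexive (sym (cong₂ _++_ (map-++ (real O O) Γ₁ Γ₂) (cords-++ O O ws₁)))))) d₀
      w₀ : map erase (ws₁ ++ ws₂) ↭ W₁ ++ W₂
      w₀ = trans (↭-reflexive (map-++ erase ws₁ ws₂)) (++⁺ w₁ w₂)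
      e₀ : Ends (W₁ ++ W₂)
      e₀ = record
        { funU = subst Unique (sym (uppers-++ W₁)) (++-Unique (funU (D-Ends δ₁ o₁)) (funU (D-Ends δ₂ o₂))
            (λ i j → disjU (ups⊆ ((k , A) ∷ Γ₁) (∈-resp-↭ (proj₁ (D-ends δ₁ (forms o₁))) i)) (ups⊆ ((k , B) ∷ Γ₂) (∈-resp-↭ (proj₁ (D-ends δ₂ (forms o₂))) j))))
        ; funL = subst Unique (sym (lowers-++ W₁)) (++-Unique (funL (D-Ends δ₁ o₁)) (funL (D-Ends δ₂ o₂))
            (λ i j → disjL (lows⊆ ((k , A) ∷ Γ₁) (∈-resp-↭ (proj₂ (D-ends δ₁ (forms o₁))) i)) (lows⊆ ((k , B) ∷ Γ₂) (∈-resp-↭ (proj₂ (D-ends δ₂ (forms o₂))) j))))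
        ; endU = λ i → [ endU (D-Ends δ₁ o₁) , endU (D-Ends δ₂ o₂) ]′ (∈-++⁻ (uppers W₁) (subst (_ ∈_) (uppers-++ W₁) i))
        ; endL = λ i → [ endL (D-Ends δ₁ o₁) , endL (D-Ends δ₂ o₂) ]′ (∈-++⁻ (lowers W₁) (subst (_ ∈_) (lowers-++ W₁) i)) }
      g₀ : Good Z (ws₁ ++ ws₂)
      g₀ = subst Unique (sym (mids-++ ws₁)) (++-Unique (proj₁ g₁) (proj₁ g₂) mm) ,
        λ i → [ proj₂ g₁ , (λ j → proj₁ (proj₂ g₂ j) , proj₂ (proj₂ g₂ j) ∘ ∈-++⁺ˡ) ]′ (∈-++⁻ (mids ws₁) (subst (_ ∈_) (mids-++ ws₁) i))
      r = contract-CF Z O {Θ} (λ i → i) s w₀ e₀ g₀ d₀′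
      ws = proj₁ r
      w = proj₁ (proj₂ r)
      g = proj₁ (proj₂ (proj₂ r))
      d = proj₂ (proj₂ (proj₂ r))

    T-exchange : ∀ {Γ Γ′ W} → Γ ↭ Γ′ → T Γ′ W → T Γ W
    T-exchange p t o Z = let ws , w , g , d = t (ok-↭ p o) Z in ws , w , g , exchange (R-↭ [] [] {_} {_} {ws} (↭-sym p) refl) d

    T-wires : ∀ {Γ W W′} → W ↭ W′ → T Γ W → T Γ W′
    T-wires p t o Z = let ws , w , g , d = t o Z in ws , trans w p , g , d

    nm-[] : ∀ {θ p} → nm [] θ p ≡ θ p
    nm-[] = nm-∉ λ ()

    θU-∉ : ∀ {Γ ws p} → OK Γ → Ends (map erase ws) → Mids ws → p ∈ P₀ → p ∉ ups Γ → θU p ∉ FU (R [] [] Γ ws)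
    θU-∉ {Γ} {ws} o e mf p∈ p∉ i with FU-R [] [] Γ ws i
    ... | nameU {q} j eq = p∉ (subst (_∈ ups Γ) (θU-inj (ups-in o j) p∈ (sym (≡-trans eq nm-[]))) j)
    ... | nameM j = mf j (θU∈ p∈)
    ... | nameL j eq = θ-disj p∈ (endL e j) (≡-trans eq nm-[])

    θL-∉ : ∀ {Γ ws q} → OK Γ → Ends (map erase ws) → Mids ws → q ∈ P₀ → q ∉ lowers (map erase ws) → θL q ∉ FU (R [] [] Γ ws)
    θL-∉ {Γ} {ws} o e mf q∈ q∉ i with FU-R [] [] Γ ws i
    ... | nameU j eq = θ-disj (ups-in o j) q∈ (sym (≡-trans eq nm-[]))
    ... | nameM j = mf j (θL∈ q∈)
    ... | nameL j eq = q∉ (subst (_∈ _) (θL-inj (endL e j) q∈ (sym (≡-trans eq nm-[]))) j)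

    real-bot : ∀ {k j i} → i ≢ j → real [] [] (k , ⊥⟨ j / i ⟩) ≡ ⊥⟨ θU (k , j) / θL (k , i) ⟩
    real-bot {k} {j} {i} i≢j = cong₂ (λ a b → ⊥⟨ a / b ⟩) (≡-trans (fix-∉ λ { (here refl) → i≢j refl }) nm-[])
      (≡-trans (fix-∉ λ { (here refl) → i≢j refl }) nm-[])

    module _ {k : ℕ} {j i : Ind} {Γ : List Item} {U : Wires} (δ : D Γ U) (o : OK ((k , ⊥⟨ j / i ⟩) ∷ Γ)) (Z : List Ind)
             {ws : List Strand} (w : map erase ws ↭ U) (g : Good Z ws) where
      private
        o′ = ok-++ʳ [ k , ⊥⟨ j / i ⟩ ] o
        e = ends-↭ (↭-sym w) (D-Ends δ o′)
        mf = good-mids {Z} {ws} g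
        a = θU (k , j)
        b = θL (k , i)
        j∈ = item-U o {j} (here refl)
        i∈ = item-L o {i} (here refl)
        a∉ : a ∉ FU (R [] [] Γ ws)
        a∉ = θU-∉ {Γ} {ws} o′ e mf j∈ (ups-∉ o (here refl))
        b∉ : b ∉ FU (R [] [] Γ ws)
        b∉ = θL-∉ {Γ} {ws} o′ e mf i∈ λ q∈ → lows-∉ o (here refl) (∈-resp-↭ (trans (lowers-↭ w) (proj₂ (D-ends δ (forms o′)))) q∈)
        i≢j : i ≢ j
        i≢j refl = head-∉ (proj₁ (All.head (forms o))) (here refl)
        a≢b : a ≢ b
        a≢b = θ-disj j∈ i∈
        z≢ : ∀ {m y} → m ∈ mids ws → y ∈ Zθ → y ≢ m
        z≢ m∈ y∈ eq = mf m∈ (subst (_∈ Zθ) eq y∈)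

      -- Splitting the half `⊥⟨ c / m ⟩` of the strand at `b` and then at `a` produces the new
      -- formula `⊥⟨ a / b ⟩` in the middle of the chain. A third splitting, at a fresh `n`,
      -- completes the second strand.
      T-bot : ∀ {x y W} → U ≡ edge x y ∷ W → CF (R [] [] Γ ws) →
              ∃ λ ws′ → map erase ws′ ↭ edge x (k , i) ∷ edge (k , j) y ∷ W × Good Z ws′ × CF (R [] [] ((k , ⊥⟨ j / i ⟩) ∷ Γ) ws′)
      T-bot {x} {y} refl d =
        let m , ws′ , r , w′ = unerase-edge {ws} w
            c = nm [] θL y
            Θ = ⊥⟨ m / nm [] θU x ⟩ ∷ R [] [] Γ ws′
            π : R [] [] Γ ws ↭ ⊥⟨ c / m ⟩ ∷ Θ
            π = trans (R-↭ [] [] {Γ} refl r) (shifts (map (real [] []) Γ) (⊥⟨ m / nm [] θU x ⟩ ∷ ⊥⟨ c / m ⟩ ∷ []) ⟨↭⟩ swap _ _ refl)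
            d₀ = exchange π d
            ∉Θ : ∀ {x} → x ∉ FU (R [] [] Γ ws) → x ≢ c × x ∉ FU Θ
            ∉Θ x∉ = (λ { refl → x∉ (∈-resp-↭ (FU-↭ (↭-sym π)) (∈-++⁺ˡ (∈-fu-bot (bot≢ d₀)))) }) ,
                    (λ q → x∉ (∈-resp-↭ (FU-↭ (↭-sym π)) (∈-++⁺ʳ (fu ⊥⟨ c / m ⟩) q)))
            m∈ = mids-∈ r
            d₁ = split-step b d₀ (z≢ m∈ (θL∈ i∈)) (proj₁ (∉Θ b∉)) (proj₂ (∉Θ b∉))
            d₂ = split-step a d₁ a≢b (proj₁ (∉Θ a∉)) (∉-FU-bot {m} Θ a≢b (proj₂ (∉Θ a∉)))
            n , n∉ = fresh (Zθ ++ Z ++ mids ws ++ FU (⊥⟨ a / b ⟩ ∷ ⊥⟨ b / m ⟩ ∷ Θ))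
            n∉θ = n∉ ∘ ∈-++⁺ˡ
            n∉m = n∉ ∘ ∈-++⁺ʳ Zθ ∘ ∈-++⁺ʳ Z ∘ ∈-++⁺ˡ
            y∈ = endL e (∈-resp-↭ (↭-sym (lowers-↭ w)) (here refl))
            d₃ = split-step n d₂ (λ eq → n∉θ (subst (_∈ Zθ) (sym eq) (θU∈ j∈))) (λ eq → n∉θ (subst (_∈ Zθ) (sym eq) (nmL∈ [] y∈)))
                   (n∉ ∘ ∈-++⁺ʳ Zθ ∘ ∈-++⁺ʳ Z ∘ ∈-++⁺ʳ (mids ws))
            e₁ : ⊥⟨ a / b ⟩ ∷ map (real [] []) Γ ++ ⊥⟨ m / nm [] θU x ⟩ ∷ ⊥⟨ b / m ⟩ ∷ ⊥⟨ n / a ⟩ ∷ ⊥⟨ c / n ⟩ ∷ cords [] [] ws′ ≡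
                 R [] [] ((k , ⊥⟨ j / i ⟩) ∷ Γ) (strand x m (k , i) ∷ strand (k , j) n y ∷ ws′)
            e₁ = cong₂ _∷_ (sym (real-bot {k} i≢j)) (cong (map (real [] []) Γ ++_) (cong (⊥⟨ m / nm [] θU x ⟩ ∷_)
                   (cong₂ (λ b a → ⊥⟨ b / m ⟩ ∷ ⊥⟨ n / a ⟩ ∷ ⊥⟨ c / n ⟩ ∷ cords [] [] ws′) (sym nm-[]) (sym nm-[]))))
            π′ = solve 7 (λ cn na ab bm mu g c → cn ⊕ na ⊕ ab ⊕ bm ⊕ mu ⊕ g ⊕ c ⊜ ab ⊕ g ⊕ mu ⊕ bm ⊕ na ⊕ cn ⊕ c) refl
                   [ ⊥⟨ c / n ⟩ ] [ ⊥⟨ n / a ⟩ ] [ ⊥⟨ a / b ⟩ ] [ ⊥⟨ b / m ⟩ ] [ ⊥⟨ m / nm [] θU x ⟩ ] (map (real [] []) Γ) (cords [] [] ws′)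
            g′ = good-∷ {Z} {n} {ws} n∉θ (n∉ ∘ ∈-++⁺ʳ Zθ ∘ ∈-++⁺ˡ) n∉m g
            ρ : n ∷ mids ws ↭ m ∷ n ∷ mids ws′
            ρ = trans (prep n (mids-↭ r)) (swap n m refl)
        in strand x m (k , i) ∷ strand (k , j) n y ∷ ws′ , prep _ (prep _ w′) ,
           (Unique-resp-↭ ρ (proj₁ g′) , λ q → proj₂ g′ (∈-resp-↭ (↭-sym ρ) q)) , subst CF e₁ (exchange π′ d₃)
        where
        _⟨↭⟩_ : ∀ {xs ys zs : List Expr} → xs ↭ ys → ys ↭ zs → xs ↭ zs
        _⟨↭⟩_ = trans

      -- Both ⊥-formulas of the ring are split, one at `a` and one at `b`, and the pieces meeting in
      -- `n` are glued to the new formula `⊥⟨ a / b ⟩`. The rest of the ring, through `m`, is the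
      -- strand from this formula to itself.
      T-loop : ∀ {W} → U ≡ loop ∷ W → CF (R [] [] Γ ws) →
               ∃ λ ws′ → map erase ws′ ↭ edge (k , j) (k , i) ∷ W × Good Z ws′ × CF (R [] [] ((k , ⊥⟨ j / i ⟩) ∷ Γ) ws′)
      T-loop refl d =
        let m , n , ws′ , r , w′ = unerase-loop {ws} w
            Θ = R [] [] Γ ws′
            π : R [] [] Γ ws ↭ ⊥⟨ m / n ⟩ ∷ ⊥⟨ n / m ⟩ ∷ Θ
            π = trans (R-↭ [] [] {Γ} refl r) (shifts (map (real [] []) Γ) (⊥⟨ m / n ⟩ ∷ ⊥⟨ n / m ⟩ ∷ []))
            ∉Θ : ∀ {x} → x ∉ FU (R [] [] Γ ws) → x ∉ FU Θ
            ∉Θ x∉ q = x∉ (∈-resp-↭ (FU-↭ (↭-sym π)) (∈-++⁺ʳ (fu ⊥⟨ m / n ⟩) (∈-++⁺ʳ (fu ⊥⟨ n / m ⟩) q)))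
            ≢m : ∀ {y} → y ∈ Zθ → y ≢ m
            ≢m = z≢ (∈-resp-↭ (mids-↭ (↭-sym r)) (here refl))
            ≢n : ∀ {y} → y ∈ Zθ → y ≢ n
            ≢n = z≢ (∈-resp-↭ (mids-↭ (↭-sym r)) (there (here refl)))
            a∈ = θU∈ j∈
            b∈ = θL∈ i∈
            d₁ = split-step a (exchange π d) (≢n a∈) (≢m a∈) (∉-FU-bot {m} Θ (≢n a∈) (∉Θ a∉))
            d₂ = split-step b (exchange (solve 4 (λ x y z t → x ⊕ y ⊕ z ⊕ t ⊜ z ⊕ x ⊕ y ⊕ t) refl [ ⊥⟨ m / a ⟩ ] [ ⊥⟨ a / n ⟩ ] [ ⊥⟨ n / m ⟩ ] Θ) d₁)
                   (≢m b∈) (≢n b∈) (∉-FU-bot {a} (⊥⟨ a / n ⟩ ∷ Θ) (≢m b∈) (∉-FU-bot {n} Θ (a≢b ∘ sym) (∉Θ b∉)))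
            d₃ = glue-step (exchange (solve 5 (λ x y z u t → x ⊕ y ⊕ z ⊕ u ⊕ t ⊜ x ⊕ u ⊕ y ⊕ z ⊕ t) refl
                   [ ⊥⟨ n / b ⟩ ] [ ⊥⟨ b / m ⟩ ] [ ⊥⟨ m / a ⟩ ] [ ⊥⟨ a / n ⟩ ] Θ) d₂) (a≢b ∘ sym) (≢n b∈)
            e₁ : ⊥⟨ a / b ⟩ ∷ map (real [] []) Γ ++ ⊥⟨ m / a ⟩ ∷ ⊥⟨ b / m ⟩ ∷ cords [] [] ws′ ≡
                 R [] [] ((k , ⊥⟨ j / i ⟩) ∷ Γ) (strand (k , j) m (k , i) ∷ ws′)
            e₁ = cong₂ _∷_ (sym (real-bot {k} i≢j)) (cong (map (real [] []) Γ ++_)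
                   (cong₂ (λ b a → ⊥⟨ m / a ⟩ ∷ ⊥⟨ b / m ⟩ ∷ cords [] [] ws′) (sym nm-[]) (sym nm-[])))
            π′ = solve 5 (λ ab bm ma g c → ab ⊕ bm ⊕ ma ⊕ g ⊕ c ⊜ ab ⊕ g ⊕ ma ⊕ bm ⊕ c) refl
                   [ ⊥⟨ a / b ⟩ ] [ ⊥⟨ b / m ⟩ ] [ ⊥⟨ m / a ⟩ ] (map (real [] []) Γ) (cords [] [] ws′)
        in strand (k , j) m (k , i) ∷ ws′ , prep _ w′ , good-⊆ {Z} {ws} {strand (k , j) m (k , i) ∷ ws′} [ n ] (trans (mids-↭ r) (swap m n refl)) g ,
           subst CF e₁ (exchange π′ d₃)

    id-balanced : ∀ {A} → IsFormula A → Balanced (dual A ∷ A ∷ [])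
    id-balanced {A} f@(_ , lin@(u , l)) = formula-dual f ∷ f ∷ [] ,
      Unique-resp-↭ (↭-sym (++⁺ (fu-dual {A} lin) (++-identityʳ (fu A)))) (++-Unique (frees-Unique l) (frees-Unique u) (λ p q → frees-disjoint q p)) ,
      trans (++⁺ (fu-dual {A} lin) (++-identityʳ (fu A))) (trans (++-comm (fl A) (fu A)) (↭-sym (++⁺ (fl-dual {A} lin) (++-identityʳ (fl A)))))

    -- The dual of 𝟏 is a ⊥-formula, so splitting it in the axiom at a fresh `m` already gives the
    -- required strand.
    T-one : ∀ {k u l} → T [ k , atom 𝟏 (u ∷ []) (l ∷ []) ] [ edge (k , u) (k , l) ]
    T-one {k} {u} {l} o Z = [ strand (k , u) m (k , l) ] , refl , ([] ∷ [] , λ { (here refl) → m∉θ , m∉ ∘ ∈-++⁺ʳ Zθ ∘ ∈-++⁺ˡ ; (there ()) }) , d₂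
      where
      a = θU (k , u)
      b = θL (k , l)
      a∈ = item-U o {u} (here refl)
      b∈ = item-L o {l} (here refl)
      a≢b : a ≢ b
      a≢b = θ-disj a∈ b∈
      u≢l : u ≢ l
      u≢l refl = head-∉ (proj₁ (All.head (forms o))) (here refl)
      A = atom 𝟏 (a ∷ []) (b ∷ [])
      d : CF (dual A ∷ A ∷ [])
      d = id 𝟏 (a ∷ []) (b ∷ []) (id-balanced {A} (∷-Unique {xs = [ b ]} (λ { (here e) → a≢b e }) ([] ∷ []) , [] ∷ [] , [] ∷ []))
      F = fresh (Zθ ++ Z ++ FU [ A ])
      m = proj₁ F
      m∉ = proj₂ F
      m∉θ : m ∉ Zθ
      m∉θ = m∉ ∘ ∈-++⁺ˡ
      d₁ : CF (⊥⟨ b / m ⟩ ∷ ⊥⟨ m / a ⟩ ∷ A ∷ [])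
      d₁ = split-step m d (λ e → m∉θ (subst (_∈ Zθ) (sym e) (θU∈ a∈))) (λ e → m∉θ (subst (_∈ Zθ) (sym e) (θL∈ b∈)))
             (m∉ ∘ ∈-++⁺ʳ Zθ ∘ ∈-++⁺ʳ Z)
      eA : A ≡ real [] [] (k , atom 𝟏 (u ∷ []) (l ∷ []))
      eA = cong₂ (λ a b → atom 𝟏 (a ∷ []) (b ∷ [])) (sym (≡-trans (fix-∉ {[ l ]} λ { (here e) → u≢l e ; (there ()) }) nm-[]))
             (sym (≡-trans (fix-∉ {[ u ]} λ { (here e) → u≢l (sym e) ; (there ()) }) nm-[]))
      e₁ : A ∷ ⊥⟨ m / a ⟩ ∷ ⊥⟨ b / m ⟩ ∷ [] ≡ R [] [] [ k , atom 𝟏 (u ∷ []) (l ∷ []) ] [ strand (k , u) m (k , l) ]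
      e₁ = cong₂ _∷_ eA (cong₂ (λ a b → ⊥⟨ m / a ⟩ ∷ ⊥⟨ b / m ⟩ ∷ []) (sym nm-[]) (sym nm-[]))
      d₂ : CF (R [] [] [ k , atom 𝟏 (u ∷ []) (l ∷ []) ] [ strand (k , u) m (k , l) ])
      d₂ = subst CF e₁ (exchange (solve 3 (λ x y z → x ⊕ y ⊕ z ⊜ z ⊕ y ⊕ x) refl [ ⊥⟨ b / m ⟩ ] [ ⊥⟨ m / a ⟩ ] [ A ]) d₁)

    module _ (k : ℕ) (E : Expr) (h : Ind → Port) (g : Ind → Ind)
             (iU : ∀ {x} → x ∈ upper E → (k , x) ∈ P₀) (ih : ∀ {x} → x ∈ upper E → h x ∈ P₀)
             (g≢U : ∀ {x y} → x ∈ upper E → y ∈ lower E → θU (k , x) ≢ g y)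
             (g≢L : ∀ {x y} → x ∈ upper E → y ∈ lower E → θL (h x) ≢ g y) (Z : List Ind) where
      private
        from to : Ind → Ind
        from x = θL (h x)
        to x = θU (k , x)

      -- At first the upper occurrence `x` is named after its partner `h x`. For each `x` in turn ⊥→
      -- introduces the name `θU` and leaves a ⊥-formula, which is split into a strand.
      expand : ∀ xs {Θ} → Unique xs → (∀ {x} → x ∈ xs → x ∈ upper E) → (∀ {x} → x ∈ xs → θU (k , x) ∉ FU Θ) →
               CF (ren from g E ∷ Θ) →
               ∃ λ ws → map erase ws ≡ map (λ x → edge (k , x) (h x)) xs × Good Z ws ×
                        CF (ren (select xs to from) g E ∷ cords [] [] ws ++ Θ)
      expand [] u i n d = [] , refl , ([] , λ ()) , subst (λ A → CF (A ∷ _)) (ren-cong E (λ _ → sym (select-∉ λ ())) (λ _ → refl)) d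
      expand (x ∷ xs) {Θ} u i n d =
        let ws , w , gd , d₁ = expand xs (Unique-++⁻ʳ [ x ] u) (i ∘ there) (n ∘ there) d
            f = select xs to from
            x∈ = i (here refl)
            fx : f x ≡ from x
            fx = select-∉ (head-∉ u)
            a = from x
            v = to x
            X = cords [] [] ws ++ Θ
            A = ren f g E
            a∈ : a ∈ fu A
            a∈ = ∈-frees⁺ (subst₂ _∈_ fx (sym (upper-ren f g E)) (∈-map⁺ f x∈))
                   λ j → let y , y∈ , e = ∈-map⁻ g (subst (a ∈_) (lower-ren f g E) j) in g≢L x∈ y∈ e
            v∉f : ∀ {y} → y ∈ upper E → v ≢ f y
            v∉f {y} y∈ e = [ (λ (q , e′) → head-∉ u (subst (_∈ xs) (sym (cong proj₂ (θU-inj (iU x∈) (iU y∈) (≡-trans e e′)))) q))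
                           , (λ (_ , e′) → θ-disj (iU x∈) (ih y∈) (≡-trans e e′)) ]′ (select-cases xs to from y)
            v∉ : v ∉ occurrences A
            v∉ j = [ (λ j → let y , y∈ , e = ∈-map⁻ f (subst (v ∈_) (upper-ren f g E) j) in v∉f y∈ e)
                   , (λ j → let y , y∈ , e = ∈-map⁻ g (subst (v ∈_) (lower-ren f g E) j) in g≢U x∈ y∈ e) ]′ (∈-++⁻ (upper A) j)
            v∉X : v ∉ FU X
            v∉X j = [ (λ j → v∉cords ws gd w x∈ (FU-cords [] [] ws j)) , n (here refl) ]′
                      (∈-++⁻ (FU (cords [] [] ws)) (subst (v ∈_) (FU-++ (cords [] [] ws)) j))
            d₂ = ⊥→′ v a d₁ a∈ v∉ v∉X
            A′ = A [ v / a ]↑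
            m , m∉ = fresh (Zθ ++ Z ++ mids ws ++ FU (A′ ∷ X))
            m∉θ = m∉ ∘ ∈-++⁺ˡ
            d₃ = split-step m d₂ (λ e → m∉θ (subst (_∈ Zθ) (sym e) (θU∈ (iU x∈)))) (λ e → m∉θ (subst (_∈ Zθ) (sym e) (θL∈ (ih x∈))))
                   (m∉ ∘ ∈-++⁺ʳ Zθ ∘ ∈-++⁺ʳ Z ∘ ∈-++⁺ʳ (mids ws))
            eA : A′ ≡ ren (select (x ∷ xs) to from) g E
            eA = ≡-trans (subst↑-ren v a A) (≡-trans (ren-∘ E) (ren-cong E (step d₁ fx) (λ _ → refl)))
            e : A′ ∷ ⊥⟨ m / v ⟩ ∷ ⊥⟨ a / m ⟩ ∷ X ≡ ren (select (x ∷ xs) to from) g E ∷ cords [] [] (strand (k , x) m (h x) ∷ ws) ++ Θ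
            e = cong₂ _∷_ eA (cong₂ (λ a b → ⊥⟨ m / a ⟩ ∷ ⊥⟨ b / m ⟩ ∷ X) (sym nm-[]) (sym nm-[]))
        in strand (k , x) m (h x) ∷ ws , cong (_ ∷_) w ,
           good-∷ {Z} {m} {ws} m∉θ (m∉ ∘ ∈-++⁺ʳ Zθ ∘ ∈-++⁺ˡ) (m∉ ∘ ∈-++⁺ʳ Zθ ∘ ∈-++⁺ʳ Z ∘ ∈-++⁺ˡ) gd ,
           subst CF e (exchange (solve 4 (λ a b c x → a ⊕ b ⊕ c ⊕ x ⊜ c ⊕ b ⊕ a ⊕ x) refl [ ⊥⟨ a / m ⟩ ] [ ⊥⟨ m / v ⟩ ] [ A′ ] X) d₃)
        where
        lowers-edges : ∀ xs → lowers (map (λ x → edge (k , x) (h x)) xs) ≡ map h xs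
        lowers-edges [] = refl
        lowers-edges (x ∷ xs) = cong (h x ∷_) (lowers-edges xs)
        v∉cords : ∀ ws → Good Z ws → map erase ws ≡ map (λ x → edge (k , x) (h x)) xs → x ∈ upper E →
                  ¬ Name [] [] [] (mids ws) (lowers (map erase ws)) (θU (k , x))
        v∉cords ws gd w x∈ (nameM j) = proj₁ (proj₂ gd j) (θU∈ (iU x∈))
        v∉cords ws gd w x∈ (nameL {q} j e)
          with y , y∈ , refl ← ∈-map⁻ h (subst (q ∈_) (≡-trans (cong lowers w) (lowers-edges xs)) j) =
          θ-disj (iU x∈) (ih (i (there y∈))) (≡-trans e nm-[])
        step : CF (ren (select xs to from) g E ∷ _) → select xs to from x ≡ from x →
               ∀ {y} → y ∈ upper E → replace (to x) (from x) (select xs to from y) ≡ select (x ∷ xs) to from y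
        step d fx {y} y∈ with y ≟ᵢ x
        ... | yes refl = ≡-trans (cong (replace (to x) (from x)) fx) (≡-trans (replace-≡ (to x) (from x)) (sym (select-∈ (here refl))))
        ... | no y≢x = ≡-trans (replace-≢ λ e → y≢x (map-Unique-injective
              (subst Unique (upper-ren (select xs to from) g E) (proj₁ (proj₂ (All.head (proj₁ (CF-balanced d)))))) y∈ (i (here refl)) (≡-trans e (sym fx))))
              (select-∷ y≢x)

    zip-edges : ∀ {k : ℕ} {h : Ind → Port} {n} (us : Vec Ind n) {k′} (ls : Vec Ind n) → Vec.map h us ≡ Vec.map (k′ ,_) ls →
                map (λ x → edge (k , x) (h x)) (toList us) ≡ toList (zipWith (λ u l → edge (k , u) (k′ , l)) us ls)
    zip-edges [] [] e = refl
    zip-edges {k} {h} (u ∷ us) {k′} (l ∷ ls) e = cong₂ _∷_ (cong (edge (k , u)) (cong Vec.head e)) (zip-edges us ls (cong Vec.tail e))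

    lookup-∈ : ∀ {n} {h : Ind → Port} {us : Vec Ind n} {Q : Vec Port n} → Vec.map h us ≡ Q → ∀ {x} → x ∈ toList us → h x ∈ toList Q
    lookup-∈ {us = u ∷ us} refl (here refl) = here refl
    lookup-∈ {us = u ∷ us} refl (there x∈) = there (lookup-∈ {us = us} refl x∈)

    -- Distinctness of the indices of an atom allows the positional matching of an axiom to be given
    -- as a function of the index.
    lookup : ∀ {n} (us : Vec Ind n) (Q : Vec Port n) → Unique (toList us) → ∃ λ (h : Ind → Port) → Vec.map h us ≡ Q
    lookup [] [] u = (λ x → 0 , x) , refl
    lookup (x ∷ us) (q ∷ Q) u = let h , e = lookup us Q (Unique-++⁻ʳ [ x ] u)
                                    h′ = λ y → select [ x ] (λ _ → q) h y in
      h′ , cong₂ _∷_ (select-∈ (here refl)) (≡-trans (map-cong-∉ us h (head-∉ u)) e)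
      where
      map-cong-∉ : ∀ {n} (us : Vec Ind n) (h : Ind → Port) → x ∉ toList us → Vec.map (select [ x ] (λ _ → q) h) us ≡ Vec.map h us
      map-cong-∉ [] h x∉ = refl
      map-cong-∉ (y ∷ us) h x∉ = cong₂ _∷_ (select-∉ λ { (here refl) → x∉ (here refl) }) (map-cong-∉ us h (x∉ ∘ there))

    real-atom : ∀ {k p us ls} → IsFormula (atom p us ls) →
                real [] [] (k , atom p us ls) ≡ ren (λ x → θU (k , x)) (λ x → θL (k , x)) (atom p us ls)
    real-atom {p = p} {us} {ls} (d , _) = ren-cong (atom p us ls)
      (λ x∈ → ≡-trans (fix-∉ λ y∈ → Unique-disjoint d x∈ y∈) nm-[]) (λ x∈ → ≡-trans (fix-∉ λ y∈ → Unique-disjoint d y∈ x∈) nm-[])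

    good-++ : ∀ {Z} ws {ws′} → Good (Z ++ mids ws) ws′ → Good Z ws → Good Z (ws′ ++ ws)
    good-++ {Z} ws {ws′} (u′ , h′) (u , h) = subst Unique (sym (mids-++ ws′)) (++-Unique u′ u (λ i j → proj₂ (h′ i) (∈-++⁺ʳ Z j))) ,
      λ i → [ (λ j → proj₁ (h′ j) , proj₂ (h′ j) ∘ ∈-++⁺ˡ) , h ]′ (∈-++⁻ (mids ws′) (subst (_ ∈_) (mids-++ ws′) i))

    -- The initial axiom gives the lower occurrences their names `θL` and the upper ones the names
    -- of their partners. `expand` then moves the upper occurrences to `θU`, first those of the
    -- positive atom, then those of the negative one.
    T-axiom : ∀ {k k′ p us ls us′ ls′} → T ((k , atom (neg p) us ls) ∷ (k′ , atom (pos p) us′ ls′) ∷ []) (axiom-wires k k′ us ls us′ ls′)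
    T-axiom {k} {k′} {p} {us} {ls} {us′} {ls′} o Z =
      ws′ ++ ws , w , g , subst CF eR (exchange π d₂)
      where
      N = atom (neg p) us ls
      P = atom (pos p) us′ ls′
      oP = ok-++ʳ [ k , N ] o
      fN = All.head (forms o)
      fP = All.head (forms oP)
      θLk : ∀ k {n} → Vec Ind n → Vec Ind n
      θLk k = Vec.map (λ x → θL (k , x))
      hP = lookup us′ (Vec.map (k ,_) (reverse ls)) (proj₁ (proj₂ fP))
      hN = lookup us (Vec.map (k′ ,_) (reverse ls′)) (proj₁ (proj₂ fN))
      ∈-rev : ∀ {n k x} {xs : Vec Ind n} → x ∈ toList (Vec.map (k ,_) (reverse xs)) → ∃ λ y → y ∈ toList xs × x ≡ (k , y)
      ∈-rev {k = k} {xs = xs} i with y , y∈ , e ← ∈-map⁻ (k ,_) (subst (_ ∈_) (Vecₚ.toList-map (k ,_) (reverse xs)) i) =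
        y , ∈-resp-↭ (toList-reverse-↭ xs) y∈ , e
      hP-∈ : ∀ {x} → x ∈ toList us′ → ∃ λ y → y ∈ toList ls × proj₁ hP x ≡ (k , y)
      hP-∈ x∈ = ∈-rev {xs = ls} (lookup-∈ {us = us′} (proj₂ hP) x∈)
      hN-∈ : ∀ {x} → x ∈ toList us → ∃ λ y → y ∈ toList ls′ × proj₁ hN x ≡ (k′ , y)
      hN-∈ x∈ = ∈-rev {xs = ls′} (lookup-∈ {us = us} (proj₂ hN) x∈)
      disjL : ∀ {x y} → x ∈ toList ls → y ∈ toList ls′ → (k , x) ≢ (k′ , y)
      disjL x∈ y∈ e = Unique-disjoint (proj₂ (apart o)) (∈-map⁺ (k ,_) x∈) (subst (_∈ _) (sym e) (∈-++⁺ˡ (∈-map⁺ (k′ ,_) y∈)))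
      disjU : ∀ {x y} → x ∈ toList us → y ∈ toList us′ → (k , x) ≢ (k′ , y)
      disjU x∈ y∈ e = Unique-disjoint (proj₁ (apart o)) (∈-map⁺ (k ,_) x∈) (subst (_∈ _) (sym e) (∈-++⁺ˡ (∈-map⁺ (k′ ,_) y∈)))
      iUN : ∀ {x} → x ∈ toList us → (k , x) ∈ P₀
      iUN = item-U {E = N} o
      iLN : ∀ {x} → x ∈ toList ls → (k , x) ∈ P₀
      iLN = item-L {E = N} o
      iUP : ∀ {x} → x ∈ toList us′ → (k′ , x) ∈ P₀
      iUP = item-U {E = P} oP
      iLP : ∀ {x} → x ∈ toList ls′ → (k′ , x) ∈ P₀
      iLP = item-L {E = P} oP
      ihP : ∀ {x} → x ∈ toList us′ → proj₁ hP x ∈ P₀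
      ihP x∈ = let y , y∈ , e = hP-∈ x∈ in subst (_∈ P₀) (sym e) (iLN y∈)
      ihN : ∀ {x} → x ∈ toList us → proj₁ hN x ∈ P₀
      ihN x∈ = let y , y∈ , e = hN-∈ x∈ in subst (_∈ P₀) (sym e) (iLP y∈)
      A₀ = atom (pos p) (reverse (θLk k ls)) (θLk k′ ls′)
      map-h : ∀ {n k} {h : Ind → Port} (us : Vec Ind n) {xs} → Vec.map h us ≡ Vec.map (k ,_) (reverse xs) →
              Vec.map (λ x → θL (h x)) us ≡ reverse (θLk k xs)
      map-h {k = k} {h} us {xs} e = ≡-trans (Vecₚ.map-∘ θL h us) (≡-trans (cong (Vec.map θL) e)
        (≡-trans (sym (Vecₚ.map-∘ θL (k ,_) (reverse xs))) (Vecₚ.map-reverse _ xs)))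
      eP : A₀ ≡ ren (λ x → θL (proj₁ hP x)) (λ x → θL (k′ , x)) P
      eP = cong (λ us → atom (pos p) us (θLk k′ ls′)) (sym (map-h {h = proj₁ hP} us′ {ls} (proj₂ hP)))
      eN : dual A₀ ≡ ren (λ x → θL (proj₁ hN x)) (λ x → θL (k , x)) N
      eN = cong₂ (atom (neg p)) (sym (map-h {h = proj₁ hN} us {ls′} (proj₂ hN))) (Vecₚ.reverse-involutive (θLk k ls))
      θL-Unique : ∀ {n k} (xs : Vec Ind n) → (∀ {x} → x ∈ toList xs → (k , x) ∈ P₀) → Unique (toList xs) → Unique (toList (θLk k xs))
      θL-Unique {k = k} xs i u = subst Unique (sym (Vecₚ.toList-map (λ x → θL (k , x)) xs))
        (map-Unique (λ p q e → cong proj₂ (θL-inj (i p) (i q) e)) u)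
      ∈-θL : ∀ {n k z} {xs : Vec Ind n} → z ∈ toList (θLk k xs) → ∃ λ y → y ∈ toList xs × z ≡ θL (k , y)
      ∈-θL {k = k} {xs = xs} i = ∈-map⁻ _ (subst (_ ∈_) (Vecₚ.toList-map (λ x → θL (k , x)) xs) i)
      uA = Unique-resp-↭ (↭-sym (toList-reverse-↭ (θLk k ls))) (θL-Unique ls iLN (proj₂ (proj₂ fN)))
      lA = θL-Unique ls′ iLP (proj₂ (proj₂ fP))
      f₀ : IsFormula A₀
      f₀ = ++-Unique uA lA (λ i j → let x , x∈ , e = ∈-θL {xs = ls} (∈-resp-↭ (toList-reverse-↭ (θLk k ls)) i) ; y , y∈ , e′ = ∈-θL {xs = ls′} j in
             disjL x∈ y∈ (θL-inj (iLN x∈) (iLP y∈) (≡-trans (sym e) e′))) , uA , lA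
      d₀ : CF (ren (λ x → θL (proj₁ hP x)) (λ x → θL (k′ , x)) P ∷ [ dual A₀ ])
      d₀ = subst (λ A → CF (A ∷ [ dual A₀ ])) eP (exchange (swap _ _ refl) (id (pos p) (reverse (θLk k ls)) (θLk k′ ls′) (id-balanced f₀)))
      n₁ : ∀ {x} → x ∈ toList us′ → θU (k′ , x) ∉ FU [ dual A₀ ]
      n₁ x∈ i with ∈-++⁻ (fu (dual A₀)) i
      ... | inj₁ j with y , y∈ , e ← ∈-θL {xs = ls′} (∈-resp-↭ (toList-reverse-↭ (θLk k′ ls′)) (proj₁ (∈-frees⁻ j))) =
        θ-disj (iUP x∈) (iLP y∈) e
      E₁ = expand k′ P (proj₁ hP) (λ x → θL (k′ , x)) iUP ihP (λ i j → θ-disj (iUP i) (iLP j))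
             (λ i j e → let y , y∈ , e′ = hP-∈ i in disjL y∈ j (≡-trans (sym e′) (θL-inj (ihP i) (iLP j) e))) Z
             (toList us′) (proj₁ (proj₂ fP)) (λ i → i) n₁ d₀
      ws = proj₁ E₁
      w₁ = proj₁ (proj₂ E₁)
      g₁ = proj₁ (proj₂ (proj₂ E₁))
      d₁ : CF (ren (λ x → θL (proj₁ hN x)) (λ x → θL (k , x)) N ∷ real [] [] (k′ , P) ∷ cords [] [] ws)
      d₁ = subst₂ (λ A B → CF (A ∷ B ∷ cords [] [] ws)) eN
        (≡-trans (ren-cong P (λ i → select-∈ i) (λ _ → refl)) (sym (real-atom fP)))
        (exchange (trans (prep _ (++-comm (cords [] [] ws) [ dual A₀ ])) (swap _ _ refl)) (proj₂ (proj₂ (proj₂ E₁))))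
      lowers-map-edges : ∀ xs → lowers (map (λ x → edge (k′ , x) (proj₁ hP x)) xs) ≡ map (proj₁ hP) xs
      lowers-map-edges [] = refl
      lowers-map-edges (x ∷ xs) = cong (_ ∷_) (lowers-map-edges xs)
      n₂ : ∀ {x} → x ∈ toList us → θU (k , x) ∉ FU (real [] [] (k′ , P) ∷ cords [] [] ws)
      n₂ {x} x∈ i = [ inP , (λ j → inC (FU-cords [] [] ws j)) ]′ (∈-++⁻ (fu (real [] [] (k′ , P))) i)
        where
        inP : θU (k , x) ∉ fu (real [] [] (k′ , P))
        inP j = let y , y∈ , e = fu-real [] [] k′ P j ; y∈′ = proj₁ (∈-frees⁻ y∈) in
          disjU x∈ y∈′ (θU-inj (iUN x∈) (iUP y∈′) (≡-trans e nm-[]))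
        inC : ¬ Name [] [] [] (mids ws) (lowers (map erase ws)) (θU (k , x))
        inC (nameM m) = proj₁ (proj₂ g₁ m) (θU∈ (iUN x∈))
        inC (nameL {q} m e) = let y , y∈ , e′ = ∈-map⁻ (proj₁ hP) (subst (q ∈_) (≡-trans (cong lowers w₁) (lowers-map-edges (toList us′))) m) in
          θ-disj (iUN x∈) (subst (_∈ P₀) (sym e′) (ihP y∈)) (≡-trans e nm-[])
      E₂ = expand k N (proj₁ hN) (λ x → θL (k , x)) iUN ihN (λ i j → θ-disj (iUN i) (iLN j))
             (λ i j e → let y , y∈ , e′ = hN-∈ i in disjL j y∈ (sym (≡-trans (sym e′) (θL-inj (ihN i) (iLN j) e)))) (Z ++ mids ws)
             (toList us) (proj₁ (proj₂ fN)) (λ i → i) n₂ d₁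
      ws′ = proj₁ E₂
      w₂ = proj₁ (proj₂ E₂)
      g₂ = proj₁ (proj₂ (proj₂ E₂))
      d₂ : CF (real [] [] (k , N) ∷ cords [] [] ws′ ++ real [] [] (k′ , P) ∷ cords [] [] ws)
      d₂ = subst (λ A → CF (A ∷ cords [] [] ws′ ++ real [] [] (k′ , P) ∷ cords [] [] ws))
        (≡-trans (ren-cong N (λ i → select-∈ i) (λ _ → refl)) (sym (real-atom fN))) (proj₂ (proj₂ (proj₂ E₂)))
      π : real [] [] (k , N) ∷ cords [] [] ws′ ++ real [] [] (k′ , P) ∷ cords [] [] ws ↭
          real [] [] (k , N) ∷ real [] [] (k′ , P) ∷ cords [] [] ws′ ++ cords [] [] ws
      π = prep _ (shift _ (cords [] [] ws′) (cords [] [] ws))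
      eR : real [] [] (k , N) ∷ real [] [] (k′ , P) ∷ cords [] [] ws′ ++ cords [] [] ws ≡
           R [] [] ((k , N) ∷ (k′ , P) ∷ []) (ws′ ++ ws)
      eR = cong (λ xs → real [] [] (k , N) ∷ real [] [] (k′ , P) ∷ xs) (sym (cords-++ [] [] ws′))
      zip-reverse : ∀ {n} (f : Ind → Ind → Wire Port) (xs ys : Vec Ind n) →
                    toList (zipWith f xs (reverse ys)) ↭ toList (zipWith f (reverse xs) ys)
      zip-reverse f xs ys = trans (↭-sym (toList-reverse-↭ (zipWith f xs (reverse ys))))
        (↭-reflexive (cong toList (≡-trans (reverse-zipWith f xs (reverse ys)) (cong (zipWith f (reverse xs)) (Vecₚ.reverse-involutive ys)))))
      w : map erase (ws′ ++ ws) ↭ axiom-wires k k′ us ls us′ ls′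
      w = trans (↭-reflexive (map-++ erase ws′ ws)) (trans (++-comm (map erase ws′) (map erase ws))
        (++⁺ (↭-reflexive (≡-trans w₁ (zip-edges us′ (reverse ls) (proj₂ hP))))
             (trans (↭-reflexive (≡-trans w₂ (zip-edges us (reverse ls′) (proj₂ hN)))) (zip-reverse _ us ls′))))
      g : Good Z (ws′ ++ ws)
      g = good-++ {Z} ws {ws′} g₂ g₁

    realise : ∀ {Γ W} → D Γ W → T Γ W
    realise (axiom p q) = T-exchange p (T-wires (↭-sym q) T-axiom)
    realise (one p q) = T-exchange p (T-wires (↭-sym q) T-one)
    realise (bot {k = k} {j} {i} p d q) = T-exchange p (T-wires (↭-sym q) λ o Z →
      let ws , w , g , c = realise d (ok-++ʳ [ k , ⊥⟨ j / i ⟩ ] o) Z in T-bot d o Z {ws} w g refl c)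
    realise (bot-loop {k = k} {j} {i} p d q) = T-exchange p (T-wires (↭-sym q) λ o Z →
      let ws , w , g , c = realise d (ok-++ʳ [ k , ⊥⟨ j / i ⟩ ] o) Z in T-loop d o Z {ws} w g refl c)
    realise (par {A = A} {B} p d) = T-exchange p (T-par {A = A} {B} d (realise d))
    realise (tensor {A = A} {B} p d e s) = T-exchange p (T-tensor {A = A} {B} d e s (realise d) (realise e))

  -- Fresh names for a given sequent, and decidability of the cut-free calculus.

  assign : Port → Ind → (Port → Ind) → Port → Ind
  assign p x θ q with q ≟ₚ p
  ... | yes _ = x
  ... | no _ = θ q

  assign-cases : ∀ p x θ q → (q ≡ p × assign p x θ q ≡ x) ⊎ (q ≢ p × assign p x θ q ≡ θ q)
  assign-cases p x θ q with q ≟ₚ p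
  ... | yes e = inj₁ (e , refl)
  ... | no ne = inj₂ (ne , refl)

  naming : ∀ (P : List Port) Z → ∃ λ (θ : Port → Ind) →
           (∀ {p q} → p ∈ P → q ∈ P → θ p ≡ θ q → p ≡ q) × (∀ {p} → p ∈ P → θ p ∉ Z)
  naming [] Z = proj₂ , (λ ()) , λ ()
  naming (p ∷ P) Z =
    let x , x∉ = fresh Z
        θ , inj , avoid = naming P (x ∷ Z)
    in assign p x θ , injective x inj avoid , avoids x∉ avoid
    where
    tail : ∀ {q} → q ∈ p ∷ P → q ≢ p → q ∈ P
    tail (here e) ne = contradiction e ne
    tail (there i) ne = i
    injective : ∀ x {θ} → (∀ {q r} → q ∈ P → r ∈ P → θ q ≡ θ r → q ≡ r) → (∀ {q} → q ∈ P → θ q ∉ x ∷ Z) →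
                ∀ {q r} → q ∈ p ∷ P → r ∈ p ∷ P → assign p x θ q ≡ assign p x θ r → q ≡ r
    injective x {θ} inj avoid {q} {r} i j e with assign-cases p x θ q | assign-cases p x θ r
    ... | inj₁ (a , _) | inj₁ (b , _) = ≡-trans a (sym b)
    ... | inj₁ (_ , a) | inj₂ (ne , b) = ⊥-elim (avoid (tail j ne) (here (≡-trans (sym b) (≡-trans (sym e) a))))
    ... | inj₂ (ne , a) | inj₁ (_ , b) = ⊥-elim (avoid (tail i ne) (here (≡-trans (sym a) (≡-trans e b))))
    ... | inj₂ (ne , a) | inj₂ (ne′ , b) = inj (tail i ne) (tail j ne′) (≡-trans (sym a) (≡-trans e b))
    avoids : ∀ {x θ} → x ∉ Z → (∀ {q} → q ∈ P → θ q ∉ x ∷ Z) → ∀ {q} → q ∈ p ∷ P → assign p x θ q ∉ Z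
    avoids {x} {θ} x∉ avoid {q} i z∈ with assign-cases p x θ q
    ... | inj₁ (_ , a) = x∉ (subst (_∈ Z) a z∈)
    ... | inj₂ (ne , a) = avoid (tail i ne) (there (subst (_∈ Z) a z∈))

  formulas-number : ∀ k {Γ} → All IsFormula Γ → Formulas (number k Γ)
  formulas-number k [] = []
  formulas-number k (f ∷ fs) = f ∷ formulas-number (suc k) fs

  module Numbered (Γ : List Expr) where
    private
      Ns = number 0 Γ
      P₀ = collect upper Ns ++ collect lower Ns
      Z₀ = map proj₂ P₀
      U = naming P₀ Z₀
      -- Lower names avoid the upper ones in addition to the original names, which yields `θ-disj`.
      L = naming P₀ (Z₀ ++ map (proj₁ U) P₀)
      θU = proj₁ U
      θL = proj₁ L
      θ-disj : ∀ {p q} → p ∈ P₀ → q ∈ P₀ → θU p ≢ θL q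
      θ-disj p∈ q∈ e = proj₂ (proj₂ L) q∈ (∈-++⁺ʳ Z₀ (subst (_∈ map θU P₀) e (∈-map⁺ θU p∈)))

    open Realisation P₀ Z₀ θU θL (proj₁ (proj₂ U)) (proj₁ (proj₂ L)) θ-disj
      (proj₂ (proj₂ U)) (λ p∈ q → proj₂ (proj₂ L) p∈ (∈-++⁺ˡ q)) (∈-map⁺ proj₂)

    number-OK : All IsFormula Γ → OK Ns
    number-OK fs = record { forms = formulas-number 0 fs ; apart = apart-number 0 fs ; inU = ∈-++⁺ˡ ; inL = ∈-++⁺ʳ _ }

    fix-id : ∀ xs ys {O} {θ : Port → Ind} {k x} → x ∈ xs → (∀ {p} → p ∈ tag k (frees xs ys) → p ∈ O) → fix ys (nm O θ) k x ≡ x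
    fix-id xs ys {k = k} {x} x∈ h with x ∈? ys
    ... | yes i = fix-∈ i
    ... | no i = ≡-trans (fix-∉ i) (nm-∈ (h (∈-map⁺ (k ,_) (∈-frees⁺ x∈ i))))

    reals-id : ∀ {OU OL} k Δ → (∀ {p} → p ∈ ups (number k Δ) → p ∈ OU) → (∀ {p} → p ∈ lows (number k Δ) → p ∈ OL) →
               map (real OU OL) (number k Δ) ≡ Δ
    reals-id k [] h h′ = refl
    reals-id k (A ∷ Δ) h h′ = cong₂ _∷_
      (≡-trans (ren-cong A (λ x∈ → fix-id (upper A) (lower A) x∈ (h ∘ ∈-++⁺ˡ)) (λ x∈ → fix-id (lower A) (upper A) x∈ (h′ ∘ ∈-++⁺ˡ))) (ren-id A))
      (reals-id (suc k) Δ (h ∘ ∈-++⁺ʳ (tag k (fu A))) (h′ ∘ ∈-++⁺ʳ (tag k (fl A))))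

    -- All wires of a sequent join occurrences of the same index, so `link*` removes every strand.
    -- Then all free occurrences are opened, and the realised formulas are the original ones.
    realisation : (b : Balanced Γ) → D Ns (map wire (proj₁ (sequent-joints b))) → CF Γ
    realisation b d =
      let Zs , eU , eL = sequent-joints b
          o = number-OK (proj₁ b)
          ws , w , g , c = realise d o []
          _ , ws′ , _ , r , c′ = link* Zs {Ns} {ws} {[]} o (ends-↭ (↭-sym w) (D-Ends d o)) (good-mids {[]} {ws} g)
            (trans w (↭-reflexive (sym (Listₚ.++-identityʳ _))))
            (λ z∈ → subst (_ ∈_) (sym eU) (∈-map⁺ upper-port z∈) , ∈-resp-↭ (↭-sym eL) (∈-map⁺ lower-port z∈))
            (subst Unique (≡-trans (sym (names-FU 0 Γ)) (≡-trans (cong (map proj₂) eU) (sym (Listₚ.map-∘ Zs)))) (proj₁ (proj₂ b))) c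
      in subst CF (≡-trans (closed {ws = ws′} r) (reals-id 0 Γ (subst (_ ∈_) eU) (∈-resp-↭ eL))) c′
      where
      closed : ∀ {OU OL ws} → map erase ws ↭ [] → R OU OL Ns ws ≡ map (real OU OL) Ns
      closed {ws = []} r = Listₚ.++-identityʳ _
      closed {ws = _ ∷ _} r with () ← ↭-empty-inv r

  CF? : ∀ {Γ} → Balanced Γ → Dec (CF Γ)
  CF? {Γ} b = map′ (Numbered.realisation Γ b) (λ d → complete (CF⇒⊢ d) b) (D? (number 0 Γ) (map wire (proj₁ (sequent-joints b))))

  -- No cut is permuted: soundness of the interpretation gives a wired derivation, and its
  -- realisation is a proof without cut.
  cut-elimination : ∀ {Γ} → ⊢ Γ → CF Γ
  cut-elimination {Γ} d = let b = derivable⇒balanced d in Numbered.realisation Γ b (complete d b)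

  -- The intuitionistic calculus

  module I = ITTL V

  tr : I.Expr → Expr
  tr (I.atom (I.lit p) us ls) = atom (pos p) us ls
  tr (I.atom I.𝟏 us ls) = atom 𝟏 us ls
  tr (A I.⊗ B) = tr A ⊗ tr B
  tr (A I.⊸ B) = dual (tr A) ⅋ tr B

  upper-tr : ∀ A → upper (tr A) ↭ I.upper A
  lower-tr : ∀ A → lower (tr A) ↭ I.lower A
  upper-tr (I.atom (I.lit p) us ls) = refl
  upper-tr (I.atom I.𝟏 us ls) = refl
  upper-tr (A I.⊗ B) = ++⁺ (upper-tr A) (upper-tr B)
  upper-tr (A I.⊸ B) = ++⁺ (trans (upper-dual (tr A)) (lower-tr A)) (upper-tr B)
  lower-tr (I.atom (I.lit p) us ls) = refl
  lower-tr (I.atom I.𝟏 us ls) = refl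
  lower-tr (A I.⊗ B) = ++⁺ (lower-tr A) (lower-tr B)
  lower-tr (A I.⊸ B) = ++⁺ (trans (lower-dual (tr A)) (upper-tr A)) (lower-tr B)

  atoms-tr⁺ : ∀ A → I.AtomsDistinct A → AtomsDistinct (tr A)
  atoms-tr⁺ (I.atom (I.lit p) us ls) d = d
  atoms-tr⁺ (I.atom I.𝟏 us ls) d = d
  atoms-tr⁺ (A I.⊗ B) (d , e) = atoms-tr⁺ A d , atoms-tr⁺ B e
  atoms-tr⁺ (A I.⊸ B) (d , e) = atoms-dual (tr A) (atoms-tr⁺ A d) , atoms-tr⁺ B e

  atoms-tr⁻ : ∀ A → AtomsDistinct (tr A) → I.AtomsDistinct A
  atoms-tr⁻ (I.atom (I.lit p) us ls) d = d
  atoms-tr⁻ (I.atom I.𝟏 us ls) d = d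
  atoms-tr⁻ (A I.⊗ B) (d , e) = atoms-tr⁻ A d , atoms-tr⁻ B e
  atoms-tr⁻ (A I.⊸ B) (d , e) =
    atoms-tr⁻ A (subst AtomsDistinct (dual-involutive (tr A)) (atoms-dual (dual (tr A)) d)) , atoms-tr⁻ B e

  dual-subst↑ : ∀ i j A → dual (A [ i / j ]↑) ≡ dual A [ i / j ]↓
  dual-subst↑ i j A = ≡-trans (cong dual (subst↑-ren i j A)) (≡-trans (dual-ren _ _ A) (sym (subst↓-ren i j (dual A))))

  dual-subst↓ : ∀ i j A → dual (A [ i / j ]↓) ≡ dual A [ i / j ]↑
  dual-subst↓ i j A = ≡-trans (cong dual (subst↓-ren i j A)) (≡-trans (dual-ren _ _ A) (sym (subst↑-ren i j (dual A))))

  tr-subst↑ : ∀ i j A → tr (A I.[ i / j ]↑) ≡ tr A [ i / j ]↑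
  tr-subst↓ : ∀ i j A → tr (A I.[ i / j ]↓) ≡ tr A [ i / j ]↓
  tr-subst↑ i j (I.atom (I.lit p) us ls) = refl
  tr-subst↑ i j (I.atom I.𝟏 us ls) = refl
  tr-subst↑ i j (A I.⊗ B) = cong₂ _⊗_ (tr-subst↑ i j A) (tr-subst↑ i j B)
  tr-subst↑ i j (A I.⊸ B) = cong₂ _⅋_ (≡-trans (cong dual (tr-subst↓ i j A)) (dual-subst↓ i j (tr A))) (tr-subst↑ i j B)
  tr-subst↓ i j (I.atom (I.lit p) us ls) = refl
  tr-subst↓ i j (I.atom I.𝟏 us ls) = refl
  tr-subst↓ i j (A I.⊗ B) = cong₂ _⊗_ (tr-subst↓ i j A) (tr-subst↓ i j B)
  tr-subst↓ i j (A I.⊸ B) = cong₂ _⅋_ (≡-trans (cong dual (tr-subst↑ i j A)) (dual-subst↑ i j (tr A))) (tr-subst↓ i j B)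

  -- An `input` stands left of the turnstile and is dualised in the one-sided sequent; an `output`
  -- stands on the right.
  data Signed : Set where
    output input : I.Expr → Signed

  emb : Signed → Expr
  emb (output A) = tr A
  emb (input A) = dual (tr A)

  upperˢ lowerˢ : Signed → List Ind
  upperˢ (output A) = I.upper A
  upperˢ (input A) = I.lower A
  lowerˢ (output A) = I.lower A
  lowerˢ (input A) = I.upper A

  upper-emb : ∀ σ → upper (emb σ) ↭ upperˢ σ
  upper-emb (output A) = upper-tr A
  upper-emb (input A) = trans (upper-dual (tr A)) (lower-tr A)

  lower-emb : ∀ σ → lower (emb σ) ↭ lowerˢ σ
  lower-emb (output A) = lower-tr A
  lower-emb (input A) = trans (lower-dual (tr A)) (upper-tr A)

  body : Signed → I.Expr
  body (output A) = A
  body (input A) = A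

  occurrences-emb : ∀ σ → occurrences (emb σ) ↭ I.occurrences (body σ)
  occurrences-emb (output A) = ++⁺ (upper-emb (output A)) (lower-emb (output A))
  occurrences-emb (input A) = trans (++⁺ (upper-emb (input A)) (lower-emb (input A))) (++-comm (I.lower A) (I.upper A))

  FI↑-emb⁺ : ∀ σ {x} → I.Free (body σ) x × x ∈ upperˢ σ → FI↑ (emb σ) x
  FI↑-emb⁺ σ (e , i) = ≡-trans (count-↭ (occurrences-emb σ)) e , ∈-resp-↭ (↭-sym (upper-emb σ)) i

  FI↑-emb⁻ : ∀ σ {x} → FI↑ (emb σ) x → I.Free (body σ) x × x ∈ upperˢ σ
  FI↑-emb⁻ σ (e , i) = ≡-trans (sym (count-↭ (occurrences-emb σ))) e , ∈-resp-↭ (upper-emb σ) i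

  FI↓-emb⁺ : ∀ σ {x} → I.Free (body σ) x × x ∈ lowerˢ σ → FI↓ (emb σ) x
  FI↓-emb⁺ σ (e , i) = ≡-trans (count-↭ (occurrences-emb σ)) e , ∈-resp-↭ (↭-sym (lower-emb σ)) i

  FI↓-emb⁻ : ∀ σ {x} → FI↓ (emb σ) x → I.Free (body σ) x × x ∈ lowerˢ σ
  FI↓-emb⁻ σ (e , i) = ≡-trans (sym (count-↭ (occurrences-emb σ))) e , ∈-resp-↭ (lower-emb σ) i

  formula-tr⁺ : ∀ {A} → I.IsFormula A → IsFormula (tr A)
  formula-tr⁺ {A} (d , u , l) = atoms-tr⁺ A d , Unique-resp-↭ (↭-sym (upper-tr A)) u , Unique-resp-↭ (↭-sym (lower-tr A)) l

  formula-tr⁻ : ∀ {A} → IsFormula (tr A) → I.IsFormula A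
  formula-tr⁻ {A} (d , u , l) = atoms-tr⁻ A d , Unique-resp-↭ (upper-tr A) u , Unique-resp-↭ (lower-tr A) l

  onesided : List I.Expr → I.Expr → List Expr
  onesided Γ A = tr A ∷ map (dual ∘ tr) Γ

  module _ {Γ : List I.Expr} {A : I.Expr} where
    in↑ : ∀ {x} → FI↑* (onesided Γ A) x → I.FI↓* Γ x ⊎ I.FI↑ A x
    in↑ (here p) = inj₂ (FI↑-emb⁻ (output A) p)
    in↑ (there p) = inj₁ (Any.map (λ {B} → FI↑-emb⁻ (input B)) (AnyP.map⁻ p))
    in↓ : ∀ {x} → FI↓* (onesided Γ A) x → I.FI↑* Γ x ⊎ I.FI↓ A x
    in↓ (here p) = inj₂ (FI↓-emb⁻ (output A) p)
    in↓ (there p) = inj₁ (Any.map (λ {B} → FI↓-emb⁻ (input B)) (AnyP.map⁻ p))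
    out↑ : ∀ {x} → I.FI↓* Γ x ⊎ I.FI↑ A x → FI↑* (onesided Γ A) x
    out↑ (inj₁ p) = there (AnyP.map⁺ (Any.map (λ {B} → FI↑-emb⁺ (input B)) p))
    out↑ (inj₂ p) = here (FI↑-emb⁺ (output A) p)
    out↓ : ∀ {x} → I.FI↑* Γ x ⊎ I.FI↓ A x → FI↓* (onesided Γ A) x
    out↓ (inj₁ p) = there (AnyP.map⁺ (Any.map (λ {B} → FI↓-emb⁺ (input B)) p))
    out↓ (inj₂ p) = here (FI↓-emb⁺ (output A) p)

  onesided-sequent : ∀ {Γ A} → I.IsSequent Γ A → IsSequent (onesided Γ A)
  onesided-sequent {Γ} {A} ((fs , cs) , f , d↑ , d↓ , to , from) =
    (formula-tr⁺ f ∷ AllP.map⁺ (All.map (λ {B} g → formula-dual {tr B} (formula-tr⁺ g)) fs) ,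
     AllP.map⁺ (All.tabulate λ {B} B∈ →
       (λ x (p , q) → d↓ x (Any.map (λ { refl → FI↑-emb⁻ (input B) q }) B∈ , FI↑-emb⁻ (output A) p)) ,
       (λ x (p , q) → d↑ x (Any.map (λ { refl → FI↓-emb⁻ (input B) q }) B∈ , FI↓-emb⁻ (output A) p))) ∷
     AllPairsP.map⁺ (AllPairs.map (λ {B} {C} (c , c′) →
       (λ x (p , q) → c′ x (FI↑-emb⁻ (input B) p , FI↑-emb⁻ (input C) q)) ,
       (λ x (p , q) → c x (FI↓-emb⁻ (input B) p , FI↓-emb⁻ (input C) q))) cs)) ,
    (λ p → out↓ (from (in↑ p))) , λ p → out↑ (to (in↓ p))

  onesided-sequent⁻ : ∀ {Γ A} → IsSequent (onesided Γ A) → I.IsSequent Γ A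
  onesided-sequent⁻ {Γ} {A} ((f ∷ fs , c ∷ cs) , to , from) =
    (All.map (λ {B} g → formula-tr⁻ (subst IsFormula (dual-involutive (tr B)) (formula-dual {dual (tr B)} g))) (AllP.map⁻ fs) ,
     AllPairs.map (λ {B} {C} (c , c′) →
       (λ x (p , q) → c′ x (FI↓-emb⁺ (input B) p , FI↓-emb⁺ (input C) q)) ,
       (λ x (p , q) → c x (FI↑-emb⁺ (input B) p , FI↑-emb⁺ (input C) q))) (AllPairsP.map⁻ cs)) ,
    formula-tr⁻ f ,
    (λ x (p , q) → apart↓ (AllP.map⁻ c) p q) ,
    (λ x (p , q) → apart↑ (AllP.map⁻ c) p q) ,
    (λ p → in↑ (from (out↓ p))) , λ p → in↓ (to (out↑ p))
    where
    apart↓ : ∀ {Γ x} → All (λ B → Compatible (tr A) (dual (tr B))) Γ → I.FI↑* Γ x → I.FI↓ A x → Empty.⊥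
    apart↓ (c ∷ _) (here {B} p) q = proj₂ c _ (FI↓-emb⁺ (output A) q , FI↓-emb⁺ (input B) p)
    apart↓ (_ ∷ cs) (there p) q = apart↓ cs p q
    apart↑ : ∀ {Γ x} → All (λ B → Compatible (tr A) (dual (tr B))) Γ → I.FI↓* Γ x → I.FI↑ A x → Empty.⊥
    apart↑ (c ∷ _) (here {B} p) q = proj₁ c _ (FI↑-emb⁺ (output A) q , FI↑-emb⁺ (input B) p)
    apart↑ (_ ∷ cs) (there p) q = apart↑ cs p q

  onesided-++ : ∀ Γ {Δ A} → onesided (Γ ++ Δ) A ≡ tr A ∷ map (dual ∘ tr) Γ ++ map (dual ∘ tr) Δ
  onesided-++ Γ = cong (_ ∷_) (map-++ (dual ∘ tr) Γ _)

  sequent-↭ : ∀ {Γ Δ} → Γ ↭ Δ → IsSequent Γ → IsSequent Δ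
  sequent-↭ p s = balanced⇒sequent (balanced-↭ p (sequent⇒balanced s))

  -- Moving everything to one side identifies rules with the same effect on indices: L𝟏→ and R𝟏→
  -- become ⊥→, L𝟏← and R𝟏← become ⊥←.
  classical : ∀ {Γ A} → Γ I.⊢ A → ⊢ onesided Γ A
  classical (I.exchange p d) = exchange (prep _ (map⁺ _ p)) (classical d)
  classical (I.id (I.lit p) us ls s) =
    exchange (swap _ _ refl) (id (pos p) us ls (sequent-↭ (swap _ _ refl) (onesided-sequent {[ I.atom (I.lit p) us ls ]} {I.atom (I.lit p) us ls} s)))
  classical (I.id I.𝟏 us ls s) =
    exchange (swap _ _ refl) (id 𝟏 us ls (sequent-↭ (swap _ _ refl) (onesided-sequent {[ I.atom I.𝟏 us ls ]} {I.atom I.𝟏 us ls} s)))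
  classical (I.cut {Γ} {Δ} {A} {B} s d e) =
    let p = trans (shift (tr B) (map (dual ∘ tr) Γ) (map (dual ∘ tr) Δ)) (↭-reflexive (sym (onesided-++ Γ)))
    in exchange p (cut (sequent-↭ (↭-sym p) (onesided-sequent s)) (classical d) (exchange (swap _ _ refl) (classical e)))
  classical (I.L⊸ {Γ} {Δ} {A} {B} {C} s d e) =
    let p = trans (swap _ _ (++-comm (map (dual ∘ tr) Δ) (map (dual ∘ tr) Γ))) (↭-reflexive (sym (onesided-++ (A I.⊸ B ∷ Γ))))
    in exchange p (⊗-rule (sequent-↭ (↭-sym p) (onesided-sequent s)) (exchange (swap _ _ refl) (classical e))
         (subst (λ E → ⊢ E ∷ map (dual ∘ tr) Γ) (sym (dual-involutive (tr A))) (classical d)))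
  classical (I.R⊸ {Γ} {A} {B} s d) = ⅋-rule (onesided-sequent s) (exchange (swap _ _ refl) (classical d))
  classical (I.L⊗ {Γ} {A} {B} {C} s d) = exchange (swap _ _ refl) (⅋-rule (sequent-↭ (swap _ _ refl) (onesided-sequent s))
    (exchange (solve 4 (λ c a b g → c ⊕ a ⊕ b ⊕ g ⊜ b ⊕ a ⊕ c ⊕ g) refl [ tr C ] [ dual (tr A) ] [ dual (tr B) ] (map (dual ∘ tr) Γ)) (classical d)))
  classical (I.R⊗ {Γ} s d e) = subst ⊢_ (sym (onesided-++ Γ)) (⊗-rule (subst IsSequent (onesided-++ Γ) (onesided-sequent s)) (classical d) (classical e))
  classical (I.L𝟏→ {Γ} {A} {B} {i} {j} s j∈ i∉ d) =
    let e = ≡-trans (cong dual (tr-subst↓ i j A)) (dual-subst↓ i j (tr A))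
        p = trans (shift (tr B) (⊥⟨ j / i ⟩ ∷ dual (tr A) [ i / j ]↑ ∷ []) (map (dual ∘ tr) Γ))
              (↭-reflexive (cong (λ E → tr B ∷ ⊥⟨ j / i ⟩ ∷ E ∷ map (dual ∘ tr) Γ) (sym e)))
    in exchange p (⊥→ (sequent-↭ (↭-sym p) (onesided-sequent s)) (FI↑-emb⁺ (input A) j∈) (i∉ ∘ ∈-resp-↭ (occurrences-emb (input A)))
         (exchange (swap _ _ refl) (classical d)))
  classical (I.R𝟏→ {Γ} {A} {i} {j} s j∈ i∉ d) =
    let p = trans (swap _ _ refl) (↭-reflexive (cong (λ E → E ∷ ⊥⟨ j / i ⟩ ∷ map (dual ∘ tr) Γ) (sym (tr-subst↑ i j A))))
    in exchange p (⊥→ (sequent-↭ (↭-sym p) (onesided-sequent s)) (FI↑-emb⁺ (output A) j∈) (i∉ ∘ ∈-resp-↭ (occurrences-emb (output A))) (classical d))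
  classical (I.L𝟏← {Γ} {A} {B} {i} {j} s j∈ i∉ d) =
    let e = ≡-trans (cong dual (tr-subst↑ i j A)) (dual-subst↑ i j (tr A))
        p = trans (swap _ _ refl) (↭-reflexive (cong (λ E → tr B ∷ E ∷ map (dual ∘ tr) Γ) (sym e)))
    in exchange p (⊥← (sequent-↭ (↭-sym p) (onesided-sequent s)) (FI↓-emb⁺ (input A) j∈) (i∉ ∘ ∈-resp-↭ (occurrences-emb (input A)))
         (exchange (↭-sym (shift (tr B) (⊥⟨ j / i ⟩ ∷ dual (tr A) ∷ []) (map (dual ∘ tr) Γ))) (classical d)))
  classical (I.R𝟏← {Γ} {A} {i} {j} s j∈ i∉ d) =
    let p = ↭-reflexive (cong (λ E → E ∷ map (dual ∘ tr) Γ) (sym (tr-subst↓ i j A)))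
    in exchange p (⊥← (sequent-↭ (↭-sym p) (onesided-sequent s)) (FI↓-emb⁺ (output A) j∈) (i∉ ∘ ∈-resp-↭ (occurrences-emb (output A)))
         (exchange (swap _ _ refl) (classical d)))

  -- Intuitionistic proofs recovered from cut-free classical ones.

  replace-inverse : ∀ {i j x} → x ≢ j → replace i j (replace j i x) ≡ x
  replace-inverse {i} {j} {x} x≢j with x ≟ᵢ i
  ... | yes refl = replace-≡ i j
  ... | no _ = replace-≢ x≢j

  map-replace-inverse : ∀ {i j n} (xs : Vec Ind n) → j ∉ toList xs → Vec.map (replace i j) (Vec.map (replace j i) xs) ≡ xs
  map-replace-inverse [] j∉ = refl
  map-replace-inverse (x ∷ xs) j∉ = cong₂ _∷_ (replace-inverse λ { refl → j∉ (here refl) }) (map-replace-inverse xs (j∉ ∘ there))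

  subst↑-inverse : ∀ {i j} A → j ∉ upper A → A [ j / i ]↑ [ i / j ]↑ ≡ A
  subst↑-inverse (atom p us ls) j∉ = cong (λ us → atom p us ls) (map-replace-inverse us j∉)
  subst↑-inverse (A ⊗ B) j∉ = cong₂ _⊗_ (subst↑-inverse A (j∉ ∘ ∈-++⁺ˡ)) (subst↑-inverse B (j∉ ∘ ∈-++⁺ʳ (upper A)))
  subst↑-inverse (A ⅋ B) j∉ = cong₂ _⅋_ (subst↑-inverse A (j∉ ∘ ∈-++⁺ˡ)) (subst↑-inverse B (j∉ ∘ ∈-++⁺ʳ (upper A)))

  subst↓-inverse : ∀ {i j} A → j ∉ lower A → A [ j / i ]↓ [ i / j ]↓ ≡ A
  subst↓-inverse (atom p us ls) j∉ = cong (atom p us) (map-replace-inverse ls j∉)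
  subst↓-inverse (A ⊗ B) j∉ = cong₂ _⊗_ (subst↓-inverse A (j∉ ∘ ∈-++⁺ˡ)) (subst↓-inverse B (j∉ ∘ ∈-++⁺ʳ (lower A)))
  subst↓-inverse (A ⅋ B) j∉ = cong₂ _⅋_ (subst↓-inverse A (j∉ ∘ ∈-++⁺ˡ)) (subst↓-inverse B (j∉ ∘ ∈-++⁺ʳ (lower A)))

  I-subst↑-inverse : ∀ {i j} A → j ∉ I.upper A → A I.[ j / i ]↑ I.[ i / j ]↑ ≡ A
  I-subst↓-inverse : ∀ {i j} A → j ∉ I.lower A → A I.[ j / i ]↓ I.[ i / j ]↓ ≡ A
  I-subst↑-inverse (I.atom p us ls) j∉ = cong (λ us → I.atom p us ls) (map-replace-inverse us j∉)
  I-subst↑-inverse (A I.⊗ B) j∉ = cong₂ I._⊗_ (I-subst↑-inverse A (j∉ ∘ ∈-++⁺ˡ)) (I-subst↑-inverse B (j∉ ∘ ∈-++⁺ʳ (I.upper A)))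
  I-subst↑-inverse (A I.⊸ B) j∉ = cong₂ I._⊸_ (I-subst↓-inverse A (j∉ ∘ ∈-++⁺ˡ)) (I-subst↑-inverse B (j∉ ∘ ∈-++⁺ʳ (I.lower A)))
  I-subst↓-inverse (I.atom p us ls) j∉ = cong (I.atom p us) (map-replace-inverse ls j∉)
  I-subst↓-inverse (A I.⊗ B) j∉ = cong₂ I._⊗_ (I-subst↓-inverse A (j∉ ∘ ∈-++⁺ˡ)) (I-subst↓-inverse B (j∉ ∘ ∈-++⁺ʳ (I.lower A)))
  I-subst↓-inverse (A I.⊸ B) j∉ = cong₂ I._⊸_ (I-subst↑-inverse A (j∉ ∘ ∈-++⁺ˡ)) (I-subst↓-inverse B (j∉ ∘ ∈-++⁺ʳ (I.upper A)))

  substˢ↑ substˢ↓ : Ind → Ind → Signed → Signed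
  substˢ↑ i j (output A) = output (A I.[ i / j ]↑)
  substˢ↑ i j (input A) = input (A I.[ i / j ]↓)
  substˢ↓ i j (output A) = output (A I.[ i / j ]↓)
  substˢ↓ i j (input A) = input (A I.[ i / j ]↑)

  emb-subst↑ : ∀ i j σ → emb (substˢ↑ i j σ) ≡ emb σ [ i / j ]↑
  emb-subst↑ i j (output A) = tr-subst↑ i j A
  emb-subst↑ i j (input A) = ≡-trans (cong dual (tr-subst↓ i j A)) (dual-subst↓ i j (tr A))

  emb-subst↓ : ∀ i j σ → emb (substˢ↓ i j σ) ≡ emb σ [ i / j ]↓
  emb-subst↓ i j (output A) = tr-subst↓ i j A
  emb-subst↓ i j (input A) = ≡-trans (cong dual (tr-subst↑ i j A)) (dual-subst↑ i j (tr A))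

  substˢ↑-inverse : ∀ {i j} σ → j ∉ upperˢ σ → substˢ↑ i j (substˢ↑ j i σ) ≡ σ
  substˢ↑-inverse (output A) j∉ = cong output (I-subst↑-inverse A j∉)
  substˢ↑-inverse (input A) j∉ = cong input (I-subst↓-inverse A j∉)

  substˢ↓-inverse : ∀ {i j} σ → j ∉ lowerˢ σ → substˢ↓ i j (substˢ↓ j i σ) ≡ σ
  substˢ↓-inverse (output A) j∉ = cong output (I-subst↓-inverse A j∉)
  substˢ↓-inverse (input A) j∉ = cong input (I-subst↑-inverse A j∉)

  map-replace-∌ : ∀ {i j} xs → i ≢ j → j ∉ map (replace i j) xs
  map-replace-∌ {i} {j} xs i≢j j∈ with x , _ , e ← ∈-map⁻ (replace i j) j∈ with x ≟ᵢ j
  ... | yes _ = i≢j (sym e)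
  ... | no x≢j = x≢j (sym e)

  -- A formula of the form A [ i / j ] can be substituted back, so the premise of
  -- a ⊥-rule is a translation whenever the conclusion is.
  unsubst↑ : ∀ {A i j} σ → j ∈ upper A → i ∉ occurrences A → A [ i / j ]↑ ≡ emb σ →
             ∃ λ τ → A ≡ emb τ × σ ≡ substˢ↑ i j τ
  unsubst↑ {A} {i} {j} σ j∈ i∉ e = substˢ↑ j i σ ,
    ≡-trans (sym (subst↑-inverse A (i∉ ∘ ∈-++⁺ˡ))) (≡-trans (cong _[ j / i ]↑ e) (sym (emb-subst↑ j i σ))) ,
    sym (substˢ↑-inverse σ λ j∈σ → map-replace-∌ (upper A) (λ { refl → i∉ (∈-++⁺ˡ j∈) })
      (subst (j ∈_) (≡-trans (cong upper (subst↑-ren i j A)) (upper-ren _ _ A))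
        (subst (λ E → j ∈ upper E) (sym e) (∈-resp-↭ (↭-sym (upper-emb σ)) j∈σ))))

  unsubst↓ : ∀ {A i j} σ → j ∈ lower A → i ∉ occurrences A → A [ i / j ]↓ ≡ emb σ →
             ∃ λ τ → A ≡ emb τ × σ ≡ substˢ↓ i j τ
  unsubst↓ {A} {i} {j} σ j∈ i∉ e = substˢ↓ j i σ ,
    ≡-trans (sym (subst↓-inverse A (i∉ ∘ ∈-++⁺ʳ (upper A)))) (≡-trans (cong _[ j / i ]↓ e) (sym (emb-subst↓ j i σ))) ,
    sym (substˢ↓-inverse σ λ j∈σ → map-replace-∌ (lower A) (λ { refl → i∉ (∈-++⁺ʳ (upper A) j∈) })
      (subst (j ∈_) (≡-trans (cong lower (subst↓-ren i j A)) (lower-ren _ _ A))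
        (subst (λ E → j ∈ lower E) (sym e) (∈-resp-↭ (↭-sym (lower-emb σ)) j∈σ))))

  map-++-inverse : ∀ Γ {Δ} Σ → Γ ++ Δ ≡ map emb Σ → ∃₂ λ Σ₁ Σ₂ → Σ ≡ Σ₁ ++ Σ₂ × Γ ≡ map emb Σ₁ × Δ ≡ map emb Σ₂
  map-++-inverse [] Σ e = [] , Σ , refl , refl , e
  map-++-inverse (A ∷ Γ) (σ ∷ Σ) e =
    let Σ₁ , Σ₂ , e₀ , e₁ , e₂ = map-++-inverse Γ Σ (Listₚ.∷-injectiveʳ e)
    in σ ∷ Σ₁ , Σ₂ , cong (σ ∷_) e₀ , cong₂ _∷_ (Listₚ.∷-injectiveˡ e) e₁ , e₂

  signed : List I.Expr → I.Expr → List Signed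
  signed Γ A = output A ∷ map input Γ

  output-∉ : ∀ {A Γ} → output A ∉ map input Γ
  output-∉ i with () ← proj₂ (proj₂ (∈-map⁻ input i))

  input-injective : ∀ {A B} → input A ≡ input B → A ≡ B
  input-injective refl = refl

  signed-output : ∀ {A B Γ Σ} → output A ∷ Σ ↭ signed Γ B → A ≡ B × Σ ↭ map input Γ
  signed-output p with ∈-resp-↭ p (here refl)
  ... | here refl = refl , drop-∷ p
  ... | there i = ⊥-elim (output-∉ i)

  signed-input : ∀ {A B Γ Σ} → input A ∷ Σ ↭ signed Γ B → ∃ λ Γ′ → Γ ↭ A ∷ Γ′ × Σ ↭ signed Γ′ B
  signed-input {B = B} p with ∈-resp-↭ p (here refl)
  ... | there i with _ , A∈ , refl ← ∈-map⁻ input i with Γ′ , q ← ∈⇒↭ A∈ =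
    Γ′ , q , drop-∷ (trans p (trans (prep _ (map⁺ input q)) (swap _ _ refl)))

  -- That there is exactly one output is part of what the induction proves: it holds for the axioms
  -- and is inherited through every rule other than cut.
  Intuitionistic : List Signed → Set
  Intuitionistic Σ = ∃₂ λ Γ A → Σ ↭ signed Γ A × Γ I.⊢ A

  intuitionistic-sequent : ∀ {Δ Σ Γ A} → Balanced Δ → Δ ≡ map emb Σ → Σ ↭ signed Γ A → I.IsSequent Γ A
  intuitionistic-sequent {Γ = Γ} {A} b refl p = onesided-sequent⁻ (balanced⇒sequent
    (subst (λ Δ → Balanced (tr A ∷ Δ)) (sym (Listₚ.map-∘ Γ)) (balanced-↭ (map⁺ emb p) b)))

  data Atomic : Expr → Set where
    atomic : ∀ {p us ls} → Atomic (atom p us ls)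

  atomic-dual : ∀ p us ls → Atomic (dual (atom p us ls))
  atomic-dual (pos p) us ls = atomic
  atomic-dual (neg p) us ls = atomic
  atomic-dual 𝟏 us ls = atomic
  atomic-dual ⊥ us ls = atomic

  -- The two members of an axiom have different signs: the translation of an atom is 𝟏 or positive.
  clash : ∀ {E} X Y → Atomic E → tr Y ≡ E → tr X ≢ dual E
  clash (I.atom (I.lit _) _ _) (I.atom (I.lit _) _ _) atomic refl ()
  clash (I.atom I.𝟏 _ _) (I.atom (I.lit _) _ _) atomic refl ()
  clash (I.atom (I.lit _) _ _) (I.atom I.𝟏 _ _) atomic refl ()
  clash (I.atom I.𝟏 _ _) (I.atom I.𝟏 _ _) atomic refl ()
  clash (_ I.⊗ _) (I.atom (I.lit _) _ _) atomic refl ()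
  clash (_ I.⊗ _) (I.atom I.𝟏 _ _) atomic refl ()
  clash (_ I.⊸ _) (I.atom (I.lit _) _ _) atomic refl ()
  clash (_ I.⊸ _) (I.atom I.𝟏 _ _) atomic refl ()

  atom-tr : ∀ {E} X Y → Atomic E → tr X ≡ E → tr Y ≡ E → X ≡ Y × (I.IsSequent [ X ] X → [ X ] I.⊢ X)
  atom-tr (I.atom (I.lit p) us ls) (I.atom (I.lit _) _ _) atomic refl refl = refl , I.id (I.lit p) us ls
  atom-tr (I.atom I.𝟏 us ls) (I.atom I.𝟏 _ _) atomic refl refl = refl , I.id I.𝟏 us ls

  dual-flip : ∀ {A B} → dual A ≡ B → A ≡ dual B
  dual-flip {A} refl = sym (dual-involutive A)

  intuitionistic-axiom : ∀ {E} σ τ → Atomic E → Atomic (dual E) → Balanced (emb σ ∷ emb τ ∷ []) → emb σ ≡ dual E → emb τ ≡ E →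
                         Intuitionistic (σ ∷ τ ∷ [])
  intuitionistic-axiom (output X) (output Y) a a′ b e e′ = ⊥-elim (clash X Y a e′ e)
  intuitionistic-axiom (input X) (output Y) a a′ b e e′ with refl , d ← atom-tr X Y a (≡-trans (dual-flip e) (dual-involutive _)) e′ =
    [ X ] , X , swap _ _ refl , d (intuitionistic-sequent {Σ = input X ∷ output X ∷ []} b refl (swap _ _ refl))
  intuitionistic-axiom (output X) (input Y) a a′ b e e′ with refl , d ← atom-tr X Y a′ e (dual-flip e′) =
    [ X ] , X , refl , d (intuitionistic-sequent {Σ = output X ∷ input X ∷ []} b refl refl)
  intuitionistic-axiom (input X) (input Y) a a′ b e e′ = ⊥-elim (clash Y X a (≡-trans (dual-flip e) (dual-involutive _)) (dual-flip e′))

  -- The source language has no ⊥, so a ⊥-formula among translations can only be the dual of a 𝟏 on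
  -- the left.
  emb-⊥ : ∀ {i j} σ → ⊥⟨ j / i ⟩ ≡ emb σ → σ ≡ input I.𝟏⟨ i / j ⟩
  emb-⊥ (output (I.atom (I.lit _) _ _)) ()
  emb-⊥ (output (I.atom I.𝟏 _ _)) ()
  emb-⊥ (input (I.atom (I.lit _) _ _)) ()
  emb-⊥ (input (I.atom I.𝟏 (_ ∷ []) (_ ∷ []))) refl = refl
  emb-⊥ (input (_ I.⊗ _)) ()
  emb-⊥ (input (_ I.⊸ _)) ()

  -- A one-sided ⊗ is either a ⊗ on the right or a ⊸ on the left, whose parts appear in reverse
  -- order because duality reverses them. `⅋-View` is the analogue for a ⊸ on the right and a ⊗ on
  -- the left.
  data ⊗-View : Expr → Expr → Signed → Set where
    output-⊗ : ∀ {E F} → ⊗-View (tr E) (tr F) (output (E I.⊗ F))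
    input-⊸  : ∀ {E F} → ⊗-View (dual (tr F)) (dual (dual (tr E))) (input (E I.⊸ F))

  ⊗-view : ∀ {A B} σ → A ⊗ B ≡ emb σ → ⊗-View A B σ
  ⊗-view (output (I.atom (I.lit _) _ _)) ()
  ⊗-view (output (I.atom I.𝟏 _ _)) ()
  ⊗-view (output (_ I.⊗ _)) refl = output-⊗
  ⊗-view (output (_ I.⊸ _)) ()
  ⊗-view (input (I.atom (I.lit _) _ _)) ()
  ⊗-view (input (I.atom I.𝟏 _ _)) ()
  ⊗-view (input (_ I.⊗ _)) ()
  ⊗-view (input (_ I.⊸ _)) refl = input-⊸

  data ⅋-View : Expr → Expr → Signed → Set where
    output-⊸ : ∀ {E F} → ⅋-View (dual (tr E)) (tr F) (output (E I.⊸ F))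
    input-⊗  : ∀ {E F} → ⅋-View (dual (tr F)) (dual (tr E)) (input (E I.⊗ F))

  ⅋-view : ∀ {A B} σ → A ⅋ B ≡ emb σ → ⅋-View A B σ
  ⅋-view (output (I.atom (I.lit _) _ _)) ()
  ⅋-view (output (I.atom I.𝟏 _ _)) ()
  ⅋-view (output (_ I.⊗ _)) ()
  ⅋-view (output (_ I.⊸ _)) refl = output-⊸
  ⅋-view (input (I.atom (I.lit _) _ _)) ()
  ⅋-view (input (I.atom I.𝟏 _ _)) ()
  ⅋-view (input (_ I.⊗ _)) refl = input-⊗
  ⅋-view (input (_ I.⊸ _)) ()

  -- A cut-free proof of translated formulas has exactly one output in each
  -- sequent, and its rules are those of the intuitionistic calculus.
  intuitionistic : ∀ {Γ} → CF Γ → ∀ Σ → Γ ≡ map emb Σ → Intuitionistic Σ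
  intuitionistic (exchange p d) Σ refl =
    let Σ′ , e , q = ↭-map-inv emb (↭-sym p)
        Γ , A , r , d′ = intuitionistic d Σ′ e
    in Γ , A , trans q r , d′
  intuitionistic (id p us ls b) (σ ∷ τ ∷ []) e = intuitionistic-axiom σ τ atomic (atomic-dual p us ls) (subst Balanced e b)
    (sym (Listₚ.∷-injectiveˡ e)) (sym (Listₚ.∷-injectiveˡ (Listₚ.∷-injectiveʳ e)))
  intuitionistic (tensor {Γ} b d₁ d₂) (σ ∷ Σ) e with ⊗-view σ (Listₚ.∷-injectiveˡ e) | map-++-inverse Γ Σ (Listₚ.∷-injectiveʳ e)
  ... | output-⊗ {E} {F} | Σ₁ , Σ₂ , refl , e₁ , e₂
    with Γ₁ , _ , p₁ , d₁′ ← intuitionistic d₁ (output E ∷ Σ₁) (cong (_ ∷_) e₁)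
    with Γ₂ , _ , p₂ , d₂′ ← intuitionistic d₂ (output F ∷ Σ₂) (cong (_ ∷_) e₂)
    with refl , q₁ ← signed-output p₁ | refl , q₂ ← signed-output p₂ =
    let r = prep _ (trans (++⁺ q₁ q₂) (↭-reflexive (sym (map-++ input Γ₁ Γ₂))))
    in Γ₁ ++ Γ₂ , E I.⊗ F , r , I.R⊗ (intuitionistic-sequent b e r) d₁′ d₂′
  ... | input-⊸ {E} {F} | Σ₁ , Σ₂ , refl , e₁ , e₂
    with Γ₁ , C , p₁ , d₁′ ← intuitionistic d₁ (input F ∷ Σ₁) (cong (_ ∷_) e₁)
    with Γ₂ , _ , p₂ , d₂′ ← intuitionistic d₂ (output E ∷ Σ₂) (cong₂ _∷_ (dual-involutive (tr E)) e₂)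
    -- The output of the second premise is `E`, so that of the conclusion comes from the first
    -- premise.
    with Γ₁′ , g , q₁ ← signed-input p₁ | refl , q₂ ← signed-output p₂ =
    let r = trans (prep _ (trans (++⁺ q₁ q₂) (prep _ (trans (++-comm (map input Γ₁′) (map input Γ₂)) (↭-reflexive (sym (map-++ input Γ₂ Γ₁′))))))) (swap _ _ refl)
    in E I.⊸ F ∷ Γ₂ ++ Γ₁′ , C , r , I.L⊸ (intuitionistic-sequent b e r) d₂′ (I.exchange g d₁′)
  intuitionistic (par b d) (σ ∷ Σ) e with ⅋-view σ (Listₚ.∷-injectiveˡ e)
  ... | output-⊸ {E} {F}
    with Γ , _ , p , d′ ← intuitionistic d (input E ∷ output F ∷ Σ) (cong (λ Γ → _ ∷ _ ∷ Γ) (Listₚ.∷-injectiveʳ e))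
    with Γ′ , g , q ← signed-input p
    with refl , r ← signed-output q =
    Γ′ , E I.⊸ F , prep _ r , I.R⊸ (intuitionistic-sequent b e (prep _ r)) (I.exchange g d′)
  ... | input-⊗ {E} {F}
    with Γ , C , p , d′ ← intuitionistic d (input F ∷ input E ∷ Σ) (cong (λ Γ → _ ∷ _ ∷ Γ) (Listₚ.∷-injectiveʳ e))
    with Γ′ , g , q ← signed-input p
    with Γ″ , g′ , r ← signed-input q =
    let s = trans (prep _ r) (swap _ _ refl)
    in E I.⊗ F ∷ Γ″ , C , s , I.L⊗ (intuitionistic-sequent b e s) (I.exchange (trans g (trans (prep _ g′) (swap _ _ refl))) d′)
  intuitionistic (⊥→ {A = A} b j∈ i∉ d) (ρ ∷ σ ∷ Σ) e
    with refl ← emb-⊥ ρ (Listₚ.∷-injectiveˡ e)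
    with τ , refl , refl ← unsubst↑ {A} σ (proj₁ (∈-frees⁻ j∈)) i∉ (Listₚ.∷-injectiveˡ (Listₚ.∷-injectiveʳ e)) =
    ⊥→-case τ b e (FI↑-emb⁻ τ (fu⇒FI↑ (emb τ) (proj₂ (All.head (proj₁ (CF-balanced d)))) j∈)) (i∉ ∘ ∈-resp-↭ (↭-sym (occurrences-emb τ)))
      (intuitionistic d (τ ∷ Σ) (cong (_ ∷_) (Listₚ.∷-injectiveʳ (Listₚ.∷-injectiveʳ e))))
    where
    ⊥→-case : ∀ {i j Δ Σ} τ → Balanced Δ → Δ ≡ map emb (input I.𝟏⟨ i / j ⟩ ∷ substˢ↑ i j τ ∷ Σ) →
              I.Free (body τ) j × j ∈ upperˢ τ → i ∉ I.occurrences (body τ) →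
              Intuitionistic (τ ∷ Σ) → Intuitionistic (input I.𝟏⟨ i / j ⟩ ∷ substˢ↑ i j τ ∷ Σ)
    ⊥→-case (output E) b e j∈ i∉ (Γ , _ , p , d) with refl , q ← signed-output p =
      let r = trans (prep _ (prep _ q)) (swap _ _ refl)
      in _ , _ , r , I.R𝟏→ (intuitionistic-sequent b e r) j∈ i∉ d
    ⊥→-case (input E) b e j∈ i∉ (Γ , C , p , d) with Γ′ , g , q ← signed-input p =
      let r = trans (prep _ (trans (prep _ q) (swap _ _ refl))) (swap _ _ refl)
      in _ , C , r , I.L𝟏→ (intuitionistic-sequent b e r) j∈ i∉ (I.exchange g d)
  intuitionistic (⊥← {A = A} {i} {j} b j∈ i∉ d) (σ ∷ Σ) e
    with τ , refl , refl ← unsubst↓ {A} σ (proj₁ (∈-frees⁻ j∈)) i∉ (Listₚ.∷-injectiveˡ e) =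
    ⊥←-case τ b e (FI↓-emb⁻ τ (fl⇒FI↓ (emb τ) (proj₂ (All.head (All.tail (proj₁ (CF-balanced d))))) j∈)) (i∉ ∘ ∈-resp-↭ (↭-sym (occurrences-emb τ)))
      (intuitionistic d (input I.𝟏⟨ i / j ⟩ ∷ τ ∷ Σ) (cong (λ Γ → _ ∷ _ ∷ Γ) (Listₚ.∷-injectiveʳ e)))
    where
    ⊥←-case : ∀ {i j Δ Σ} τ → Balanced Δ → Δ ≡ map emb (substˢ↓ i j τ ∷ Σ) →
              I.Free (body τ) j × j ∈ lowerˢ τ → i ∉ I.occurrences (body τ) →
              Intuitionistic (input I.𝟏⟨ i / j ⟩ ∷ τ ∷ Σ) → Intuitionistic (substˢ↓ i j τ ∷ Σ)
    ⊥←-case (output E) b e j∈ i∉ (Γ , _ , p , d) with Γ′ , g , q ← signed-input p with refl , r ← signed-output q =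
      Γ′ , _ , prep _ r , I.R𝟏← (intuitionistic-sequent b e (prep _ r)) j∈ i∉ (I.exchange g d)
    ⊥←-case (input E) b e j∈ i∉ (Γ , C , p , d) with Γ′ , g , q ← signed-input p with Γ″ , g′ , r ← signed-input q =
      let s = trans (prep _ r) (swap _ _ refl)
      in _ , C , s , I.L𝟏← (intuitionistic-sequent b e s) j∈ i∉ (I.exchange (trans g (prep _ g′)) d)

  -- The induction returns a context only up to permutation; injectivity of `input` relates it to
  -- `Γ`.
  CF⇒ITTL : ∀ {Γ A} → CF (onesided Γ A) → Γ I.⊢ A
  CF⇒ITTL {Γ} {A} d with Δ , _ , p , d′ ← intuitionistic d (signed Γ A) (cong (_ ∷_) (Listₚ.map-∘ Γ))
    with refl , q ← signed-output p
    with Δ′ , e , r ← ↭-map-inv input q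
    with refl ← Listₚ.map-injective input-injective e = I.exchange (↭-sym r) d′

  TTL-decidable : ∀ Γ → IsSequent Γ → Dec (⊢ Γ)
  TTL-decidable Γ s = map′ CF⇒⊢ cut-elimination (CF? (sequent⇒balanced s))

  -- Cuts of ITTL are eliminated on the classical side, and the way back from cut-free proofs makes
  -- the embedding conservative.
  ITTL-decidable : ∀ Γ A → I.IsSequent Γ A → Dec (Γ I.⊢ A)
  ITTL-decidable Γ A s = map′ CF⇒ITTL (cut-elimination ∘ classical) (CF? (sequent⇒balanced (onesided-sequent s)))

corollary6p6 : (∀ (V : Vocabulary) (Γ : List (TTL.Expr V)) →
    TTL.IsSequent V Γ → Dec (TTL.⊢_ V Γ))
    × (∀ (V : Vocabulary) (Γ : List (ITTL.Expr V)) (A : ITTL.Expr V) →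
    ITTL.IsSequent V Γ A → Dec (ITTL._⊢_ V Γ A))
corollary6p6 = TTL-decidable , ITTL-decidable
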